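{- There exist $C_1,C_2>0$ such that for all $t\in\mathbb{N}$ the following hold, where $T$ is sampled uniformly at random from all trees on vertex set $[t]$: for all integers $\ell\in[1,t]$ we have $\mathbb{E}[\mathrm{cov}_\ell(T)]\le \frac{C_1 t}{\ell}$, and for all integers $\ell\in[1,C_2\sqrt{t}]$ we have $\mathbb{E}[\mathrm{cov}_\ell(T)]\ge \frac{C_2 t}{\ell}$. Furthermore, there exists $c>0$ such that for all $t\in\mathbb{N}$, all integers $1\le \ell\le c\sqrt{t}$ and all $\delta\in(0,1)$, if $T$ is sampled uniformly at random from all trees on vertex set $[t]$, then $$\mathbb{P}_T\left(\left|\mathrm{cov}_\ell(T)-\mathbb{E}[\mathrm{cov}_\ell(T)]\right|>\frac{\delta t}{\ell}\right)\le \frac{c\,t^2}{\delta\, e^{c\delta^2 t/\ell^3}}.$$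
   Context: For a graph $G$ and integer $\ell$, $\mathrm{cov}_\ell(G)$ denotes the maximum number of vertices of $G$ that can be covered by a system of vertex-disjoint paths in $G$, each of length at least $\ell$ (length = number of edges).
   Formalization: The deviation parameter δ ranges over the rational numbers in (0,1); the case of real δ follows by letting rational δ' increase to δ. -}

module Defs where

open import Data.Nat as ℕ using (ℕ; zero; suc; _∸_; _⊔_)
open import Data.Fin using (Fin; toℕ)
open import Data.Bool using (Bool; true; false; _∧_; _∨_; not)
open import Data.List using (List; []; _∷_; [_]; _++_; map; concatMap; concat; length; filterᵇ; foldr; sum; upTo; allFin)
open import Data.Bool.ListAction using (any; all)
open import Data.Product using (_×_; _,_)
open import Data.Integer using (+_)
open import Data.Rational as ℚ using (ℚ; 0ℚ; 1ℚ; _≤ᵇ_; ∣_∣)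

sublists : ∀ {A : Set} → List A → List (List A)
sublists [] = [ [] ]
sublists (x ∷ xs) = map (x ∷_) (sublists xs) ++ sublists xs

listsOfLength : ∀ {A : Set} → List A → ℕ → List (List A)
listsOfLength xs zero = [ [] ]
listsOfLength xs (suc n) = concatMap (λ x → map (x ∷_) (listsOfLength xs n)) xs

_==_ : ∀ {t} → Fin t → Fin t → Bool
i == j = toℕ i ℕ.≡ᵇ toℕ j

memᵇ : ∀ {t} → Fin t → List (Fin t) → Bool
memᵇ x xs = any (x ==_) xs

distinct : ∀ {t} → List (Fin t) → Bool
distinct [] = true
distinct (x ∷ xs) = not (memᵇ x xs) ∧ distinct xs

vertexSeqs : (t : ℕ) → List (List (Fin t))
vertexSeqs t = filterᵇ distinct (concatMap (listsOfLength (allFin t)) (upTo (suc t)))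

-- Simple graphs on [t]: a set of edges {i,j}, i < j, given as a sublist
-- of the list of all such pairs.

Graph : ℕ → Set
Graph t = List (Fin t × Fin t)

allEdges : (t : ℕ) → Graph t
allEdges t = concatMap (λ i → filterᵇ (λ e → pairOK e) (map (λ j → (i , j)) (allFin t))) (allFin t)
  where
  pairOK : Fin t × Fin t → Bool
  pairOK (i , j) = toℕ i ℕ.<ᵇ toℕ j

allGraphs : (t : ℕ) → List (Graph t)
allGraphs t = sublists (allEdges t)

adj : ∀ {t} → Graph t → Fin t → Fin t → Bool
adj G u v = any (λ { (a , b) → ((a == u) ∧ (b == v)) ∨ ((a == v) ∧ (b == u)) }) G

walkOK : ∀ {t} → Graph t → List (Fin t) → Bool
walkOK G [] = true
walkOK G (x ∷ []) = true
walkOK G (x ∷ y ∷ rest) = adj G x y ∧ walkOK G (y ∷ rest)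

nonempty : ∀ {A : Set} → List A → Bool
nonempty [] = false
nonempty (_ ∷ _) = true

isPath : ∀ {t} → Graph t → List (Fin t) → Bool
isPath G p = nonempty p ∧ distinct p ∧ walkOK G p

pathLength : ∀ {t} → List (Fin t) → ℕ
pathLength p = length p ∸ 1

firstIs : ∀ {t} → Fin t → List (Fin t) → Bool
firstIs u [] = false
firstIs u (x ∷ _) = x == u

lastIs : ∀ {t} → Fin t → List (Fin t) → Bool
lastIs u [] = false
lastIs u (x ∷ []) = x == u
lastIs u (x ∷ y ∷ rest) = lastIs u (y ∷ rest)

connected : ∀ {t} → Graph t → Bool
connected {t} G =
  all (λ u → all (λ v → any (λ p → isPath G p ∧ firstIs u p ∧ lastIs v p) (vertexSeqs t)) (allFin t)) (allFin t)

atLeast3 : ∀ {A : Set} → List A → Bool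
atLeast3 (_ ∷ _ ∷ _ ∷ _) = true
atLeast3 _ = false

closes : ∀ {t} → Graph t → List (Fin t) → Bool
closes G [] = false
closes G (x ∷ rest) = any (λ y → lastIs y (x ∷ rest) ∧ adj G y x) (x ∷ rest)

isCycle : ∀ {t} → Graph t → List (Fin t) → Bool
isCycle G p = atLeast3 p ∧ distinct p ∧ walkOK G p ∧ closes G p

acyclic : ∀ {t} → Graph t → Bool
acyclic {t} G = not (any (isCycle G) (vertexSeqs t))

isTree : ∀ {t} → Graph t → Bool
isTree G = connected G ∧ acyclic G

trees : (t : ℕ) → List (Graph t)
trees t = filterᵇ isTree (allGraphs t)

longPaths : ∀ {t} → ℕ → Graph t → List (List (Fin t))
longPaths {t} ℓ G = filterᵇ (λ p → isPath G p ∧ (ℓ ℕ.≤ᵇ pathLength p)) (vertexSeqs t)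

pathSystems : ∀ {t} → ℕ → Graph t → List (List (List (Fin t)))
pathSystems ℓ G = filterᵇ (λ S → distinct (concat S)) (sublists (longPaths ℓ G))

maximum : List ℕ → ℕ
maximum = foldr _⊔_ 0

cov : ∀ {t} → ℕ → Graph t → ℕ
cov ℓ G = maximum (map (λ S → length (concat S)) (pathSystems ℓ G))

fromℕ : ℕ → ℚ
fromℕ n = + n ℚ./ 1

-- a / b as a rational (b = 0 gives 0; only used with b ≥ 1)
divℕ : ℕ → ℕ → ℚ
divℕ a zero = 0ℚ
divℕ a (suc b) = + a ℚ./ suc b

-- average of a list of rationals (0 for the empty list)
mean : List ℚ → ℚ
mean xs = foldr ℚ._+_ 0ℚ xs ℚ.* divℕ 1 (length xs)

expCov : ℕ → ℕ → ℚ
expCov ℓ t = mean (map (λ T → fromℕ (cov ℓ T)) (trees t))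

probDev : ℕ → ℕ → ℚ → ℚ
probDev ℓ t δ =
  mean (map (λ T → if' (not (∣ fromℕ (cov ℓ T) ℚ.- expCov ℓ t ∣ ≤ᵇ δ ℚ.* divℕ t ℓ))) (trees t))
  where
  if' : Bool → ℚ
  if' true = 1ℚ
  if' false = 0ℚ

expTerm : ℚ → ℕ → ℚ
expTerm x zero = 1ℚ
expTerm x (suc k) = expTerm x k ℚ.* x ℚ.* (+ 1 ℚ./ suc k)

expPartial : ℚ → ℕ → ℚ
expPartial x zero = 0ℚ
expPartial x (suc n) = expPartial x n ℚ.+ expTerm x n

-- Root a tree at 0 and encode it by its parent function p, and then by the Prüfer-like word that lists the
-- parents of all non-root vertices in the order of increasing height (without its last letter 0).  This is a
-- bijection with the words of length t − 2, and the numbers N_h of vertices of height at least h are read off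
-- the word u: N_{h+1} = N_h − 1 − (number of repeated letters among the last N_h − 2 letters of u).
--
-- Cutting the tree into slices of ℓ + 1 consecutive heights gives cov_ℓ ≥ N_ℓ, and since one of the two
-- neighbours of an inner vertex of a path is its child, cov_ℓ ≤ 2 N_h for 4h ≤ ℓ.  A first moment bound for
-- the repeats gives the lower bound on the expectation of cov_ℓ, and Chebyshev's inequality on dyadic scales
-- the upper bound.
--
-- If p and p′ differ in d of the vertices covered by an optimal system for T, then cov_ℓ(T) ≤ cov_ℓ(T′) + 3ℓd.
-- A Talagrand-type inequality on the product space of all parent functions (proved by induction on the number
-- of coordinates) therefore bounds the product of the sizes of a lower and an upper deviation event.  Markov's
-- inequality around the mean supplies one of the two events, and as probabilities are at most 1, a fourth
-- power absorbs the remaining polynomial factors.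

module Submission where

open import Defs

-- Heuristically N_h loses about N_h²/(2t) vertices per step, so it behaves like 2t/h. For the lower
-- bound a single scale of about t/(4ℓ) letters suffices. For the upper bound the repeats have to be
-- bounded from below at every scale that the sizes pass through, whence the dyadic scales and a
-- geometric sum over the bad ones.
--
-- For the tail, bounded differences do not suffice: t coordinates of influence 3ℓ would give the
-- exponent δ²t/ℓ⁴. The missing factor ℓ comes from the fact that only the covered vertices of T
-- matter, typically about t/ℓ of them, which is what a certificate-type inequality exploits. Its
-- parameter κ has order δ/ℓ. Trees have density at least t^(-2) among all parent functions, so
-- passing to the product space costs only a power of t. Exponentials are replaced by powers of 1 -
-- κ², so that the argument stays rational until partial sums of the series are compared with such a
-- power.

module Indicator where

  open import Data.Bool using (Bool; true; false; not; if_then_else_)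
  open import Data.List using (map)
  open import Data.Nat using (ℕ)
  open import Data.Product using (Σ; _,_; proj₁)
  open import Data.Rational using (ℚ; 0ℚ; 1ℚ; _*_; _-_; _≤ᵇ_; ∣_∣)
  open import Relation.Binary.PropositionalEquality

  indicatorℚ : Bool → ℚ
  indicatorℚ b = if b then 1ℚ else 0ℚ

  deviates : ℕ → ∀ {t} → ℚ → ℚ → Graph t → Bool
  deviates ℓ μ Δ T = not (∣ fromℕ (cov ℓ T) - μ ∣ ≤ᵇ Δ)

  -- The summand of probDev is built from a local function of Defs, so it can only be obtained by unification.
  probDev-summand : ∀ ℓ t δ → Σ (Graph t → ℚ) λ h → probDev ℓ t δ ≡ mean (map h (trees t))
  probDev-summand ℓ t δ = _ , refl

  probDev-indicator : ∀ ℓ t δ T →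
    proj₁ (probDev-summand ℓ t δ) T ≡ indicatorℚ (deviates ℓ (expCov ℓ t) (δ * divℕ t ℓ) T)
  probDev-indicator ℓ t δ T with ∣ fromℕ (cov ℓ T) - expCov ℓ t ∣ ≤ᵇ δ * divℕ t ℓ
  ... | true = refl
  ... | false = refl

-- Boolean tests as propositions, sums and counts over lists, and the enumerations in the
-- definitions.

module Basics where

  open import Data.Bool using (Bool; true; false; _∧_; _∨_; not)
  open import Data.Bool.Properties using (T-≡; T?)
  open import Data.Bool.ListAction using (any; all)
  open import Data.Empty using (⊥; ⊥-elim)
  open import Data.Fin using (Fin; toℕ; zero; suc)
  open import Data.Fin.Properties using (toℕ-injective)
  open import Data.List using (List; []; _∷_; _++_; map; concatMap; length; filterᵇ; upTo; allFin)
  open import Data.List.Properties using (length-map; map-++; length-tabulate)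
  open import Data.List.Membership.Propositional using (_∈_; _∉_)
  open import Data.List.Membership.Propositional.Properties
    using (∈-filter⁺; ∈-filter⁻; ∈-allFin; ∈-map⁺; ∈-map⁻; ∈-++⁺ˡ; ∈-++⁺ʳ; ∈-++⁻; ∈-∃++; ∈-concatMap⁺; ∈-upTo⁺)
  open import Data.List.Relation.Unary.All as All using (All; []; _∷_)
  open import Data.List.Relation.Unary.AllPairs using ([]; _∷_)
  open import Data.List.Relation.Unary.Any as Any using (Any; here; there)
  open import Data.List.Relation.Unary.Linked using (Linked; []; [-]; _∷_)
  open import Data.List.Relation.Unary.Unique.Propositional using (Unique)
  open import Data.List.Relation.Unary.Unique.Propositional.Properties as U using (allFin⁺)
  open import Data.Nat.ListAction using (sum)
  open import Data.Nat.ListAction.Properties using (sum-++)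
  open import Data.Nat as ℕ using (ℕ; zero; suc; _+_; _*_; _≤_; z≤n; s≤s)
  open import Data.Nat.Properties as ℕₚ
  open import Data.Product using (_×_; _,_; proj₁; proj₂; ∃)
  open import Data.Sum using (_⊎_; inj₁; inj₂)
  open import Function using (_∘_; Equivalence)
  open import Relation.Nullary using (¬_)
  open import Relation.Binary.PropositionalEquality

  private variable
    A B : Set
    t : ℕ

  true≢false : ∀ {b : Bool} → b ≡ true → b ≡ false → ⊥
  true≢false refl ()

  bool-cases : (b : Bool) → b ≡ true ⊎ b ≡ false
  bool-cases true = inj₁ refl
  bool-cases false = inj₂ refl

  ∧⁻ : ∀ a {b} → a ∧ b ≡ true → a ≡ true × b ≡ true
  ∧⁻ true eq = refl , eq

  ∧⁺ : ∀ {a b} → a ≡ true → b ≡ true → a ∧ b ≡ true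
  ∧⁺ refl refl = refl

  ∨⁻ : ∀ a {b} → a ∨ b ≡ true → a ≡ true ⊎ b ≡ true
  ∨⁻ true _ = inj₁ refl
  ∨⁻ false eq = inj₂ eq

  ∨⁺ˡ : ∀ {a b} → a ≡ true → a ∨ b ≡ true
  ∨⁺ˡ refl = refl

  ∨⁺ʳ : ∀ a {b} → b ≡ true → a ∨ b ≡ true
  ∨⁺ʳ true _ = refl
  ∨⁺ʳ false eq = eq

  not⁻ : ∀ {a} → not a ≡ true → a ≡ false
  not⁻ {false} _ = refl

  not⁺ : ∀ {a} → a ≡ false → not a ≡ true
  not⁺ refl = refl

  ¬true⇒false : ∀ {a} → ¬ (a ≡ true) → a ≡ false
  ¬true⇒false {true} h = ⊥-elim (h refl)
  ¬true⇒false {false} _ = refl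

  iff⇒≡ : ∀ {a b} → (a ≡ true → b ≡ true) → (b ≡ true → a ≡ true) → a ≡ b
  iff⇒≡ {true} f _ = sym (f refl)
  iff⇒≡ {false} {true} _ g = g refl
  iff⇒≡ {false} {false} _ _ = refl

  any⁻ : ∀ (p : A → Bool) xs → any p xs ≡ true → ∃ λ x → x ∈ xs × p x ≡ true
  any⁻ p (x ∷ xs) eq with ∨⁻ (p x) eq
  ... | inj₁ px = x , here refl , px
  ... | inj₂ rest with any⁻ p xs rest
  ...   | y , y∈ , py = y , there y∈ , py

  any⁺ : ∀ (p : A → Bool) {xs x} → x ∈ xs → p x ≡ true → any p xs ≡ true
  any⁺ p (here refl) px = ∨⁺ˡ px
  any⁺ p {y ∷ _} (there x∈) px = ∨⁺ʳ (p y) (any⁺ p x∈ px)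

  all⁻ : ∀ (p : A → Bool) xs → all p xs ≡ true → ∀ {x} → x ∈ xs → p x ≡ true
  all⁻ p (x ∷ xs) eq (here refl) = proj₁ (∧⁻ (p x) eq)
  all⁻ p (x ∷ xs) eq (there x∈) = all⁻ p xs (proj₂ (∧⁻ (p x) eq)) x∈

  all⁺ : ∀ (p : A → Bool) xs → (∀ {x} → x ∈ xs → p x ≡ true) → all p xs ≡ true
  all⁺ p [] h = refl
  all⁺ p (x ∷ xs) h = ∧⁺ (h (here refl)) (all⁺ p xs (h ∘ there))

  ∈-filterᵇ⁺ : ∀ (p : A → Bool) {xs x} → x ∈ xs → p x ≡ true → x ∈ filterᵇ p xs
  ∈-filterᵇ⁺ p x∈ px = ∈-filter⁺ (T? ∘ p) x∈ (Equivalence.from T-≡ px)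

  ∈-filterᵇ⁻ : ∀ (p : A → Bool) {xs x} → x ∈ filterᵇ p xs → x ∈ xs × p x ≡ true
  ∈-filterᵇ⁻ p {xs} x∈ with ∈-filter⁻ (T? ∘ p) {xs = xs} x∈
  ... | x∈xs , px = x∈xs , Equivalence.to T-≡ px

  filterᵇ-true : ∀ (p : A → Bool) {x} xs → p x ≡ true → filterᵇ p (x ∷ xs) ≡ x ∷ filterᵇ p xs
  filterᵇ-true p {x} xs eq with p x | eq
  ... | true | refl = refl

  filterᵇ-false : ∀ (p : A → Bool) {x} xs → p x ≡ false → filterᵇ p (x ∷ xs) ≡ filterᵇ p xs
  filterᵇ-false p {x} xs eq with p x | eq
  ... | false | refl = refl

  filterᵇ-cong : ∀ (p q : A → Bool) xs → (∀ x → p x ≡ q x) → filterᵇ p xs ≡ filterᵇ q xs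
  filterᵇ-cong p q [] h = refl
  filterᵇ-cong p q (x ∷ xs) h with p x in eq
  ... | true = trans (cong (x ∷_) (filterᵇ-cong p q xs h)) (sym (filterᵇ-true q xs (trans (sym (h x)) eq)))
  ... | false = trans (filterᵇ-cong p q xs h) (sym (filterᵇ-false q xs (trans (sym (h x)) eq)))

  filterᵇ-Unique : ∀ (p : A → Bool) {xs} → Unique xs → Unique (filterᵇ p xs)
  filterᵇ-Unique p = U.filter⁺ (T? ∘ p)

  ∉⇒All≢ : ∀ {x : A} {xs} → x ∉ xs → All (x ≢_) xs
  ∉⇒All≢ {xs = []} _ = []
  ∉⇒All≢ {xs = y ∷ xs} h = (λ eq → h (here eq)) ∷ ∉⇒All≢ (h ∘ there)

  All≢⇒∉ : ∀ {x : A} {xs} → All (x ≢_) xs → x ∉ xs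
  All≢⇒∉ (h ∷ _) (here eq) = h eq
  All≢⇒∉ (_ ∷ hs) (there x∈) = All≢⇒∉ hs x∈

  uncons∉ : ∀ {x : A} {xs} → Unique (x ∷ xs) → x ∉ xs
  uncons∉ (h ∷ _) = All≢⇒∉ h

  uncons-Unique : ∀ {x : A} {xs} → Unique (x ∷ xs) → Unique xs
  uncons-Unique (_ ∷ u) = u

  cons-Unique : ∀ {x : A} {xs} → x ∉ xs → Unique xs → Unique (x ∷ xs)
  cons-Unique h u = ∉⇒All≢ h ∷ u

  sumOver : (A → ℕ) → List A → ℕ
  sumOver f xs = sum (map f xs)

  sumOver-++ : ∀ (f : A → ℕ) xs ys → sumOver f (xs ++ ys) ≡ sumOver f xs + sumOver f ys
  sumOver-++ f xs ys = trans (cong sum (map-++ f xs ys)) (sum-++ (map f xs) (map f ys))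

  -- Each element of `xs` uses up one occurrence in `ys`, so only `xs` has to be free of
  -- repetitions. The later comparisons of cardinalities by injections rest on this.
  sumOver-⊆ : ∀ (f : A → ℕ) {xs ys} → Unique xs → (∀ {x} → x ∈ xs → x ∈ ys) → sumOver f xs ≤ sumOver f ys
  sumOver-⊆ f {[]} u sub = z≤n
  sumOver-⊆ f {x ∷ xs} u sub with ∈-∃++ (sub (here refl))
  ... | as , bs , refl = begin
    f x + sumOver f xs                     ≤⟨ +-monoʳ-≤ (f x) (sumOver-⊆ f (uncons-Unique u) sub′) ⟩
    f x + sumOver f (as ++ bs)             ≡⟨ cong (f x +_) (sumOver-++ f as bs) ⟩
    f x + (sumOver f as + sumOver f bs)    ≡⟨ +-assoc (f x) _ _ ⟨
    (f x + sumOver f as) + sumOver f bs    ≡⟨ cong (_+ sumOver f bs) (+-comm (f x) _) ⟩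
    (sumOver f as + f x) + sumOver f bs    ≡⟨ +-assoc (sumOver f as) _ _ ⟩
    sumOver f as + (f x + sumOver f bs)    ≡⟨ sumOver-++ f as (x ∷ bs) ⟨
    sumOver f (as ++ x ∷ bs)               ∎
    where
    open ≤-Reasoning
    sub′ : ∀ {y} → y ∈ xs → y ∈ as ++ bs
    sub′ y∈ with ∈-++⁻ as (sub (there y∈))
    ... | inj₁ h = ∈-++⁺ˡ h
    ... | inj₂ (here refl) = ⊥-elim (uncons∉ u y∈)
    ... | inj₂ (there h) = ∈-++⁺ʳ as h

  sumOver-const : ∀ c (xs : List A) → sumOver (λ _ → c) xs ≡ length xs * c
  sumOver-const c [] = refl
  sumOver-const c (x ∷ xs) = cong (c +_) (sumOver-const c xs)

  length-⊆ : ∀ {xs ys : List A} → Unique xs → (∀ {x} → x ∈ xs → x ∈ ys) → length xs ≤ length ys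
  length-⊆ {xs = xs} {ys} u sub =
    subst₂ _≤_ (eq xs) (eq ys) (sumOver-⊆ (λ _ → 1) u sub)
    where
    eq : ∀ zs → sumOver (λ _ → 1) zs ≡ length zs
    eq zs = trans (sumOver-const 1 zs) (*-identityʳ _)

  length-≡ : ∀ {xs ys : List A} → Unique xs → Unique ys →
             (∀ {x} → x ∈ xs → x ∈ ys) → (∀ {x} → x ∈ ys → x ∈ xs) → length xs ≡ length ys
  length-≡ u v f g = ≤-antisym (length-⊆ u f) (length-⊆ v g)

  sumOver-mono : ∀ {f g : A → ℕ} xs → (∀ {x} → x ∈ xs → f x ≤ g x) → sumOver f xs ≤ sumOver g xs
  sumOver-mono [] h = z≤n
  sumOver-mono (x ∷ xs) h = +-mono-≤ (h (here refl)) (sumOver-mono xs (h ∘ there))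

  interchange : ∀ a b c d → (a + b) + (c + d) ≡ (a + c) + (b + d)
  interchange a b c d = begin
    (a + b) + (c + d) ≡⟨ +-assoc a b (c + d) ⟩
    a + (b + (c + d)) ≡⟨ cong (a +_) (sym (+-assoc b c d)) ⟩
    a + ((b + c) + d) ≡⟨ cong (λ z → a + (z + d)) (+-comm b c) ⟩
    a + ((c + b) + d) ≡⟨ cong (a +_) (+-assoc c b d) ⟩
    a + (c + (b + d)) ≡⟨ sym (+-assoc a c (b + d)) ⟩
    (a + c) + (b + d) ∎
    where open ≡-Reasoning

  sumOver-+ : ∀ (f g : A → ℕ) xs → sumOver (λ x → f x + g x) xs ≡ sumOver f xs + sumOver g xs
  sumOver-+ f g [] = refl
  sumOver-+ f g (x ∷ xs) = trans (cong (f x + g x +_) (sumOver-+ f g xs)) (interchange (f x) (g x) _ _)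

  sumOver-* : ∀ c (f : A → ℕ) xs → sumOver (λ x → c * f x) xs ≡ c * sumOver f xs
  sumOver-* c f [] = sym (*-zeroʳ c)
  sumOver-* c f (x ∷ xs) = trans (cong (c * f x +_) (sumOver-* c f xs)) (sym (*-distribˡ-+ c (f x) _))

  sumOver-cong : ∀ {f g : A → ℕ} xs → (∀ {x} → x ∈ xs → f x ≡ g x) → sumOver f xs ≡ sumOver g xs
  sumOver-cong [] h = refl
  sumOver-cong (x ∷ xs) h = cong₂ _+_ (h (here refl)) (sumOver-cong xs (h ∘ there))

  sumOver-map : ∀ (f : B → ℕ) (g : A → B) xs → sumOver f (map g xs) ≡ sumOver (f ∘ g) xs
  sumOver-map f g [] = refl
  sumOver-map f g (x ∷ xs) = cong (f (g x) +_) (sumOver-map f g xs)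

  map-Unique : ∀ (f : A → B) {xs} → (∀ {x y} → x ∈ xs → y ∈ xs → f x ≡ f y → x ≡ y) → Unique xs → Unique (map f xs)
  map-Unique f {[]} h u = []
  map-Unique f {x ∷ xs} h u = cons-Unique fx∉ (map-Unique f (λ a b → h (there a) (there b)) (uncons-Unique u))
    where
    fx∉ : f x ∉ map f xs
    fx∉ p with ∈-map⁻ f p
    ... | y , y∈ , eq = uncons∉ u (subst (_∈ xs) (sym (h (here refl) (there y∈) eq)) y∈)

  ==-refl : (i : Fin t) → (i == i) ≡ true
  ==-refl i = Equivalence.to T-≡ (≡⇒≡ᵇ (toℕ i) (toℕ i) refl)

  ==⇒≡ : (i j : Fin t) → (i == j) ≡ true → i ≡ j
  ==⇒≡ i j eq = toℕ-injective (≡ᵇ⇒≡ (toℕ i) (toℕ j) (Equivalence.from T-≡ eq))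

  ≡⇒== : ∀ {i j : Fin t} → i ≡ j → (i == j) ≡ true
  ≡⇒== {i = i} refl = ==-refl i

  ≢⇒== : ∀ {i j : Fin t} → i ≢ j → (i == j) ≡ false
  ≢⇒== h = ¬true⇒false (h ∘ ==⇒≡ _ _)

  ==-false : ∀ {i j : Fin t} → (i == j) ≡ false → i ≢ j
  ==-false {i = i} eq refl = true≢false (==-refl i) eq

  memᵇ⁻ : ∀ {x : Fin t} xs → memᵇ x xs ≡ true → x ∈ xs
  memᵇ⁻ {x = x} xs eq with any⁻ (x ==_) xs eq
  ... | y , y∈ , x=y = subst (_∈ xs) (sym (==⇒≡ x y x=y)) y∈

  memᵇ⁺ : ∀ {x : Fin t} {xs} → x ∈ xs → memᵇ x xs ≡ true
  memᵇ⁺ {x = x} x∈ = any⁺ (x ==_) x∈ (==-refl x)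

  memᵇ-false : ∀ {x : Fin t} {xs} → x ∉ xs → memᵇ x xs ≡ false
  memᵇ-false h = ¬true⇒false (h ∘ memᵇ⁻ _)

  memᵇ-false⁻ : ∀ {x : Fin t} {xs} → memᵇ x xs ≡ false → x ∉ xs
  memᵇ-false⁻ eq x∈ = true≢false (memᵇ⁺ x∈) eq

  distinct⁻ : (xs : List (Fin t)) → distinct xs ≡ true → Unique xs
  distinct⁻ [] _ = []
  distinct⁻ (x ∷ xs) eq with ∧⁻ (not (memᵇ x xs)) eq
  ... | x∉ , d = cons-Unique (memᵇ-false⁻ (not⁻ x∉)) (distinct⁻ xs d)

  distinct⁺ : {xs : List (Fin t)} → Unique xs → distinct xs ≡ true
  distinct⁺ {xs = []} _ = refl
  distinct⁺ {xs = x ∷ xs} u = ∧⁺ (not⁺ (memᵇ-false (uncons∉ u))) (distinct⁺ (uncons-Unique u))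

  count : (Fin t → Bool) → ℕ
  count {t} χ = length (filterᵇ χ (allFin t))

  length-allFin : ∀ t → length (allFin t) ≡ t
  length-allFin t = length-tabulate (λ i → i)

  ∈-count : ∀ (χ : Fin t → Bool) {x} → χ x ≡ true → x ∈ filterᵇ χ (allFin t)
  ∈-count χ {x} h = ∈-filterᵇ⁺ χ (∈-allFin x) h

  count-Unique : ∀ (χ : Fin t → Bool) → Unique (filterᵇ χ (allFin t))
  count-Unique {t} χ = filterᵇ-Unique χ {allFin t} (allFin⁺ t)

  count-mono : ∀ (χ ψ : Fin t → Bool) → (∀ {x} → χ x ≡ true → ψ x ≡ true) → count χ ≤ count ψ
  count-mono χ ψ h = length-⊆ (count-Unique χ) (λ x∈ → ∈-count ψ (h (proj₂ (∈-filterᵇ⁻ χ {allFin _} x∈))))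

  length≤count : ∀ (χ : Fin t → Bool) {xs} → Unique xs → (∀ {x} → x ∈ xs → χ x ≡ true) → length xs ≤ count χ
  length≤count χ u h = length-⊆ u (λ x∈ → ∈-count χ (h x∈))

  Unique⇒length≤ : ∀ {xs : List (Fin t)} → Unique xs → length xs ≤ t
  Unique⇒length≤ {t} {xs} u = subst (length xs ≤_) (length-allFin t) (length-⊆ u (λ {x} _ → ∈-allFin x))

  length-split : ∀ (p : A → Bool) xs → length (filterᵇ p xs) + length (filterᵇ (not ∘ p) xs) ≡ length xs
  length-split p [] = refl
  length-split p (x ∷ xs) with p x
  ... | true = cong suc (length-split p xs)
  ... | false = trans (+-suc _ _) (cong suc (length-split p xs))

  record Adj (G : Graph t) (u v : Fin t) : Set where
    constructor adjacent
    field is-adj : adj G u v ≡ true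

  open Adj public

  Adj-sym : ∀ (G : Graph t) {u v} → Adj G u v → Adj G v u
  Adj-sym G (adjacent h) = adjacent (go G h)
    where
    go : ∀ (G : Graph t) {u v} → adj G u v ≡ true → adj G v u ≡ true
    go ((a , b) ∷ G) {u} {v} h with ∨⁻ (((a == u) ∧ (b == v)) ∨ ((a == v) ∧ (b == u))) h
    ... | inj₂ h′ = ∨⁺ʳ (((a == v) ∧ (b == u)) ∨ ((a == u) ∧ (b == v))) (go G h′)
    ... | inj₁ h′ with ∨⁻ ((a == u) ∧ (b == v)) h′
    ...   | inj₁ e = ∨⁺ˡ (∨⁺ʳ ((a == v) ∧ (b == u)) e)
    ...   | inj₂ e = ∨⁺ˡ (∨⁺ˡ e)

  walkOK⁻ : ∀ (G : Graph t) xs → walkOK G xs ≡ true → Linked (Adj G) xs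
  walkOK⁻ G [] _ = []
  walkOK⁻ G (x ∷ []) _ = [-]
  walkOK⁻ G (x ∷ y ∷ xs) eq =
    adjacent (proj₁ (∧⁻ (adj G x y) eq)) ∷ walkOK⁻ G (y ∷ xs) (proj₂ (∧⁻ (adj G x y) eq))

  walkOK⁺ : ∀ {G : Graph t} {xs} → Linked (Adj G) xs → walkOK G xs ≡ true
  walkOK⁺ [] = refl
  walkOK⁺ [-] = refl
  walkOK⁺ (adjacent a ∷ w) = ∧⁺ a (walkOK⁺ w)

  isPath⁻ : ∀ (G : Graph t) xs → isPath G xs ≡ true → Unique xs × Linked (Adj G) xs
  isPath⁻ G xs eq with ∧⁻ (nonempty xs) eq
  ... | _ , eq′ with ∧⁻ (distinct xs) eq′
  ...   | d , w = distinct⁻ xs d , walkOK⁻ G xs w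

  isPath⁺ : ∀ {G : Graph t} {x xs} → Unique (x ∷ xs) → Linked (Adj G) (x ∷ xs) → isPath G (x ∷ xs) ≡ true
  isPath⁺ {xs = xs} u w = ∧⁺ (distinct⁺ u) (walkOK⁺ w)

  listsOfLength⁺ : ∀ (xs : List A) ys → (∀ {y} → y ∈ ys → y ∈ xs) → ys ∈ listsOfLength xs (length ys)
  listsOfLength⁺ xs [] h = here refl
  listsOfLength⁺ xs (y ∷ ys) h =
    ∈-concatMap⁺ _ (Any.map (λ { refl → ∈-map⁺ (y ∷_) (listsOfLength⁺ xs ys (h ∘ there)) }) (h (here refl)))

  listsOfLength-length : ∀ (xs : List A) n {ys} → ys ∈ listsOfLength xs n → length ys ≡ n
  listsOfLength-length xs zero (here refl) = refl
  listsOfLength-length {A} xs (suc n) {ys} ys∈ = go xs ys∈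
    where
    go : ∀ zs → ys ∈ concatMap (λ x → map (x ∷_) (listsOfLength xs n)) zs → length ys ≡ suc n
    go (z ∷ zs) h with ∈-++⁻ (map (z ∷_) (listsOfLength xs n)) h
    ... | inj₂ h′ = go zs h′
    ... | inj₁ h′ with ∈-map⁻ (z ∷_) h′
    ...   | _ , ∈′ , refl = cong suc (listsOfLength-length xs n ∈′)

  -- `k` reads off from an element the index of the block it comes from, which makes different
  -- blocks disjoint.
  concatMap-Unique : ∀ (f : A → List B) (k : B → A) {xs} → Unique xs → (∀ {x} → x ∈ xs → Unique (f x)) →
    (∀ {x y} → x ∈ xs → y ∈ f x → k y ≡ x) → Unique (concatMap f xs)
  concatMap-Unique f k {[]} u fu inv = []
  concatMap-Unique f k {x ∷ xs} u fu inv =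
    U.++⁺ (fu (here refl)) (concatMap-Unique f k (uncons-Unique u) (fu ∘ there) (inv ∘ there)) λ (h₁ , h₂) → disj h₁ xs (λ z → z) h₂
    where
    disj : ∀ {y} → y ∈ f x → ∀ zs → (∀ {z} → z ∈ zs → z ∈ xs) → y ∈ concatMap f zs → ⊥
    disj y∈ (z ∷ zs) sub h with ∈-++⁻ (f z) h
    ... | inj₂ h′ = disj y∈ zs (sub ∘ there) h′
    ... | inj₁ h′ = uncons∉ u (subst (_∈ xs) (trans (sym (inv (there (sub (here refl))) h′)) (inv (here refl) y∈)) (sub (here refl)))

  listsOfLength-Unique : ∀ {xs : List A} → Unique xs → ∀ n → Unique (listsOfLength xs n)
  listsOfLength-Unique u zero = [] ∷ []
  listsOfLength-Unique {xs = []} u (suc n) = []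
  listsOfLength-Unique {A} {xs = x₀ ∷ xs₀} u (suc n) =
    concatMap-Unique _ hd u (λ _ → map-Unique _ (λ { _ _ refl → refl }) (listsOfLength-Unique u n)) inv
    where
    hd : List A → A
    hd [] = x₀
    hd (x ∷ _) = x
    inv : ∀ {x y} → x ∈ x₀ ∷ xs₀ → y ∈ map (x ∷_) (listsOfLength (x₀ ∷ xs₀) n) → hd y ≡ x
    inv {x} _ y∈ with ∈-map⁻ (x ∷_) y∈
    ... | _ , _ , refl = refl

  vertexSeqs⁺ : {xs : List (Fin t)} → Unique xs → xs ∈ vertexSeqs t
  vertexSeqs⁺ {t} {xs} u = ∈-filterᵇ⁺ distinct
    (∈-concatMap⁺ (listsOfLength (allFin t)) (Any.map (λ { refl → listsOfLength⁺ (allFin t) xs (λ {y} _ → ∈-allFin y) }) (∈-upTo⁺ (s≤s (Unique⇒length≤ u)))))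
    (distinct⁺ u)

  vertexSeqs-Unique : ∀ t → Unique (vertexSeqs t)
  vertexSeqs-Unique t = filterᵇ-Unique distinct
    {concatMap (listsOfLength (allFin t)) (upTo (suc t))}
    (concatMap-Unique (listsOfLength (allFin t)) length (U.upTo⁺ (suc t)) (λ {n} _ → listsOfLength-Unique (allFin⁺ t) n)
      (λ {n} _ → listsOfLength-length (allFin t) n))

  sublists⁻ : ∀ (ys : List A) {xs} → xs ∈ sublists ys → ∀ {x} → x ∈ xs → x ∈ ys
  sublists⁻ [] (here refl) ()
  sublists⁻ (y ∷ ys) xs∈ x∈ with ∈-++⁻ (map (y ∷_) (sublists ys)) xs∈
  ... | inj₂ h = there (sublists⁻ ys h x∈)
  ... | inj₁ h with ∈-map⁻ (y ∷_) h | x∈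
  ...   | _ , _ , refl | here e = here e
  ...   | zs , zs∈ , refl | there x∈zs = there (sublists⁻ ys zs∈ x∈zs)

  filterᵇ∈sublists : ∀ (p : A → Bool) ys → filterᵇ p ys ∈ sublists ys
  filterᵇ∈sublists p [] = here refl
  filterᵇ∈sublists p (y ∷ ys) with p y
  ... | true = ∈-++⁺ˡ (∈-map⁺ (y ∷_) (filterᵇ∈sublists p ys))
  ... | false = ∈-++⁺ʳ (map (y ∷_) (sublists ys)) (filterᵇ∈sublists p ys)

  -- Sublists inherit the order of `ys`, so the edge list of a graph is canonical: graphs with the
  -- same adjacency are equal as lists.
  sublists-ext : ∀ {ys : List A} → Unique ys → ∀ {xs zs} → xs ∈ sublists ys → zs ∈ sublists ys →
    (∀ {x} → x ∈ xs → x ∈ zs) → (∀ {x} → x ∈ zs → x ∈ xs) → xs ≡ zs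
  sublists-ext {ys = []} u (here refl) (here refl) f g = refl
  sublists-ext {ys = y ∷ ys} u xs∈ zs∈ f g
    with ∈-++⁻ (map (y ∷_) (sublists ys)) xs∈ | ∈-++⁻ (map (y ∷_) (sublists ys)) zs∈
  ... | inj₂ a | inj₂ b = sublists-ext (uncons-Unique u) a b f g
  ... | inj₁ a | inj₂ b with ∈-map⁻ (y ∷_) a
  ...   | _ , _ , refl = ⊥-elim (uncons∉ u (sublists⁻ ys b (f (here refl))))
  sublists-ext {ys = y ∷ ys} u xs∈ zs∈ f g | inj₂ a | inj₁ b with ∈-map⁻ (y ∷_) b
  ...   | _ , _ , refl = ⊥-elim (uncons∉ u (sublists⁻ ys a (g (here refl))))
  sublists-ext {ys = y ∷ ys} u xs∈ zs∈ f g | inj₁ a | inj₁ b with ∈-map⁻ (y ∷_) a | ∈-map⁻ (y ∷_) b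
  ...   | xs′ , a′ , refl | zs′ , b′ , refl =
    cong (y ∷_) (sublists-ext (uncons-Unique u) a′ b′ (tl a′ f) (tl b′ g))
    where
    tl : ∀ {as bs} → as ∈ sublists ys → (∀ {x} → x ∈ y ∷ as → x ∈ y ∷ bs) → ∀ {x} → x ∈ as → x ∈ bs
    tl as∈ h x∈ with h (there x∈)
    ... | there x∈bs = x∈bs
    ... | here refl = ⊥-elim (uncons∉ u (sublists⁻ ys as∈ x∈))

  sublists-Unique : ∀ {ys : List A} → Unique ys → Unique (sublists ys)
  sublists-Unique {ys = []} u = [] ∷ []
  sublists-Unique {ys = y ∷ ys} u =
    U.++⁺ (map-Unique _ (λ { _ _ refl → refl }) rec) rec disj
    where
    rec = sublists-Unique (uncons-Unique u)
    disj : ∀ {xs} → ¬ (xs ∈ map (y ∷_) (sublists ys) × xs ∈ sublists ys)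
    disj (a , b) with ∈-map⁻ (y ∷_) a
    ... | _ , _ , refl = uncons∉ u (sublists⁻ ys b (here refl))

  sumOver-inject : ∀ (F : B → ℕ) (f : A → B) {xs ys} → Unique xs →
    (∀ {x y} → x ∈ xs → y ∈ xs → f x ≡ f y → x ≡ y) → (∀ {x} → x ∈ xs → f x ∈ ys) →
    sumOver (F ∘ f) xs ≤ sumOver F ys
  sumOver-inject F f {xs} {ys} u inj into =
    subst (_≤ sumOver F ys) (sumOver-map F f xs) (sumOver-⊆ F (map-Unique f inj u) sub)
    where
    sub : ∀ {y} → y ∈ map f xs → y ∈ ys
    sub y∈ with ∈-map⁻ f y∈
    ... | _ , x∈ , refl = into x∈

  length-inject : ∀ (f : A → B) {xs ys} → Unique xs →
    (∀ {x y} → x ∈ xs → y ∈ xs → f x ≡ f y → x ≡ y) → (∀ {x} → x ∈ xs → f x ∈ ys) →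
    length xs ≤ length ys
  length-inject f {xs} {ys} u inj into = subst (_≤ length ys) (length-map f xs) (length-⊆ (map-Unique f inj u) sub)
    where
    sub : ∀ {y} → y ∈ map f xs → y ∈ ys
    sub y∈ with ∈-map⁻ f y∈
    ... | _ , x∈ , refl = into x∈

-- Walks, and trees as acyclic parent functions.

module Trees where

  open Basics
  open import Data.Bool using (Bool; true; false; _∧_; _∨_; not)
  open import Data.Bool.Properties using (T-≡)
  open import Data.Bool.ListAction using (any)
  open import Data.Empty using (⊥; ⊥-elim)
  open import Data.Fin using (Fin; toℕ; zero; suc)
  open import Data.Fin.Properties as Finₚ using (_≟_; toℕ-injective)
  open import Data.List using (List; []; _∷_; map; length; filterᵇ; allFin)
  open import Data.List.Membership.Propositional using (_∈_; _∉_)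
  open import Data.List.Membership.DecPropositional using (_∈?_)
  open import Data.List.Membership.Propositional.Properties using (∈-allFin; ∈-map⁺; ∈-map⁻; ∈-concatMap⁺; ∈-concatMap⁻)
  open import Data.List.Relation.Unary.All using ([]; _∷_)
  open import Data.List.Relation.Unary.AllPairs using ([]; _∷_)
  open import Data.List.Relation.Unary.Any as Any using (Any; here; there)
  open import Data.List.Relation.Unary.Linked using (Linked; []; [-]; _∷_)
  open import Data.List.Relation.Unary.Unique.Propositional using (Unique)
  open import Data.List.Relation.Unary.Unique.Propositional.Properties as U using (allFin⁺)
  open import Data.Nat as ℕ using (ℕ; zero; suc; _+_; _≤_; _<_)
  open import Data.Nat.Properties as ℕₚ using (<-cmp; <⇒<ᵇ; <ᵇ⇒<; +-suc; <-irrefl; <-asym; m≤n+m)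
  open import Data.Product using (_×_; _,_; proj₁; proj₂; ∃; ∃₂)
  open import Data.Sum using (_⊎_; inj₁; inj₂)
  open import Function using (_∘_; Equivalence)
  open import Relation.Nullary using (¬_; Dec; yes; no)
  open import Relation.Binary using (tri<; tri≈; tri>)
  open import Relation.Binary.PropositionalEquality

  private variable
    t n h : ℕ

  -- The endpoints are indices, unlike in `Linked`, so that walks can be joined at a common
  -- endpoint.
  data Walk {A : Set} (R : A → A → Set) : A → A → List A → Set where
    [-] : ∀ {u} → Walk R u u (u ∷ [])
    _∷_ : ∀ {u v w xs} → R u v → Walk R v w xs → Walk R u w (u ∷ xs)

  module _ {A : Set} {R : A → A → Set} where

    start∈ : ∀ {u v xs} → Walk R u v xs → u ∈ xs
    start∈ [-] = here refl
    start∈ (_ ∷ _) = here refl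

    end∈ : ∀ {u v xs} → Walk R u v xs → v ∈ xs
    end∈ [-] = here refl
    end∈ (_ ∷ w) = there (end∈ w)

    walk-linked : ∀ {u v xs} → Walk R u v xs → Linked R xs
    walk-linked [-] = [-]
    walk-linked (e ∷ [-]) = e ∷ [-]
    walk-linked (e ∷ e′ ∷ w) = e ∷ walk-linked (e′ ∷ w)

    -- Only an inclusion is recorded for the new vertex list, because later arguments merely check
    -- that certain vertices are avoided.
    walk-++ : ∀ {u v w xs ys} → Walk R u v xs → Walk R v w ys →
              ∃ λ zs → Walk R u w zs × (∀ {z} → z ∈ zs → z ∈ xs ⊎ z ∈ ys)
    walk-++ [-] w = _ , w , inj₂
    walk-++ (e ∷ v) w with walk-++ v w
    ... | zs , r , sub = _ , e ∷ r , λ { (here eq) → inj₁ (here eq) ; (there z∈) → Data.Sum.map₁ there (sub z∈) }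

    walk-reverse : (∀ {a b} → R a b → R b a) → ∀ {u v xs} → Walk R u v xs →
                   ∃ λ ys → Walk R v u ys × (∀ {z} → z ∈ ys → z ∈ xs)
    walk-reverse s [-] = _ , [-] , λ z∈ → z∈
    walk-reverse s (e ∷ w) with walk-reverse s w
    ... | ys , r , sub with walk-++ r (s e ∷ [-])
    ...   | zs , r′ , sub′ = zs , r′ , λ z∈ → Data.Sum.[ there ∘ sub , (λ { (here eq) → there (subst (_∈ _) (sym eq) (start∈ w)) ; (there (here eq)) → here eq }) ] (sub′ z∈)

    walk-suffix : ∀ {u v xs x} → Walk R u v xs → x ∈ xs →
                  ∃ λ ys → Walk R x v ys × (Unique xs → Unique ys) × (∀ {z} → z ∈ ys → z ∈ xs)
    walk-suffix [-] (here refl) = _ , [-] , (λ u → u) , λ z∈ → z∈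
    walk-suffix (e ∷ w) (here refl) = _ , e ∷ w , (λ u → u) , λ z∈ → z∈
    walk-suffix (e ∷ w) (there x∈) with walk-suffix w x∈
    ... | ys , r , u , sub = ys , r , u ∘ uncons-Unique , there ∘ sub

    -- Loop erasure from the far end: if the start reappears in the shortened rest, the suffix from
    -- that occurrence replaces everything.
    walk-shorten : (∀ (a b : A) → Dec (a ≡ b)) → ∀ {u v xs} → Walk R u v xs →
                   ∃ λ ys → Walk R u v ys × Unique ys × (∀ {z} → z ∈ ys → z ∈ xs)
    walk-shorten _≟_ [-] = _ , [-] , [] ∷ [] , λ z∈ → z∈
    walk-shorten _≟_ {u} (e ∷ w) with walk-shorten _≟_ w
    ... | ys , r , un , sub with _∈?_ _≟_ u ys
    ...   | no u∉ = _ , e ∷ r , cons-Unique u∉ un , λ { (here eq) → here eq ; (there z∈) → there (sub z∈) }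
    ...   | yes u∈ with walk-suffix r u∈
    ...     | zs , r′ , un′ , sub′ = zs , r′ , un′ un , there ∘ sub ∘ sub′

  lastIs⁺ : ∀ {R : Fin t → Fin t → Set} {u v xs} → Walk R u v xs → lastIs v xs ≡ true
  lastIs⁺ {u = u} [-] = ==-refl u
  lastIs⁺ {v = v} (_ ∷ [-]) = ==-refl v
  lastIs⁺ (_ ∷ e ∷ w) = lastIs⁺ (e ∷ w)

  firstIs⁺ : ∀ {R : Fin t → Fin t → Set} {u v xs} → Walk R u v xs → firstIs u xs ≡ true
  firstIs⁺ {u = u} [-] = ==-refl u
  firstIs⁺ {u = u} (_ ∷ _) = ==-refl u

  walk⁺ : ∀ {R : Fin t → Fin t → Set} {x v xs} → lastIs v (x ∷ xs) ≡ true → Linked R (x ∷ xs) → Walk R x v (x ∷ xs)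
  walk⁺ {x = x} {v} {[]} l [-] with ==⇒≡ x v l
  ... | refl = [-]
  walk⁺ {xs = y ∷ ys} l (e ∷ w) = e ∷ walk⁺ l w

  path-spec : ∀ (G : Graph t) u v xs → isPath G xs ∧ firstIs u xs ∧ lastIs v xs ≡ true → Walk (Adj G) u v xs × Unique xs
  path-spec G u v (x ∷ xs) eq with ∧⁻ (isPath G (x ∷ xs)) eq
  ... | p , q with ∧⁻ (x == u) q | isPath⁻ G (x ∷ xs) p
  ...   | f , l | un , lk with ==⇒≡ x u f
  ...     | refl = walk⁺ l lk , un

  path-spec⁺ : ∀ {G : Graph t} {u v xs} → Walk (Adj G) u v xs → Unique xs → isPath G xs ∧ firstIs u xs ∧ lastIs v xs ≡ true
  path-spec⁺ {xs = x ∷ xs} w un = ∧⁺ (isPath⁺ un (walk-linked w)) (∧⁺ (firstIs⁺ w) (lastIs⁺ w))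
  path-spec⁺ {xs = []} ()

  adj⁻ : ∀ (G : Graph t) {u v} → Adj G u v → (u , v) ∈ G ⊎ (v , u) ∈ G
  adj⁻ G {u} {v} (adjacent eq) with any⁻ _ G eq
  ... | (a , b) , ab∈ , h with ∨⁻ ((a == u) ∧ (b == v)) h
  ...   | inj₁ h′ with ∧⁻ (a == u) h′
  ...     | e₁ , e₂ = inj₁ (subst₂ (λ x y → (x , y) ∈ G) (==⇒≡ a u e₁) (==⇒≡ b v e₂) ab∈)
  adj⁻ G {u} {v} (adjacent eq) | (a , b) , ab∈ , h | inj₂ h′ with ∧⁻ (a == v) h′
  ...     | e₁ , e₂ = inj₂ (subst₂ (λ x y → (x , y) ∈ G) (==⇒≡ a v e₁) (==⇒≡ b u e₂) ab∈)

  adj⁺ : ∀ (G : Graph t) {u v} → (u , v) ∈ G → Adj G u v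
  adj⁺ G {u} {v} uv∈ = adjacent (any⁺ _ uv∈ (∨⁺ˡ (∧⁺ (==-refl u) (==-refl v))))

  allEdges⁺ : ∀ {u v : Fin t} → toℕ u < toℕ v → (u , v) ∈ allEdges t
  allEdges⁺ {t} {u} {v} lt =
    ∈-concatMap⁺ _ (Any.map (λ { refl → ∈-filterᵇ⁺ _ (∈-map⁺ (u ,_) (∈-allFin v)) (Equivalence.to T-≡ (<⇒<ᵇ lt)) }) (∈-allFin u))

  module _ {t : ℕ} where
    allEdges⁻ : ∀ {e : Fin t × Fin t} → e ∈ allEdges t → toℕ (proj₁ e) < toℕ (proj₂ e)
    allEdges⁻ e∈ with Any.satisfied (∈-concatMap⁻ _ {xs = allFin t} e∈)
    ... | i , h with ∈-filterᵇ⁻ _ {map (i ,_) (allFin t)} h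
    ...   | h′ , lt with ∈-map⁻ (i ,_) h′
    ...     | j , _ , refl = <ᵇ⇒< (toℕ i) (toℕ j) (Equivalence.from T-≡ lt)

  allEdges-Unique : ∀ t → Unique (allEdges t)
  allEdges-Unique t = concatMap-Unique _ proj₁ (allFin⁺ t)
    (λ {i} _ → filterᵇ-Unique _ {map (i ,_) (allFin t)} (map-Unique _ (λ { _ _ refl → refl }) (allFin⁺ t)))
    λ {i} _ h → fst-eq i (proj₁ (∈-filterᵇ⁻ _ {map (i ,_) (allFin t)} h))
    where
    fst-eq : ∀ (i : Fin t) {e : Fin t × Fin t} → e ∈ map (i ,_) (allFin t) → proj₁ e ≡ i
    fst-eq i h with ∈-map⁻ (i ,_) h
    ... | _ , _ , refl = refl

  adj-irrefl : ∀ {G : Graph t} → G ∈ allGraphs t → ∀ {u} → ¬ Adj G u u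
  adj-irrefl {t} {G} G∈ a with adj⁻ G a
  ... | inj₁ h = <-irrefl refl (allEdges⁻ (sublists⁻ (allEdges t) G∈ h))
  ... | inj₂ h = <-irrefl refl (allEdges⁻ (sublists⁻ (allEdges t) G∈ h))

  graph-ext : ∀ {G G′ : Graph t} → G ∈ allGraphs t → G′ ∈ allGraphs t →
    (∀ {u v} → Adj G u v → Adj G′ u v) → (∀ {u v} → Adj G′ u v → Adj G u v) → G ≡ G′
  graph-ext {t} {G} {G′} G∈ G′∈ f g = sublists-ext (allEdges-Unique t) G∈ G′∈ (to G∈ G′∈ f) (to G′∈ G∈ g)
    where
    to : ∀ {G G′ : Graph t} → G ∈ allGraphs t → G′ ∈ allGraphs t →
      (∀ {u v} → Adj G u v → Adj G′ u v) → ∀ {e} → e ∈ G → e ∈ G′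
    to {G} {G′} G∈ G′∈ f e∈ with adj⁻ G′ (f (adj⁺ G e∈))
    ... | inj₁ h = h
    ... | inj₂ h = ⊥-elim (<-asym (allEdges⁻ (sublists⁻ (allEdges t) G∈ e∈)) (allEdges⁻ (sublists⁻ (allEdges t) G′∈ h)))

  -- Prepending `u` closes the walk to a cycle; `a ≢ b` ensures that it has at least three vertices.
  acyclic-no-cycle : ∀ {G : Graph t} → acyclic G ≡ true → ∀ {u a b xs} → Adj G u a → Adj G b u → a ≢ b →
    Walk (Adj G) a b xs → Unique xs → u ∉ xs → ⊥
  acyclic-no-cycle {t} {G} ac {u} {a} {b} {xs} ua bu a≢b w un u∉ = true≢false (any⁺ (isCycle G) (vertexSeqs⁺ cyc-un) (cyc w un u∉)) (not⁻ ac)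
    where
    cyc-un : Unique (u ∷ xs)
    cyc-un = cons-Unique u∉ un
    cyc : Walk (Adj G) a b xs → Unique xs → u ∉ xs → isCycle G (u ∷ xs) ≡ true
    cyc [-] _ _ = ⊥-elim (a≢b refl)
    cyc (e ∷ [-]) un u∉ = ∧⁺ (distinct⁺ (cons-Unique u∉ un)) (∧⁺ (walkOK⁺ (ua ∷ e ∷ [-]))
      (any⁺ (λ y → lastIs y (u ∷ a ∷ b ∷ []) ∧ adj G y u) {u ∷ a ∷ b ∷ []} (there (there (here refl))) (∧⁺ (==-refl b) (is-adj bu))))
    cyc w@(e ∷ e′ ∷ w′) un u∉ = ∧⁺ (distinct⁺ (cons-Unique u∉ un)) (∧⁺ (walkOK⁺ (walk-linked (ua ∷ w)))
      (any⁺ (λ y → lastIs y (u ∷ xs) ∧ adj G y u) (there (end∈ w)) (∧⁺ (lastIs⁺ (ua ∷ w)) (is-adj bu))))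

  -- Where the walks first part after `u`, the rest of one followed by the reversed rest of the
  -- other joins two different neighbours of `u` while avoiding `u`. After loop erasure this
  -- contradicts `acyclic-no-cycle`.
  simple-walk-unique : ∀ {G : Graph t} → acyclic G ≡ true → ∀ {u v xs ys} →
    Walk (Adj G) u v xs → Walk (Adj G) u v ys → Unique xs → Unique ys → xs ≡ ys
  simple-walk-unique ac [-] [-] _ _ = refl
  simple-walk-unique ac [-] (_ ∷ w) _ un = ⊥-elim (uncons∉ un (end∈ w))
  simple-walk-unique ac (_ ∷ w) [-] un _ = ⊥-elim (uncons∉ un (end∈ w))
  simple-walk-unique {G = G} ac {u} (_∷_ {v = a} e w) (_∷_ {v = b} e′ w′) un un′ with a ≟ b
  ... | yes refl = cong (u ∷_) (simple-walk-unique ac w w′ (uncons-Unique un) (uncons-Unique un′))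
  ... | no a≢b with walk-reverse (Adj-sym G) w′
  ...   | _ , r , sub with walk-++ w r
  ...     | _ , r′ , sub′ with walk-shorten _≟_ r′
  ...       | zs , s , uz , sub″ = ⊥-elim (acyclic-no-cycle {G = G} ac e (Adj-sym G e′) a≢b s uz
                λ u∈ → Data.Sum.[ uncons∉ un , uncons∉ un′ ∘ sub ] (sub′ (sub″ u∈)))

  -- A tree on Fin (suc n), rooted at zero, is encoded by its parent function; the value at zero is irrelevant.

  Child : (Fin (suc n) → Fin (suc n)) → Fin (suc n) → Fin (suc n) → Set
  Child p y x = y ≢ zero × p y ≡ x

  Edge : (Fin (suc n) → Fin (suc n)) → Fin (suc n) → Fin (suc n) → Set
  Edge p u v = Child p u v ⊎ Child p v u

  height≥ : (Fin (suc n) → Fin (suc n)) → ℕ → Fin (suc n) → Bool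
  height≥ p zero x = true
  height≥ {n} p (suc h) x = any (λ y → not (y == zero) ∧ (p y == x) ∧ height≥ p h y) (allFin (suc n))

  -- Bounded heights express that iterating `p` always reaches the root: the vertices of a cycle off
  -- the root would have every height.
  Acyclic : (Fin (suc n) → Fin (suc n)) → Set
  Acyclic p = ∃ λ H → ∀ x → height≥ p H x ≡ false

  record ParentOf (G : Graph (suc n)) (p : Fin (suc n) → Fin (suc n)) : Set where
    field
      adj⇒edge : ∀ {u v} → Adj G u v → Edge p u v
      adj-parent : ∀ {u} → u ≢ zero → Adj G u (p u)
      noCycle : Acyclic p

    edge⇒adj : ∀ {u v} → Edge p u v → Adj G u v
    edge⇒adj (inj₁ (u≢0 , refl)) = adj-parent u≢0
    edge⇒adj (inj₂ (v≢0 , refl)) = Adj-sym G (adj-parent v≢0)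

  module _ (p : Fin (suc n) → Fin (suc n)) where

    height⁺ : ∀ {h y x} → Child p y x → height≥ p h y ≡ true → height≥ p (suc h) x ≡ true
    height⁺ {h} {y} {x} (y≢0 , eq) hy = any⁺ (λ y → not (y == zero) ∧ (p y == x) ∧ height≥ p h y) (∈-allFin y) (∧⁺ (not⁺ (≢⇒== y≢0)) (∧⁺ (≡⇒== eq) hy))

    height⁻ : ∀ {h x} → height≥ p (suc h) x ≡ true → ∃ λ y → Child p y x × height≥ p h y ≡ true
    height⁻ {h} {x} eq with any⁻ _ (allFin (suc n)) eq
    ... | y , _ , e with ∧⁻ (not (y == zero)) e
    ...   | y≢0 , e′ with ∧⁻ (p y == x) e′
    ...     | py , hy = y , (==-false (not⁻ y≢0) , ==⇒≡ (p y) x py) , hy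

    height-pred : ∀ h {x} → height≥ p (suc h) x ≡ true → height≥ p h x ≡ true
    height-pred zero _ = refl
    height-pred (suc h) e with height⁻ {suc h} e
    ... | y , c , hy = height⁺ {h} c (height-pred h hy)

    height-mono : ∀ {h} k {x} → height≥ p (k + h) x ≡ true → height≥ p h x ≡ true
    height-mono zero e = e
    height-mono {h} (suc k) e = height-mono k (height-pred (k + h) e)

    unbounded-height : ∀ (P : Fin (suc n) → Set) → (∀ {x} → P x → ∃ λ y → Child p y x × P y) →
      ∀ h {x} → P x → height≥ p h x ≡ true
    unbounded-height P step zero px = refl
    unbounded-height P step (suc h) px with step px
    ... | y , c , py = height⁺ {h} c (unbounded-height P step h py)

    -- The way in which acyclicity is used: it suffices to exhibit a set of vertices each of which
    -- has a child in the same set.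
    no-unbounded : Acyclic p → ∀ (P : Fin (suc n) → Set) → (∀ {x} → P x → ∃ λ y → Child p y x × P y) → ∀ {x} → ¬ P x
    no-unbounded (H , f) P step {x} px = true≢false (unbounded-height P step H px) (f x)

    -- Induction along parents. Passing to the parent raises a known lower bound on the height,
    -- which cannot exceed `H`, so the root is reached after at most `H` steps.
    climb : Acyclic p → ∀ (P : Fin (suc n) → Set) → P zero → (∀ {x} → x ≢ zero → P (p x) → P x) → ∀ x → P x
    climb (H , f) P P0 step x = go H 0 (ℕₚ.+-identityʳ H) x refl
      where
      go : ∀ k h → k + h ≡ H → ∀ x → height≥ p h x ≡ true → P x
      go zero h refl x hx = ⊥-elim (true≢false hx (f x))
      go (suc k) h eq x hx with x ≟ zero
      ... | yes refl = P0
      ... | no x≢0 = step x≢0 (go k (suc h) (trans (+-suc k h) eq) (p x) (height⁺ {h} (x≢0 , refl) hx))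

  -- By induction from the root. If the edge from `x` to `p x` were oriented the other way by `q`,
  -- then `p (p x)`, which is `q (p x)` by induction, would be `x`: a cycle of length two.
  parent-unique : ∀ {G : Graph (suc n)} {p q} → ParentOf G p → ParentOf G q → ∀ x → x ≢ zero → p x ≡ q x
  parent-unique {n} {G} {p} {q} P Q = climb p (noCycle P) (λ x → x ≢ zero → p x ≡ q x) (λ h → ⊥-elim (h refl)) step
    where
    open ParentOf
    step : ∀ {x} → x ≢ zero → (p x ≢ zero → p (p x) ≡ q (p x)) → x ≢ zero → p x ≡ q x
    step {x} x≢0 ih _ with adj⇒edge Q (adj-parent P x≢0)
    ... | inj₁ (_ , e) = sym e
    ... | inj₂ (px≢0 , e) = ⊥-elim (no-unbounded p (noCycle P) (λ z → z ≡ x ⊎ z ≡ p x)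
        (λ { (inj₁ refl) → p x , (px≢0 , trans (ih px≢0) e) , inj₂ refl ; (inj₂ refl) → x , (x≢0 , refl) , inj₁ refl }) {x} (inj₁ refl))

  graph-determined : ∀ {G G′ : Graph (suc n)} {p q} → G ∈ allGraphs (suc n) → G′ ∈ allGraphs (suc n) →
    ParentOf G p → ParentOf G′ q → (∀ x → x ≢ zero → p x ≡ q x) → G ≡ G′
  graph-determined {n} {G} {G′} {p} {q} G∈ G′∈ P Q eq = graph-ext G∈ G′∈
    (ParentOf.edge⇒adj Q ∘ conv eq ∘ ParentOf.adj⇒edge P)
    (ParentOf.edge⇒adj P ∘ conv (λ x x≢0 → sym (eq x x≢0)) ∘ ParentOf.adj⇒edge Q)
    where
    conv : ∀ {p q : Fin (suc n) → Fin (suc n)} → (∀ x → x ≢ zero → p x ≡ q x) → ∀ {u v} → Edge p u v → Edge q u v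
    conv eq {u} {v} (inj₁ (h , e)) = inj₁ (h , trans (sym (eq u h)) e)
    conv eq {u} {v} (inj₂ (h , e)) = inj₂ (h , trans (sym (eq v h)) e)

  module _ (p : Fin (suc n) → Fin (suc n)) where
    isEdge : Fin (suc n) × Fin (suc n) → Bool
    isEdge (i , j) = (not (i == zero) ∧ (p i == j)) ∨ (not (j == zero) ∧ (p j == i))

    parentGraph : Graph (suc n)
    parentGraph = filterᵇ isEdge (allEdges (suc n))

    isEdge⁻ : ∀ {u v} → isEdge (u , v) ≡ true → Edge p u v
    isEdge⁻ {u} {v} e with ∨⁻ (not (u == zero) ∧ (p u == v)) e
    ... | inj₁ e′ with ∧⁻ (not (u == zero)) e′
    ...   | a , b = inj₁ (==-false (not⁻ a) , ==⇒≡ (p u) v b)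
    isEdge⁻ {u} {v} e | inj₂ e′ with ∧⁻ (not (v == zero)) e′
    ...   | a , b = inj₂ (==-false (not⁻ a) , ==⇒≡ (p v) u b)

    isEdge⁺ : ∀ {u v} → Edge p u v → isEdge (u , v) ≡ true
    isEdge⁺ (inj₁ (h , e)) = ∨⁺ˡ (∧⁺ (not⁺ (≢⇒== h)) (≡⇒== e))
    isEdge⁺ {u} {v} (inj₂ (h , e)) = ∨⁺ʳ (not (u == zero) ∧ (p u == v)) (∧⁺ (not⁺ (≢⇒== h)) (≡⇒== e))

    edge-swap : ∀ {u v} → Edge p u v → Edge p v u
    edge-swap (inj₁ e) = inj₂ e
    edge-swap (inj₂ e) = inj₁ e

    parentGraph∈ : parentGraph ∈ allGraphs (suc n)
    parentGraph∈ = filterᵇ∈sublists isEdge (allEdges (suc n))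

    parentGraph-parent : Acyclic p → ParentOf parentGraph p
    parentGraph-parent ac = record { adj⇒edge = a⇒e ; adj-parent = a-p ; noCycle = ac }
      where
      a⇒e : ∀ {u v} → Adj parentGraph u v → Edge p u v
      a⇒e a with adj⁻ parentGraph a
      ... | inj₁ h = isEdge⁻ (proj₂ (∈-filterᵇ⁻ isEdge {allEdges (suc n)} h))
      ... | inj₂ h = edge-swap (isEdge⁻ (proj₂ (∈-filterᵇ⁻ isEdge {allEdges (suc n)} h)))
      a-p : ∀ {u} → u ≢ zero → Adj parentGraph u (p u)
      a-p {u} u≢0 with <-cmp (toℕ u) (toℕ (p u))
      ... | tri< lt _ _ = adj⁺ parentGraph (∈-filterᵇ⁺ isEdge (allEdges⁺ lt) (isEdge⁺ (inj₁ (u≢0 , refl))))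
      ... | tri> _ _ gt = Adj-sym parentGraph (adj⁺ parentGraph (∈-filterᵇ⁺ isEdge (allEdges⁺ gt) (isEdge⁺ (inj₂ (u≢0 , refl)))))
      ... | tri≈ _ eq _ = ⊥-elim (no-unbounded p ac (_≡ u) (λ { refl → u , (u≢0 , sym (toℕ-injective eq)) , refl }) {u} refl)

    -- A vertex has only one parent, so two different neighbours cannot both be it.
    one-is-child : ∀ {z a b} → Edge p z a → Edge p z b → a ≢ b → Child p a z ⊎ Child p b z
    one-is-child (inj₂ c) _ _ = inj₁ c
    one-is-child (inj₁ _) (inj₂ c) _ = inj₂ c
    one-is-child (inj₁ (_ , refl)) (inj₁ (_ , refl)) h = ⊥-elim (h refl)

  module _ {G : Graph (suc n)} {p : Fin (suc n) → Fin (suc n)} (P : ParentOf G p) where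
    open ParentOf P

    walk-to-root : ∀ x → ∃ λ xs → Walk (Adj G) x zero xs
    walk-to-root = climb p noCycle _ (_ , [-]) (λ { x≢0 (xs , w) → _ , adj-parent x≢0 ∷ w })

    parent⇒connected : connected G ≡ true
    parent⇒connected = all⁺ _ (allFin (suc n)) λ {u} _ → all⁺ _ (allFin (suc n)) λ {v} _ → conn u v
      where
      conn : ∀ u v → any (λ xs → isPath G xs ∧ firstIs u xs ∧ lastIs v xs) (vertexSeqs (suc n)) ≡ true
      conn u v with walk-reverse (Adj-sym G) (proj₂ (walk-to-root v))
      ... | _ , r , _ with walk-++ (proj₂ (walk-to-root u)) r
      ...   | _ , w , _ with walk-shorten _≟_ w
      ...     | xs , w′ , un , _ = any⁺ (λ xs → isPath G xs ∧ firstIs u xs ∧ lastIs v xs) (vertexSeqs⁺ un) (path-spec⁺ w′ un)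

    private
      TwoNbrs : List (Fin (suc n)) → Fin (suc n) → Set
      TwoNbrs c z = ∃₂ λ a b → Adj G z a × Adj G z b × a ≢ b × a ∈ c × b ∈ c

      -- Runs along the cycle behind `q`; `s` is the vertex at which the cycle closes.
      inner : ∀ c {q s x y xs} → Adj G q x → Walk (Adj G) x y xs → Adj G y s → Unique (q ∷ xs) → s ∉ q ∷ xs →
        (∀ {z} → z ∈ q ∷ s ∷ xs → z ∈ c) → ∀ {z} → z ∈ xs → TwoNbrs c z
      inner c {q} {s} qx [-] ys un s∉ sub (here refl) =
        q , s , Adj-sym G qx , ys , (λ e → s∉ (here (sym e))) , sub (here refl) , sub (there (here refl))
      inner c {q} {s} qx (_∷_ {v = v} e w) ys un s∉ sub (here refl) =
        q , v , Adj-sym G qx , e , (λ eq → uncons∉ un (there (subst (_∈ _) (sym eq) (start∈ w)))) , sub (here refl) , sub (there (there (there (start∈ w))))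
      inner c qx (e ∷ w) ys un s∉ sub (there z∈) =
        inner c e w ys (uncons-Unique un) (s∉ ∘ there) (λ { (here eq) → sub (there (there (here eq))) ; (there (here eq)) → sub (there (here eq)) ; (there (there h)) → sub (there (there (there h))) }) z∈

      cycle-nbrs : ∀ {x y x₂ x₃ xs} → Adj G x x₂ → Adj G x₂ x₃ → Walk (Adj G) x₃ y xs → Adj G y x → Unique (x ∷ x₂ ∷ xs) →
        ∀ {z} → z ∈ x ∷ x₂ ∷ xs → TwoNbrs (x ∷ x₂ ∷ xs) z
      cycle-nbrs {x} {y} {x₂} {x₃} e₁ e₂ w e₃ un (here refl) =
        x₂ , y , e₁ , Adj-sym G e₃ , (λ eq → uncons∉ (uncons-Unique un) (subst (_∈ _) (sym eq) (end∈ w))) , there (here refl) , there (there (end∈ w))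
      cycle-nbrs {x} {y} {x₂} {x₃} e₁ e₂ w e₃ un (there (here refl)) =
        x , x₃ , Adj-sym G e₁ , e₂ , (λ eq → uncons∉ un (there (subst (_∈ _) (sym eq) (start∈ w)))) , here refl , there (there (start∈ w))
      cycle-nbrs {x} {y} {x₂} {x₃} {xs} e₁ e₂ w e₃ un (there (there z∈)) =
        inner (x ∷ x₂ ∷ xs) e₂ w e₃ (uncons-Unique un) (uncons∉ un) (λ { (here eq) → there (here eq) ; (there (here eq)) → here eq ; (there (there h)) → there (there h) }) z∈

    -- Every vertex of a cycle has two different neighbours on it, hence a child on it, so the
    -- heights along the cycle would be unbounded.
    parent⇒acyclic : acyclic G ≡ true
    parent⇒acyclic = not⁺ (¬true⇒false λ e → no-cycle (any⁻ (isCycle G) (vertexSeqs (suc n)) e))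
      where
      no-cycle : ¬ ∃ λ c → c ∈ vertexSeqs (suc n) × isCycle G c ≡ true
      no-cycle (c@(x ∷ x₂ ∷ x₃ ∷ xs) , _ , e) with ∧⁻ (distinct c) e
      ... | d , e′ with ∧⁻ (walkOK G c) e′
      ...   | wk , cl with walkOK⁻ G c wk | any⁻ _ c cl
      ...     | e₁ ∷ e₂ ∷ lk | y , _ , yl with ∧⁻ (lastIs y c) yl
      ...       | l , yx = no-unbounded p noCycle (_∈ c) step {x} (here refl)
        where
        step : ∀ {z} → z ∈ c → ∃ λ w → Child p w z × w ∈ c
        step {z} z∈ with cycle-nbrs e₁ e₂ (walk⁺ {xs = xs} l lk) (adjacent yx) (distinct⁻ c d) z∈
        ... | a , b , za , zb , a≢b , a∈ , b∈ with one-is-child p (adj⇒edge za) (adj⇒edge zb) a≢b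
        ...   | inj₁ ch = a , ch , a∈
        ...   | inj₂ ch = b , ch , b∈

  parentGraph∈trees : ∀ (p : Fin (suc n) → Fin (suc n)) → Acyclic p → parentGraph p ∈ trees (suc n)
  parentGraph∈trees p ac = ∈-filterᵇ⁺ isTree (parentGraph∈ p) (∧⁺ (parent⇒connected P) (parent⇒acyclic P))
    where P = parentGraph-parent p ac

  headOr[] : {A : Set} → List (List A) → List A
  headOr[] [] = []
  headOr[] (x ∷ _) = x

  headOr[]-∈ : {A : Set} {x : List A} (xs : List (List A)) → x ∈ xs → headOr[] xs ∈ xs
  headOr[]-∈ (x ∷ xs) _ = here refl

  rootPath : Graph (suc n) → Fin (suc n) → List (Fin (suc n)) → Bool
  rootPath G u xs = isPath G xs ∧ firstIs u xs ∧ lastIs zero xs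

  pathToRoot : Graph (suc n) → Fin (suc n) → List (Fin (suc n))
  pathToRoot {n} G u = headOr[] (filterᵇ (rootPath G u) (vertexSeqs (suc n)))

  second : List (Fin (suc n)) → Fin (suc n)
  second (_ ∷ y ∷ _) = y
  second _ = zero

  parent : Graph (suc n) → Fin (suc n) → Fin (suc n)
  parent G u = second (pathToRoot G u)

  trees⁻ : ∀ {G : Graph t} → G ∈ trees t → G ∈ allGraphs t × connected G ≡ true × acyclic G ≡ true
  trees⁻ {t} {G} G∈ with ∈-filterᵇ⁻ isTree {allGraphs t} G∈
  ... | a , e with ∧⁻ (connected G) e
  ...   | c , ac = a , c , ac

  -- For an edge `u v` there are two cases. If `v` is off the path from `u` to the root, prepending
  -- `v` yields the path of `v`, so `u` is the parent of `v`. Otherwise the part of that path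
  -- starting at `v`, with `u` put in front, is again a simple path from `u` to the root; by
  -- uniqueness its second vertex `v` is the parent of `u`.
  parent-ParentOf : ∀ {G : Graph (suc n)} → G ∈ trees (suc n) → ParentOf G (parent G)
  parent-ParentOf {n} {G} G∈ = record { adj⇒edge = a⇒e ; adj-parent = a-p ; noCycle = suc (suc n) , bounded }
    where
    G∈′ = proj₁ (trees⁻ G∈)
    conn = proj₁ (proj₂ (trees⁻ G∈))
    ac = proj₂ (proj₂ (trees⁻ G∈))
    P = pathToRoot G

    spec : ∀ u → Walk (Adj G) u zero (P u) × Unique (P u)
    spec u with any⁻ (rootPath G u) (vertexSeqs (suc n)) (all⁻ _ (allFin (suc n)) (all⁻ _ (allFin (suc n)) conn (∈-allFin u)) (∈-allFin zero))
    ... | xs , xs∈ , e = path-spec G u zero (P u)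
      (proj₂ (∈-filterᵇ⁻ (rootPath G u) {vertexSeqs (suc n)} (headOr[]-∈ _ (∈-filterᵇ⁺ (rootPath G u) xs∈ e))))

    unique : ∀ {u xs} → Walk (Adj G) u zero xs → Unique xs → P u ≡ xs
    unique {u} w un = simple-walk-unique {G = G} ac (proj₁ (spec u)) w (proj₂ (spec u)) un

    unfold : ∀ {u xs} → Walk (Adj G) u zero xs → Unique xs → u ≢ zero → Adj G u (second xs) × xs ≡ u ∷ P (second xs)
    unfold [-] un u≢0 = ⊥-elim (u≢0 refl)
    unfold {u} (e ∷ [-]) un _ = e , cong (u ∷_) (sym (unique {zero} [-] (uncons-Unique un)))
    unfold {u} (e ∷ w@(_ ∷ _)) un _ = e , cong (u ∷_) (sym (unique w (uncons-Unique un)))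

    a-p : ∀ {u} → u ≢ zero → Adj G u (parent G u)
    a-p {u} u≢0 = proj₁ (unfold (proj₁ (spec u)) (proj₂ (spec u)) u≢0)

    P-step : ∀ {u} → u ≢ zero → P u ≡ u ∷ P (parent G u)
    P-step {u} u≢0 = proj₂ (unfold (proj₁ (spec u)) (proj₂ (spec u)) u≢0)

    second-walk : ∀ {u a b xs} → Walk (Adj G) a b xs → second (u ∷ xs) ≡ a
    second-walk [-] = refl
    second-walk (_ ∷ _) = refl

    a⇒e : ∀ {u v} → Adj G u v → Edge (parent G) u v
    a⇒e {u} {v} uv with _∈?_ _≟_ v (P u)
    ... | no v∉ = inj₂ (v≢0 , trans (cong second (unique w′ un′)) (second-walk (proj₁ (spec u))))
      where
      v≢0 : v ≢ zero
      v≢0 refl = v∉ (end∈ (proj₁ (spec u)))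
      w′ = Adj-sym G uv ∷ proj₁ (spec u)
      un′ = cons-Unique v∉ (proj₂ (spec u))
    ... | yes v∈ with u ≟ zero
    ...   | yes refl = ⊥-elim (adj-irrefl G∈′ (subst (λ z → Adj G z v) (v≡0 (subst (v ∈_) (unique {zero} [-] ([] ∷ [])) v∈)) uv))
      where
      v≡0 : v ∈ zero ∷ [] → zero ≡ v
      v≡0 (here eq) = sym eq
    ...   | no u≢0 with subst (v ∈_) (P-step u≢0) v∈
    ...     | here refl = ⊥-elim (adj-irrefl G∈′ uv)
    ...     | there v∈′ with walk-suffix (proj₁ (spec (parent G u))) v∈′
    ...       | zs , w , un , sub = inj₁ (u≢0 , trans (cong second (unique (uv ∷ w) (cons-Unique u∉ (un (proj₂ (spec (parent G u))))))) (second-walk w))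
      where
      u∉ : u ∉ zs
      u∉ u∈ = uncons∉ (subst Unique (P-step u≢0) (proj₂ (spec u))) (sub u∈)

    -- The path of a child to the root is longer by one, and a simple path has at most `suc n`
    -- vertices.
    height-bound : ∀ h x → height≥ (parent G) h x ≡ true → length (P x) + h ≤ suc n
    height-bound zero x _ = subst (_≤ suc n) (sym (ℕₚ.+-identityʳ _)) (Unique⇒length≤ (proj₂ (spec x)))
    height-bound (suc h) x e with height⁻ (parent G) {h} e
    ... | y , (y≢0 , refl) , hy = subst (_≤ suc n) (trans (cong (λ l → length l + h) (P-step y≢0)) (sym (+-suc _ h))) (height-bound h y hy)

    bounded : ∀ x → height≥ (parent G) (suc (suc n)) x ≡ false
    bounded x = ¬true⇒false λ e → <-irrefl refl (ℕₚ.≤-trans (m≤n+m (suc (suc n)) (length (P x))) (height-bound (suc (suc n)) x e))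

  trees-Unique : ∀ t → Unique (trees t)
  trees-Unique t = filterᵇ-Unique isTree {allGraphs t} (sublists-Unique (allEdges-Unique t))

-- Heights, and the word of parents in the order of height.

module Codes where

  open Basics
  open Trees
  open import Data.Bool using (Bool; true; false; _∧_; not)
  open import Data.Empty using (⊥; ⊥-elim)
  open import Data.Fin using (Fin; zero; suc)
  open import Data.Fin.Properties using (_≟_)
  open import Data.List using (List; []; _∷_; _++_; map; length; filterᵇ; allFin; drop)
  open import Data.List.Properties using (length-map; length-++; map-++; ++-assoc; ∷-injectiveˡ; ∷-injectiveʳ)
  open import Data.List.Membership.Propositional using (_∈_; _∉_)
  open import Data.List.Membership.Propositional.Properties using (∈-map⁺; ∈-map⁻; ∈-++⁺ˡ; ∈-++⁺ʳ; ∈-++⁻)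
  open import Data.List.Relation.Unary.Any as Any using (here; there)
  open import Data.List.Relation.Unary.AllPairs using ([]; _∷_)
  open import Data.List.Relation.Unary.All using ([]; _∷_)
  open import Data.List.Relation.Unary.Unique.Propositional using (Unique)
  import Data.List.Relation.Unary.Unique.Propositional.Properties as U
  open import Data.Nat as ℕ using (ℕ; zero; suc; _+_; _≤_; _∸_)
  open import Data.Nat.Properties hiding (_≟_)
  open import Data.Product using (_×_; _,_; proj₁; proj₂; ∃)
  open import Data.Sum using (_⊎_; inj₁; inj₂)
  open import Function using (_∘_)
  open import Relation.Nullary using (yes; no)
  open import Relation.Binary.PropositionalEquality

  private variable
    A : Set
    n : ℕ

  drop-length-++ : ∀ (xs : List A) {ys} → drop (length xs) (xs ++ ys) ≡ ys
  drop-length-++ [] = refl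
  drop-length-++ (x ∷ xs) = drop-length-++ xs

  nonzero : Fin (suc n) → Bool
  nonzero x = not (x == zero)

  nonzero⁺ : ∀ {x : Fin (suc n)} → x ≢ zero → nonzero x ≡ true
  nonzero⁺ h = not⁺ (≢⇒== h)

  nonzero⁻ : ∀ {x : Fin (suc n)} → nonzero x ≡ true → x ≢ zero
  nonzero⁻ e = ==-false (not⁻ e)

  -- The family `χ` is arbitrary because decoding needs the same layers for sets computed from a
  -- word, before they are known to be the heights of a parent function.
  module Layers {n : ℕ} (χ : ℕ → Fin (suc n) → Bool) where

    inLayer : ℕ → Fin (suc n) → Bool
    inLayer h x = nonzero x ∧ (χ h x ∧ not (χ (suc h) x))

    layer : ℕ → List (Fin (suc n))
    layer h = filterᵇ (inLayer h) (allFin (suc n))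

    order : ℕ → ℕ → List (Fin (suc n))
    order h zero = []
    order h (suc k) = layer h ++ order (suc h) k

    nz : ℕ → Fin (suc n) → Bool
    nz h x = nonzero x ∧ χ h x

    layer⁻ : ∀ {h x} → x ∈ layer h → x ≢ zero × χ h x ≡ true × χ (suc h) x ≡ false
    layer⁻ {h} {x} x∈ with ∧⁻ (nonzero x) (proj₂ (∈-filterᵇ⁻ (inLayer h) {allFin (suc n)} x∈))
    ... | a , e with ∧⁻ (χ h x) e
    ...   | b , c = nonzero⁻ a , b , not⁻ c

    layer⁺ : ∀ {h x} → x ≢ zero → χ h x ≡ true → χ (suc h) x ≡ false → x ∈ layer h
    layer⁺ {h} a b c = ∈-count (inLayer h) (∧⁺ (nonzero⁺ a) (∧⁺ b (not⁺ c)))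

    order-+ : ∀ h j k → order h (j + k) ≡ order h j ++ order (j + h) k
    order-+ h zero k = refl
    order-+ h (suc j) k = trans (cong (layer h ++_) (trans (order-+ (suc h) j k) (cong (λ z → order (suc h) j ++ order z k) (+-suc j h))))
      (sym (++-assoc (layer h) _ _))

    module _ (mono : ∀ h {x} → χ (suc h) x ≡ true → χ h x ≡ true) where

      mono* : ∀ k {h x} → χ (k + h) x ≡ true → χ h x ≡ true
      mono* zero e = e
      mono* (suc k) e = mono* k (mono _ e)

      order⁻ : ∀ k {h x} → x ∈ order h k → x ≢ zero × χ h x ≡ true × χ (k + h) x ≡ false
      order⁻ (suc k) {h} {x} x∈ with ∈-++⁻ (layer h) x∈
      ... | inj₁ l with layer⁻ l
      ...   | a , b , c = a , b , ¬true⇒false (λ e → true≢false (mono* k (subst (λ z → χ z x ≡ true) (sym (+-suc k h)) e)) c)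
      order⁻ (suc k) {h} {x} x∈ | inj₂ o with order⁻ k o
      ...   | a , b , c = a , mono h b , subst (λ z → χ z x ≡ false) (+-suc k h) c

      order⁺ : ∀ k {h x} → x ≢ zero → χ h x ≡ true → χ (k + h) x ≡ false → x ∈ order h k
      order⁺ zero a b c = ⊥-elim (true≢false b c)
      order⁺ (suc k) {h} {x} a b c with bool-cases (χ (suc h) x)
      ... | inj₁ e = ∈-++⁺ʳ (layer h) (order⁺ k a e (subst (λ z → χ z x ≡ false) (sym (+-suc k h)) c))
      ... | inj₂ e = ∈-++⁺ˡ (layer⁺ a b e)

      order-Unique : ∀ h k → Unique (order h k)
      order-Unique h zero = []
      order-Unique h (suc k) = U.++⁺ (count-Unique (inLayer h)) (order-Unique (suc h) k)
        λ { (l , o) → true≢false (proj₁ (proj₂ (order⁻ k o))) (proj₂ (proj₂ (layer⁻ l))) }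

      length-order : ∀ h k → (∀ x → χ (k + h) x ≡ false) → length (order h k) ≡ count (nz h)
      length-order h k end = length-≡ (order-Unique h k) (count-Unique (nz h))
        (λ x∈ → let (a , b , _) = order⁻ k x∈ in ∈-count (nz h) (∧⁺ (nonzero⁺ a) b))
        (λ {x} x∈ → let (a , b) = ∧⁻ (nonzero x) (proj₂ (∈-filterᵇ⁻ (nz h) {allFin (suc n)} x∈)) in order⁺ k (nonzero⁻ a) b (end x))

  order-cong : ∀ {χ ψ : ℕ → Fin (suc n) → Bool} → (∀ h x → χ h x ≡ ψ h x) → ∀ h k → Layers.order χ h k ≡ Layers.order ψ h k
  order-cong eq h zero = refl
  order-cong {n} {χ} {ψ} eq h (suc k) = cong₂ _++_
    (filterᵇ-cong _ _ (allFin (suc n)) (λ x → cong₂ (λ a b → nonzero x ∧ (a ∧ not b)) (eq h x) (eq (suc h) x))) (order-cong eq (suc h) k)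

  module Word {n : ℕ} (p : Fin (suc n) → Fin (suc n)) where
    open Layers (height≥ p) public

    size : ℕ → ℕ
    size h = count (height≥ p h)

    word : ℕ → ℕ → List (Fin (suc n))
    word h k = map p (order h k)

    module _ (ac : Acyclic p) where

      -- Climbing to the root only increases the height. Hence every nonempty level contains the
      -- root, which is why `size h` exceeds the number of its other vertices by one.
      root-highest : ∀ {h} x → height≥ p h x ≡ true → height≥ p h zero ≡ true
      root-highest {h} x e = climb p ac (λ x → ∀ h → height≥ p h x ≡ true → height≥ p h zero ≡ true)
        (λ h e → e) (λ x≢0 ih h e → ih h (height-pred p h (height⁺ p {h} (x≢0 , refl) e))) x h e

      size-nz : ∀ h → size h ≡ 0 × count (nz h) ≡ 0 ⊎ size h ≡ suc (count (nz h))
      size-nz h with bool-cases (height≥ p h zero)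
      ... | inj₁ e = inj₂ (length-≡ (count-Unique (height≥ p h)) (cons-Unique z∉ (count-Unique (nz h))) to from)
        where
        z∉ : zero ∉ filterᵇ (nz h) (allFin (suc n))
        z∉ z∈ = nonzero⁻ {n} {zero} (proj₁ (∧⁻ (nonzero {n} zero) {height≥ p h zero} (proj₂ (∈-filterᵇ⁻ (nz h) {allFin (suc n)} z∈)))) refl
        to : ∀ {x} → x ∈ filterᵇ (height≥ p h) (allFin (suc n)) → x ∈ zero ∷ filterᵇ (nz h) (allFin (suc n))
        to {x} x∈ with x ≟ zero
        ... | yes refl = here refl
        ... | no x≢0 = there (∈-count (nz h) (∧⁺ (nonzero⁺ x≢0) (proj₂ (∈-filterᵇ⁻ (height≥ p h) {allFin (suc n)} x∈))))
        from : ∀ {x} → x ∈ zero ∷ filterᵇ (nz h) (allFin (suc n)) → x ∈ filterᵇ (height≥ p h) (allFin (suc n))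
        from (here refl) = ∈-count (height≥ p h) e
        from {x} (there x∈) = ∈-count (height≥ p h) (proj₂ (∧⁻ (nonzero x) (proj₂ (∈-filterᵇ⁻ (nz h) {allFin (suc n)} x∈))))
      ... | inj₂ e = inj₁ (n≤0⇒n≡0 (length-⊆ {ys = []} (count-Unique (height≥ p h)) none) ,
                           n≤0⇒n≡0 (length-⊆ {ys = []} (count-Unique (nz h)) (λ {x} x∈ → ⊥-elim (empty x (proj₂ (∧⁻ (nonzero x) (proj₂ (∈-filterᵇ⁻ (nz h) {allFin (suc n)} x∈))))))))
        where
        empty : ∀ x → height≥ p h x ≡ true → ⊥
        empty x hx = true≢false (root-highest {h} x hx) e
        none : ∀ {x} → x ∈ filterᵇ (height≥ p h) (allFin (suc n)) → x ∈ []
        none {x} x∈ = ⊥-elim (empty x (proj₂ (∈-filterᵇ⁻ (height≥ p h) {allFin (suc n)} x∈)))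

      nz≡size∸1 : ∀ h → count (nz h) ≡ size h ∸ 1
      nz≡size∸1 h with size-nz h
      ... | inj₁ (a , b) rewrite a | b = refl
      ... | inj₂ e rewrite e = refl

      size-suc : ∀ h → size (suc h) ≤ count (nz h)
      size-suc h = subst (size (suc h) ≤_) (length-map p (filterᵇ (nz h) (allFin (suc n)))) (length-⊆ (count-Unique (height≥ p (suc h))) sub)
        where
        sub : ∀ {x} → x ∈ filterᵇ (height≥ p (suc h)) (allFin (suc n)) → x ∈ map p (filterᵇ (nz h) (allFin (suc n)))
        sub {x} x∈ with height⁻ p {h} (proj₂ (∈-filterᵇ⁻ (height≥ p (suc h)) {allFin (suc n)} x∈))
        ... | y , (y≢0 , refl) , hy = ∈-map⁺ p (∈-count (nz h) (∧⁺ (nonzero⁺ y≢0) hy))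

      size-bound : ∀ h → size h ≤ suc n ∸ h
      size-bound zero = Unique⇒length≤ (count-Unique (height≥ p 0))
      size-bound (suc h) = begin
        size (suc h)    ≤⟨ size-suc h ⟩
        count (nz h)    ≡⟨ nz≡size∸1 h ⟩
        size h ∸ 1      ≤⟨ ∸-monoˡ-≤ 1 (size-bound h) ⟩
        suc n ∸ h ∸ 1   ≡⟨ ∸-+-assoc (suc n) h 1 ⟩
        suc n ∸ (h + 1) ≡⟨ cong (suc n ∸_) (+-comm h 1) ⟩
        suc n ∸ suc h   ∎
        where open ≤-Reasoning

      height-top : ∀ x → height≥ p (suc n) x ≡ false
      height-top x = ¬true⇒false λ e → 1+n≰n (begin
        1 ≤⟨ length≤count (height≥ p (suc n)) {x ∷ []} ([] ∷ []) (λ { (here refl) → e }) ⟩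
        size (suc n) ≤⟨ size-bound (suc n) ⟩
        suc n ∸ suc n ≡⟨ n∸n≡0 (suc n) ⟩
        0 ∎)
        where open ≤-Reasoning

      height-end : ∀ {h k} → k + h ≡ suc n → ∀ x → height≥ p (k + h) x ≡ false
      height-end eq x = subst (λ z → height≥ p z x ≡ false) (sym eq) (height-top x)

      length-word : ∀ {h k} → k + h ≡ suc n → length (word h k) ≡ size h ∸ 1
      length-word {h} {k} eq = trans (length-map p (order h k)) (trans (length-order (height-pred p) h k (height-end {h} {k} eq)) (nz≡size∸1 h))

      -- Together with `word⁺`: the letters of this suffix are exactly the vertices of height at
      -- least `suc h`. This is how the word remembers the heights.
      word⁻ : ∀ {h k x} → x ∈ word h k → height≥ p (suc h) x ≡ true
      word⁻ {h} {k} x∈ with ∈-map⁻ p x∈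
      ... | y , y∈ , refl with order⁻ (height-pred p) k y∈
      ...   | a , b , _ = height⁺ p {h} (a , refl) b

      word⁺ : ∀ {h k x} → k + h ≡ suc n → height≥ p (suc h) x ≡ true → x ∈ word h k
      word⁺ {h} {k} eq e with height⁻ p {h} e
      ... | y , (y≢0 , refl) , hy = ∈-map⁺ p (order⁺ (height-pred p) k y≢0 hy (height-end {h} {k} eq y))

      EndsZero : List (Fin (suc n)) → Set
      EndsZero w = w ≡ [] ⊎ ∃ λ u → w ≡ u ++ zero ∷ []

      all-zero-ends : ∀ w → (∀ {x} → x ∈ w → x ≡ zero) → EndsZero w
      all-zero-ends [] h = inj₁ refl
      all-zero-ends (x ∷ w) h with h (here refl) | all-zero-ends w (h ∘ there)
      ... | refl | inj₁ refl = inj₂ ([] , refl)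
      ... | refl | inj₂ (u , refl) = inj₂ (zero ∷ u , refl)

      -- If the later part of the word is empty, no vertex other than the root exceeds the current
      -- layer, so all parents in this layer are the root.
      word-ends : ∀ {h} k → k + h ≡ suc n → EndsZero (word h k)
      word-ends zero eq = inj₁ refl
      word-ends {h} (suc k) eq rewrite map-++ p (layer h) (order (suc h) k) with word-ends {suc h} k (trans (+-suc k h) eq)
      ... | inj₂ (u , e) = inj₂ (map p (layer h) ++ u , trans (cong (map p (layer h) ++_) e) (sym (++-assoc (map p (layer h)) _ _)))
      ... | inj₁ e = all-zero-ends _ zeros
        where
        zeros : ∀ {x} → x ∈ map p (layer h) ++ word (suc h) k → x ≡ zero
        zeros {x} x∈ with ∈-++⁻ (map p (layer h)) x∈
        ... | inj₂ x∈w with subst (x ∈_) e x∈w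
        ...   | ()
        zeros {x} x∈ | inj₁ x∈l with x ≟ zero
        ... | yes eq = eq
        ... | no x≢0 with ∈-map⁻ p x∈l
        ...   | y , y∈ , refl with layer⁻ {h} y∈
        ...     | a , b , _ with subst (p x ∈_) e (∈-map⁺ p (order⁺ (height-pred p) k x≢0 (height⁺ p {h} (a , refl) b) (height-end {suc h} {k} (trans (+-suc k h) eq) x)))
        ...       | ()

      word-suffix : ∀ {h k} → k + h ≡ suc n → drop (length (word 0 (suc n)) ∸ length (word h k)) (word 0 (suc n)) ≡ word h k
      word-suffix {h} {k} eq = trans (cong (λ z → drop (length z ∸ length (word h k)) z) split)
        (trans (cong (λ z → drop z (pre ++ word h k)) len) (drop-length-++ pre))
        where
        pre = map p (order 0 h)
        split : word 0 (suc n) ≡ pre ++ word h k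
        split = trans (cong (word 0) (trans (sym eq) (+-comm k h)))
          (trans (cong (map p) (trans (order-+ 0 h k) (cong (λ z → order 0 h ++ order z k) (+-identityʳ h)))) (map-++ p (order 0 h) (order h k)))
        len : length (pre ++ word h k) ∸ length (word h k) ≡ length pre
        len = trans (cong (_∸ length (word h k)) (length-++ pre)) (m+n∸n≡m (length pre) (length (word h k)))

  fullWord : (Fin (suc n) → Fin (suc n)) → List (Fin (suc n))
  fullWord {n} p = Word.word p 0 (suc n)

  map-≡⇒≡ : ∀ {B : Set} {f g : A → B} xs → map f xs ≡ map g xs → ∀ {x} → x ∈ xs → f x ≡ g x
  map-≡⇒≡ (x ∷ xs) eq (here refl) = ∷-injectiveˡ eq
  map-≡⇒≡ (x ∷ xs) eq (there x∈) = map-≡⇒≡ xs (∷-injectiveʳ eq) x∈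

  -- The heights are reconstructed level by level: the letters of the remaining word give the
  -- vertices of height at least `suc h`, these determine the layer of height `h`, and the length of
  -- the layer tells how many letters to remove before continuing.
  fullWord-injective : ∀ {p q : Fin (suc n) → Fin (suc n)} → Acyclic p → Acyclic q → fullWord p ≡ fullWord q → ∀ x → x ≢ zero → p x ≡ q x
  fullWord-injective {n} {p} {q} acp acq eq x x≢0 =
    map-≡⇒≡ (P.order 0 (suc n)) (trans eq (cong (map q) (sym orders))) (P.order⁺ (height-pred p) (suc n) {0} {x} x≢0 refl (P.height-end acp {0} {suc n} (+-identityʳ (suc n)) x))
    where
    module P = Word p
    module Q = Word q
    go : ∀ k h → k + h ≡ suc n → (∀ x → height≥ p h x ≡ height≥ q h x) → P.word h k ≡ Q.word h k → P.order h k ≡ Q.order h k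
    go zero h _ _ _ = refl
    go (suc k) h e same weq = cong₂ _++_ lay (go k (suc h) (trans (+-suc k h) e) next rest)
      where
      next : ∀ x → height≥ p (suc h) x ≡ height≥ q (suc h) x
      next x = iff⇒≡ (λ a → Q.word⁻ acq {h} {suc k} (subst (x ∈_) weq (P.word⁺ acp {h} {suc k} e a)))
                     (λ a → P.word⁻ acp {h} {suc k} (subst (x ∈_) (sym weq) (Q.word⁺ acq {h} {suc k} e a)))
      lay : P.layer h ≡ Q.layer h
      lay = filterᵇ-cong _ _ (allFin (suc n)) (λ x → cong₂ (λ a b → nonzero x ∧ (a ∧ not b)) (same x) (next x))
      tl : ∀ (r : Fin (suc n) → Fin (suc n)) l o → drop (length l) (map r (l ++ o)) ≡ map r o
      tl r l o = trans (cong₂ drop (sym (length-map r l)) (map-++ r l o)) (drop-length-++ (map r l))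
      rest : P.word (suc h) k ≡ Q.word (suc h) k
      rest = trans (sym (tl p (P.layer h) _)) (trans (cong₂ drop (cong length lay) weq) (tl q (Q.layer h) _))
    orders : P.order 0 (suc n) ≡ Q.order 0 (suc n)
    orders = go (suc n) 0 (+-identityʳ (suc n)) (λ _ → refl) eq

-- Level sizes read off a word, decoding, and the lower bound in Cayley's formula.

module Counting where

  open Basics
  open Trees
  open Codes
  open import Data.Bool using (Bool; true; false; _∧_; not; if_then_else_)
  open import Data.Empty using (⊥-elim)
  open import Data.Fin using (Fin; zero; suc)
  open import Data.Fin.Properties using (_≟_)
  open import Data.List using (List; []; _∷_; _++_; map; length; filterᵇ; allFin; drop; take; concatMap)
  open import Data.List.Properties using (length-map; length-++; map-++; length-drop; ∷ʳ-injectiveˡ; map-cong-local)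
  open import Data.List.Membership.Propositional using (_∈_; _∉_)
  open import Data.List.Membership.Propositional.Properties using (∈-allFin; ∈-map⁺; ∈-map⁻; ∈-++⁺ˡ; ∈-++⁺ʳ; ∈-++⁻)
  open import Data.List.Relation.Unary.Any as Any using (here; there)
  open import Data.List.Relation.Unary.AllPairs using ([]; _∷_)
  open import Data.List.Relation.Unary.All as All using ([]; _∷_)
  open import Data.List.Relation.Unary.Unique.Propositional using (Unique)
  open import Data.List.Relation.Unary.Unique.Propositional.Properties as U using (allFin⁺)
  open import Data.Nat as ℕ using (ℕ; zero; suc; _+_; _*_; _^_; _≤_; _∸_; z≤n; s≤s)
  open import Data.Nat.Properties hiding (_≟_)
  open import Data.Product using (_×_; _,_; proj₁; proj₂; ∃)
  open import Data.Sum using (_⊎_; inj₁; inj₂)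
  open import Function using (_∘_)
  open import Relation.Nullary using (yes; no)
  open import Relation.Binary.PropositionalEquality

  private variable
    A : Set
    n : ℕ

  suffix : ℕ → List A → List A
  suffix m w = drop (length w ∸ m) w

  -- In rep₀ the letter zero counts as already present after the end of the word.
  rep₀ : List (Fin (suc n)) → ℕ
  rep₀ [] = 0
  rep₀ (a ∷ v) = (if memᵇ a (zero ∷ v) then 1 else 0) + rep₀ v

  letters : List (Fin (suc n)) → List (Fin (suc n))
  letters [] = zero ∷ []
  letters (a ∷ v) = if memᵇ a (zero ∷ v) then letters v else a ∷ letters v

  letters⁻ : ∀ (v : List (Fin (suc n))) {x} → x ∈ letters v → x ∈ zero ∷ v
  letters⁻ [] h = h
  letters⁻ (a ∷ v) h with memᵇ a (zero ∷ v)
  letters⁻ (a ∷ v) h | true with letters⁻ v h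
  ... | here eq = here eq
  ... | there h′ = there (there h′)
  letters⁻ (a ∷ v) (here eq) | false = there (here eq)
  letters⁻ (a ∷ v) (there h) | false with letters⁻ v h
  ... | here eq = here eq
  ... | there h′ = there (there h′)

  letters⁺ : ∀ (v : List (Fin (suc n))) {x} → x ∈ zero ∷ v → x ∈ letters v
  letters⁺ [] h = h
  letters⁺ (a ∷ v) h with memᵇ a (zero ∷ v) in eq
  letters⁺ (a ∷ v) (here e) | true = letters⁺ v (here e)
  letters⁺ (a ∷ v) (there (here refl)) | true = letters⁺ v (memᵇ⁻ (zero ∷ v) eq)
  letters⁺ (a ∷ v) (there (there h)) | true = letters⁺ v (there h)
  letters⁺ (a ∷ v) (here e) | false = there (letters⁺ v (here e))
  letters⁺ (a ∷ v) (there (here e)) | false = here e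
  letters⁺ (a ∷ v) (there (there h)) | false = there (letters⁺ v (there h))

  letters-Unique : ∀ (v : List (Fin (suc n))) → Unique (letters v)
  letters-Unique [] = [] ∷ []
  letters-Unique (a ∷ v) with memᵇ a (zero ∷ v) in eq
  ... | true = letters-Unique v
  ... | false = cons-Unique (λ h → memᵇ-false⁻ eq (letters⁻ v h)) (letters-Unique v)

  letters-rep₀ : ∀ (v : List (Fin (suc n))) → length (letters v) + rep₀ v ≡ suc (length v)
  letters-rep₀ [] = refl
  letters-rep₀ (a ∷ v) with memᵇ a (zero ∷ v)
  ... | true = trans (+-suc _ _) (cong suc (letters-rep₀ v))
  ... | false = cong suc (letters-rep₀ v)

  -- One vertex is subtracted for the root, which contributes no letter. The suffix is shorter by
  -- another letter because `code` omits the final `zero`, which `rep₀` puts back.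
  levelSize : List (Fin (suc n)) → ℕ → ℕ
  levelSize {n} u zero = suc n
  levelSize u (suc h) = (levelSize u h ∸ 1) ∸ rep₀ (suffix (levelSize u h ∸ 2) u)

  code : (Fin (suc n) → Fin (suc n)) → List (Fin (suc n))
  code {n} p = take (n ∸ 1) (fullWord p)

  take-++-exact : ∀ (xs : List A) {ys} → take (length xs) (xs ++ ys) ≡ xs
  take-++-exact [] = refl
  take-++-exact (x ∷ xs) = cong (x ∷_) (take-++-exact xs)

  drop-++-short : ∀ k (xs : List A) {ys} → k ≤ length xs → drop k (xs ++ ys) ≡ drop k xs ++ ys
  drop-++-short zero xs _ = refl
  drop-++-short (suc k) (x ∷ xs) (s≤s le) = drop-++-short k xs le

  length-∷ʳ : ∀ (xs : List A) {x} → length (xs ++ x ∷ []) ≡ suc (length xs)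
  length-∷ʳ xs = trans (length-++ xs) (+-comm (length xs) 1)

  module _ {p : Fin (suc n) → Fin (suc n)} (ac : Acyclic p) where
    open Word p

    size-zero : size 0 ≡ suc n
    size-zero = ≤-antisym (size-bound ac 0)
      (subst (_≤ size 0) (length-allFin (suc n)) (length≤count (height≥ p 0) (allFin⁺ (suc n)) (λ _ → refl)))

    length-fullWord : length (fullWord p) ≡ n
    length-fullWord = trans (length-word ac {0} {suc n} (+-identityʳ (suc n))) (cong (_∸ 1) size-zero)

    -- The first case is the tree with a single vertex.
    fullWord-code : (fullWord p ≡ [] × code p ≡ []) ⊎ (fullWord p ≡ code p ++ zero ∷ [] × suc (length (code p)) ≡ n)
    fullWord-code with word-ends ac {0} (suc n) (+-identityʳ (suc n))
    ... | inj₁ e = inj₁ (e , trans (cong (take (n ∸ 1)) e) (take-[] (n ∸ 1)))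
      where
      take-[] : ∀ k → take k ([] {A = Fin (suc n)}) ≡ []
      take-[] zero = refl
      take-[] (suc k) = refl
    ... | inj₂ (u , e) = inj₂ (trans e (cong (_++ zero ∷ []) (sym c≡)) , trans (cong (suc ∘ length) c≡) len)
      where
      len : suc (length u) ≡ n
      len = trans (sym (length-∷ʳ u)) (trans (cong length (sym e)) length-fullWord)
      c≡ : code p ≡ u
      c≡ = trans (cong₂ take (cong (_∸ 1) (sym len)) e) (take-++-exact u)

    length-code : length (code p) ≡ n ∸ 1
    length-code with fullWord-code
    ... | inj₂ (_ , e) = cong (_∸ 1) e
    ... | inj₁ (a , b) = trans (cong length b) (cong (_∸ 1) (trans (cong length (sym a)) length-fullWord))

    -- The vertices counted on the left are the different letters of `word h k`, and that word is a
    -- suffix of the code followed by `zero`.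
    size-step : ∀ {h k} → k + h ≡ suc n → size (suc h) ≡ (size h ∸ 1) ∸ rep₀ (suffix (size h ∸ 2) (code p))
    size-step {h} {k} eq with word-ends ac {h} k eq
    ... | inj₁ e = trans (n≤0⇒n≡0 (length-⊆ {ys = []} (count-Unique (height≥ p (suc h)))
          (λ x∈ → subst (_ ∈_) e (word⁺ ac {h} {k} eq (proj₂ (∈-filterᵇ⁻ (height≥ p (suc h)) {allFin (suc n)} x∈))))))
        (sym (trans (cong (_∸ rep₀ (suffix (size h ∸ 2) (code p))) (trans (sym (length-word ac {h} {k} eq)) (cong length e))) (0∸n≡0 (rep₀ (suffix (size h ∸ 2) (code p))))))
    ... | inj₂ (v , e) = begin
      size (suc h)                          ≡⟨ length-≡ (count-Unique (height≥ p (suc h))) (letters-Unique v) to from ⟩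
      length (letters v)                    ≡⟨ m+n∸n≡m (length (letters v)) (rep₀ v) ⟨
      length (letters v) + rep₀ v ∸ rep₀ v  ≡⟨ cong (_∸ rep₀ v) (letters-rep₀ v) ⟩
      suc (length v) ∸ rep₀ v               ≡⟨ cong₂ _∸_ lv (cong rep₀ sv) ⟩
      (size h ∸ 1) ∸ rep₀ (suffix (size h ∸ 2) (code p)) ∎
      where
      open ≡-Reasoning
      lv : suc (length v) ≡ size h ∸ 1
      lv = trans (sym (length-∷ʳ v)) (trans (cong length (sym e)) (length-word ac {h} {k} eq))
      lv₂ : length v ≡ size h ∸ 2
      lv₂ = trans (cong (_∸ 1) lv) (∸-+-assoc (size h) 1 1)
      swap : ∀ {x} → x ∈ zero ∷ v → x ∈ v ++ zero ∷ []
      swap (here e) = ∈-++⁺ʳ v (here e)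
      swap (there x∈) = ∈-++⁺ˡ x∈
      swap⁻ : ∀ {x} → x ∈ v ++ zero ∷ [] → x ∈ zero ∷ v
      swap⁻ x∈ with ∈-++⁻ v x∈
      ... | inj₁ h = there h
      ... | inj₂ (here e) = here e
      to : ∀ {x} → x ∈ filterᵇ (height≥ p (suc h)) (allFin (suc n)) → x ∈ letters v
      to x∈ = letters⁺ v (swap⁻ (subst (_ ∈_) e (word⁺ ac {h} {k} eq (proj₂ (∈-filterᵇ⁻ (height≥ p (suc h)) {allFin (suc n)} x∈)))))
      from : ∀ {x} → x ∈ letters v → x ∈ filterᵇ (height≥ p (suc h)) (allFin (suc n))
      from x∈ = ∈-count (height≥ p (suc h)) (word⁻ ac {h} {k} (subst (_ ∈_) (sym e) (swap (letters⁻ v x∈))))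
      sv : v ≡ suffix (size h ∸ 2) (code p)
      sv with fullWord-code
      ... | inj₁ (a , _) = ⊥-elim (m+1+n≢0 (length v) (trans (sym (length-++ v)) (cong length (trans (sym e) (trans (sym (word-suffix ac {h} {k} eq)) (trans (cong (λ z → drop (length z ∸ length (word h k)) z) a) (drop-[]′ (0 ∸ length (word h k)))))))))
        where
        drop-[]′ : ∀ k → drop k ([] {A = Fin (suc n)}) ≡ []
        drop-[]′ zero = refl
        drop-[]′ (suc k) = refl
      ... | inj₂ (a , _) = sym (trans (cong (λ m → suffix m (code p)) (sym lv₂)) (∷ʳ-injectiveˡ _ v (begin
        drop (length (code p) ∸ length v) (code p) ++ zero ∷ []      ≡⟨ drop-++-short _ (code p) (m∸n≤m (length (code p)) (length v)) ⟨
        drop (length (code p) ∸ length v) (code p ++ zero ∷ [])      ≡⟨ cong₂ drop (sym (cong₂ _∸_ (trans (cong length a) (length-∷ʳ (code p))) (trans (cong length e) (length-∷ʳ v)))) (sym a) ⟩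
        drop (length (fullWord p) ∸ length (word h k)) (fullWord p)  ≡⟨ word-suffix ac {h} {k} eq ⟩
        word h k                                                     ≡⟨ e ⟩
        v ++ zero ∷ []                                               ∎)))

    size-levelSize : ∀ h → size h ≡ levelSize (code p) h
    size-levelSize zero = size-zero
    size-levelSize (suc h) = trans step (cong (λ s → (s ∸ 1) ∸ rep₀ (suffix (s ∸ 2) (code p))) (size-levelSize h))
      where
      step : size (suc h) ≡ (size h ∸ 1) ∸ rep₀ (suffix (size h ∸ 2) (code p))
      step with h ≤? suc n
      ... | yes h≤ = size-step {h} {suc n ∸ h} (m∸n+n≡m h≤)
      -- Beyond the greatest possible height both sides are `0`.
      ... | no h≰ = trans (n≤0⇒n≡0 (≤-trans (size-suc ac h) (≤-reflexive (trans (nz≡size∸1 ac h) (cong (_∸ 1) sz)))))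
                    (sym (trans (cong (λ s → (s ∸ 1) ∸ rep₀ (suffix (size h ∸ 2) (code p))) sz) (0∸n≡0 (rep₀ (suffix (size h ∸ 2) (code p))))))
        where
        sz : size h ≡ 0
        sz = n≤0⇒n≡0 (≤-trans (size-bound ac h) (≤-reflexive (m≤n⇒m∸n≡0 (<⇒≤ (≰⇒> h≰)))))

  code-injective : ∀ {p q : Fin (suc n) → Fin (suc n)} → Acyclic p → Acyclic q → code p ≡ code q → ∀ x → x ≢ zero → p x ≡ q x
  code-injective {n} {p} {q} acp acq eq = fullWord-injective acp acq full
    where
    full : fullWord p ≡ fullWord q
    full with fullWord-code acp | fullWord-code acq
    ... | inj₁ (a , _) | inj₁ (b , _) = trans a (sym b)
    ... | inj₂ (a , _) | inj₂ (b , _) = trans a (trans (cong (_++ zero ∷ []) eq) (sym b))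
    ... | inj₁ (a , _) | inj₂ (_ , b) = ⊥-elim (0≢1+n (trans (cong length (sym a)) (trans (length-fullWord acp) (sym b))))
    ... | inj₂ (_ , a) | inj₁ (b , _) = ⊥-elim (0≢1+n (trans (cong length (sym b)) (trans (length-fullWord acq) (sym a))))

  fullWord-cong : ∀ {p q : Fin (suc n) → Fin (suc n)} → (∀ x → x ≢ zero → p x ≡ q x) → fullWord p ≡ fullWord q
  fullWord-cong {n} {p} {q} eq =
    trans (map-cong-local (All.tabulate λ {x} x∈ → eq x (proj₁ (Layers.order⁻ (height≥ p) (height-pred p) (suc n) {0} x∈))))
          (cong (map q) (order-cong heights 0 (suc n)))
    where
    le : ∀ {p q : Fin (suc n) → Fin (suc n)} → (∀ x → x ≢ zero → p x ≡ q x) → ∀ h {x} → height≥ p h x ≡ true → height≥ q h x ≡ true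
    le eq zero e = refl
    le {p} {q} eq (suc h) e with height⁻ p {h} e
    ... | y , (y≢0 , py) , hy = height⁺ q {h} (y≢0 , trans (sym (eq y y≢0)) py) (le eq h hy)
    heights : ∀ h x → height≥ p h x ≡ height≥ q h x
    heights h x = iff⇒≡ (le eq h) (le (λ x x≢0 → sym (eq x x≢0)) h)

  assoc : List (Fin (suc n)) → List (Fin (suc n)) → Fin (suc n) → Fin (suc n)
  assoc (a ∷ as) (b ∷ bs) x = if x == a then b else assoc as bs x
  assoc _ _ x = zero

  map-assoc : ∀ (as bs : List (Fin (suc n))) → Unique as → length as ≡ length bs → map (assoc as bs) as ≡ bs
  map-assoc [] [] _ _ = refl
  map-assoc (a ∷ as) (b ∷ bs) un eq rewrite ==-refl a = cong (b ∷_)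
    (trans (map-cong-local (All.tabulate λ {x} x∈ → skip x (λ { refl → uncons∉ un x∈ }))) (map-assoc as bs (uncons-Unique un) (suc-injective eq)))
    where
    skip : ∀ x → x ≢ a → assoc (a ∷ as) (b ∷ bs) x ≡ assoc as bs x
    skip x h rewrite ≢⇒== h = refl

  module Decode {n : ℕ} (w : List (Fin (suc n))) (len : length w ≡ n) where

    -- Inverts the encoding without knowing the tree: the letters still in `rest h` are declared to
    -- be the vertices higher than `h`. This fixes the layer of height `h`, and hence the number of
    -- letters which that layer consumes.
    mutual
      χ : ℕ → Fin (suc n) → Bool
      χ zero x = true
      χ (suc h) x = memᵇ x (rest h)

      rest : ℕ → List (Fin (suc n))
      rest zero = w
      rest (suc h) = drop (length (filterᵇ (λ x → nonzero x ∧ (χ h x ∧ not (memᵇ x (rest h)))) (allFin (suc n)))) (rest h)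

    open Layers χ

    Ends : List (Fin (suc n)) → Set
    Ends w = w ≡ [] ⊎ ∃ λ u → w ≡ u ++ zero ∷ []

    drop-ends : ∀ k {w} → Ends w → Ends (drop k w)
    drop-ends zero e = e
    drop-ends (suc k) (inj₁ refl) = inj₁ refl
    drop-ends (suc k) (inj₂ ([] , refl)) = drop-ends k (inj₁ refl)
    drop-ends (suc k) (inj₂ (a ∷ u , refl)) = drop-ends k (inj₂ (u , refl))

    drop⊆ : ∀ k {w : List (Fin (suc n))} {x} → x ∈ drop k w → x ∈ w
    drop⊆ zero h = h
    drop⊆ (suc k) {a ∷ w} h = there (drop⊆ k h)

    count-nonzero : count (nz 0) ≡ n
    count-nonzero = suc-injective (trans (length-≡ (cons-Unique z∉ (count-Unique (nz 0))) (allFin⁺ (suc n)) (λ {x} _ → ∈-allFin x) from) (length-allFin (suc n)))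
      where
      z∉ : zero ∉ filterᵇ (nz 0) (allFin (suc n))
      z∉ z∈ = nonzero⁻ {n} {zero} (proj₁ (∧⁻ (nonzero {n} zero) {true} (proj₂ (∈-filterᵇ⁻ (nz 0) {allFin (suc n)} z∈)))) refl
      from : ∀ {x} → x ∈ allFin (suc n) → x ∈ zero ∷ filterᵇ (nz 0) (allFin (suc n))
      from {x} _ with x ≟ zero
      ... | yes eq = here eq
      ... | no h = there (∈-count (nz 0) (∧⁺ (nonzero⁺ h) refl))

    nz-split : ∀ h → (∀ {x} → χ (suc h) x ≡ true → χ h x ≡ true) → count (nz h) ≡ length (layer h) + count (nz (suc h))
    nz-split h mono = trans (length-≡ (count-Unique (nz h)) un to from) (length-++ (layer h))
      where
      un : Unique (layer h ++ filterᵇ (nz (suc h)) (allFin (suc n)))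
      un = U.++⁺ (count-Unique (inLayer h)) (count-Unique (nz (suc h)))
        λ { {x} (l , m) → true≢false (proj₂ (∧⁻ (nonzero x) (proj₂ (∈-filterᵇ⁻ (nz (suc h)) {allFin (suc n)} m)))) (proj₂ (proj₂ (layer⁻ {h} l))) }
      to : ∀ {x} → x ∈ filterᵇ (nz h) (allFin (suc n)) → x ∈ layer h ++ filterᵇ (nz (suc h)) (allFin (suc n))
      to {x} x∈ with ∧⁻ (nonzero x) (proj₂ (∈-filterᵇ⁻ (nz h) {allFin (suc n)} x∈)) | bool-cases (χ (suc h) x)
      ... | a , b | inj₁ e = ∈-++⁺ʳ (layer h) (∈-count (nz (suc h)) (∧⁺ a e))
      ... | a , b | inj₂ e = ∈-++⁺ˡ (layer⁺ {h} (nonzero⁻ a) b e)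
      from : ∀ {x} → x ∈ layer h ++ filterᵇ (nz (suc h)) (allFin (suc n)) → x ∈ filterᵇ (nz h) (allFin (suc n))
      from {x} x∈ with ∈-++⁻ (layer h) x∈
      ... | inj₁ l = ∈-count (nz h) (∧⁺ (nonzero⁺ (proj₁ (layer⁻ {h} l))) (proj₁ (proj₂ (layer⁻ {h} l))))
      ... | inj₂ m with ∧⁻ (nonzero x) (proj₂ (∈-filterᵇ⁻ (nz (suc h)) {allFin (suc n)} m))
      ...   | a , b = ∈-count (nz h) (∧⁺ a (mono b))

    module _ (ends : Ends w) where

      -- There always remain as many letters as there are vertices still waiting for a parent.
      invariant : ∀ h → length (rest h) ≡ count (nz h) × (∀ {x} → x ∈ rest h → χ h x ≡ true) × Ends (rest h)
      invariant zero = trans len (sym count-nonzero) , (λ _ → refl) , ends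
      invariant (suc h) with invariant h
      ... | l , sub , e = trans (length-drop (length (layer h)) (rest h)) (trans (cong (_∸ length (layer h)) (trans l (nz-split h (λ c → sub (memᵇ⁻ (rest h) c)))))
                            (m+n∸m≡n (length (layer h)) (count (nz (suc h)))))
                        , (λ x∈ → memᵇ⁺ (drop⊆ (length (layer h)) x∈)) , drop-ends (length (layer h)) e

      χ-mono : ∀ h {x} → χ (suc h) x ≡ true → χ h x ≡ true
      χ-mono h e = proj₁ (proj₂ (invariant h)) (memᵇ⁻ (rest h) e)

      -- Why decoding terminates: the final letter is `zero`, so the remaining letters contain at
      -- least one vertex fewer than there are positions.
      shrink : ∀ h → count (nz (suc h)) ≤ count (nz h) ∸ 1
      shrink h with proj₂ (proj₂ (invariant h))
      ... | inj₁ e = ≤-trans (length-⊆ {ys = []} (count-Unique (nz (suc h))) sub) z≤n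
        where
        sub : ∀ {x} → x ∈ filterᵇ (nz (suc h)) (allFin (suc n)) → x ∈ []
        sub {x} x∈ = subst (x ∈_) e (memᵇ⁻ (rest h) (proj₂ (∧⁻ (nonzero x) (proj₂ (∈-filterᵇ⁻ (nz (suc h)) {allFin (suc n)} x∈)))))
      ... | inj₂ (u , e) = subst (count (nz (suc h)) ≤_) (cong (_∸ 1) (trans (sym (length-∷ʳ u)) (trans (cong length (sym e)) (proj₁ (invariant h)))))
                             (length-⊆ (count-Unique (nz (suc h))) sub)
        where
        sub : ∀ {x} → x ∈ filterᵇ (nz (suc h)) (allFin (suc n)) → x ∈ u
        sub {x} x∈ with ∧⁻ (nonzero x) (proj₂ (∈-filterᵇ⁻ (nz (suc h)) {allFin (suc n)} x∈))
        ... | a , b with ∈-++⁻ u (subst (x ∈_) e (memᵇ⁻ (rest h) b))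
        ...   | inj₁ x∈u = x∈u
        ...   | inj₂ (here eq) = ⊥-elim (nonzero⁻ a eq)

      nz-bound : ∀ h → count (nz h) ≤ n ∸ h
      nz-bound zero = ≤-reflexive count-nonzero
      nz-bound (suc h) = ≤-trans (shrink h) (≤-trans (∸-monoˡ-≤ 1 (nz-bound h)) (≤-reflexive (trans (∸-+-assoc n h 1) (cong (n ∸_) (+-comm h 1)))))

      rest-end : rest n ≡ []
      rest-end with rest n | proj₁ (invariant n)
      ... | [] | _ = refl
      ... | x ∷ r | e = ⊥-elim (1+n≰n {0} (≤-trans (s≤s z≤n) (≤-trans (≤-reflexive e) (≤-trans (nz-bound n) (≤-reflexive (n∸n≡0 n))))))

      χ-top : ∀ x → χ (suc n) x ≡ false
      χ-top x rewrite rest-end = refl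

      χ-end : ∀ {h k} → k + h ≡ suc n → ∀ x → χ (k + h) x ≡ false
      χ-end eq x = subst (λ z → χ z x ≡ false) (sym eq) (χ-top x)

      ord : List (Fin (suc n))
      ord = order 0 (suc n)

      p : Fin (suc n) → Fin (suc n)
      p = assoc ord w

      rest-order : ∀ h k → k + h ≡ suc n → map p (order h k) ≡ rest h
      rest-order zero k eq rewrite trans (sym (+-identityʳ k)) eq =
        map-assoc ord w (order-Unique χ-mono 0 (suc n)) (trans (length-order χ-mono 0 (suc n) (χ-end {0} {suc n} (+-identityʳ (suc n)))) (trans count-nonzero (sym len)))
      rest-order (suc h) k eq = trans (sym (trans (cong₂ drop (sym (length-map p (layer h))) (map-++ p (layer h) (order (suc h) k))) (drop-length-++ (map p (layer h)))))
        (cong (drop (length (layer h))) (rest-order h (suc k) (trans (sym (+-suc k h)) eq)))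

      -- The sets guessed from the word are the true heights of the decoded function. Hence `order`
      -- is its height order, and encoding it again returns the word.
      heights-low : ∀ h k → k + h ≡ suc n → ∀ x → height≥ p h x ≡ χ h x
      heights-low zero k eq x = refl
      heights-low (suc h) k eq x = iff⇒≡ to from
        where
        eq′ = trans (sym (+-suc k h)) eq
        to : height≥ p (suc h) x ≡ true → χ (suc h) x ≡ true
        to e with height⁻ p {h} e
        ... | y , (y≢0 , py) , hy = memᵇ⁺ (subst (x ∈_) (rest-order h (suc k) eq′) (subst (_∈ map p (order h (suc k))) py
          (∈-map⁺ p (order⁺ χ-mono (suc k) {h} y≢0 (trans (sym (heights-low h (suc k) eq′ y)) hy) (χ-end {h} {suc k} eq′ y)))))
        from : χ (suc h) x ≡ true → height≥ p (suc h) x ≡ true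
        from e with ∈-map⁻ p (subst (x ∈_) (sym (rest-order h (suc k) eq′)) (memᵇ⁻ (rest h) e))
        ... | y , y∈ , refl with order⁻ χ-mono (suc k) {h} y∈
        ...   | y≢0 , c , _ = height⁺ p {h} (y≢0 , refl) (trans (heights-low h (suc k) eq′ y) c)

      p-acyclic : Acyclic p
      p-acyclic = suc n , λ x → trans (heights-low (suc n) 0 refl x) (χ-top x)

      heights : ∀ h x → height≥ p h x ≡ χ h x
      heights h x with h ≤? suc n
      ... | yes h≤ = heights-low h (suc n ∸ h) (m∸n+n≡m h≤) x
      ... | no h≰ = trans (¬true⇒false (λ e → true≢false (height-mono p (h ∸ suc n) (subst (λ z → height≥ p z x ≡ true) (sym hn) e)) (proj₂ p-acyclic x)))
                      (sym (¬true⇒false (λ e → true≢false (mono* χ-mono (h ∸ suc n) (subst (λ z → χ z x ≡ true) (sym hn) e)) (χ-top x))))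
        where
        hn : h ∸ suc n + suc n ≡ h
        hn = m∸n+n≡m (<⇒≤ (≰⇒> h≰))

      fullWord-p : fullWord p ≡ w
      fullWord-p = trans (cong (map p) (order-cong heights 0 (suc n))) (rest-order 0 (suc n) (+-identityʳ (suc n)))

  decode : ∀ (u : List (Fin (suc n))) → suc (length u) ≡ n → ∃ λ p → Acyclic p × code p ≡ u
  decode {n} u len = D.p e , D.p-acyclic e ,
    trans (cong (take (n ∸ 1)) (D.fullWord-p e)) (trans (cong (λ k → take (k ∸ 1) (u ++ zero ∷ [])) (sym len)) (take-++-exact u))
    where
    module D = Decode (u ++ zero ∷ []) (trans (length-∷ʳ u) len)
    e : D.Ends (u ++ zero ∷ [])
    e = inj₂ (u , refl)

  length-listsOfLength : ∀ (xs : List A) m → length (listsOfLength xs m) ≡ length xs ^ m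
  length-listsOfLength {A} xs zero = refl
  length-listsOfLength {A} xs (suc m) = go xs
    where
    go : ∀ ys → length (concatMap (λ x → map (x ∷_) (listsOfLength xs m)) ys) ≡ length ys * length xs ^ m
    go [] = refl
    go (y ∷ ys) = trans (length-++ (map (y ∷_) (listsOfLength xs m))) (cong₂ _+_ (trans (length-map (y ∷_) (listsOfLength xs m)) (length-listsOfLength xs m)) (go ys))

  treeCode : Graph (suc n) → List (Fin (suc n))
  treeCode G = code (parent G)

  -- Injectivity of the code gives only an inequality. Together with `trees-lower` it bounds
  -- averages over trees by averages over uniform words, since `F` is nonnegative; no bijection
  -- between the two lists has to be constructed.
  sum-treeCode : ∀ (F : List (Fin (suc n)) → ℕ) →
    sumOver (F ∘ treeCode) (trees (suc n)) ≤ sumOver F (listsOfLength (allFin (suc n)) (n ∸ 1))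
  sum-treeCode {n} F = sumOver-inject F treeCode (trees-Unique (suc n))
    (λ {G} {G′} G∈ G′∈ eq → graph-determined (proj₁ (trees⁻ G∈)) (proj₁ (trees⁻ G′∈)) (parent-ParentOf G∈) (parent-ParentOf G′∈)
      (code-injective (ParentOf.noCycle (parent-ParentOf G∈)) (ParentOf.noCycle (parent-ParentOf G′∈)) eq))
    (λ {G} G∈ → subst (λ m → treeCode G ∈ listsOfLength (allFin (suc n)) m) (length-code (ParentOf.noCycle (parent-ParentOf G∈)))
      (listsOfLength⁺ (allFin (suc n)) (treeCode G) (λ {y} _ → ∈-allFin y)))

  -- The value `[]` at words of a wrong length only makes the function total.
  decodedGraph : List (Fin (suc n)) → Graph (suc n)
  decodedGraph {n} u with suc (length u) ℕ.≟ n
  ... | yes e = parentGraph (proj₁ (decode u e))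
  ... | no _ = []

  decodedGraph-spec : ∀ (u : List (Fin (suc n))) → suc (length u) ≡ n →
    ∃ λ p → Acyclic p × code p ≡ u × decodedGraph u ≡ parentGraph p
  decodedGraph-spec {n} u e with suc (length u) ℕ.≟ n
  ... | yes e′ = proj₁ (decode u e′) , proj₁ (proj₂ (decode u e′)) , proj₂ (proj₂ (decode u e′)) , refl
  ... | no h = ⊥-elim (h e)

  -- The graph determines its parent function off `zero`, and a word never reads the value at
  -- `zero`.
  decodedGraph-injective : ∀ {u v : List (Fin (suc n))} → suc (length u) ≡ n → suc (length v) ≡ n →
    decodedGraph u ≡ decodedGraph v → u ≡ v
  decodedGraph-injective {n} {u} {v} e e′ eq =
    let (p , acp , cp , gp) = decodedGraph-spec u e
        (q , acq , cq , gq) = decodedGraph-spec v e′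
        same = parent-unique (subst (λ G → ParentOf G p) (trans (sym gp) (trans eq gq)) (parentGraph-parent p acp)) (parentGraph-parent q acq)
    in trans (sym cp) (trans (cong (take (n ∸ 1)) (fullWord-cong same)) cq)

  -- With t for `suc n`, this is the bound t^(t-2), one half of Cayley's formula.
  trees-lower : 1 ≤ n → suc n ^ (n ∸ 1) ≤ length (trees (suc n))
  trees-lower {n} 1≤n = subst (_≤ length (trees (suc n))) len
    (length-inject decodedGraph (listsOfLength-Unique (allFin⁺ (suc n)) (n ∸ 1))
      (λ u∈ v∈ → decodedGraph-injective (size u∈) (size v∈))
      (λ {u} u∈ → let (p , ac , _ , eq) = decodedGraph-spec u (size u∈) in subst (_∈ trees (suc n)) (sym eq) (parentGraph∈trees p ac)))
    where
    len : length (listsOfLength (allFin (suc n)) (n ∸ 1)) ≡ suc n ^ (n ∸ 1)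
    len = trans (length-listsOfLength (allFin (suc n)) (n ∸ 1)) (cong (_^ (n ∸ 1)) (length-allFin (suc n)))
    size : ∀ {u} → u ∈ listsOfLength (allFin (suc n)) (n ∸ 1) → suc (length u) ≡ n
    size u∈ = trans (cong suc (listsOfLength-length (allFin (suc n)) (n ∸ 1) u∈)) (m+[n∸m]≡n 1≤n)

-- Path systems: stability under changes of parents, and comparison with level sizes.

module Covers where

  open Basics
  open Trees
  open Codes
  open import Data.Bool using (Bool; true; false; _∧_; not; if_then_else_)
  open import Data.Bool.Properties using (T-≡)
  open import Data.Empty using (⊥-elim)
  open import Data.Fin using (Fin; zero; suc)
  open import Data.Fin.Properties using (_≟_)
  open import Data.List using (List; []; _∷_; _++_; map; length; filterᵇ; allFin; concat; concatMap)
  open import Data.List.Properties using (length-++; concat-++; ≡-dec)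
  open import Data.List.Membership.Propositional using (_∈_; _∉_)
  open import Data.List.Membership.DecPropositional using (_∈?_)
  open import Data.List.Membership.Propositional.Properties using (∈-map⁻; ∈-++⁺ˡ; ∈-++⁺ʳ; ∈-++⁻; ∈-concat⁺′; ∈-concat⁻′)
  open import Data.List.Relation.Binary.Disjoint.Propositional using (Disjoint)
  open import Data.List.Relation.Unary.Any as Any using (here; there)
  open import Data.List.Relation.Unary.AllPairs using (AllPairs; []; _∷_)
  open import Data.List.Relation.Unary.All as All using (All; []; _∷_)
  open import Data.List.Relation.Unary.Linked as Linked using (Linked; []; [-]; _∷_)
  open import Data.List.Relation.Unary.Unique.Propositional using (Unique)
  import Data.List.Relation.Unary.Unique.Propositional.Properties as U
  open import Data.Nat as ℕ using (ℕ; zero; suc; _+_; _*_; _≤_; _<_; _∸_; z≤n; s≤s; _≤ᵇ_)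
  open import Data.Nat.Properties hiding (_≟_)
  open import Data.Nat.Tactic.RingSolver using (solve-∀)
  open import Data.Product using (_×_; _,_; proj₁; proj₂; ∃)
  open import Data.Sum using (_⊎_; inj₁; inj₂)
  open import Function using (_∘_; Equivalence)
  open import Relation.Nullary using (yes; does)
  open import Relation.Nullary.Decidable using (dec-true)
  open import Relation.Binary.PropositionalEquality

  private variable
    A B : Set
    n t : ℕ

  maximum-≥ : ∀ (f : A → ℕ) {x} xs → x ∈ xs → f x ≤ maximum (map f xs)
  maximum-≥ f (x ∷ xs) (here refl) = m≤m⊔n (f x) _
  maximum-≥ f (x ∷ xs) (there x∈) = ≤-trans (maximum-≥ f xs x∈) (m≤n⊔m (f x) _)

  maximum-attained : ∀ (f : A → ℕ) xs → maximum (map f xs) ≡ 0 ⊎ ∃ λ x → x ∈ xs × maximum (map f xs) ≡ f x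
  maximum-attained f [] = inj₁ refl
  maximum-attained f (x ∷ xs) with ⊔-sel (f x) (maximum (map f xs)) | maximum-attained f xs
  ... | inj₁ e | _ = inj₂ (x , here refl , e)
  ... | inj₂ e | inj₁ e′ = inj₁ (trans e e′)
  ... | inj₂ e | inj₂ (y , y∈ , e′) = inj₂ (y , there y∈ , trans e e′)

  Unique⇒AllPairs : ∀ {R : A → A → Set} {xs} → Unique xs → (∀ {x y} → x ∈ xs → y ∈ xs → x ≢ y → R x y) → AllPairs R xs
  Unique⇒AllPairs {xs = []} u h = []
  Unique⇒AllPairs {xs = x ∷ xs} u h =
    All.tabulate (λ {y} y∈ → h (here refl) (there y∈) (λ { refl → uncons∉ u y∈ })) ∷ Unique⇒AllPairs (uncons-Unique u) (λ a b → h (there a) (there b))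

  ++-Unique⁻ : ∀ (xs : List A) {ys} → Unique (xs ++ ys) → Unique xs × Unique ys × (∀ {x} → x ∈ xs → x ∉ ys)
  ++-Unique⁻ [] u = [] , u , λ ()
  ++-Unique⁻ (x ∷ xs) u with ++-Unique⁻ xs (uncons-Unique u)
  ... | a , b , d = cons-Unique (uncons∉ u ∘ ∈-++⁺ˡ) a , b , λ { (here refl) y∈ → uncons∉ u (∈-++⁺ʳ xs y∈) ; (there x∈) → d x∈ }

  concat-disjoint : ∀ {S : List (List A)} → Unique (concat S) → ∀ {P Q x} → P ∈ S → Q ∈ S → P ≢ Q → x ∈ P → x ∉ Q
  concat-disjoint u (here refl) (here refl) P≢Q _ _ = P≢Q refl
  concat-disjoint {S = P ∷ S} u (here refl) (there Q∈) _ x∈P x∈Q = proj₂ (proj₂ (++-Unique⁻ P u)) x∈P (∈-concat⁺′ x∈Q Q∈)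
  concat-disjoint {S = Q ∷ S} u (there P∈) (here refl) _ x∈P x∈Q = proj₂ (proj₂ (++-Unique⁻ Q u)) x∈Q (∈-concat⁺′ x∈P P∈)
  concat-disjoint {S = P ∷ S} u (there P∈) (there Q∈) P≢Q = concat-disjoint (proj₁ (proj₂ (++-Unique⁻ P u))) P∈ Q∈ P≢Q

  filterᵇ-concat-Unique : ∀ (χ : List A → Bool) {S} → Unique (concat S) → Unique (concat (filterᵇ χ S))
  filterᵇ-concat-Unique χ {[]} u = u
  filterᵇ-concat-Unique {A} χ {P ∷ S} u with ++-Unique⁻ P u | χ P
  ... | a , b , d | false = filterᵇ-concat-Unique χ {S} b
  ... | a , b , d | true = U.++⁺ a (filterᵇ-concat-Unique χ {S} b) λ (x∈P , x∈S) → d x∈P (sub x∈S)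
    where
    sub : ∀ {x} → x ∈ concat (filterᵇ χ S) → x ∈ concat S
    sub x∈ with ∈-concat⁻′ (filterᵇ χ S) x∈
    ... | Q , x∈Q , Q∈ = ∈-concat⁺′ x∈Q (proj₁ (∈-filterᵇ⁻ χ {S} Q∈))

  record LongPath (ℓ : ℕ) (G : Graph t) (P : List (Fin t)) : Set where
    field
      unique : Unique P
      linked : Linked (Adj G) P
      long : ℓ < length P

  record System (ℓ : ℕ) (G : Graph t) (S : List (List (Fin t))) : Set where
    field
      paths : ∀ {P} → P ∈ S → LongPath ℓ G P
      disjoint : Unique (concat S)

  isLong : ℕ → Graph t → List (Fin t) → Bool
  isLong ℓ G P = isPath G P ∧ (ℓ ≤ᵇ pathLength P)

  longPath⁺ : ∀ {ℓ} {G : Graph t} {P} → LongPath ℓ G P → isLong ℓ G P ≡ true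
  longPath⁺ {P = []} L with LongPath.long L
  ... | ()
  longPath⁺ {ℓ = ℓ} {P = x ∷ P} L with LongPath.long L
  ... | s≤s le = ∧⁺ (isPath⁺ (LongPath.unique L) (LongPath.linked L)) (Equivalence.to T-≡ (≤⇒≤ᵇ le))

  longPath⁻ : ∀ ℓ (G : Graph t) P → isLong ℓ G P ≡ true → LongPath ℓ G P
  longPath⁻ ℓ G (x ∷ P) e with ∧⁻ (isPath G (x ∷ P)) e
  ... | a , b with isPath⁻ G (x ∷ P) a
  ...   | u , l = record { unique = u ; linked = l ; long = s≤s (≤ᵇ⇒≤ ℓ (length P) (Equivalence.from T-≡ b)) }

  cov-attained : ∀ ℓ (G : Graph t) → ∃ λ S → System ℓ G S × cov ℓ G ≡ length (concat S)
  cov-attained {t} ℓ G with maximum-attained (λ S → length (concat S)) (pathSystems ℓ G)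
  ... | inj₁ e = [] , record { paths = λ () ; disjoint = [] } , e
  ... | inj₂ (S , S∈ , e) with ∈-filterᵇ⁻ (λ S → distinct (concat S)) {sublists (longPaths ℓ G)} S∈
  ...   | s , d = S , record { paths = λ {P} P∈ → longPath⁻ ℓ G P (proj₂ (∈-filterᵇ⁻ (isLong ℓ G) {vertexSeqs t} (sublists⁻ (longPaths ℓ G) s P∈)))
                             ; disjoint = distinct⁻ (concat S) d } , e

  -- A system need not list its paths in the order of `longPaths`. It is replaced by those entries
  -- of `longPaths` that belong to `S`; they cover the same vertices.
  cov-≥ : ∀ {ℓ} {G : Graph t} {S} → System ℓ G S → length (concat S) ≤ cov ℓ G
  cov-≥ {t} {ℓ} {G} {S} sys = ≤-trans (length-⊆ (System.disjoint sys) sub)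
    (maximum-≥ (λ S → length (concat S)) (pathSystems ℓ G)
      (∈-filterᵇ⁺ (λ S → distinct (concat S)) (filterᵇ∈sublists member (longPaths ℓ G)) (distinct⁺ un)))
    where
    member : List (Fin t) → Bool
    member P = does (_∈?_ (≡-dec _≟_) P S)
    member⁻ : ∀ {P} → member P ≡ true → P ∈ S
    member⁻ {P} e with _∈?_ (≡-dec _≟_) P S
    ... | yes P∈ = P∈
    S′ = filterᵇ member (longPaths ℓ G)
    in-S : ∀ {P} → P ∈ S′ → P ∈ S
    in-S P∈ = member⁻ (proj₂ (∈-filterᵇ⁻ member {longPaths ℓ G} P∈))
    un : Unique (concat S′)
    un = U.concat⁺ (All.tabulate (λ P∈ → LongPath.unique (System.paths sys (in-S P∈))))
      (Unique⇒AllPairs (filterᵇ-Unique member {longPaths ℓ G} (filterᵇ-Unique (isLong ℓ G) {vertexSeqs t} (vertexSeqs-Unique t)))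
        (λ P∈ Q∈ P≢Q (a , b) → concat-disjoint (System.disjoint sys) (in-S P∈) (in-S Q∈) P≢Q a b))
    sub : ∀ {x} → x ∈ concat S → x ∈ concat S′
    sub x∈ with ∈-concat⁻′ S x∈
    ... | P , x∈P , P∈ = ∈-concat⁺′ x∈P (∈-filterᵇ⁺ member
      (∈-filterᵇ⁺ (isLong ℓ G) (vertexSeqs⁺ (LongPath.unique (System.paths sys P∈))) (longPath⁺ (System.paths sys P∈)))
      (dec-true (_∈?_ (≡-dec _≟_) P S) P∈))

  cov-≤ : ∀ ℓ (G : Graph t) → cov ℓ G ≤ t
  cov-≤ ℓ G with cov-attained ℓ G
  ... | S , sys , e = subst (_≤ _) (sym e) (Unique⇒length≤ (System.disjoint sys))

  filterᵇ-++ : ∀ (χ : A → Bool) xs ys → filterᵇ χ (xs ++ ys) ≡ filterᵇ χ xs ++ filterᵇ χ ys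
  filterᵇ-++ χ [] ys = refl
  filterᵇ-++ χ (x ∷ xs) ys with χ x
  ... | true = cong (x ∷_) (filterᵇ-++ χ xs ys)
  ... | false = filterᵇ-++ χ xs ys

  module _ {A : Set} (good : A → Bool) where

    splitFirst : List A → List A
    splitFirst [] = []
    splitFirst (x ∷ xs) = if good x then x ∷ splitFirst xs else []

    splitRest : List A → List (List A)
    splitRest [] = []
    splitRest (x ∷ xs) = if good x then splitRest xs else splitFirst xs ∷ splitRest xs

    -- Maximal runs of good vertices, possibly empty: k bad vertices leave exactly k + 1 of them.
    segments : List A → List (List A)
    segments P = splitFirst P ∷ splitRest P

    concat-segments : ∀ P → concat (segments P) ≡ filterᵇ good P
    concat-segments [] = refl
    concat-segments (x ∷ P) with good x
    ... | true = cong (x ∷_) (concat-segments P)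
    ... | false = concat-segments P

    length-splitRest : ∀ P → length (splitRest P) ≡ length (filterᵇ (not ∘ good) P)
    length-splitRest [] = refl
    length-splitRest (x ∷ P) with good x
    ... | true = length-splitRest P
    ... | false = cong suc (length-splitRest P)

    module _ {R Q : A → A → Set} (R⇒Q : ∀ {x y} → R x y → good x ≡ true → good y ≡ true → Q x y) where

      splitFirst-linked : ∀ {P} → Linked R P → Linked Q (splitFirst P)
      splitFirst-linked [] = []
      splitFirst-linked {x ∷ []} [-] with good x
      ... | true = [-]
      ... | false = []
      splitFirst-linked {x ∷ y ∷ P} (r ∷ l) with good x in gx | good y in gy | splitFirst-linked l
      ... | false | _ | _ = []
      ... | true | true | l′ = R⇒Q r gx gy ∷ l′
      ... | true | false | l′ = [-]

      segments-linked : ∀ {P} → Linked R P → ∀ {T} → T ∈ segments P → Linked Q T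
      segments-linked l (here refl) = splitFirst-linked l
      segments-linked {x ∷ P} l (there T∈) with good x
      ... | true = segments-linked (Linked.tail l) (there T∈)
      ... | false = segments-linked (Linked.tail l) T∈

    longSegments : ℕ → List A → List (List A)
    longSegments ℓ P = filterᵇ (λ T → suc ℓ ≤ᵇ length T) (segments P)

    drop-short : ∀ ℓ (S : List (List A)) → length (concat S) ≤ length (concat (filterᵇ (λ T → suc ℓ ≤ᵇ length T) S)) + length S * ℓ
    drop-short ℓ [] = z≤n
    drop-short ℓ (T ∷ S) with suc ℓ ≤ᵇ length T in e
    ... | true = begin
      length (T ++ concat S)                    ≡⟨ length-++ T ⟩
      length T + length (concat S)              ≤⟨ +-monoʳ-≤ (length T) (≤-trans (drop-short ℓ S) (+-monoʳ-≤ (length K) (m≤n+m _ ℓ))) ⟩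
      length T + (length K + (ℓ + length S * ℓ)) ≡⟨ +-assoc (length T) _ _ ⟨
      length T + length K + (ℓ + length S * ℓ)  ≡⟨ cong (_+ (ℓ + length S * ℓ)) (length-++ T) ⟨
      length (T ++ K) + (ℓ + length S * ℓ)      ∎
      where
      open ≤-Reasoning
      K = concat (filterᵇ (λ T → suc ℓ ≤ᵇ length T) S)
    ... | false = begin
      length (T ++ concat S)                    ≡⟨ length-++ T ⟩
      length T + length (concat S)              ≤⟨ +-mono-≤ short (drop-short ℓ S) ⟩
      ℓ + (length K + length S * ℓ)             ≡⟨ (λ a b c → trans (sym (+-assoc a b c)) (trans (cong (_+ c) (+-comm a b)) (+-assoc b a c))) ℓ (length K) (length S * ℓ) ⟩
      length K + (ℓ + length S * ℓ)             ∎
      where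
      open ≤-Reasoning
      K = concat (filterᵇ (λ T → suc ℓ ≤ᵇ length T) S)
      short : length T ≤ ℓ
      short = ≮⇒≥ λ lt → true≢false (Equivalence.to T-≡ (≤⇒≤ᵇ lt)) e

    -- A path without bad vertices survives whole. For k ≥ 1 bad vertices one loses these and at
    -- most ℓ vertices in each of k + 1 short runs, and (k + 1)ℓ + k ≤ 3ℓk.
    longSegments-length : ∀ ℓ P → 1 ≤ ℓ → ℓ < length P →
      length P ≤ length (concat (longSegments ℓ P)) + 3 * ℓ * length (filterᵇ (not ∘ good) P)
    longSegments-length ℓ P 1≤ℓ lt with length (filterᵇ (not ∘ good) P) in eq
    ... | zero = ≤-trans (≤-reflexive (trans (sym (++-[] P)) (cong (length ∘ concat) (sym (keep P eq lt))))) (m≤m+n _ _)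
      where
      ++-[] : ∀ (xs : List A) → length (xs ++ []) ≡ length xs
      ++-[] xs = trans (length-++ xs) (+-identityʳ _)
      all-good : ∀ P → length (filterᵇ (not ∘ good) P) ≡ 0 → segments P ≡ P ∷ []
      all-good [] _ = refl
      all-good (x ∷ P) e with good x
      ... | true = cong₂ (λ a b → (x ∷ a) ∷ b) (cong (λ { [] → [] ; (a ∷ _) → a }) (all-good P e)) (cong (λ { [] → [] ; (_ ∷ b) → b }) (all-good P e))
      keep : ∀ P → length (filterᵇ (not ∘ good) P) ≡ 0 → ℓ < length P → longSegments ℓ P ≡ P ∷ []
      keep P e lt = trans (cong (filterᵇ (λ T → suc ℓ ≤ᵇ length T)) (all-good P e)) (filterᵇ-true (λ T → suc ℓ ≤ᵇ length T) [] (Equivalence.to T-≡ (≤⇒≤ᵇ lt)))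
    ... | suc k = begin
      length P                                                          ≡⟨ length-split good P ⟨
      length (filterᵇ good P) + length (filterᵇ (not ∘ good) P)         ≡⟨ cong₂ _+_ (cong length (sym (concat-segments P))) eq ⟩
      length (concat (segments P)) + suc k                              ≤⟨ +-monoˡ-≤ (suc k) (drop-short ℓ (segments P)) ⟩
      length L + length (segments P) * ℓ + suc k                        ≡⟨ cong (λ z → length L + suc z * ℓ + suc k) (trans (length-splitRest P) eq) ⟩
      length L + suc (suc k) * ℓ + suc k                                ≡⟨ +-assoc (length L) _ _ ⟩
      length L + (suc (suc k) * ℓ + suc k)                              ≤⟨ +-monoʳ-≤ (length L) (arith ℓ k 1≤ℓ) ⟩
      length L + 3 * ℓ * suc k                                          ∎
      where
      open ≤-Reasoning
      L = concat (longSegments ℓ P)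
      arith : ∀ ℓ k → 1 ≤ ℓ → suc (suc k) * ℓ + suc k ≤ 3 * ℓ * suc k
      arith (suc m) k _ = subst (suc (suc k) * suc m + suc k ≤_) (sym (ring m k)) (m≤m+n _ _)
        where
        ring : ∀ m k → 3 * suc m * suc k ≡ (suc (suc k) * suc m + suc k) + (m + k + 2 * m * k)
        ring = solve-∀

  module _ {G G′ : Graph (suc n)} {p q : Fin (suc n) → Fin (suc n)} (P : ParentOf G p) (Q : ParentOf G′ q) where

    changed : Fin (suc n) → Bool
    changed x = not (p x == q x)

    private
      good : Fin (suc n) → Bool
      good x = p x == q x

      -- An edge is recorded in the parent of its lower end, so it persists if neither end is
      -- changed.
      keeps-edge : ∀ {x y} → Adj G x y → good x ≡ true → good y ≡ true → Adj G′ x y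
      keeps-edge {x} {y} a gx gy with ParentOf.adj⇒edge P a
      ... | inj₁ (h , e) = ParentOf.edge⇒adj Q (inj₁ (h , trans (sym (==⇒≡ (p x) (q x) gx)) e))
      ... | inj₂ (h , e) = ParentOf.edge⇒adj Q (inj₂ (h , trans (sym (==⇒≡ (p y) (q y) gy)) e))

      concat-concatMap : ∀ S → concat (concatMap (segments good) S) ≡ filterᵇ good (concat S)
      concat-concatMap [] = refl
      concat-concatMap (T ∷ S) = trans (sym (concat-++ (segments good T) _))
        (trans (cong₂ _++_ (concat-segments good T) (concat-concatMap S)) (sym (filterᵇ-++ good T (concat S))))

    -- Only changes at vertices of the given system count. This one-sided form turns an optimal
    -- system into a certificate consisting of as many coordinates as it covers vertices.
    cov-lipschitz : ∀ {ℓ S} → 1 ≤ ℓ → System ℓ G S →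
      length (concat S) ≤ cov ℓ G′ + 3 * ℓ * length (filterᵇ changed (concat S))
    cov-lipschitz {ℓ} {S} 1≤ℓ sys = ≤-trans (total S (λ P∈ → LongPath.long (System.paths sys P∈))) (+-monoˡ-≤ _ (cov-≥ sys′))
      where
      isL : List (Fin (suc n)) → Bool
      isL T = suc ℓ ≤ᵇ length T
      kept : List (List (Fin (suc n))) → List (List (Fin (suc n)))
      kept S = filterᵇ isL (concatMap (segments good) S)
      total : ∀ S → (∀ {T} → T ∈ S → ℓ < length T) → length (concat S) ≤ length (concat (kept S)) + 3 * ℓ * length (filterᵇ changed (concat S))
      total [] _ = z≤n
      total (T ∷ S) long = begin
        length (T ++ concat S)                                     ≡⟨ length-++ T ⟩
        length T + length (concat S)                               ≤⟨ +-mono-≤ (longSegments-length good ℓ T 1≤ℓ (long (here refl))) (total S (long ∘ there)) ⟩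
        (a + 3 * ℓ * b) + (c + 3 * ℓ * d)                          ≡⟨ ring a b c d ℓ ⟩
        (a + c) + 3 * ℓ * (b + d)                                  ≡⟨ cong₂ (λ x y → x + 3 * ℓ * y) (sym (trans (cong length e₁) (length-++ (concat (longSegments good ℓ T)))))
                                                                        (sym (trans (cong length (filterᵇ-++ changed T (concat S))) (length-++ (filterᵇ changed T)))) ⟩
        length (concat (kept (T ∷ S))) + 3 * ℓ * length (filterᵇ changed (T ++ concat S)) ∎
        where
        open ≤-Reasoning
        a = length (concat (longSegments good ℓ T))
        b = length (filterᵇ changed T)
        c = length (concat (kept S))
        d = length (filterᵇ changed (concat S))
        ring : ∀ a b c d ℓ → (a + 3 * ℓ * b) + (c + 3 * ℓ * d) ≡ (a + c) + 3 * ℓ * (b + d)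
        ring = solve-∀
        e₁ : concat (kept (T ∷ S)) ≡ concat (longSegments good ℓ T) ++ concat (kept S)
        e₁ = trans (cong concat (filterᵇ-++ isL (segments good T) (concatMap (segments good) S))) (sym (concat-++ (longSegments good ℓ T) (kept S)))
      un : Unique (concat (concatMap (segments good) S))
      un = subst Unique (sym (concat-concatMap S)) (filterᵇ-Unique good {concat S} (System.disjoint sys))
      unT : ∀ {S} → Unique (concat S) → ∀ {T : List (Fin (suc n))} → T ∈ S → Unique T
      unT u (here refl) = proj₁ (++-Unique⁻ _ u)
      unT {T′ ∷ S} u (there T∈) = unT (proj₁ (proj₂ (++-Unique⁻ T′ u))) T∈
      lk : ∀ S → (∀ {T} → T ∈ S → Linked (Adj G) T) → ∀ {T} → T ∈ concatMap (segments good) S → Linked (Adj G′) T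
      lk (T′ ∷ S) h T∈ with ∈-++⁻ (segments good T′) T∈
      ... | inj₁ T∈′ = segments-linked good keeps-edge (h (here refl)) T∈′
      ... | inj₂ T∈′ = lk S (h ∘ there) T∈′
      sys′ : System ℓ G′ (kept S)
      sys′ = record
        { paths = λ {T} T∈ → let (T∈′ , e) = ∈-filterᵇ⁻ isL {concatMap (segments good) S} T∈ in record
            { unique = unT un T∈′
            ; linked = lk S (λ T∈ → LongPath.linked (System.paths sys T∈)) T∈′
            ; long = ≤ᵇ⇒≤ (suc ℓ) (length T) (Equivalence.from T-≡ e) }
        ; disjoint = filterᵇ-concat-Unique isL {concatMap (segments good) S} un }

  dropLast : List A → List A
  dropLast [] = []
  dropLast (x ∷ []) = []
  dropLast (x ∷ y ∷ ys) = x ∷ dropLast (y ∷ ys)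

  trim : List A → List A
  trim [] = []
  trim (x ∷ xs) = dropLast xs

  dropLast⊆ : ∀ (xs : List A) {x} → x ∈ dropLast xs → x ∈ xs
  dropLast⊆ (x ∷ y ∷ ys) (here e) = here e
  dropLast⊆ (x ∷ y ∷ ys) (there h) = there (dropLast⊆ (y ∷ ys) h)

  trim⊆ : ∀ (xs : List A) {x} → x ∈ trim xs → x ∈ xs
  trim⊆ (x ∷ xs) h = there (dropLast⊆ xs h)

  length-dropLast : ∀ (xs : List A) → length (dropLast xs) ≡ length xs ∸ 1
  length-dropLast [] = refl
  length-dropLast (x ∷ []) = refl
  length-dropLast (x ∷ y ∷ ys) = cong suc (length-dropLast (y ∷ ys))

  length-trim : ∀ (xs : List A) → length (trim xs) ≡ length xs ∸ 2
  length-trim [] = refl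
  length-trim (x ∷ xs) = length-dropLast xs

  dropLast-Unique : ∀ {xs : List A} → Unique xs → Unique (dropLast xs)
  dropLast-Unique {xs = []} u = []
  dropLast-Unique {xs = x ∷ []} u = []
  dropLast-Unique {xs = x ∷ y ∷ ys} u = cons-Unique (uncons∉ u ∘ dropLast⊆ (y ∷ ys)) (dropLast-Unique (uncons-Unique u))

  trim-Unique : ∀ {xs : List A} → Unique xs → Unique (trim xs)
  trim-Unique {xs = []} u = []
  trim-Unique {xs = x ∷ xs} u = dropLast-Unique (uncons-Unique u)

  dropLast-linked : ∀ {R : A → A → Set} {xs} → Linked R xs → Linked R (dropLast xs)
  dropLast-linked [] = []
  dropLast-linked [-] = []
  dropLast-linked (r ∷ [-]) = [-]
  dropLast-linked (r ∷ r′ ∷ l) = r ∷ dropLast-linked (r′ ∷ l)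

  trim-linked : ∀ {R : A → A → Set} {xs} → Linked R xs → Linked R (trim xs)
  trim-linked [] = []
  trim-linked [-] = []
  trim-linked (_ ∷ l) = dropLast-linked l

  module _ {G : Graph (suc n)} {p : Fin (suc n) → Fin (suc n)} (P : ParentOf G p) where
    open ParentOf P
    open Word p using (size; size-bound)

    -- Of the two neighbours of an inner vertex of a path at least one is its child.
    inner-height : ∀ h {x xs} → Unique (x ∷ xs) → Linked (Adj G) (x ∷ xs) → (∀ {z} → z ∈ x ∷ xs → height≥ p h z ≡ true) →
      ∀ {y} → y ∈ dropLast xs → height≥ p (suc h) y ≡ true
    inner-height h {x} {y ∷ z ∷ zs} u (a ∷ b ∷ l) hs (here refl)
      with one-is-child p (adj⇒edge (Adj-sym G a)) (adj⇒edge b) (λ { refl → uncons∉ u (there (here refl)) })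
    ... | inj₁ c = height⁺ p {h} c (hs (here refl))
    ... | inj₂ c = height⁺ p {h} c (hs (there (there (here refl))))
    inner-height h {x} {y ∷ z ∷ zs} u (a ∷ l) hs (there y∈) = inner-height h (uncons-Unique u) l (hs ∘ there) y∈

    trimmed : ℕ → List (Fin (suc n)) → List (Fin (suc n))
    trimmed zero T = T
    trimmed (suc h) T = trim (trimmed h T)

    trimmed-path : ∀ h {T} → Unique T → Linked (Adj G) T →
      Unique (trimmed h T) × Linked (Adj G) (trimmed h T) × (∀ {z} → z ∈ trimmed h T → height≥ p h z ≡ true × z ∈ T)
    trimmed-path zero u l = u , l , λ z∈ → refl , z∈
    trimmed-path (suc h) {T} u l with trimmed h T | trimmed-path h {T} u l
    ... | [] | u′ , l′ , hs = [] , [] , λ ()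
    ... | x ∷ xs | u′ , l′ , hs = trim-Unique u′ , trim-linked l′ ,
          λ z∈ → inner-height h u′ l′ (proj₁ ∘ hs) z∈ , proj₂ (hs (trim⊆ (x ∷ xs) z∈))

    length-trimmed : ∀ h T → length T ≤ length (trimmed h T) + 2 * h
    length-trimmed zero T = m≤m+n _ _
    length-trimmed (suc h) T = begin
      length T                                    ≤⟨ length-trimmed h T ⟩
      length (trimmed h T) + 2 * h                ≤⟨ +-monoˡ-≤ (2 * h) (≤-trans (m≤n+m∸n (length (trimmed h T)) 2) (+-monoʳ-≤ 2 (≤-reflexive (sym (length-trim (trimmed h T)))))) ⟩
      2 + length (trim (trimmed h T)) + 2 * h     ≡⟨ ring (length (trim (trimmed h T))) h ⟩
      length (trim (trimmed h T)) + 2 * suc h     ∎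
      where
      open ≤-Reasoning
      ring : ∀ a h → 2 + a + 2 * h ≡ a + 2 * suc h
      ring = solve-∀

    -- Removing both ends `h` times leaves vertices of height at least `h` and costs at most `2 * h`
    -- vertices, which is no more than half of the path.
    path-heights : ∀ {h ℓ T} → 4 * h ≤ ℓ → LongPath ℓ G T → length T ≤ 2 * length (filterᵇ (height≥ p h) T)
    path-heights {h} {ℓ} {T} 4h≤ L = +-cancelˡ-≤ (4 * h) _ _ (begin
      4 * h + length T              ≤⟨ +-monoˡ-≤ (length T) (≤-trans 4h≤ (<⇒≤ (LongPath.long L))) ⟩
      length T + length T           ≤⟨ +-mono-≤ bound bound ⟩
      (f + 2 * h) + (f + 2 * h)     ≡⟨ ring f h ⟩
      4 * h + 2 * f                 ∎)
      where
      open ≤-Reasoning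
      f = length (filterᵇ (height≥ p h) T)
      tp = trimmed-path h (LongPath.unique L) (LongPath.linked L)
      bound : length T ≤ f + 2 * h
      bound = ≤-trans (length-trimmed h T) (+-monoˡ-≤ (2 * h) (length-⊆ (proj₁ tp)
        (λ z∈ → ∈-filterᵇ⁺ (height≥ p h) (proj₂ (proj₂ (proj₂ tp) z∈)) (proj₁ (proj₂ (proj₂ tp) z∈)))))
      ring : ∀ f h → (f + 2 * h) + (f + 2 * h) ≡ 4 * h + 2 * f
      ring = solve-∀

    cov-size : ∀ {h ℓ} → 4 * h ≤ ℓ → cov ℓ G ≤ 2 * size h
    cov-size {h} {ℓ} 4h≤ with cov-attained ℓ G
    ... | S , sys , e = subst (_≤ 2 * size h) (sym e) (≤-trans (total S (System.paths sys))
        (*-monoʳ-≤ 2 (length≤count (height≥ p h) (filterᵇ-Unique (height≥ p h) {concat S} (System.disjoint sys))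
          (λ x∈ → proj₂ (∈-filterᵇ⁻ (height≥ p h) {concat S} x∈)))))
      where
      total : ∀ S → (∀ {T} → T ∈ S → LongPath ℓ G T) → length (concat S) ≤ 2 * length (filterᵇ (height≥ p h) (concat S))
      total [] _ = z≤n
      total (T ∷ S) paths = begin
        length (T ++ concat S)                ≡⟨ length-++ T ⟩
        length T + length (concat S)          ≤⟨ +-mono-≤ (path-heights {h} 4h≤ (paths (here refl))) (total S (paths ∘ there)) ⟩
        2 * a + 2 * b                         ≡⟨ *-distribˡ-+ 2 a b ⟨
        2 * (a + b)                           ≡⟨ cong (2 *_) (sym (trans (cong length (filterᵇ-++ (height≥ p h) T (concat S))) (length-++ (filterᵇ (height≥ p h) T)))) ⟩
        2 * length (filterᵇ (height≥ p h) (T ++ concat S)) ∎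
        where
        open ≤-Reasoning
        a = length (filterᵇ (height≥ p h) T)
        b = length (filterᵇ (height≥ p h) (concat S))

    -- Vertical paths through slices of consecutive heights.

    exact : ℕ → Fin (suc n) → Bool
    exact h x = height≥ p h x ∧ not (height≥ p (suc h) x)

    isHeir : ℕ → Fin (suc n) → Fin (suc n) → Bool
    isHeir h x y = nonzero y ∧ ((p y == x) ∧ exact h y)

    headOr0 : List (Fin (suc n)) → Fin (suc n)
    headOr0 [] = zero
    headOr0 (x ∷ _) = x

    -- The next vertex of a longest downward chain from a vertex of exact height `suc h`; for all
    -- others the value is irrelevant.
    heir : ℕ → Fin (suc n) → Fin (suc n)
    heir h x = headOr0 (filterᵇ (isHeir h x) (allFin (suc n)))

    exact⁻ : ∀ h x → exact h x ≡ true → height≥ p h x ≡ true × height≥ p (suc h) x ≡ false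
    exact⁻ h x e with ∧⁻ (height≥ p h x) e
    ... | a , b = a , not⁻ b

    heir-spec : ∀ h x → exact (suc h) x ≡ true → Child p (heir h x) x × exact h (heir h x) ≡ true
    heir-spec h x e with exact⁻ (suc h) x e
    ... | a , b with height⁻ p {h} a
    ...   | y , (y≢0 , py) , hy = fin (∧⁻ (nonzero z) hz)
      where
      z = heir h x
      hd : ∀ {xs : List (Fin (suc n))} {y} → y ∈ xs → headOr0 xs ∈ xs
      hd (here _) = here refl
      hd (there _) = here refl
      ey : exact h y ≡ true
      ey = ∧⁺ hy (not⁺ (¬true⇒false (λ hy′ → true≢false (height⁺ p {suc h} (y≢0 , py) hy′) b)))
      hz : isHeir h x z ≡ true
      hz = proj₂ (∈-filterᵇ⁻ (isHeir h x) {allFin (suc n)} (hd (∈-count (isHeir h x) {y} (∧⁺ (nonzero⁺ y≢0) (∧⁺ (≡⇒== py) ey)))))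
      fin : nonzero z ≡ true × (p z == x) ∧ exact h z ≡ true → Child p z x × exact h z ≡ true
      fin (c , d) with ∧⁻ (p z == x) d
      ... | pz , ez = (nonzero⁻ c , ==⇒≡ (p z) x pz) , ez

    -- Follows heirs through the heights `i + j`, ..., `j`, one vertex for each.
    descent : ℕ → ℕ → Fin (suc n) → List (Fin (suc n))
    descent j zero x = x ∷ []
    descent j (suc i) x = x ∷ descent j i (heir (i + j) x)

    length-descent : ∀ j i x → length (descent j i x) ≡ suc i
    length-descent j zero x = refl
    length-descent j (suc i) x = cong suc (length-descent j i (heir (i + j) x))

    descent-heights : ∀ j i x → exact (i + j) x ≡ true → ∀ {z} → z ∈ descent j i x → height≥ p j z ≡ true × height≥ p (suc (i + j)) z ≡ false
    descent-heights j zero x e (here refl) = exact⁻ j x e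
    descent-heights j (suc i) x e (here refl) = height-mono p (suc i) (proj₁ (exact⁻ (suc i + j) x e)) , proj₂ (exact⁻ (suc i + j) x e)
    descent-heights j (suc i) x e (there z∈) with descent-heights j i (heir (i + j) x) (proj₂ (heir-spec (i + j) x e)) z∈
    ... | a , b = a , ¬true⇒false (λ h → true≢false (height-pred p (suc (i + j)) h) b)

    head∉descent : ∀ j i x {y} → exact (suc i + j) x ≡ true → exact (i + j) y ≡ true → x ∉ descent j i y
    head∉descent j i x {y} ex ey x∈ = true≢false (proj₁ (exact⁻ (suc i + j) x ex)) (proj₂ (descent-heights j i y ey x∈))

    descent-path : ∀ j i x → exact (i + j) x ≡ true → Unique (descent j i x) × Linked (Adj G) (descent j i x)
    descent-path j zero x e = [] ∷ [] , [-]
    descent-path j (suc i) x e with heir-spec (i + j) x e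
    ... | c , e′ with descent-path j i (heir (i + j) x) e′
    ...   | u , l = cons-Unique (head∉descent j i x e e′) u , link i (subst (Adj G (heir (i + j) x)) (proj₂ c) (adj-parent (proj₁ c))) l
      where
      link : ∀ i {y} → Adj G y x → Linked (Adj G) (descent j i y) → Linked (Adj G) (x ∷ descent j i y)
      link zero a l = Adj-sym G a ∷ l
      link (suc i) a l = Adj-sym G a ∷ l

    -- Heights drop strictly along a descent, so a common vertex stands at the same place in both,
    -- and the parent function leads from it back to both tops.
    descent-injective : ∀ j i x y → exact (i + j) x ≡ true → exact (i + j) y ≡ true → ∀ {z} → z ∈ descent j i x → z ∈ descent j i y → x ≡ y
    descent-injective j zero x y _ _ (here refl) (here refl) = refl
    descent-injective j (suc i) x y ex ey (here refl) (here refl) = refl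
    descent-injective j (suc i) x y ex ey (here refl) (there z∈) = ⊥-elim (head∉descent j i x ex (proj₂ (heir-spec (i + j) y ey)) z∈)
    descent-injective j (suc i) x y ex ey (there z∈) (here refl) = ⊥-elim (head∉descent j i y ey (proj₂ (heir-spec (i + j) x ex)) z∈)
    descent-injective j (suc i) x y ex ey (there z∈) (there z∈′) =
      trans (sym (proj₂ (proj₁ (heir-spec (i + j) x ex)))) (trans (cong p
        (descent-injective j i _ _ (proj₂ (heir-spec (i + j) x ex)) (proj₂ (heir-spec (i + j) y ey)) z∈ z∈′)) (proj₂ (proj₁ (heir-spec (i + j) y ey))))

    exactSize : ℕ → ℕ
    exactSize h = count (exact h)

    -- `heir` is injective on this layer, since the parent of an heir is the vertex itself.
    exactSize-suc : ∀ h → exactSize (suc h) ≤ exactSize h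
    exactSize-suc h = length-inject (heir h) (count-Unique (exact (suc h)))
      (λ {x} {y} x∈ y∈ eq → trans (sym (proj₂ (proj₁ (heir-spec h x (ex x∈))))) (trans (cong p eq) (proj₂ (proj₁ (heir-spec h y (ex y∈))))))
      (λ {x} x∈ → ∈-count (exact h) (proj₂ (heir-spec h x (ex x∈))))
      where
      ex : ∀ {x} → x ∈ filterᵇ (exact (suc h)) (allFin (suc n)) → exact (suc h) x ≡ true
      ex x∈ = proj₂ (∈-filterᵇ⁻ (exact (suc h)) {allFin (suc n)} x∈)

    exactSize-mono : ∀ i h → exactSize (i + h) ≤ exactSize h
    exactSize-mono zero h = ≤-refl
    exactSize-mono (suc i) h = ≤-trans (exactSize-suc (i + h)) (exactSize-mono i h)

    size-exact : ∀ h → size h ≤ exactSize h + size (suc h)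
    size-exact h = subst (size h ≤_) (length-++ (filterᵇ (exact h) (allFin (suc n)))) (length-⊆ (count-Unique (height≥ p h)) sub)
      where
      sub : ∀ {x} → x ∈ filterᵇ (height≥ p h) (allFin (suc n)) → x ∈ filterᵇ (exact h) (allFin (suc n)) ++ filterᵇ (height≥ p (suc h)) (allFin (suc n))
      sub {x} x∈ with bool-cases (height≥ p (suc h) x)
      ... | inj₁ e = ∈-++⁺ʳ (filterᵇ (exact h) (allFin (suc n))) (∈-count (height≥ p (suc h)) e)
      ... | inj₂ e = ∈-++⁺ˡ (∈-count (exact h) (∧⁺ (proj₂ (∈-filterᵇ⁻ (height≥ p h) {allFin (suc n)} x∈)) (not⁺ e)))

    size-block : ∀ i h → size h ≤ i * exactSize h + size (i + h)
    size-block zero h = ≤-refl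
    size-block (suc i) h = begin
      size h                                                   ≤⟨ size-block i h ⟩
      i * exactSize h + size (i + h)                           ≤⟨ +-monoʳ-≤ (i * exactSize h) (size-exact (i + h)) ⟩
      i * exactSize h + (exactSize (i + h) + size (suc i + h)) ≤⟨ +-monoʳ-≤ (i * exactSize h) (+-monoˡ-≤ _ (exactSize-mono i h)) ⟩
      i * exactSize h + (exactSize h + size (suc i + h))       ≡⟨ trans (sym (+-assoc (i * exactSize h) _ _)) (cong (_+ size (suc i + h)) (+-comm (i * exactSize h) _)) ⟩
      suc i * exactSize h + size (suc i + h)                   ∎
      where open ≤-Reasoning

    block : ℕ → ℕ → List (List (Fin (suc n)))
    block ℓ j = map (descent j ℓ) (filterᵇ (exact (ℓ + j)) (allFin (suc n)))

    blocks : ℕ → ℕ → ℕ → List (List (Fin (suc n)))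
    blocks ℓ zero j = []
    blocks ℓ (suc J) j = block ℓ j ++ blocks ℓ J (suc ℓ + j)

    module _ (ℓ : ℕ) where

      block⁻ : ∀ j {T} → T ∈ block ℓ j → ∃ λ x → exact (ℓ + j) x ≡ true × T ≡ descent j ℓ x
      block⁻ j T∈ with ∈-map⁻ (descent j ℓ) T∈
      ... | x , x∈ , e = x , proj₂ (∈-filterᵇ⁻ (exact (ℓ + j)) {allFin (suc n)} x∈) , e

      block-heights : ∀ j {z} → z ∈ concat (block ℓ j) → height≥ p (suc ℓ + j) z ≡ false
      block-heights j z∈ with ∈-concat⁻′ (block ℓ j) z∈
      ... | T , z∈T , T∈ with block⁻ j T∈
      ...   | x , e , refl = proj₂ (descent-heights j ℓ x e z∈T)

      block-Unique : ∀ j → Unique (concat (block ℓ j))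
      block-Unique j = U.concat⁺ (All.tabulate (λ T∈ → let (x , e , eq) = block⁻ j T∈ in subst Unique (sym eq) (proj₁ (descent-path j ℓ x e))))
        (Unique⇒AllPairs (map-Unique (descent j ℓ) inj (count-Unique (exact (ℓ + j)))) disj)
        where
        hd : ∀ i x → x ∈ descent j i x
        hd zero x = here refl
        hd (suc i) x = here refl
        inj : ∀ {x y} → x ∈ filterᵇ (exact (ℓ + j)) (allFin (suc n)) → y ∈ filterᵇ (exact (ℓ + j)) (allFin (suc n)) → descent j ℓ x ≡ descent j ℓ y → x ≡ y
        inj {x} {y} x∈ y∈ eq = descent-injective j ℓ x y (proj₂ (∈-filterᵇ⁻ (exact (ℓ + j)) {allFin (suc n)} x∈)) (proj₂ (∈-filterᵇ⁻ (exact (ℓ + j)) {allFin (suc n)} y∈))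
          (hd ℓ x) (subst (x ∈_) eq (hd ℓ x))
        disj : ∀ {T T′} → T ∈ block ℓ j → T′ ∈ block ℓ j → T ≢ T′ → Disjoint T T′
        disj T∈ T′∈ T≢ (a , b) with block⁻ j T∈ | block⁻ j T′∈
        ... | x , ex , refl | y , ey , refl = T≢ (cong (descent j ℓ) (descent-injective j ℓ x y ex ey a b))

      blocks⁻ : ∀ J j {T} → T ∈ blocks ℓ J j → LongPath ℓ G T × (∀ {z} → z ∈ T → height≥ p j z ≡ true)
      blocks⁻ (suc J) j {T} T∈ with ∈-++⁻ (block ℓ j) T∈
      ... | inj₂ T∈′ with blocks⁻ J (suc ℓ + j) T∈′
      ...   | L , h = L , λ z∈ → height-mono p (suc ℓ) (h z∈)
      blocks⁻ (suc J) j T∈ | inj₁ T∈′ with block⁻ j T∈′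
      ... | x , e , refl = record { unique = proj₁ dp ; linked = proj₂ dp ; long = ≤-reflexive (sym (length-descent j ℓ x)) }
                         , λ z∈ → proj₁ (descent-heights j ℓ x e z∈)
        where dp = descent-path j ℓ x e

      blocks-Unique : ∀ J j → Unique (concat (blocks ℓ J j))
      blocks-Unique zero j = []
      blocks-Unique (suc J) j = subst Unique (concat-++ (block ℓ j) (blocks ℓ J (suc ℓ + j)))
        (U.++⁺ (block-Unique j) (blocks-Unique J (suc ℓ + j)) disj)
        where
        disj : Disjoint (concat (block ℓ j)) (concat (blocks ℓ J (suc ℓ + j)))
        disj (a , b) with ∈-concat⁻′ (blocks ℓ J (suc ℓ + j)) b
        ... | T , z∈ , T∈ = true≢false (proj₂ (blocks⁻ J (suc ℓ + j) T∈) z∈) (block-heights j a)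

      length-block : ∀ j → length (concat (block ℓ j)) ≡ suc ℓ * exactSize (ℓ + j)
      length-block j = trans (go (filterᵇ (exact (ℓ + j)) (allFin (suc n)))) (*-comm _ (suc ℓ))
        where
        go : ∀ xs → length (concat (map (descent j ℓ) xs)) ≡ length xs * suc ℓ
        go [] = refl
        go (x ∷ xs) = trans (length-++ (descent j ℓ x)) (cong₂ _+_ (length-descent j ℓ x) (go xs))

      -- Layers shrink with height, so the heights ℓ + j to 2ℓ + j contain at most
      -- `suc ℓ * exactSize (ℓ + j)` vertices. This is exactly what the block with heights j to ℓ +
      -- j covers, and the estimates telescope. The remainder is stated coarsely; it only has to
      -- vanish for large `J`.
      blocks-size : ∀ J j → size (ℓ + j) ≤ length (concat (blocks ℓ J j)) + size (J + (ℓ + j))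
      blocks-size zero j = ≤-refl
      blocks-size (suc J) j = begin
        size (ℓ + j)                                                   ≤⟨ size-block (suc ℓ) (ℓ + j) ⟩
        suc ℓ * exactSize (ℓ + j) + size (suc ℓ + (ℓ + j))             ≡⟨ cong₂ (λ a b → a + size b) (sym (length-block j)) (ring ℓ j) ⟩
        b + size (ℓ + (suc ℓ + j))                                     ≤⟨ +-monoʳ-≤ b (blocks-size J (suc ℓ + j)) ⟩
        b + (c + size (J + (ℓ + (suc ℓ + j))))                         ≤⟨ +-monoʳ-≤ b (+-monoʳ-≤ c (size-mono J)) ⟩
        b + (c + size (suc J + (ℓ + j)))                               ≡⟨ +-assoc b c _ ⟨
        b + c + size (suc J + (ℓ + j))                                 ≡⟨ cong (_+ size (suc J + (ℓ + j))) (trans (sym (length-++ (concat (block ℓ j)))) (cong length (concat-++ (block ℓ j) (blocks ℓ J (suc ℓ + j))))) ⟩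
        length (concat (blocks ℓ (suc J) j)) + size (suc J + (ℓ + j))  ∎
        where
        open ≤-Reasoning
        b = length (concat (block ℓ j))
        c = length (concat (blocks ℓ J (suc ℓ + j)))
        ring : ∀ ℓ j → suc ℓ + (ℓ + j) ≡ ℓ + (suc ℓ + j)
        ring = solve-∀
        ring′ : ∀ J ℓ j → J + (ℓ + (suc ℓ + j)) ≡ ℓ + (suc J + (ℓ + j))
        ring′ = solve-∀
        size-mono : ∀ J → size (J + (ℓ + (suc ℓ + j))) ≤ size (suc J + (ℓ + j))
        size-mono J = subst (λ z → size z ≤ size (suc J + (ℓ + j))) (sym (ring′ J ℓ j))
          (count-mono (height≥ p (ℓ + (suc J + (ℓ + j)))) (height≥ p (suc J + (ℓ + j))) (height-mono p ℓ))

      size-cov : size ℓ ≤ cov ℓ G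
      size-cov = begin
        size ℓ                                                         ≡⟨ cong size (+-identityʳ ℓ) ⟨
        size (ℓ + 0)                                                   ≤⟨ blocks-size (suc n) 0 ⟩
        length (concat (blocks ℓ (suc n) 0)) + size (suc n + (ℓ + 0))  ≤⟨ +-monoʳ-≤ _ (≤-trans (size-bound noCycle (suc n + (ℓ + 0))) (≤-reflexive (m≤n⇒m∸n≡0 (m≤m+n (suc n) (ℓ + 0))))) ⟩
        length (concat (blocks ℓ (suc n) 0)) + 0                       ≡⟨ +-identityʳ _ ⟩
        length (concat (blocks ℓ (suc n) 0))                           ≤⟨ cov-≥ (record { paths = λ T∈ → proj₁ (blocks⁻ (suc n) 0 T∈) ; disjoint = blocks-Unique (suc n) 0 }) ⟩
        cov ℓ G                                                        ∎
        where open ≤-Reasoning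

-- Sums over all words, the mean number of repeats, and a lower bound for level sizes.

module Words where

  open Basics
  open Counting
  open import Data.Bool using (Bool; true; false; if_then_else_)
  open import Data.Fin using (Fin; zero; suc)
  open import Data.List using (List; []; _∷_; _++_; map; length; filterᵇ; allFin; drop; concatMap)
  open import Data.List.Properties using (drop-drop)
  import Data.List.Relation.Unary.Any as Any
  import Data.List.Relation.Unary.Unique.Propositional.Properties as U
  open import Data.Nat as ℕ using (ℕ; zero; suc; _+_; _*_; _^_; _≤_; _∸_; z≤n; s≤s)
  open import Data.Nat.Properties
  open import Data.Nat.Tactic.RingSolver using (solve-∀)
  open import Data.Product using (_×_; _,_; proj₂; ∃)
  open import Function using (_∘_)
  open import Relation.Nullary using (yes; no)
  open import Relation.Binary.PropositionalEquality

  private variable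
    A : Set
    n t : ℕ

  -- An expectation over uniform words without its normalisation. In the recursive form,
  -- conditioning on the first letter holds by definition.
  wordSum : ∀ t → ℕ → (List (Fin t) → ℕ) → ℕ
  wordSum t zero F = F []
  wordSum t (suc m) F = sumOver (λ a → wordSum t m (λ v → F (a ∷ v))) (allFin t)

  wordSum-list : ∀ m (F : List (Fin t) → ℕ) → sumOver F (listsOfLength (allFin t) m) ≡ wordSum t m F
  wordSum-list zero F = +-identityʳ _
  wordSum-list {t} (suc m) F = go (allFin t)
    where
    go : ∀ xs → sumOver F (concatMap (λ x → map (x ∷_) (listsOfLength (allFin t) m)) xs) ≡ sumOver (λ a → wordSum t m (λ v → F (a ∷ v))) xs
    go [] = refl
    go (x ∷ xs) = trans (sumOver-++ F (map (x ∷_) (listsOfLength (allFin t) m)) _)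
      (cong₂ _+_ (trans (sumOver-map F (x ∷_) (listsOfLength (allFin t) m)) (wordSum-list m (λ v → F (x ∷ v)))) (go xs))

  wordSum-mono : ∀ m {F G : List (Fin t) → ℕ} → (∀ v → length v ≡ m → F v ≤ G v) → wordSum t m F ≤ wordSum t m G
  wordSum-mono zero h = h [] refl
  wordSum-mono {t} (suc m) h = sumOver-mono (allFin t) (λ {a} _ → wordSum-mono m (λ v e → h (a ∷ v) (cong suc e)))

  wordSum-cong : ∀ m {F G : List (Fin t) → ℕ} → (∀ v → length v ≡ m → F v ≡ G v) → wordSum t m F ≡ wordSum t m G
  wordSum-cong m h = ≤-antisym (wordSum-mono m (λ v e → ≤-reflexive (h v e))) (wordSum-mono m (λ v e → ≤-reflexive (sym (h v e))))

  wordSum-+ : ∀ m (F G : List (Fin t) → ℕ) → wordSum t m (λ v → F v + G v) ≡ wordSum t m F + wordSum t m G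
  wordSum-+ zero F G = refl
  wordSum-+ {t} (suc m) F G = trans (sumOver-cong (allFin t) (λ {a} _ → wordSum-+ m (λ v → F (a ∷ v)) (λ v → G (a ∷ v)))) (sumOver-+ _ _ (allFin t))

  wordSum-* : ∀ m c (F : List (Fin t) → ℕ) → wordSum t m (λ v → c * F v) ≡ c * wordSum t m F
  wordSum-* zero c F = refl
  wordSum-* {t} (suc m) c F = trans (sumOver-cong (allFin t) (λ {a} _ → wordSum-* m c (λ v → F (a ∷ v)))) (sumOver-* c _ (allFin t))

  sumOver-letters : ∀ t c → sumOver (λ (_ : Fin t) → c) (allFin t) ≡ t * c
  sumOver-letters t c = trans (sumOver-const c (allFin t)) (cong (_* c) (length-allFin t))

  wordSum-const : ∀ m c → wordSum t m (λ _ → c) ≡ t ^ m * c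
  wordSum-const zero c = sym (+-identityʳ c)
  wordSum-const {t} (suc m) c = trans (sumOver-cong (allFin t) (λ _ → wordSum-const m c)) (trans (sumOver-letters t (t ^ m * c)) (sym (*-assoc t (t ^ m) c)))

  wordSum-swap : ∀ m (F : A → List (Fin t) → ℕ) xs → sumOver (λ a → wordSum t m (F a)) xs ≡ wordSum t m (λ v → sumOver (λ a → F a v) xs)
  wordSum-swap m F [] = sym (trans (wordSum-const m 0) (*-zeroʳ (_ ^ m)))
  wordSum-swap m F (x ∷ xs) = trans (cong (wordSum _ m (F x) +_) (wordSum-swap m F xs)) (sym (wordSum-+ m (F x) _))

  wordSum-drop : ∀ k m (F : List (Fin t) → ℕ) → wordSum t (k + m) (F ∘ drop k) ≡ t ^ k * wordSum t m F
  wordSum-drop zero m F = sym (+-identityʳ _)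
  wordSum-drop {t} (suc k) m F = trans (sumOver-cong (allFin t) (λ _ → wordSum-drop k m F)) (trans (sumOver-letters t (t ^ k * wordSum t m F)) (sym (*-assoc t (t ^ k) _)))

  wordSum-++ : ∀ k m (F : List (Fin t) → ℕ) → wordSum t (k + m) F ≡ wordSum t k (λ v → wordSum t m (λ w → F (v ++ w)))
  wordSum-++ zero m F = refl
  wordSum-++ {t} (suc k) m F = sumOver-cong (allFin t) (λ {a} _ → wordSum-++ k m (λ v → F (a ∷ v)))

  wordSum-exchange : ∀ k m (G : List (Fin t) → List (Fin t) → ℕ) →
    wordSum t k (λ v → wordSum t m (G v)) ≡ wordSum t m (λ w → wordSum t k (λ v → G v w))
  wordSum-exchange zero m G = refl
  wordSum-exchange {t} (suc k) m G = trans (sumOver-cong (allFin t) (λ {a} _ → wordSum-exchange k m (λ v → G (a ∷ v)))) (wordSum-swap m _ (allFin t))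

  wordSum-suffix : ∀ {M m} → M ≤ m → ∀ (F : List (Fin t) → ℕ) → wordSum t m (F ∘ suffix M) ≡ t ^ (m ∸ M) * wordSum t M F
  wordSum-suffix {t} {M} {m} M≤m F = trans (wordSum-cong m (λ v e → cong (λ l → F (drop (l ∸ M) v)) e))
    (trans (cong (λ l → wordSum t l (F ∘ drop (m ∸ M))) (sym (m∸n+n≡m M≤m))) (wordSum-drop (m ∸ M) M F))

  indicator : Bool → ℕ
  indicator b = if b then 1 else 0

  sum-indicator : ∀ (χ : A → Bool) xs → sumOver (indicator ∘ χ) xs ≡ length (filterᵇ χ xs)
  sum-indicator χ [] = refl
  sum-indicator χ (x ∷ xs) with χ x
  ... | true = cong suc (sum-indicator χ xs)
  ... | false = sum-indicator χ xs

  member₀ : List (Fin (suc n)) → Fin (suc n) → Bool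
  member₀ v a = memᵇ a (zero ∷ v)

  letters-count : ∀ (v : List (Fin (suc n))) → sumOver (indicator ∘ member₀ v) (allFin (suc n)) ≡ length (letters v)
  letters-count {n} v = trans (sum-indicator (member₀ v) (allFin (suc n))) (length-≡ (count-Unique (member₀ v)) (letters-Unique v)
    (λ x∈ → letters⁺ v (memᵇ⁻ (zero ∷ v) (proj₂ (∈-filterᵇ⁻ (member₀ v) {allFin (suc n)} x∈))))
    (λ x∈ → ∈-count (member₀ v) (memᵇ⁺ (letters⁻ v x∈))))

  length-letters≤ : ∀ (v : List (Fin (suc n))) → length (letters v) ≤ suc (length v)
  length-letters≤ v = subst (length (letters v) ≤_) (letters-rep₀ v) (m≤m+n _ _)

  -- In front of a suffix of length j at most j + 1 letters are repeats, and 1 + ... + m ≤ m².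
  rep₀-mean : ∀ m → suc n * wordSum (suc n) m rep₀ ≤ m * m * suc n ^ m
  rep₀-mean {n} zero = ≤-reflexive (*-zeroʳ n)
  rep₀-mean {n} (suc m) = begin
    τ * sumOver (λ a → wordSum τ m (λ v → indicator (member₀ v a) + rep₀ v)) (allFin τ)
      ≡⟨ cong (τ *_) (wordSum-swap m (λ a v → indicator (member₀ v a) + rep₀ v) (allFin τ)) ⟩
    τ * wordSum τ m (λ v → sumOver (λ a → indicator (member₀ v a) + rep₀ v) (allFin τ))
      ≤⟨ *-monoʳ-≤ τ (wordSum-mono m (λ v e → ≤-reflexive (trans (sumOver-+ (indicator ∘ member₀ v) (λ _ → rep₀ v) (allFin τ)) (cong (sumOver (indicator ∘ member₀ v) (allFin τ) +_) (sumOver-letters τ (rep₀ v)))))) ⟩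
    τ * wordSum τ m (λ v → sumOver (indicator ∘ member₀ v) (allFin τ) + τ * rep₀ v)
      ≤⟨ *-monoʳ-≤ τ (wordSum-mono m (λ v e → +-monoˡ-≤ (τ * rep₀ v) (subst₂ _≤_ (sym (letters-count v)) (cong suc e) (length-letters≤ v)))) ⟩
    τ * wordSum τ m (λ v → suc m + τ * rep₀ v)
      ≡⟨ cong (τ *_) (trans (wordSum-+ m (λ _ → suc m) (λ v → τ * rep₀ v)) (cong₂ _+_ (wordSum-const m (suc m)) (wordSum-* m τ rep₀))) ⟩
    τ * (τ ^ m * suc m + τ * wordSum τ m rep₀)
      ≤⟨ *-monoʳ-≤ τ (+-monoʳ-≤ (τ ^ m * suc m) (rep₀-mean m)) ⟩
    τ * (τ ^ m * suc m + m * m * τ ^ m)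
      ≤⟨ subst (τ * (τ ^ m * suc m + m * m * τ ^ m) ≤_) (sym (ring τ (τ ^ m) m)) (m≤m+n _ _) ⟩
    suc m * suc m * (τ * τ ^ m) ∎
    where
    open ≤-Reasoning
    τ = suc n
    ring : ∀ τ p m → suc m * suc m * (τ * p) ≡ τ * (p * suc m + m * m * p) + m * τ * p
    ring = solve-∀

  rep₀-drop-≤ : ∀ k (v : List (Fin (suc n))) → rep₀ (drop k v) ≤ rep₀ v
  rep₀-drop-≤ zero v = ≤-refl
  rep₀-drop-≤ (suc k) [] = ≤-refl
  rep₀-drop-≤ (suc k) (a ∷ v) = ≤-trans (rep₀-drop-≤ k v) (m≤n+m (rep₀ v) _)

  rep₀-drop-≥ : ∀ k (v : List (Fin (suc n))) → rep₀ v ≤ k + rep₀ (drop k v)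
  rep₀-drop-≥ zero v = ≤-refl
  rep₀-drop-≥ (suc k) [] = z≤n
  rep₀-drop-≥ (suc k) (a ∷ v) = +-mono-≤ (le (member₀ v a)) (rep₀-drop-≥ k v)
    where
    le : ∀ b → indicator b ≤ 1
    le true = ≤-refl
    le false = z≤n

  repeats : List (Fin (suc n)) → ℕ → ℕ
  repeats u m = rep₀ (suffix m u)

  suffix-suffix : ∀ (u : List A) {M M′} → M ≤ M′ → ∃ λ k → k ≤ M′ ∸ M × drop k (suffix M′ u) ≡ suffix M u
  suffix-suffix u {M} {M′} M≤M′ = (L ∸ M) ∸ (L ∸ M′) , le , trans (drop-drop (L ∸ M′) _ u) (cong (λ k → drop k u) (m+[n∸m]≡n (∸-monoʳ-≤ L M≤M′)))
    where
    L = length u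
    le : (L ∸ M) ∸ (L ∸ M′) ≤ M′ ∸ M
    le = m≤n+o⇒m∸n≤o (L ∸ M) (L ∸ M′) (m≤n+o⇒m∸n≤o L M (begin
      L                             ≤⟨ m≤n+m∸n L M′ ⟩
      M′ + (L ∸ M′)                 ≡⟨ cong (_+ (L ∸ M′)) (m+[n∸m]≡n M≤M′) ⟨
      M + (M′ ∸ M) + (L ∸ M′)       ≡⟨ trans (+-assoc M _ _) (cong (M +_) (+-comm (M′ ∸ M) _)) ⟩
      M + ((L ∸ M′) + (M′ ∸ M))     ∎))
      where open ≤-Reasoning

  repeats-mono : ∀ (u : List (Fin (suc n))) {M M′} → M ≤ M′ → repeats u M ≤ repeats u M′
  repeats-mono u {M} {M′} h with suffix-suffix u h
  ... | k , _ , eq = subst (λ w → rep₀ w ≤ repeats u M′) eq (rep₀-drop-≤ k (suffix M′ u))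

  repeats-lipschitz : ∀ (u : List (Fin (suc n))) {M M′} → M ≤ M′ → repeats u M′ ≤ repeats u M + (M′ ∸ M)
  repeats-lipschitz u {M} {M′} h with suffix-suffix u h
  ... | k , k≤ , eq = ≤-trans (rep₀-drop-≥ k (suffix M′ u)) (subst (λ w → k + rep₀ w ≤ repeats u M + (M′ ∸ M)) (sym eq) (≤-trans (+-monoˡ-≤ (repeats u M) k≤) (≤-reflexive (+-comm (M′ ∸ M) _))))

  -- Once the size is at most M + 1, a step loses at most 1 + `repeats u M`. A larger size cannot
  -- jump far below M: its excess over M bounds the additional repeats that the longer suffix can
  -- have, so the two cancel.
  levelSize-lower : ∀ (u : List (Fin (suc n))) {M} → M ≤ suc n → ∀ h → M ≤ levelSize u h + h * suc (repeats u M)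
  levelSize-lower u M≤ zero = ≤-trans M≤ (m≤m+n _ 0)
  levelSize-lower u {M} M≤ (suc h) with levelSize u h ≤? suc M
  ... | yes small = begin
    M                                                     ≤⟨ levelSize-lower u M≤ h ⟩
    N + h * suc ρ                                         ≤⟨ +-monoˡ-≤ (h * suc ρ) (≤-trans (m≤n+m∸n N (1 + r)) (≤-reflexive (cong (suc r +_) (sym (∸-+-assoc N 1 r))))) ⟩
    suc r + (N ∸ 1 ∸ r) + h * suc ρ                       ≤⟨ +-monoˡ-≤ (h * suc ρ) (+-monoˡ-≤ (N ∸ 1 ∸ r) (s≤s (repeats-mono u (≤-trans (∸-monoˡ-≤ 2 small) (m∸n≤m M 1))))) ⟩
    suc ρ + (N ∸ 1 ∸ r) + h * suc ρ                       ≡⟨ ring (suc ρ) (N ∸ 1 ∸ r) (h * suc ρ) ⟩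
    (N ∸ 1 ∸ r) + suc h * suc ρ                           ∎
    where
    open ≤-Reasoning
    N = levelSize u h
    r = repeats u (N ∸ 2)
    ρ = repeats u M
    ring : ∀ a b c → a + b + c ≡ b + (a + c)
    ring = solve-∀
  ... | no large = +-cancelˡ-≤ (suc e) _ _ (begin
    suc e + M                                  ≡⟨ cong suc (+-comm e M) ⟩
    suc (M + e)                                ≡⟨ cong (_∸ 1) Ne ⟨
    N ∸ 1                                      ≤⟨ m≤n+m∸n (N ∸ 1) r ⟩
    r + (N ∸ 1 ∸ r)                            ≤⟨ +-monoˡ-≤ (N ∸ 1 ∸ r) r≤ ⟩
    ρ + e + (N ∸ 1 ∸ r)                        ≤⟨ subst (ρ + e + (N ∸ 1 ∸ r) ≤_) (sym (ring e ρ (N ∸ 1 ∸ r) (h * suc ρ))) (m≤m+n _ _) ⟩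
    suc e + ((N ∸ 1 ∸ r) + suc h * suc ρ)      ∎)
    where
    open ≤-Reasoning
    N = levelSize u h
    e = N ∸ suc (suc M)
    Ne : N ≡ suc (suc (M + e))
    Ne = sym (m+[n∸m]≡n (≰⇒> large))
    r = repeats u (N ∸ 2)
    ρ = repeats u M
    N∸2 : N ∸ 2 ≡ M + e
    N∸2 = cong (_∸ 2) Ne
    r≤ : r ≤ ρ + e
    r≤ = subst₂ (λ a b → repeats u a ≤ ρ + b) (sym N∸2) (m+n∸m≡n M e) (repeats-lipschitz u (m≤m+n M e))
    ring : ∀ e ρ x y → suc e + (x + (suc ρ + y)) ≡ (ρ + e + x) + (2 + y)
    ring = solve-∀

-- A Talagrand-type inequality for two weights on a product space.

module Product where

  open Basics using (==-refl)
  open import Data.Bool using (Bool; true; false; _∧_; not; if_then_else_)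
  open import Data.Fin using (Fin)
  open import Data.List using (List; []; _∷_; foldr; map; allFin)
  open import Data.List.Membership.Propositional using (_∈_)
  open import Data.List.Membership.Propositional.Properties using (∈-allFin)
  open import Data.List.Relation.Unary.Any using (here; there)
  open import Data.Maybe using (Maybe; just; nothing)
  open import Data.Nat as ℕ using (ℕ; zero; suc)
  open import Data.Product using (_,_; proj₁; ∃; Σ)
  open import Data.Rational using (ℚ; 0ℚ; 1ℚ; _+_; _*_; _-_; -_; _≤_; _<_; _⊔_; positive; nonNegative)
  open import Data.Rational.Properties
  open import Data.Sum using (_⊎_; inj₁; inj₂)
  open import Data.Vec using (Vec; []; _∷_; head; tail)
  open import Level using (0ℓ)
  open import Relation.Nullary using (yes; no)
  open import Relation.Binary.PropositionalEquality
  open import Tactic.RingSolver using (solve-∀)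
  import Tactic.RingSolver.Core.AlmostCommutativeRing as ACR

  isZero? : ∀ x → Maybe (0ℚ ≡ x)
  isZero? x with 0ℚ ≟ x
  ... | yes e = just e
  ... | no _ = nothing

  ℚ-ring : ACR.AlmostCommutativeRing 0ℓ 0ℓ
  ℚ-ring = ACR.fromCommutativeRing +-*-commutativeRing isZero?

  2ℚ : ℚ
  2ℚ = 1ℚ + 1ℚ

  *-monoˡ : ∀ {a b c} → 0ℚ ≤ c → a ≤ b → c * a ≤ c * b
  *-monoˡ {c = c} h = *-monoˡ-≤-nonNeg c {{nonNegative h}}

  *-monoʳ : ∀ {a b c} → 0ℚ ≤ c → a ≤ b → a * c ≤ b * c
  *-monoʳ {c = c} h = *-monoʳ-≤-nonNeg c {{nonNegative h}}

  *-nonneg : ∀ {a b} → 0ℚ ≤ a → 0ℚ ≤ b → 0ℚ ≤ a * b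
  *-nonneg {a} {b} ha hb = subst (_≤ a * b) (*-zeroʳ a) (*-monoˡ ha hb)

  +-nonneg : ∀ {a b} → 0ℚ ≤ a → 0ℚ ≤ b → 0ℚ ≤ a + b
  +-nonneg {a} {b} ha hb = +-mono-≤ ha hb

  *-mono : ∀ {a b c d} → 0ℚ ≤ c → 0ℚ ≤ b → a ≤ b → c ≤ d → a * c ≤ b * d
  *-mono hc hb ab cd = ≤-trans (*-monoʳ hc ab) (*-monoˡ hb cd)

  cancel-pos : ∀ {a b c} → 0ℚ < c → a * c ≤ b * c → a ≤ b
  cancel-pos {c = c} h = *-cancelʳ-≤-pos c {{positive h}}

  ≤-from : ∀ {a b e} → 0ℚ ≤ e → a + e ≡ b → a ≤ b
  ≤-from {a} {b} {e} h eq = subst₂ _≤_ (+-identityʳ a) eq (+-monoʳ-≤ a h)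

  ≤⇒0≤- : ∀ {a b} → a ≤ b → 0ℚ ≤ b - a
  ≤⇒0≤- {a} {b} h = subst (_≤ b - a) (+-inverseʳ a) (+-monoˡ-≤ (- a) h)

  0≤1 : 0ℚ ≤ 1ℚ
  0≤1 = nonNegative⁻¹ 1ℚ

  square-nonneg : ∀ x → 0ℚ ≤ x * x
  square-nonneg x with ≤-total 0ℚ x
  ... | inj₁ h = *-nonneg h h
  ... | inj₂ h = subst (0ℚ ≤_) (sq x) (*-nonneg h′ h′)
    where
    sq : ∀ x → (0ℚ - x) * (0ℚ - x) ≡ x * x
    sq = solve-∀ ℚ-ring
    h′ : 0ℚ ≤ 0ℚ - x
    h′ = ≤⇒0≤- h

  pow : ℚ → ℕ → ℚ
  pow x zero = 1ℚ
  pow x (suc n) = x * pow x n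

  pow-nonneg : ∀ {x} → 0ℚ ≤ x → ∀ n → 0ℚ ≤ pow x n
  pow-nonneg h zero = 0≤1
  pow-nonneg h (suc n) = *-nonneg h (pow-nonneg h n)

  pow-+ : ∀ x m n → pow x (m ℕ.+ n) ≡ pow x m * pow x n
  pow-+ x zero n = sym (*-identityˡ _)
  pow-+ x (suc m) n = trans (cong (x *_) (pow-+ x m n)) (sym (*-assoc x _ _))

  sumℚ : ∀ {A : Set} → (A → ℚ) → List A → ℚ
  sumℚ f xs = foldr _+_ 0ℚ (map f xs)

  module _ {A : Set} where

    sumℚ-nonneg : ∀ {f : A → ℚ} → (∀ x → 0ℚ ≤ f x) → ∀ xs → 0ℚ ≤ sumℚ f xs
    sumℚ-nonneg h [] = ≤-refl
    sumℚ-nonneg h (x ∷ xs) = +-nonneg (h x) (sumℚ-nonneg h xs)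

    sumℚ-mono : ∀ {f g : A → ℚ} xs → (∀ x → f x ≤ g x) → sumℚ f xs ≤ sumℚ g xs
    sumℚ-mono [] h = ≤-refl
    sumℚ-mono (x ∷ xs) h = +-mono-≤ (h x) (sumℚ-mono xs h)

    sumℚ-lin : ∀ (f g : A → ℚ) a b xs → sumℚ (λ x → a * f x + b * g x) xs ≡ a * sumℚ f xs + b * sumℚ g xs
    sumℚ-lin f g a b [] = lem a b
      where
      lem : ∀ a b → 0ℚ ≡ a * 0ℚ + b * 0ℚ
      lem = solve-∀ ℚ-ring
    sumℚ-lin f g a b (x ∷ xs) = trans (cong (a * f x + b * g x +_) (sumℚ-lin f g a b xs)) (lem a b (f x) (g x) (sumℚ f xs) (sumℚ g xs))
      where
      lem : ∀ a b p q s t → a * p + b * q + (a * s + b * t) ≡ a * (p + s) + b * (q + t)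
      lem = solve-∀ ℚ-ring

  marked : ∀ {n} → Vec Bool n → ℕ
  marked [] = 0
  marked (e ∷ I) = (if e then 1 else 0) ℕ.+ marked I

  module _ {t : ℕ} where

    private
      V = Fin t

    sumWords : ∀ n → (Vec V n → ℚ) → ℚ
    sumWords zero F = F []
    sumWords (suc n) F = sumℚ (λ a → sumWords n (λ v → F (a ∷ v))) (allFin t)

    sumWords-nonneg : ∀ n {F} → (∀ v → 0ℚ ≤ F v) → 0ℚ ≤ sumWords n F
    sumWords-nonneg zero h = h []
    sumWords-nonneg (suc n) h = sumℚ-nonneg (λ a → sumWords-nonneg n (λ v → h (a ∷ v))) (allFin t)

    sumWords-mono : ∀ n {F G} → (∀ v → F v ≤ G v) → sumWords n F ≤ sumWords n G
    sumWords-mono zero h = h []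
    sumWords-mono (suc n) h = sumℚ-mono (allFin t) (λ a → sumWords-mono n (λ v → h (a ∷ v)))

    sumWords-lin : ∀ n (F G : Vec V n → ℚ) a b → sumWords n (λ v → a * F v + b * G v) ≡ a * sumWords n F + b * sumWords n G
    sumWords-lin zero F G a b = refl
    sumWords-lin (suc n) F G a b = trans (cong-sum (allFin t)) (sumℚ-lin (λ x → sumWords n (λ v → F (x ∷ v))) (λ x → sumWords n (λ v → G (x ∷ v))) a b (allFin t))
      where
      cong-sum : ∀ xs → sumℚ (λ x → sumWords n (λ v → a * F (x ∷ v) + b * G (x ∷ v))) xs
                      ≡ sumℚ (λ x → a * sumWords n (λ v → F (x ∷ v)) + b * sumWords n (λ v → G (x ∷ v))) xs
      cong-sum [] = refl
      cong-sum (x ∷ xs) = cong₂ _+_ (sumWords-lin n (λ v → F (x ∷ v)) (λ v → G (x ∷ v)) a b) (cong-sum xs)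

    mismatch : ∀ {n} → Vec Bool n → Vec V n → Vec V n → ℕ
    mismatch [] [] [] = 0
    mismatch (e ∷ I) (a ∷ x) (b ∷ y) = (if e ∧ not (a == b) then 1 else 0) ℕ.+ mismatch I x y

    alphabet : ℚ
    alphabet = sumℚ (λ (_ : V) → 1ℚ) (allFin t)

    -- The floor `0ℚ` covers an empty alphabet; for nonnegative `f` it changes nothing else.
    best : (V → ℚ) → ℚ
    best f = foldr (λ a m → f a ⊔ m) 0ℚ (allFin t)

    best-≥ : ∀ f a → f a ≤ best f
    best-≥ f a = go (allFin t) (∈-allFin a)
      where
      go : ∀ xs → a ∈ xs → f a ≤ foldr (λ a m → f a ⊔ m) 0ℚ xs
      go (x ∷ xs) (here refl) = p≤p⊔q (f x) _
      go (x ∷ xs) (there h) = ≤-trans (go xs h) (p≤q⊔p (f x) _)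

    best-attained : ∀ f → best f ≡ 0ℚ ⊎ ∃ λ a → best f ≡ f a
    best-attained f = go (allFin t)
      where
      go : ∀ xs → foldr (λ a m → f a ⊔ m) 0ℚ xs ≡ 0ℚ ⊎ ∃ λ a → foldr (λ a m → f a ⊔ m) 0ℚ xs ≡ f a
      go [] = inj₁ refl
      go (x ∷ xs) with ⊔-sel (f x) (foldr (λ a m → f a ⊔ m) 0ℚ xs) | go xs
      ... | inj₁ e | _ = inj₂ (x , e)
      ... | inj₂ e | inj₁ e′ = inj₁ (trans e e′)
      ... | inj₂ e | inj₂ (a , e′) = inj₂ (a , trans e e′)

    best-nonneg : ∀ f → 0ℚ ≤ best f
    best-nonneg f = go (allFin t)
      where
      go : ∀ xs → 0ℚ ≤ foldr (λ a m → f a ⊔ m) 0ℚ xs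
      go [] = ≤-refl
      go (x ∷ xs) = ≤-trans (go xs) (p≤q⊔p (f x) _)

    -- A marked coordinate contributes the factor `S`, or S(1 - κ) if the two words differ there.
    -- The condition S(1 - κ²) ≥ 1 is precisely what the one-coordinate bounds `mix` and `crude`
    -- demand.
    module Concentration {κ S : ℚ} (0≤κ : 0ℚ ≤ κ) (κ≤1 : κ ≤ 1ℚ) (1≤S : 1ℚ ≤ S * (1ℚ - κ * κ)) (0≤S : 0ℚ ≤ S)
                         {c : ℚ} (0≤c : 0ℚ ≤ c) where

      r : ℚ
      r = 1ℚ - κ

      0≤r : 0ℚ ≤ r
      0≤r = ≤⇒0≤- κ≤1

      r≤1 : r ≤ 1ℚ
      r≤1 = ≤-from 0≤κ (lem κ)
        where
        lem : ∀ κ → (1ℚ - κ) + κ ≡ 1ℚ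
        lem = solve-∀ ℚ-ring

      weight : ∀ {n} → Vec Bool n → Vec V n → Vec V n → ℚ
      weight I x y = pow S (marked I) * pow r (mismatch I x y)

      weight-nonneg : ∀ {n} (I : Vec Bool n) x y → 0ℚ ≤ weight I x y
      weight-nonneg I x y = *-nonneg (pow-nonneg 0≤S (marked I)) (pow-nonneg 0≤r (mismatch I x y))

      gain loss : Bool → ℚ
      gain e = if e then S else 1ℚ
      loss e = if e then S * r else 1ℚ

      gain-nonneg : ∀ e → 0ℚ ≤ gain e
      gain-nonneg true = 0≤S
      gain-nonneg false = 0≤1

      loss-nonneg : ∀ e → 0ℚ ≤ loss e
      loss-nonneg true = *-nonneg 0≤S 0≤r
      loss-nonneg false = 0≤1

      weight-same : ∀ {n} e (I : Vec Bool n) a x y → weight (e ∷ I) (a ∷ x) (a ∷ y) ≡ gain e * weight I x y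
      weight-same true I a x y rewrite ==-refl a = *-assoc S _ _
      weight-same false I a x y = sym (*-identityˡ _)

      weight-differ : ∀ {n} e (I : Vec Bool n) a b x y → loss e * weight I x y ≤ weight (e ∷ I) (a ∷ x) (b ∷ y)
      weight-differ false I a b x y = ≤-reflexive (*-identityˡ _)
      weight-differ true I a b x y with a == b
      ... | false = ≤-reflexive (lem S r _ _)
        where
        lem : ∀ S r p q → S * r * (p * q) ≡ S * p * (r * q)
        lem = solve-∀ ℚ-ring
      ... | true = ≤-trans (*-monoʳ (weight-nonneg I x y) (≤-trans (*-monoˡ 0≤S r≤1) (≤-reflexive (*-identityʳ S)))) (≤-reflexive (sym (*-assoc S _ _)))

      -- For a marked coordinate, (1 - κ)S + κS(1 - κ) = S(1 - κ²) ≥ 1.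
      mix : ∀ e {ψ} → 0ℚ ≤ ψ → ψ ≤ (1ℚ - κ) * (ψ * gain e) + κ * (ψ * loss e)
      mix false {ψ} h = ≤-reflexive (lem κ ψ)
        where
        lem : ∀ κ ψ → ψ ≡ (1ℚ - κ) * (ψ * 1ℚ) + κ * (ψ * 1ℚ)
        lem = solve-∀ ℚ-ring
      mix true {ψ} h = subst₂ _≤_ (*-identityʳ ψ) (lem κ S ψ) (*-monoˡ h 1≤S)
        where
        lem : ∀ κ S ψ → ψ * (S * (1ℚ - κ * κ)) ≡ (1ℚ - κ) * (ψ * S) + κ * (ψ * (S * (1ℚ - κ)))
        lem = solve-∀ ℚ-ring

      -- The same identity read as (1 + κ) · S(1 - κ) ≥ 1. The empty summand `0ℚ * 0ℚ` gives the
      -- shape to which `sumWords-lin` applies.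
      crude : ∀ e {ψ} → 0ℚ ≤ ψ → ψ ≤ (1ℚ + κ) * (ψ * loss e) + 0ℚ * 0ℚ
      crude false {ψ} h = ≤-from (*-nonneg 0≤κ h) (lem κ ψ)
        where
        lem : ∀ κ ψ → ψ + κ * ψ ≡ (1ℚ + κ) * (ψ * 1ℚ) + 0ℚ * 0ℚ
        lem = solve-∀ ℚ-ring
      crude true {ψ} h = subst₂ _≤_ (*-identityʳ ψ) (lem κ S ψ) (*-monoˡ h 1≤S)
        where
        lem : ∀ κ S ψ → ψ * (S * (1ℚ - κ * κ)) ≡ (1ℚ + κ) * (ψ * (S * (1ℚ - κ))) + 0ℚ * 0ℚ
        lem = solve-∀ ℚ-ring

      -- If the section sum Y is below (1 - κ)N, the bound that always allows for a mismatch is good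
      -- enough, because 1 + κ ≤ 2 - Y/N.
      small-case : ∀ {X B N Y T} → 0ℚ ≤ N → 0ℚ ≤ T → X ≤ (1ℚ + κ) * B → B * N ≤ T → Y ≤ (1ℚ - κ) * N →
        X * (N * N) ≤ T * (2ℚ * N - Y)
      small-case {X} {B} {N} {Y} {T} 0≤N 0≤T crude BN small = begin
        X * (N * N)                    ≤⟨ *-monoʳ (*-nonneg 0≤N 0≤N) crude ⟩
        (1ℚ + κ) * B * (N * N)         ≡⟨ lem₁ κ B N ⟩
        (1ℚ + κ) * N * (B * N)         ≤⟨ *-monoˡ (*-nonneg (+-nonneg 0≤1 0≤κ) 0≤N) BN ⟩
        (1ℚ + κ) * N * T               ≤⟨ ≤-from (*-nonneg 0≤T (≤⇒0≤- small)) (lem₂ κ N T Y) ⟩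
        T * (2ℚ * N - Y)               ∎
        where
        open ≤-Reasoning
        lem₁ : ∀ κ B N → (1ℚ + κ) * B * (N * N) ≡ (1ℚ + κ) * N * (B * N)
        lem₁ = solve-∀ ℚ-ring
        lem₂ : ∀ κ N T Y → (1ℚ + κ) * N * T + T * ((1ℚ - κ) * N - Y) ≡ T * ((1ℚ + 1ℚ) * N - Y)
        lem₂ = solve-∀ ℚ-ring

      -- Division-free form of X/T · N ≤ 2 − Y/N for the section sums X and Y, where N is the sum of the maxima.
      section : ∀ {X A B N Y T} → 0ℚ ≤ N → 0ℚ ≤ Y → Y ≤ N → 0ℚ ≤ T →
        X ≤ (1ℚ - κ) * A + κ * B → X ≤ (1ℚ + κ) * B → A * Y ≤ T → B * N ≤ T → X * (N * N) ≤ T * (2ℚ * N - Y)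
      section {X} {A} {B} {N} {Y} {T} 0≤N 0≤Y Y≤N 0≤T mixed crude AY BN with ≤-total Y ((1ℚ - κ) * N)
      ... | inj₁ small = small-case 0≤N 0≤T crude BN small
      ... | inj₂ large with 0ℚ <? Y
      ...   | yes 0<Y = cancel-pos 0<Y (begin
        X * (N * N) * Y                                            ≤⟨ *-monoʳ 0≤Y (*-monoʳ (*-nonneg 0≤N 0≤N) mixed) ⟩
        ((1ℚ - κ) * A + κ * B) * (N * N) * Y                       ≡⟨ lem₁ κ A B N Y ⟩
        (1ℚ - κ) * (N * N) * (A * Y) + κ * N * Y * (B * N)         ≤⟨ +-mono-≤ (*-monoˡ (*-nonneg 0≤r (*-nonneg 0≤N 0≤N)) AY) (*-monoˡ (*-nonneg (*-nonneg 0≤κ 0≤N) 0≤Y) BN) ⟩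
        -- With u = Y/N the claim is (1 - κ)/u + κ ≤ 2 - u, that is (1 - u)(u - (1 - κ)) ≥ 0, true
        -- for u between 1 - κ and 1.
        (1ℚ - κ) * (N * N) * T + κ * N * Y * T                     ≤⟨ ≤-from (*-nonneg 0≤T (*-nonneg (≤⇒0≤- Y≤N) (≤⇒0≤- large))) (lem₂ κ N Y T) ⟩
        T * (2ℚ * N - Y) * Y                                       ∎)
        where
        open ≤-Reasoning
        lem₁ : ∀ κ A B N Y → ((1ℚ - κ) * A + κ * B) * (N * N) * Y ≡ (1ℚ - κ) * (N * N) * (A * Y) + κ * N * Y * (B * N)
        lem₁ = solve-∀ ℚ-ring
        lem₂ : ∀ κ N Y T → (1ℚ - κ) * (N * N) * T + κ * N * Y * T + T * ((N - Y) * (Y - (1ℚ - κ) * N)) ≡ T * ((1ℚ + 1ℚ) * N - Y) * Y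
        lem₂ = solve-∀ ℚ-ring
      ...   | no Y≯0 = small-case 0≤N 0≤T crude BN (≤-trans (≮⇒≥ Y≯0) (*-nonneg 0≤r 0≤N))

      -- The marking may depend on `x` but not on `y`. For indicators of two sets it is a
      -- certificate of `x`: each `y` in the other set must differ from `x` at many marked
      -- coordinates, relative to their number.
      Bound : ∀ n → (Vec V n → ℚ) → (Vec V n → ℚ) → Set
      Bound n Ψ Φ = ∀ x → Σ (Vec Bool n) λ I → ∀ y → Ψ x * Φ y * weight I x y ≤ c

      -- Induction on the first coordinate. Against the section of `Φ` at the same letter the first
      -- coordinates agree, which yields `gain`; against `U`, the pointwise maximum of the sections,
      -- they differ at worst, which yields `loss`. `section` combines the two for each letter, and
      -- summing leaves an expression quadratic in the total of `Φ`.
      concentration : ∀ n (Ψ Φ : Vec V n → ℚ) → (∀ x → 0ℚ ≤ Ψ x) → (∀ y → 0ℚ ≤ Φ y) → Bound n Ψ Φ →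
        sumWords n Ψ * sumWords n Φ ≤ c * pow (alphabet * alphabet) n
      concentration zero Ψ Φ hΨ hΦ bound with bound []
      ... | [] , h = subst₂ _≤_ (trans (cong (Ψ [] * Φ [] *_) (*-identityˡ 1ℚ)) (*-identityʳ _)) (sym (*-identityʳ c)) (h [])
      concentration (suc n) Ψ Φ hΨ hΦ bound = finish
        where
        U : Vec V n → ℚ
        U y = best (λ b → Φ (b ∷ y))
        N T : ℚ
        N = sumWords n U
        T = c * pow (alphabet * alphabet) n
        X Y : V → ℚ
        X a = sumWords n (λ x → Ψ (a ∷ x))
        Y a = sumWords n (λ y → Φ (a ∷ y))
        mark : ∀ a x → Vec Bool (suc n)
        mark a x = proj₁ (bound (a ∷ x))
        e : V → Vec V n → Bool
        e a x = head (mark a x)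
        I : V → Vec V n → Vec Bool n
        I a x = tail (mark a x)
        hyp : ∀ a x b y → Ψ (a ∷ x) * Φ (b ∷ y) * weight (e a x ∷ I a x) (a ∷ x) (b ∷ y) ≤ c
        hyp a x b y with bound (a ∷ x)
        ... | _ ∷ _ , h = h (b ∷ y)
        Ψ₁ Ψ₂ : V → Vec V n → ℚ
        Ψ₁ a x = Ψ (a ∷ x) * gain (e a x)
        Ψ₂ a x = Ψ (a ∷ x) * loss (e a x)
        0≤N : 0ℚ ≤ N
        0≤N = sumWords-nonneg n (λ y → best-nonneg (λ b → Φ (b ∷ y)))
        0≤alphabet : 0ℚ ≤ alphabet
        0≤alphabet = sumℚ-nonneg (λ _ → 0≤1) (allFin t)
        0≤T : 0ℚ ≤ T
        0≤T = *-nonneg 0≤c (pow-nonneg (*-nonneg 0≤alphabet 0≤alphabet) n)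
        first : ∀ a → sumWords n (Ψ₁ a) * Y a ≤ T
        first a = concentration n (Ψ₁ a) (λ y → Φ (a ∷ y)) (λ x → *-nonneg (hΨ (a ∷ x)) (gain-nonneg (e a x))) (λ y → hΦ (a ∷ y))
          λ x → I a x , λ y → ≤-trans (≤-reflexive (trans (lem (Ψ (a ∷ x)) (gain (e a x)) (Φ (a ∷ y)) (weight (I a x) x y))
            (cong (Ψ (a ∷ x) * Φ (a ∷ y) *_) (sym (weight-same (e a x) (I a x) a x y))))) (hyp a x a y)
          where
          lem : ∀ ψ g φ w → ψ * g * φ * w ≡ ψ * φ * (g * w)
          lem = solve-∀ ℚ-ring
        second : ∀ a → sumWords n (Ψ₂ a) * N ≤ T
        second a = concentration n (Ψ₂ a) U (λ x → *-nonneg (hΨ (a ∷ x)) (loss-nonneg (e a x))) (λ y → best-nonneg (λ b → Φ (b ∷ y)))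
          λ x → I a x , λ y → pointwise x y (best-attained (λ b → Φ (b ∷ y)))
          where
          lem : ∀ ψ g φ w → ψ * g * φ * w ≡ ψ * φ * (g * w)
          lem = solve-∀ ℚ-ring
          lem₀ : ∀ ψ w → ψ * 0ℚ * w ≡ 0ℚ
          lem₀ = solve-∀ ℚ-ring
          pointwise : ∀ x y → (U y ≡ 0ℚ ⊎ ∃ λ b → U y ≡ Φ (b ∷ y)) → Ψ₂ a x * U y * weight (I a x) x y ≤ c
          pointwise x y (inj₁ eq) = subst (λ u → Ψ₂ a x * u * weight (I a x) x y ≤ c) (sym eq)
            (≤-trans (≤-reflexive (lem₀ (Ψ₂ a x) (weight (I a x) x y))) 0≤c)
          pointwise x y (inj₂ (b , eq)) = subst (λ u → Ψ₂ a x * u * weight (I a x) x y ≤ c) (sym eq)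
            (≤-trans (≤-reflexive (lem (Ψ (a ∷ x)) (loss (e a x)) (Φ (b ∷ y)) (weight (I a x) x y)))
              (≤-trans (*-monoˡ (*-nonneg (hΨ (a ∷ x)) (hΦ (b ∷ y))) (weight-differ (e a x) (I a x) a b x y)) (hyp a x b y)))
        each : ∀ a → X a * (N * N) ≤ T * (2ℚ * N - Y a)
        each a = section 0≤N (sumWords-nonneg n (λ y → hΦ (a ∷ y))) (sumWords-mono n (λ y → best-≥ (λ b → Φ (b ∷ y)) a)) 0≤T
          (≤-trans (sumWords-mono n (λ x → mix (e a x) (hΨ (a ∷ x)))) (≤-reflexive (sumWords-lin n (Ψ₁ a) (Ψ₂ a) (1ℚ - κ) κ)))
          (≤-trans (sumWords-mono n (λ x → crude (e a x) (hΨ (a ∷ x)))) (≤-reflexive (trans (sumWords-lin n (Ψ₂ a) (λ _ → 0ℚ) (1ℚ + κ) 0ℚ) (lem (1ℚ + κ) (sumWords n (Ψ₂ a)) (sumWords n (λ _ → 0ℚ))))))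
          (first a) (second a)
          where
          lem : ∀ k x z → k * x + 0ℚ * z ≡ k * x
          lem = solve-∀ ℚ-ring
        total : ∀ as → sumℚ X as * (N * N) ≤ T * (2ℚ * sumℚ (λ _ → 1ℚ) as * N - sumℚ Y as)
        total [] = ≤-reflexive (lem N T)
          where
          lem : ∀ N T → 0ℚ * (N * N) ≡ T * ((1ℚ + 1ℚ) * 0ℚ * N - 0ℚ)
          lem = solve-∀ ℚ-ring
        total (a ∷ as) = ≤-trans (≤-reflexive (*-distribʳ-+ (N * N) (X a) (sumℚ X as))) (≤-trans (+-mono-≤ (each a) (total as))
          (≤-reflexive (lem T N (Y a) (sumℚ (λ _ → 1ℚ) as) (sumℚ Y as))))
          where
          lem : ∀ T N y l s → T * ((1ℚ + 1ℚ) * N - y) + T * ((1ℚ + 1ℚ) * l * N - s) ≡ T * ((1ℚ + 1ℚ) * (1ℚ + l) * N - (y + s))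
          lem = solve-∀ ℚ-ring
        ΣX ΣY : ℚ
        ΣX = sumℚ X (allFin t)
        ΣY = sumℚ Y (allFin t)
        0≤ΣY : 0ℚ ≤ ΣY
        0≤ΣY = sumℚ-nonneg (λ a → sumWords-nonneg n (λ y → hΦ (a ∷ y))) (allFin t)
        goal : ΣX * ΣY ≤ T * (alphabet * alphabet) → ΣX * ΣY ≤ c * pow (alphabet * alphabet) (suc n)
        goal h = ≤-trans h (≤-reflexive (lem c (pow (alphabet * alphabet) n) (alphabet * alphabet)))
          where
          lem : ∀ c p a → c * p * a ≡ c * (a * p)
          lem = solve-∀ ℚ-ring
        finish : ΣX * ΣY ≤ c * pow (alphabet * alphabet) (suc n)
        finish with 0ℚ <? N
        ... | yes 0<N = goal (cancel-pos 0<N (cancel-pos 0<N (begin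
          ΣX * ΣY * N * N                                       ≡⟨ lem₁ ΣX ΣY N ⟩
          ΣX * (N * N) * ΣY                                     ≤⟨ *-monoʳ 0≤ΣY (total (allFin t)) ⟩
          -- Completing the square: (2aN - s)s ≤ (aN)² for a the alphabet size and s the sum `ΣY`.
          T * (2ℚ * alphabet * N - ΣY) * ΣY                     ≤⟨ ≤-from (*-nonneg 0≤T (square-nonneg (alphabet * N - ΣY))) (lem₂ T alphabet N ΣY) ⟩
          T * (alphabet * alphabet) * N * N                     ∎)))
          where
          open ≤-Reasoning
          lem₁ : ∀ x y n → x * y * n * n ≡ x * (n * n) * y
          lem₁ = solve-∀ ℚ-ring
          lem₂ : ∀ T a n y → T * ((1ℚ + 1ℚ) * a * n - y) * y + T * ((a * n - y) * (a * n - y)) ≡ T * (a * a) * n * n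
          lem₂ = solve-∀ ℚ-ring
        -- If the maxima sum to zero, so do all sections of `Φ`, and the product vanishes.
        ... | no N≯0 = goal (≤-trans (≤-reflexive (trans (cong (ΣX *_) ΣY≡0) (*-zeroʳ ΣX))) (*-nonneg 0≤T (*-nonneg 0≤alphabet 0≤alphabet)))
          where
          Y≤0 : ∀ a → Y a ≤ 0ℚ
          Y≤0 a = ≤-trans (sumWords-mono n (λ y → best-≥ (λ b → Φ (b ∷ y)) a)) (≮⇒≥ N≯0)
          sum0 : ∀ as → sumℚ Y as ≤ 0ℚ
          sum0 [] = ≤-refl
          sum0 (a ∷ as) = +-mono-≤ (Y≤0 a) (sum0 as)
          ΣY≡0 : ΣY ≡ 0ℚ
          ΣY≡0 = ≤-antisym (sum0 (allFin t)) 0≤ΣY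

-- Naturals inside the rationals, powers, and partial sums of the exponential series.

module Rationals where

  open Basics using (sumOver)
  open Product
  open import Data.Integer as ℤ using (+<+; +≤+) renaming (+_ to pos)
  import Data.Integer.Properties as ℤₚ
  open import Data.List using ([]; _∷_)
  open import Data.Nat as ℕ using (ℕ; zero; suc; z≤n; s≤s)
  import Data.Nat.Properties as ℕₚ
  open import Data.Product using (_×_; _,_; ∃)
  open import Data.Rational as ℚ using (ℚ; mkℚ; 0ℚ; 1ℚ; _+_; _*_; _-_; -_; _≤_; _<_; toℚᵘ)
  open import Data.Rational.Properties
  open import Data.Rational.Unnormalised as ℚᵘ using (ℚᵘ; mkℚᵘ; *≡*; *≤*; *<*)
  import Data.Rational.Unnormalised.Properties as ℚᵘₚ
  open import Data.Empty using (⊥-elim)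
  open import Relation.Nullary using (yes; no)
  open import Relation.Binary.PropositionalEquality
  open import Tactic.RingSolver using (solve-∀)

  toℚᵘ-fromℕ : ∀ n → toℚᵘ (fromℕ n) ℚᵘ.≃ mkℚᵘ (pos n) 0
  toℚᵘ-fromℕ n = toℚᵘ-fromℚᵘ (mkℚᵘ (pos n) 0)

  fromℕ-+ : ∀ m n → fromℕ (m ℕ.+ n) ≡ fromℕ m + fromℕ n
  fromℕ-+ m n = toℚᵘ-injective (ℚᵘₚ.≃-trans (toℚᵘ-fromℕ (m ℕ.+ n)) (ℚᵘₚ.≃-sym (ℚᵘₚ.≃-trans (toℚᵘ-homo-+ (fromℕ m) (fromℕ n))
    (ℚᵘₚ.≃-trans (ℚᵘₚ.+-cong (toℚᵘ-fromℕ m) (toℚᵘ-fromℕ n)) (*≡* (cong (ℤ._* pos 1) (cong₂ ℤ._+_ (ℤₚ.*-identityʳ (pos m)) (ℤₚ.*-identityʳ (pos n)))))))))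

  fromℕ-* : ∀ m n → fromℕ (m ℕ.* n) ≡ fromℕ m * fromℕ n
  fromℕ-* m n = toℚᵘ-injective (ℚᵘₚ.≃-trans (toℚᵘ-fromℕ (m ℕ.* n)) (ℚᵘₚ.≃-sym (ℚᵘₚ.≃-trans (toℚᵘ-homo-* (fromℕ m) (fromℕ n))
    (ℚᵘₚ.≃-trans (ℚᵘₚ.*-cong (toℚᵘ-fromℕ m) (toℚᵘ-fromℕ n)) (*≡* (cong (ℤ._* pos 1) (sym (ℤₚ.pos-* m n))))))))

  fromℕ-mono : ∀ {m n} → m ℕ.≤ n → fromℕ m ≤ fromℕ n
  fromℕ-mono {m} {n} h = toℚᵘ-cancel-≤ (ℚᵘₚ.≤-respˡ-≃ (ℚᵘₚ.≃-sym (toℚᵘ-fromℕ m)) (ℚᵘₚ.≤-respʳ-≃ (ℚᵘₚ.≃-sym (toℚᵘ-fromℕ n))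
    (*≤* (subst₂ ℤ._≤_ (sym (ℤₚ.*-identityʳ (pos m))) (sym (ℤₚ.*-identityʳ (pos n))) (+≤+ h)))))

  fromℕ-reflect : ∀ {m n} → fromℕ m ≤ fromℕ n → m ℕ.≤ n
  fromℕ-reflect {m} {n} h with ℚᵘₚ.≤-respˡ-≃ (toℚᵘ-fromℕ m) (ℚᵘₚ.≤-respʳ-≃ (toℚᵘ-fromℕ n) (toℚᵘ-mono-≤ h))
  ... | *≤* le = ℤₚ.drop‿+≤+ (subst₂ ℤ._≤_ (ℤₚ.*-identityʳ (pos m)) (ℤₚ.*-identityʳ (pos n)) le)

  fromℕ-nonneg : ∀ n → 0ℚ ≤ fromℕ n
  fromℕ-nonneg n = fromℕ-mono {0} {n} z≤n

  0<1 : 0ℚ < 1ℚ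
  0<1 = positive⁻¹ 1ℚ

  fromℕ-pos : ∀ {n} → 1 ℕ.≤ n → 0ℚ < fromℕ n
  fromℕ-pos {n} h = <-≤-trans 0<1 (fromℕ-mono {1} {n} h)

  divℕ-fromℕ : ∀ a b → 1 ℕ.≤ b → divℕ a b * fromℕ b ≡ fromℕ a
  divℕ-fromℕ a (suc b) _ = toℚᵘ-injective (ℚᵘₚ.≃-trans (toℚᵘ-homo-* (divℕ a (suc b)) (fromℕ (suc b)))
    (ℚᵘₚ.≃-trans (ℚᵘₚ.*-cong (toℚᵘ-fromℚᵘ (mkℚᵘ (pos a) b)) (toℚᵘ-fromℕ (suc b)))
      (ℚᵘₚ.≃-trans (*≡* (trans (ℤₚ.*-identityʳ (pos a ℤ.* pos (suc b))) (cong (λ x → pos a ℤ.* pos (suc x)) (sym (ℕₚ.*-identityʳ b))))) (ℚᵘₚ.≃-sym (toℚᵘ-fromℕ a)))))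

  divℕ-nonneg : ∀ a b → 0ℚ ≤ divℕ a b
  divℕ-nonneg a zero = ≤-refl
  divℕ-nonneg a (suc b) = nonNegative⁻¹ (divℕ a (suc b)) {{normalize-nonNeg a (suc b)}}

  fromℕ-sum : ∀ {A : Set} (f : A → ℕ) xs → sumℚ (λ x → fromℕ (f x)) xs ≡ fromℕ (sumOver f xs)
  fromℕ-sum f [] = refl
  fromℕ-sum f (x ∷ xs) = trans (cong (fromℕ (f x) +_) (fromℕ-sum f xs)) (sym (fromℕ-+ (f x) _))

  fromℕ-^ : ∀ m k → fromℕ (m ℕ.^ k) ≡ pow (fromℕ m) k
  fromℕ-^ m zero = refl
  fromℕ-^ m (suc k) = trans (fromℕ-* m (m ℕ.^ k)) (cong (fromℕ m *_) (fromℕ-^ m k))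

  pow-mono : ∀ {x y} → 0ℚ ≤ x → x ≤ y → ∀ k → pow x k ≤ pow y k
  pow-mono h le zero = ≤-refl
  pow-mono h le (suc k) = *-mono (pow-nonneg h k) (≤-trans h le) le (pow-mono h le k)

  pow-≤1 : ∀ {x} → 0ℚ ≤ x → x ≤ 1ℚ → ∀ k → pow x k ≤ 1ℚ
  pow-≤1 h le zero = ≤-refl
  pow-≤1 {x} h le (suc k) = ≤-trans (*-mono (pow-nonneg h k) 0≤1 le (pow-≤1 h le k)) (≤-reflexive (*-identityˡ 1ℚ))

  pow-* : ∀ x m n → pow x (m ℕ.* n) ≡ pow (pow x n) m
  pow-* x zero n = refl
  pow-* x (suc m) n = trans (pow-+ x n (m ℕ.* n)) (cong (pow x n *_) (pow-* x m n))

  pow-distrib : ∀ x y k → pow (x * y) k ≡ pow x k * pow y k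
  pow-distrib x y zero = refl
  pow-distrib x y (suc k) = trans (cong (x * y *_) (pow-distrib x y k)) (lem x y (pow x k) (pow y k))
    where
    lem : ∀ x y p q → x * y * (p * q) ≡ x * p * (y * q)
    lem = solve-∀ ℚ-ring

  pow-1 : ∀ k → pow 1ℚ k ≡ 1ℚ
  pow-1 zero = refl
  pow-1 (suc k) = trans (*-identityˡ _) (pow-1 k)

  bernoulli : ∀ {x} → 0ℚ ≤ x → x ≤ 1ℚ → ∀ k → 1ℚ - fromℕ k * x ≤ pow (1ℚ - x) k
  bernoulli {x} h le zero = ≤-reflexive (lem x)
    where
    lem : ∀ x → 1ℚ - 0ℚ * x ≡ 1ℚ
    lem = solve-∀ ℚ-ring
  bernoulli {x} h le (suc k) = ≤-trans (≤-from (*-nonneg (fromℕ-nonneg k) (*-nonneg h h)) (trans (cong (λ s → 1ℚ - s * x + fromℕ k * (x * x)) (fromℕ-+ 1 k)) (lem x (fromℕ k)))) (*-monoˡ (≤⇒0≤- le) (bernoulli h le k))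
    where
    lem : ∀ x k → 1ℚ - (1ℚ + k) * x + k * (x * x) ≡ (1ℚ - x) * (1ℚ - k * x)
    lem = solve-∀ ℚ-ring

  square-cancel : ∀ {x y} → 0ℚ ≤ y → x * x ≤ y * y → x ≤ y
  square-cancel {x} {y} 0≤y h with x ≤? y
  ... | yes le = le
  ... | no gt = ⊥-elim (<-irrefl refl (≤-<-trans h (≤-<-trans (*-monoˡ 0≤y (<⇒≤ y<x)) (*-monoˡ-<-pos x {{ℚ.positive (≤-<-trans 0≤y y<x)}} y<x))))
    where
    y<x : y < x
    y<x = ≰⇒> gt

  expTerm-nonneg : ∀ {x} → 0ℚ ≤ x → ∀ k → 0ℚ ≤ expTerm x k
  expTerm-nonneg h zero = 0≤1
  expTerm-nonneg h (suc k) = *-nonneg (*-nonneg (expTerm-nonneg h k) h) (divℕ-nonneg 1 (suc k))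

  expPartial-nonneg : ∀ {x} → 0ℚ ≤ x → ∀ N → 0ℚ ≤ expPartial x N
  expPartial-nonneg h zero = ≤-refl
  expPartial-nonneg h (suc N) = +-nonneg (expPartial-nonneg h N) (expTerm-nonneg h N)

  expTerm-mono : ∀ {x y} → 0ℚ ≤ x → x ≤ y → ∀ k → expTerm x k ≤ expTerm y k
  expTerm-mono h le zero = ≤-refl
  expTerm-mono h le (suc k) = *-monoʳ (divℕ-nonneg 1 (suc k)) (*-mono h (expTerm-nonneg (≤-trans h le) k) (expTerm-mono h le k) le)

  expPartial-mono : ∀ {x y} → 0ℚ ≤ x → x ≤ y → ∀ N → expPartial x N ≤ expPartial y N
  expPartial-mono h le zero = ≤-refl
  expPartial-mono h le (suc N) = +-mono-≤ (expPartial-mono h le N) (expTerm-mono h le N)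

  -- The tangent bound w^(k+1)/(k+1)! ≤ y^(k+1)/(k+1)! + x w^k/k! for w = y + x.
  expTerm-tangent : ∀ {x y} → 0ℚ ≤ x → 0ℚ ≤ y → ∀ k → expTerm (y + x) (suc k) ≤ expTerm y (suc k) + x * expTerm (y + x) k
  expTerm-tangent {x} {y} 0≤x 0≤y zero = ≤-reflexive (lem x y)
    where
    lem : ∀ x y → 1ℚ * (y + x) * 1ℚ ≡ 1ℚ * y * 1ℚ + x * 1ℚ
    lem = solve-∀ ℚ-ring
  expTerm-tangent {x} {y} 0≤x 0≤y (suc k) = begin
    a * (y + x) * i                               ≡⟨ lem₁ a x y i ⟩
    a * (y * i) + a * x * i                       ≤⟨ +-monoˡ-≤ (a * x * i) (*-monoʳ (*-nonneg 0≤y 0≤i) (expTerm-tangent 0≤x 0≤y k)) ⟩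
    (b + x * c) * (y * i) + a * x * i             ≡⟨ lem₂ a b c x y i ⟩
    b * y * i + x * i * (c * y) + a * x * i       ≤⟨ +-monoˡ-≤ (a * x * i) (+-monoʳ-≤ (b * y * i) (*-monoˡ (*-nonneg 0≤x 0≤i) (*-monoˡ 0≤c y≤w))) ⟩
    b * y * i + x * i * (c * w) + a * x * i       ≡⟨ cong (λ s → b * y * i + x * i * s + a * x * i) cw ⟩
    b * y * i + x * i * (a * j) + a * x * i       ≡⟨ lem₃ a b x y i j ⟩
    b * y * i + x * a * (i * (1ℚ + j))            ≡⟨ cong (λ s → b * y * i + x * a * s) (trans (cong (i *_) (sym (fromℕ-+ 1 (suc k)))) (divℕ-fromℕ 1 (suc (suc k)) (s≤s z≤n))) ⟩
    b * y * i + x * a * 1ℚ                        ≡⟨ cong (b * y * i +_) (*-identityʳ (x * a)) ⟩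
    b * y * i + x * a                             ∎
    where
    open ≤-Reasoning
    w a b c i j : ℚ
    w = y + x
    a = expTerm w (suc k)
    b = expTerm y (suc k)
    c = expTerm w k
    i = divℕ 1 (suc (suc k))
    j = fromℕ (suc k)
    0≤i : 0ℚ ≤ i
    0≤i = divℕ-nonneg 1 (suc (suc k))
    0≤c : 0ℚ ≤ c
    0≤c = expTerm-nonneg (+-nonneg 0≤y 0≤x) k
    y≤w : y ≤ w
    y≤w = ≤-from 0≤x refl
    cw : c * w ≡ a * j
    cw = sym (trans (*-assoc (c * w) (divℕ 1 (suc k)) j) (trans (cong (c * w *_) (divℕ-fromℕ 1 (suc k) (s≤s z≤n))) (*-identityʳ (c * w))))
    lem₁ : ∀ a x y i → a * (y + x) * i ≡ a * (y * i) + a * x * i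
    lem₁ = solve-∀ ℚ-ring
    lem₂ : ∀ a b c x y i → (b + x * c) * (y * i) + a * x * i ≡ b * y * i + x * i * (c * y) + a * x * i
    lem₂ = solve-∀ ℚ-ring
    lem₃ : ∀ a b x y i j → b * y * i + x * i * (a * j) + a * x * i ≡ b * y * i + x * a * (i * (1ℚ + j))
    lem₃ = solve-∀ ℚ-ring

  expPartial-tangent : ∀ {x y} → 0ℚ ≤ x → 0ℚ ≤ y → ∀ N → expPartial (y + x) (suc N) ≤ expPartial y (suc N) + x * expPartial (y + x) N
  expPartial-tangent {x} {y} 0≤x 0≤y zero = ≤-reflexive (lem x)
    where
    lem : ∀ x → 0ℚ + 1ℚ ≡ 0ℚ + 1ℚ + x * 0ℚ
    lem = solve-∀ ℚ-ring
  expPartial-tangent {x} {y} 0≤x 0≤y (suc N) = ≤-trans (+-mono-≤ (expPartial-tangent 0≤x 0≤y N) (expTerm-tangent 0≤x 0≤y N))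
    (≤-reflexive (lem (expPartial y (suc N)) x (expPartial (y + x) N) (expTerm y (suc N)) (expTerm (y + x) N)))
    where
    lem : ∀ p x q r s → p + x * q + (r + x * s) ≡ p + r + x * (q + s)
    lem = solve-∀ ℚ-ring

  -- The counterpart of exp(y + x) · (1 - x) ≤ exp(y) at a fixed truncation: it follows from the
  -- tangent bound because adding a term only increases the partial sum.
  expPartial-step : ∀ {x y} → 0ℚ ≤ x → 0ℚ ≤ y → ∀ N → expPartial (y + x) N * (1ℚ - x) ≤ expPartial y N
  expPartial-step {x} 0≤x 0≤y zero = ≤-reflexive (lem x)
    where
    lem : ∀ x → 0ℚ * (1ℚ - x) ≡ 0ℚ
    lem = solve-∀ ℚ-ring
  expPartial-step {x} {y} 0≤x 0≤y (suc N) = begin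
    e′ * (1ℚ - x)                                    ≤⟨ ≤-from (*-nonneg 0≤x (expTerm-nonneg (+-nonneg 0≤y 0≤x) N)) (lem e x (expTerm (y + x) N)) ⟩
    e′ - x * e                                       ≤⟨ +-monoˡ-≤ (- (x * e)) (expPartial-tangent 0≤x 0≤y N) ⟩
    expPartial y (suc N) + x * e - x * e             ≡⟨ lem′ (expPartial y (suc N)) (x * e) ⟩
    expPartial y (suc N)                             ∎
    where
    open ≤-Reasoning
    e e′ : ℚ
    e = expPartial (y + x) N
    e′ = expPartial (y + x) (suc N)
    lem : ∀ e x s → (e + s) * (1ℚ - x) + x * s ≡ e + s - x * e
    lem = solve-∀ ℚ-ring
    lem′ : ∀ a b → a + b - b ≡ a
    lem′ = solve-∀ ℚ-ring

  expPartial-zero : ∀ N → expPartial 0ℚ N ≤ 1ℚ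
  expPartial-zero zero = 0≤1
  expPartial-zero (suc zero) = ≤-refl
  expPartial-zero (suc (suc N)) = ≤-trans (+-monoʳ-≤ (expPartial 0ℚ (suc N)) (≤-reflexive (lem (expTerm 0ℚ N) (divℕ 1 (suc N))))) (≤-trans (≤-reflexive (+-identityʳ _)) (expPartial-zero (suc N)))
    where
    lem : ∀ a b → a * 0ℚ * b ≡ 0ℚ
    lem = solve-∀ ℚ-ring

  -- Replaces exp(mx) ≤ (1 - x)^(-m): every factor 1 - x lowers the argument by x.
  expPartial-pow : ∀ {x} → 0ℚ ≤ x → x ≤ 1ℚ → ∀ m N → expPartial (fromℕ m * x) N * pow (1ℚ - x) m ≤ 1ℚ
  expPartial-pow {x} 0≤x x≤1 zero N = ≤-trans (≤-reflexive (trans (*-identityʳ _) (cong (λ s → expPartial s N) (*-zeroˡ x)))) (expPartial-zero N)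
  expPartial-pow {x} 0≤x x≤1 (suc m) N = begin
    expPartial (fromℕ (suc m) * x) N * ((1ℚ - x) * p)   ≡⟨ cong (λ s → expPartial s N * ((1ℚ - x) * p)) (trans (cong (_* x) (fromℕ-+ 1 m)) (lem (fromℕ m) x)) ⟩
    expPartial (fromℕ m * x + x) N * ((1ℚ - x) * p)     ≡⟨ *-assoc (expPartial (fromℕ m * x + x) N) (1ℚ - x) p ⟨
    expPartial (fromℕ m * x + x) N * (1ℚ - x) * p       ≤⟨ *-monoʳ (pow-nonneg (≤⇒0≤- x≤1) m) (expPartial-step 0≤x (*-nonneg (fromℕ-nonneg m) 0≤x) N) ⟩
    expPartial (fromℕ m * x) N * p                      ≤⟨ expPartial-pow 0≤x x≤1 m N ⟩
    1ℚ                                                  ∎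
    where
    open ≤-Reasoning
    p = pow (1ℚ - x) m
    lem : ∀ m x → (1ℚ + m) * x ≡ m * x + x
    lem = solve-∀ ℚ-ring

  archimedean : ∀ δ → 0ℚ < δ → ∃ λ b → 1ℚ ≤ δ * fromℕ b
  -- For δ = (a + 1)/(d + 1) the denominator itself is large enough.
  archimedean δ@(mkℚ (pos (suc a)) d _) _ = suc d , toℚᵘ-cancel-≤ (ℚᵘₚ.≤-respʳ-≃ (ℚᵘₚ.≃-sym (ℚᵘₚ.≃-trans (toℚᵘ-homo-* δ (fromℕ (suc d))) (ℚᵘₚ.*-congˡ {toℚᵘ δ} (toℚᵘ-fromℕ (suc d)))))
    (*≤* (+≤+ (subst₂ ℕ._≤_ (sym (trans (ℕₚ.+-identityʳ _) (ℕₚ.*-identityʳ (suc d)))) (sym (ℕₚ.*-identityʳ _)) (ℕₚ.m≤m+n (suc d) (a ℕ.* suc d))))))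
  archimedean (mkℚ (pos zero) d _) (ℚ.*<* (+<+ ()))
  archimedean (mkℚ (ℤ.-[1+ a ]) d _) (ℚ.*<* ())

  -- Rounding up ℓ/δ.
  round-up : ∀ {δ} ℓ → 0ℚ < δ → δ < 1ℚ → 1 ℕ.≤ ℓ → ∃ λ m → fromℕ ℓ ≤ δ * fromℕ m × δ * fromℕ m ≤ fromℕ (ℓ ℕ.+ ℓ)
  round-up {δ} ℓ 0<δ δ<1 1≤ℓ with archimedean δ 0<δ
  ... | b , 1≤δb = search (ℓ ℕ.* b) (subst₂ _≤_ (*-identityʳ (fromℕ ℓ)) (trans (lem (fromℕ ℓ) δ (fromℕ b)) (cong (δ *_) (sym (fromℕ-* ℓ b)))) (*-monoˡ (fromℕ-nonneg ℓ) 1≤δb))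
    where
    lem : ∀ l d b → l * (d * b) ≡ d * (l * b)
    lem = solve-∀ ℚ-ring
    search : ∀ m → fromℕ ℓ ≤ δ * fromℕ m → ∃ λ m → fromℕ ℓ ≤ δ * fromℕ m × δ * fromℕ m ≤ fromℕ (ℓ ℕ.+ ℓ)
    search zero h = ⊥-elim (<-irrefl refl (<-≤-trans (fromℕ-pos 1≤ℓ) (≤-trans h (≤-reflexive (*-zeroʳ δ)))))
    search (suc m) h with fromℕ ℓ ≤? δ * fromℕ m
    ... | yes h′ = search m h′
    -- The downward search stops just before δm falls below ℓ, and one more summand δ, at most 1 ≤
    -- ℓ, keeps the product below 2ℓ.
    ... | no ¬h = suc m , h , (begin
      δ * fromℕ (suc m)            ≡⟨ trans (cong (δ *_) (fromℕ-+ 1 m)) (lem′ δ (fromℕ m)) ⟩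
      δ * fromℕ m + δ              ≤⟨ +-mono-≤ (<⇒≤ (≰⇒> ¬h)) (≤-trans (<⇒≤ δ<1) (fromℕ-mono {1} {ℓ} 1≤ℓ)) ⟩
      fromℕ ℓ + fromℕ ℓ            ≡⟨ fromℕ-+ ℓ ℓ ⟨
      fromℕ (ℓ ℕ.+ ℓ)              ∎)
      where
      open ≤-Reasoning
      lem′ : ∀ d m → d * (1ℚ + m) ≡ d * m + d
      lem′ = solve-∀ ℚ-ring

-- Chebyshev's inequality for repeated letters, and level sizes at dyadic scales.

module Estimates where

  open Basics
  open Trees
  open Codes
  open Counting
  open Covers
  open Words
  open import Data.Bool using (Bool; true; false; _∧_; if_then_else_)
  open import Data.Bool.Properties using (T-≡)
  open import Data.Empty using (⊥; ⊥-elim)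
  open import Data.Fin using (Fin; zero; suc)
  open import Data.List using (List; []; _∷_; _++_; length; allFin; drop; upTo)
  open import Data.List.Properties using (length-drop)
  open import Data.List.Membership.Propositional using (_∈_)
  open import Data.List.Membership.Propositional.Properties using (∈-upTo⁺; ∈-++⁺ʳ)
  open import Data.List.Relation.Unary.Any as Any using (here; there)
  open import Data.Bool.ListAction using (any)
  open import Data.Nat as ℕ using (ℕ; zero; suc; _+_; _*_; _^_; _≤_; _<_; _∸_; z≤n; s≤s; _<ᵇ_; _≤ᵇ_; NonZero)
  open import Data.Nat.Properties
  open import Data.Nat.Tactic.RingSolver using (solve-∀)
  open import Data.Product using (_×_; _,_; ∃)
  open import Data.Sum using (_⊎_; inj₁; inj₂)
  open import Function using (_∘_; Equivalence)
  open import Relation.Nullary using (yes; no)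
  open import Relation.Binary.PropositionalEquality

  private variable
    A : Set
    n t : ℕ

  ≤-via : ∀ {a b e} → b ≡ a + e → a ≤ b
  ≤-via {a} {b} {e} eq = subst (a ≤_) (sym eq) (m≤m+n a e)

  2ab≤a²+b² : ∀ a b → 2 * (a * b) ≤ a * a + b * b
  2ab≤a²+b² a b with ≤-total a b
  ... | inj₁ a≤b with m≤n⇒∃[o]m+o≡n a≤b
  ...   | e , refl = ≤-via (ring a e)
    where
    ring : ∀ a e → a * a + (a + e) * (a + e) ≡ 2 * (a * (a + e)) + e * e
    ring = solve-∀
  2ab≤a²+b² a b | inj₂ b≤a with m≤n⇒∃[o]m+o≡n b≤a
  ...   | e , refl = ≤-via (ring b e)
    where
    ring : ∀ b e → (b + e) * (b + e) + b * b ≡ 2 * ((b + e) * b) + e * e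
    ring = solve-∀

  module _ {t : ℕ} (χ : Fin t → Bool) where

    hits : List (Fin t) → ℕ
    hits = sumOver (indicator ∘ χ)

    private
      d = hits (allFin t)

    hits-first : ∀ k → t * wordSum t k hits ≡ k * d * t ^ k
    hits-first zero = *-zeroʳ t
    hits-first (suc k) = begin
      t * sumOver (λ a → wordSum t k (λ v → indicator (χ a) + hits v)) (allFin t)
        ≡⟨ cong (t *_) (trans (sumOver-cong (allFin t) (λ {a} _ → trans (wordSum-+ k (λ _ → indicator (χ a)) hits) (cong (_+ S) (wordSum-const k (indicator (χ a))))))
             (trans (sumOver-+ (λ a → t ^ k * indicator (χ a)) (λ _ → S) (allFin t)) (cong₂ _+_ (sumOver-* (t ^ k) (indicator ∘ χ) (allFin t)) (sumOver-letters t S)))) ⟩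
      t * (t ^ k * d + t * S)        ≡⟨ cong (λ s → t * (t ^ k * d + s)) (hits-first k) ⟩
      t * (t ^ k * d + k * d * t ^ k) ≡⟨ ring t (t ^ k) d k ⟩
      suc k * d * (t * t ^ k)        ∎
      where
      open ≡-Reasoning
      S = wordSum t k hits
      ring : ∀ t p d k → t * (p * d + k * d * p) ≡ suc k * d * (t * p)
      ring = solve-∀

    hits² : List (Fin t) → ℕ
    hits² v = hits v * hits v

    -- The second moment of a binomial variable with success probability d/t, its variance estimated
    -- by kd/t.
    hits-second : ∀ k → t * (t * wordSum t k hits²) ≤ t ^ k * (k * d * t + k * d * (k * d))
    hits-second zero = ≤-reflexive (trans (cong (t *_) (*-zeroʳ t)) (*-zeroʳ t))
    hits-second (suc k) = begin
      t * (t * sumOver (λ a → wordSum t k (λ v → hits² (a ∷ v))) (allFin t))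
        ≡⟨ cong (λ s → t * (t * s)) (trans (sumOver-cong (allFin t) (λ {a} _ → each a))
             (trans (sumOver-+ (λ a → (t ^ k + 2 * S) * indicator (χ a)) (λ _ → Q) (allFin t)) (cong₂ _+_ (sumOver-* (t ^ k + 2 * S) (indicator ∘ χ) (allFin t)) (sumOver-letters t Q)))) ⟩
      t * (t * ((t ^ k + 2 * S) * d + t * Q))              ≡⟨ ring₁ t (t ^ k) S d Q ⟩
      t * (t * (t ^ k * d) + 2 * d * (t * S) + t * (t * Q)) ≤⟨ *-monoʳ-≤ t (+-mono-≤ (≤-reflexive (cong (λ s → t * (t ^ k * d) + 2 * d * s) (hits-first k))) (hits-second k)) ⟩
      t * (t * (t ^ k * d) + 2 * d * (k * d * t ^ k) + t ^ k * (k * d * t + k * d * (k * d))) ≤⟨ ≤-via (ring₂ t (t ^ k) d k) ⟩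
      t * t ^ k * (suc k * d * t + suc k * d * (suc k * d)) ∎
      where
      open ≤-Reasoning
      S = wordSum t k hits
      Q = wordSum t k hits²
      expand : ∀ b h → (indicator b + h) * (indicator b + h) ≡ indicator b + (2 * indicator b * h + h * h)
      expand true h = lem h
        where
        lem : ∀ h → (1 + h) * (1 + h) ≡ 1 + (2 * 1 * h + h * h)
        lem = solve-∀
      expand false h = refl
      each : ∀ a → wordSum t k (λ v → hits² (a ∷ v)) ≡ (t ^ k + 2 * S) * indicator (χ a) + Q
      each a = trans (wordSum-cong k (λ v _ → expand (χ a) (hits v))) (trans (wordSum-+ k (λ _ → indicator (χ a)) (λ v → 2 * indicator (χ a) * hits v + hits² v))
        (trans (cong₂ _+_ (wordSum-const k (indicator (χ a))) (trans (wordSum-+ k (λ v → 2 * indicator (χ a) * hits v) hits²) (cong (_+ Q) (wordSum-* k (2 * indicator (χ a)) hits))))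
          (lem (t ^ k) (indicator (χ a)) S Q)))
        where
        lem : ∀ p i s q → p * i + (2 * i * s + q) ≡ (p + 2 * s) * i + q
        lem = solve-∀
      ring₁ : ∀ t p s d q → t * (t * ((p + 2 * s) * d + t * q)) ≡ t * (t * (p * d) + 2 * d * (t * s) + t * (t * q))
      ring₁ = solve-∀
      ring₂ : ∀ t p d k → t * p * (suc k * d * t + suc k * d * (suc k * d)) ≡ t * (t * (p * d) + 2 * d * (k * d * p) + p * (k * d * t + k * d * (k * d))) + t * p * (d * d)
      ring₂ = solve-∀

    -- `f` is an event on which the number of hits is at most half its mean kd/t; Chebyshev bounds
    -- its probability by 4t/(kd). Everything is kept in the natural numbers, so the square is
    -- expanded and the mixed term moved to the other side.
    chebyshev : ∀ k (f : List (Fin t) → Bool) → (∀ v → f v ≡ true → 2 * (t * hits v) ≤ k * d) →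
      k * d * wordSum t k (indicator ∘ f) ≤ 4 * t * t ^ k
    chebyshev k f small with k * d in eq
    ... | zero = z≤n
    ... | suc a′ = *-cancelˡ-≤ a (+-cancelʳ-≤ (8 * (a * a * t ^ k)) _ _ (begin
      a * (a * W) + 8 * (a * a * t ^ k)                           ≡⟨ cong (a * (a * W) +_) (trans (lem₁ a (t ^ k)) (cong (λ s → 8 * a * s) (sym first))) ⟩
      a * (a * W) + 8 * a * (t * wordSum t k hits)                ≡⟨ cong₂ _+_ (sym (*-assoc a a W)) (sym (*-assoc (8 * a) t _)) ⟩
      a * a * W + 8 * a * t * wordSum t k hits                    ≡⟨ cong₂ _+_ (wordSum-* k (a * a) (indicator ∘ f)) (wordSum-* k (8 * a * t) hits) ⟨
      wordSum t k (λ v → a * a * indicator (f v)) + wordSum t k (λ v → 8 * a * t * hits v)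
        ≡⟨ wordSum-+ k (λ v → a * a * indicator (f v)) (λ v → 8 * a * t * hits v) ⟨
      wordSum t k (λ v → a * a * indicator (f v) + 8 * a * t * hits v)
        ≤⟨ wordSum-mono k (λ v _ → pointwise v) ⟩
      wordSum t k (λ v → 4 * t * t * hits² v + 4 * (a * a))
        ≡⟨ trans (wordSum-+ k (λ v → 4 * t * t * hits² v) (λ _ → 4 * (a * a))) (cong₂ _+_ (wordSum-* k (4 * t * t) hits²) (wordSum-const k (4 * (a * a)))) ⟩
      4 * t * t * wordSum t k hits² + t ^ k * (4 * (a * a))       ≡⟨ cong (_+ t ^ k * (4 * (a * a))) (lem₂ t (wordSum t k hits²)) ⟩
      4 * (t * (t * wordSum t k hits²)) + t ^ k * (4 * (a * a))   ≤⟨ +-monoˡ-≤ _ (*-monoʳ-≤ 4 second-moment) ⟩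
      4 * (t ^ k * (a * t + a * a)) + t ^ k * (4 * (a * a))       ≡⟨ lem₃ (t ^ k) a t ⟩
      a * (4 * t * t ^ k) + 8 * (a * a * t ^ k)                   ∎))
      where
      open ≤-Reasoning
      a = suc a′
      W = wordSum t k (indicator ∘ f)
      first : t * wordSum t k hits ≡ a * t ^ k
      first = trans (hits-first k) (cong (_* t ^ k) eq)
      second-moment : t * (t * wordSum t k hits²) ≤ t ^ k * (a * t + a * a)
      second-moment = subst (λ z → t * (t * wordSum t k hits²) ≤ t ^ k * (z * t + z * z)) eq (hits-second k)
      lem₁ : ∀ a p → 8 * (a * a * p) ≡ 8 * a * (a * p)
      lem₁ = solve-∀
      lem₂ : ∀ t w → 4 * t * t * w ≡ 4 * (t * (t * w))
      lem₂ = solve-∀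
      lem₃ : ∀ p a t → 4 * (p * (a * t + a * a)) + p * (4 * (a * a)) ≡ a * (4 * t * p) + 8 * (a * a * p)
      lem₃ = solve-∀
      -- With a for kd, this is a² · `indicator (f v)` ≤ 4(a - t · `hits v`)² without subtraction:
      -- on the event, a - t · `hits v` is at least a/2.
      pointwise : ∀ v → a * a * indicator (f v) + 8 * a * t * hits v ≤ 4 * t * t * hits² v + 4 * (a * a)
      pointwise v with f v in fv
      ... | false = begin
        a * a * 0 + 8 * a * t * hits v                        ≡⟨ ring a t (hits v) ⟩
        4 * (2 * (a * (t * hits v)))                          ≤⟨ *-monoʳ-≤ 4 (2ab≤a²+b² a (t * hits v)) ⟩
        4 * (a * a + t * hits v * (t * hits v))               ≡⟨ ring′ a t (hits v) ⟩
        4 * t * t * hits² v + 4 * (a * a)                     ∎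
        where
        ring : ∀ a t y → a * a * 0 + 8 * a * t * y ≡ 4 * (2 * (a * (t * y)))
        ring = solve-∀
        ring′ : ∀ a t y → 4 * (a * a + t * y * (t * y)) ≡ 4 * t * t * (y * y) + 4 * (a * a)
        ring′ = solve-∀
      ... | true with m≤n⇒∃[o]m+o≡n (small v fv)
      ...   | e , b+e = subst (λ a → a * a * 1 + 8 * a * t * hits v ≤ 4 * t * t * hits² v + 4 * (a * a)) b+e (≤-via (ring t (hits v) e))
        where
        ring : ∀ t y e → 4 * t * t * (y * y) + 4 * ((2 * (t * y) + e) * (2 * (t * y) + e))
          ≡ ((2 * (t * y) + e) * (2 * (t * y) + e) * 1 + 8 * (2 * (t * y) + e) * t * y) + (4 * (t * y) * e + 3 * (e * e))
        ring = solve-∀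

  -- A letter of `v` that is `zero` or occurs in `w` is certainly a repeat; repeats within `v` are
  -- ignored, which makes the hits independent.
  hits-rep₀ : ∀ (v w : List (Fin (suc n))) → hits (member₀ w) v ≤ rep₀ (v ++ w)
  hits-rep₀ [] w = z≤n
  hits-rep₀ (a ∷ v) w = +-mono-≤ (le (member₀ w a) refl) (hits-rep₀ v w)
    where
    le : ∀ b → member₀ w a ≡ b → indicator b ≤ indicator (member₀ (v ++ w) a)
    le false _ = z≤n
    le true e = ≤-reflexive (sym (cong indicator (memᵇ⁺ {x = a} {zero ∷ v ++ w} (ext (memᵇ⁻ (zero ∷ w) e)))))
      where
      ext : a ∈ zero ∷ w → a ∈ zero ∷ v ++ w
      ext (here eq) = here eq
      ext (there h) = there (∈-++⁺ʳ v h)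

  -- The chain of level sizes is controlled at the scale k by the number of repeats among the last 2k letters;
  -- its typical value is about 2k²/t.
  abstract
    -- Abstract, so that the type checker does not unfold the multiplication by a large literal.
    threshold : ℕ → ℕ
    threshold t = 256 * t

    threshold-≡ : ∀ t → threshold t ≡ 256 * t
    threshold-≡ t = refl

    -- Fewer than k²/(4t) repeats, a fixed fraction of the typical number. The common factor 64 is
    -- kept since `good-step` compares with (8k)².
    isBad : ℕ → List (Fin (suc n)) → Bool
    isBad {n} k w = threshold (suc n) * rep₀ w <ᵇ 64 * (k * k)

    isBad⁻ : ∀ k (w : List (Fin (suc n))) → isBad k w ≡ true → threshold (suc n) * rep₀ w < 64 * (k * k)
    isBad⁻ k w e = <ᵇ⇒< _ _ (Equivalence.from T-≡ e)

    isBad-false : ∀ k (w : List (Fin (suc n))) → isBad k w ≡ false → 64 * (k * k) ≤ threshold (suc n) * rep₀ w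
    isBad-false k w e = ≮⇒≥ λ lt → true≢false (Equivalence.to T-≡ (<⇒<ᵇ lt)) e

  drop-++-length : ∀ k (v w : List A) → length v ≡ k → drop k (v ++ w) ≡ w
  drop-++-length k v w refl = drop-length-++ v

  -- Condition on the second half `w` of the word. If at least k/2 of its letters are repeats, these
  -- alone prevent badness, as k ≤ t. Otherwise `w` and `zero` provide d ≥ k/2 different letters.
  -- The first half hits them kd/t times on average, and a bad word has at most half as many hits,
  -- so `chebyshev` applies.
  bad-rare : ∀ k → k ≤ suc n → k * k * wordSum (suc n) (k + k) (indicator ∘ isBad k) ≤ 8 * suc n * suc n ^ (k + k)
  bad-rare {n} k k≤t = begin
    k * k * wordSum τ (k + k) F                                      ≡⟨ cong (k * k *_) (trans (wordSum-++ k k F) (wordSum-exchange k k (λ v w → F (v ++ w)))) ⟩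
    k * k * wordSum τ k (λ w → wordSum τ k (λ v → F (v ++ w)))       ≡⟨ wordSum-* k (k * k) _ ⟨
    wordSum τ k (λ w → k * k * wordSum τ k (λ v → F (v ++ w)))       ≤⟨ wordSum-mono k each ⟩
    wordSum τ k (λ _ → 8 * τ * τ ^ k)                                ≡⟨ wordSum-const k (8 * τ * τ ^ k) ⟩
    τ ^ k * (8 * τ * τ ^ k)                                          ≡⟨ trans (ring τ (τ ^ k)) (cong (8 * τ *_) (sym (^-distribˡ-+-* τ k k))) ⟩
    8 * τ * τ ^ (k + k)                                              ∎
    where
    open ≤-Reasoning
    τ = suc n
    F : List (Fin τ) → ℕ
    F = indicator ∘ isBad k
    ring : ∀ t p → p * (8 * t * p) ≡ 8 * t * (p * p)
    ring = solve-∀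
    each : ∀ w → length w ≡ k → k * k * wordSum τ k (λ v → F (v ++ w)) ≤ 8 * τ * τ ^ k
    each w lw with k ≤? 2 * rep₀ w
    ... | yes many = begin
      k * k * wordSum τ k (λ v → F (v ++ w))   ≤⟨ *-monoʳ-≤ (k * k) (wordSum-mono k none) ⟩
      k * k * wordSum τ k (λ _ → 0)            ≡⟨ cong (k * k *_) (trans (wordSum-const k 0) (*-zeroʳ (τ ^ k))) ⟩
      k * k * 0                                ≡⟨ *-zeroʳ (k * k) ⟩
      0                                        ≤⟨ z≤n ⟩
      8 * τ * τ ^ k                            ∎
      where
      none : ∀ v → length v ≡ k → F (v ++ w) ≤ 0
      none v lv with isBad k (v ++ w) in e
      ... | false = z≤n
      ... | true = ⊥-elim (<⇒≱ (isBad⁻ k (v ++ w) e) (begin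
        64 * (k * k)                   ≤⟨ *-monoʳ-≤ 64 (*-mono-≤ k≤t (≤-trans many (*-monoʳ-≤ 2 (subst (λ x → rep₀ x ≤ rep₀ (v ++ w)) (drop-++-length k v w lv) (rep₀-drop-≤ k (v ++ w)))))) ⟩
        64 * (τ * (2 * rep₀ (v ++ w))) ≤⟨ ≤-via (lem τ (rep₀ (v ++ w))) ⟩
        256 * τ * rep₀ (v ++ w)        ≡⟨ cong (_* rep₀ (v ++ w)) (threshold-≡ τ) ⟨
        threshold τ * rep₀ (v ++ w)    ∎))
        where
        lem : ∀ t r → 256 * t * r ≡ 64 * (t * (2 * r)) + 128 * (t * r)
        lem = solve-∀
    ... | no few = begin
      k * k * W                        ≤⟨ *-monoˡ-≤ W (*-monoʳ-≤ k k≤2d) ⟩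
      k * (2 * d) * W                  ≡⟨ lem k d W ⟩
      2 * (k * d * W)                  ≤⟨ *-monoʳ-≤ 2 (chebyshev χ k (λ v → isBad k (v ++ w)) small) ⟩
      2 * (4 * τ * τ ^ k)              ≡⟨ lem′ τ (τ ^ k) ⟩
      8 * τ * τ ^ k                    ∎
      where
      χ = member₀ w
      W = wordSum τ k (λ v → F (v ++ w))
      d = hits χ (allFin τ)
      lem : ∀ k d w → k * (2 * d) * w ≡ 2 * (k * d * w)
      lem = solve-∀
      lem′ : ∀ t p → 2 * (4 * t * p) ≡ 8 * t * p
      lem′ = solve-∀
      d-eq : d + rep₀ w ≡ suc k
      d-eq = trans (cong (_+ rep₀ w) (letters-count w)) (trans (letters-rep₀ w) (cong suc lw))
      k≤2d : k ≤ 2 * d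
      k≤2d = +-cancelʳ-≤ (2 * rep₀ w) k (2 * d) (begin
        k + 2 * rep₀ w          ≤⟨ +-monoʳ-≤ k (<⇒≤ (≰⇒> few)) ⟩
        k + k                   ≤⟨ ≤-via (lem″ k) ⟩
        2 * suc k               ≡⟨ cong (2 *_) d-eq ⟨
        2 * (d + rep₀ w)        ≡⟨ *-distribˡ-+ 2 d (rep₀ w) ⟩
        2 * d + 2 * rep₀ w      ∎)
        where
        lem″ : ∀ k → 2 * suc k ≡ (k + k) + 2
        lem″ = solve-∀
      small : ∀ v → isBad k (v ++ w) ≡ true → 2 * (τ * hits χ v) ≤ k * d
      small v e = *-cancelˡ-≤ 128 (begin
        128 * (2 * (τ * hits χ v))         ≡⟨ lem₁ τ (hits χ v) ⟩
        256 * τ * hits χ v                 ≡⟨ cong (_* hits χ v) (threshold-≡ τ) ⟨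
        threshold τ * hits χ v             ≤⟨ *-monoʳ-≤ (threshold τ) (hits-rep₀ v w) ⟩
        threshold τ * rep₀ (v ++ w)        ≤⟨ <⇒≤ (isBad⁻ k (v ++ w) e) ⟩
        64 * (k * k)                       ≤⟨ *-monoʳ-≤ 64 (*-monoʳ-≤ k k≤2d) ⟩
        64 * (k * (2 * d))                 ≡⟨ lem₂ k d ⟩
        128 * (k * d)                      ∎)
        where
        lem₁ : ∀ t h → 128 * (2 * (t * h)) ≡ 256 * t * h
        lem₁ = solve-∀
        lem₂ : ∀ k d → 64 * (k * (2 * d)) ≡ 128 * (k * d)
        lem₂ = solve-∀

  rep₀≤length : ∀ (v : List (Fin (suc n))) → rep₀ v ≤ length v
  rep₀≤length [] = z≤n
  rep₀≤length (a ∷ v) = +-mono-≤ (le (member₀ v a)) (rep₀≤length v)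
    where
    le : ∀ b → indicator b ≤ 1
    le true = ≤-refl
    le false = z≤n

  repeats≤ : ∀ (u : List (Fin (suc n))) M → repeats u M ≤ M
  repeats≤ u M = ≤-trans (rep₀≤length (suffix M u)) (subst (_≤ M) (sym (length-drop (length u ∸ M) u))
    (m≤n+o⇒m∸n≤o (length u) (length u ∸ M) (≤-trans (m≤n+m∸n (length u) M) (≤-reflexive (+-comm M _)))))

  module _ {n : ℕ} (u : List (Fin (suc n))) where

    private
      A′ = threshold (suc n)

    levelSize-dec : ∀ a b → levelSize u (a + b) ≤ levelSize u b ∸ a
    levelSize-dec zero b = ≤-refl
    levelSize-dec (suc a) b = begin
      (N ∸ 1) ∸ repeats u (N ∸ 2)   ≤⟨ m∸n≤m (N ∸ 1) (repeats u (N ∸ 2)) ⟩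
      N ∸ 1                         ≤⟨ ∸-monoˡ-≤ 1 (levelSize-dec a b) ⟩
      levelSize u b ∸ a ∸ 1         ≡⟨ trans (∸-+-assoc (levelSize u b) a 1) (cong (levelSize u b ∸_) (+-comm a 1)) ⟩
      levelSize u b ∸ suc a         ∎
      where
      open ≤-Reasoning
      N = levelSize u (a + b)

    levelSize-antitone : ∀ {h h′} → h ≤ h′ → levelSize u h′ ≤ levelSize u h
    levelSize-antitone {h} h≤ with m≤n⇒∃[o]m+o≡n h≤
    ... | e , refl = subst (λ z → levelSize u z ≤ levelSize u h) (+-comm e h) (≤-trans (levelSize-dec e h) (m∸n≤m (levelSize u h) e))

    -- The potential h · N_h stays below A as long as N decreases by at least N²/A in every step.
    potential-step : ∀ {h N N′ A} → 1 ≤ N → h * N ≤ A → A * N′ + N * N ≤ A * N → suc h * N′ ≤ A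
    potential-step {h} {suc N₀} {N′} {A} _ hN step = *-cancelˡ-≤ {suc h * N′} {A} A {{A≠0}} (begin
      A * (suc h * N′)               ≡⟨ lem₁ A h N′ ⟩
      suc h * (A * N′)               ≤⟨ *-monoʳ-≤ (suc h) AN′ ⟩
      suc h * (B * N)                ≡⟨ lem₂ h B N ⟩
      B * (h * N) + B * N            ≤⟨ +-mono-≤ (*-monoʳ-≤ B hN) (*-monoˡ-≤ N (m∸n≤m A N)) ⟩
      B * A + A * N                  ≡⟨ lem₃ B A N ⟩
      A * (N + B)                    ≡⟨ cong (A *_) (m+[n∸m]≡n N≤A) ⟩
      A * A                          ∎)
      where
      open ≤-Reasoning
      N = suc N₀
      N≤A : N ≤ A
      N≤A = *-cancelʳ-≤ N A N (≤-trans (m≤n+m (N * N) (A * N′)) step)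
      B = A ∸ N
      A≠0 : NonZero A
      A≠0 = ℕ.>-nonZero (≤-trans (s≤s z≤n) N≤A)
      AN′ : A * N′ ≤ B * N
      AN′ = +-cancelʳ-≤ (N * N) (A * N′) (B * N) (≤-trans step (≤-reflexive (trans (cong (_* N) (sym (m∸n+n≡m N≤A))) (*-distribʳ-+ N B N))))
      lem₁ : ∀ A h n → A * (suc h * n) ≡ suc h * (A * n)
      lem₁ = solve-∀
      lem₂ : ∀ h B n → suc h * (B * n) ≡ B * (h * n) + B * n
      lem₂ = solve-∀
      lem₃ : ∀ B A n → B * A + A * n ≡ A * (n + B)
      lem₃ = solve-∀

    record Good (k : ℕ) : Set where
      constructor good
      field many-repeats : 64 * (k * k) ≤ A′ * repeats u (k + k)

    -- The size N = X + 2 is at most 8k, so N² ≤ 64k², and a good scale supplies N²/A′ repeats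
    -- already among the last 2k letters.
    good-step : ∀ {h k X} → levelSize u h ≡ suc (suc X) → k + k ≤ X → X < 2 * (k + k) → Good k →
      A′ * levelSize u (suc h) + levelSize u h * levelSize u h ≤ A′ * levelSize u h
    good-step {h} {k} {X} eq lo hi (good many) rewrite eq = begin
      A′ * (suc X ∸ r) + suc (suc X) * suc (suc X)      ≤⟨ +-monoʳ-≤ (A′ * (suc X ∸ r)) (*-mono-≤ X≤ X≤) ⟩
      A′ * (suc X ∸ r) + (8 * k) * (8 * k)              ≡⟨ cong (A′ * (suc X ∸ r) +_) (lem k) ⟩
      A′ * (suc X ∸ r) + 64 * (k * k)                   ≤⟨ +-monoʳ-≤ (A′ * (suc X ∸ r)) (≤-trans many (*-monoʳ-≤ A′ (repeats-mono u lo))) ⟩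
      A′ * (suc X ∸ r) + A′ * r                         ≡⟨ *-distribˡ-+ A′ (suc X ∸ r) r ⟨
      A′ * (suc X ∸ r + r)                              ≡⟨ cong (A′ *_) (m∸n+n≡m (≤-trans (repeats≤ u X) (n≤1+n X))) ⟩
      A′ * suc X                                        ≤⟨ *-monoʳ-≤ A′ (n≤1+n (suc X)) ⟩
      A′ * suc (suc X)                                  ∎
      where
      open ≤-Reasoning
      r = repeats u X
      lem : ∀ k → (8 * k) * (8 * k) ≡ 64 * (k * k)
      lem = solve-∀
      k≥1 : ∀ k → X < 2 * (k + k) → suc (suc X) ≤ 8 * k
      k≥1 (suc j) hi = ≤-trans (s≤s hi) (≤-via (ring j))
        where
        ring : ∀ j → 8 * suc j ≡ suc (2 * (suc j + suc j)) + (4 * j + 3)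
        ring = solve-∀
      X≤ : suc (suc X) ≤ 8 * k
      X≤ = k≥1 k hi

    -- Doubles `k` until `X` lies within a factor two above 2k; `f` is fuel that bounds the number
    -- of doublings.
    dyadic : ∀ f {X k} → 1 ≤ k → k + k ≤ X → X ≤ f + (k + k) → ∃ λ i → (k * 2 ^ i) + (k * 2 ^ i) ≤ X × X < 2 * (k * 2 ^ i + k * 2 ^ i)
    dyadic f {X} {k} 1≤k lo hi with X <? 2 * (k + k)
    ... | yes lt = 0 , subst (λ z → z + z ≤ X) (sym (*-identityʳ k)) lo , subst (λ z → X < 2 * (z + z)) (sym (*-identityʳ k)) lt
    dyadic zero {X} {suc k} 1≤k lo hi | no ge = ⊥-elim (ge (s≤s (≤-trans hi (≤-via (ring k)))))
      where
      ring : ∀ k → k + suc k + (suc k + suc k + 0) ≡ suc k + suc k + (k + suc k)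
      ring = solve-∀
    dyadic (suc f) {X} {k} 1≤k lo hi | no ge with dyadic f {X} {2 * k} (≤-trans 1≤k (m≤m+n k _)) (≤-trans (≤-reflexive (ring k)) (≮⇒≥ ge)) (≤-trans hi (≤-trans (≤-reflexive (ring₁ f k)) (+-monoʳ-≤ f (ring₂ k 1≤k))))
      where
      ring : ∀ k → 2 * k + 2 * k ≡ 2 * (k + k)
      ring = solve-∀
      ring₁ : ∀ f k → suc f + (k + k) ≡ f + suc (k + k)
      ring₁ = solve-∀
      ring₂ : ∀ k → 1 ≤ k → suc (k + k) ≤ 2 * k + 2 * k
      ring₂ (suc j) _ = ≤-via (ring₃ j)
        where
        ring₃ : ∀ j → 2 * suc j + 2 * suc j ≡ suc (suc j + suc j) + (2 * j + 1)
        ring₃ = solve-∀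
    ... | i , a , b = suc i , subst (λ z → z + z ≤ X) (ring₄ k (2 ^ i)) a , subst (λ z → X < 2 * (z + z)) (ring₄ k (2 ^ i)) b
      where
      ring₄ : ∀ k p → 2 * k * p ≡ k * (2 * p)
      ring₄ = solve-∀

    -- If every scale from k upwards is good, the potential of `potential-step` stays bounded for as
    -- long as the size exceeds the smallest scale.
    good-scales : ∀ {k} → 1 ≤ k → (∀ i → k * 2 ^ i + k * 2 ^ i ≤ n ∸ 1 → Good (k * 2 ^ i)) →
      ∀ h → levelSize u h ≤ suc (k + k) ⊎ h * levelSize u h ≤ A′
    good-scales 1≤k all-good zero = inj₂ z≤n
    good-scales {k} 1≤k all-good (suc h) with levelSize u h ≤? suc (k + k)
    ... | yes small = inj₁ (≤-trans (levelSize-antitone (n≤1+n h)) small)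
    ... | no large with good-scales 1≤k all-good h
    ...   | inj₁ small = ⊥-elim (large small)
    ...   | inj₂ hN with m≤n⇒∃[o]m+o≡n (≰⇒> large)
    ...     | e , eq with dyadic (k + k + e) {k + k + e} 1≤k (m≤m+n (k + k) e) (m≤m+n _ _)
    ...       | i , lo , hi = inj₂ (potential-step {h} (≤-trans (s≤s z≤n) (≤-reflexive eq)) hN
                  (good-step {h} {k * 2 ^ i} (sym eq) lo hi (all-good i (≤-trans lo (∸-monoˡ-≤ 2 (≤-trans (≤-reflexive eq) (levelSize-antitone {0} {h} z≤n)))))))

    -- A bad scale k is charged with 6k, an upper bound for the level sizes that belong to it.
    -- Scales longer than the word are charged nothing.
    badScale : ℕ → ℕ → ℕ
    badScale z i = if k + k ≤ᵇ n ∸ 1 then 6 * k * indicator (isBad k (suffix (k + k) u)) else 0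
      where k = z * 2 ^ i

    badScales : ℕ → ℕ
    badScales z = sumOver (badScale z) (upTo n)

    2^i>i : ∀ i → i < 2 ^ i
    2^i>i zero = s≤s z≤n
    2^i>i (suc i) = ≤-trans (s≤s (2^i>i i)) (≤-trans (+-monoˡ-≤ (2 ^ i) (≤-trans (s≤s z≤n) (2^i>i i))) (+-monoʳ-≤ (2 ^ i) (≤-reflexive (sym (+-identityʳ (2 ^ i))))))

    term≤sum : ∀ (f : ℕ → ℕ) {i} xs → i ∈ xs → f i ≤ sumOver f xs
    term≤sum f (x ∷ xs) (here refl) = m≤m+n (f x) _
    term≤sum f (x ∷ xs) (there i∈) = ≤-trans (term≤sum f xs i∈) (m≤n+m _ (f x))

    scale-index : ∀ {z i} → 1 ≤ z → z * 2 ^ i + z * 2 ^ i ≤ n ∸ 1 → i < n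
    scale-index {z} {i} 1≤z le = ≤-trans (2^i>i i) (≤-trans (m≤n*m (2 ^ i) z {{ℕ.>-nonZero 1≤z}}) (≤-trans (m≤m+n _ _) (≤-trans le (m∸n≤m n 1))))

    isBadScale : ℕ → ℕ → Bool
    isBadScale z i = (k + k ≤ᵇ n ∸ 1) ∧ isBad k (suffix (k + k) u)
      where k = z * 2 ^ i

    badScale-≥ : ∀ z i → isBadScale z i ≡ true → 1 ≤ z → 6 * (z * 2 ^ i) ≤ badScales z
    badScale-≥ z i e 1≤z with ∧⁻ (z * 2 ^ i + z * 2 ^ i ≤ᵇ n ∸ 1) e
    ... | f , g = ≤-trans (≤-reflexive (sym val))
      (term≤sum (badScale z) (upTo n) (∈-upTo⁺ (scale-index {z} {i} 1≤z (≤ᵇ⇒≤ (z * 2 ^ i + z * 2 ^ i) (n ∸ 1) (Equivalence.from T-≡ f)))))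
      where
      val : badScale z i ≡ 6 * (z * 2 ^ i)
      val rewrite f | g = *-identityʳ _

    not-bad⇒good : ∀ z i → z * 2 ^ i + z * 2 ^ i ≤ n ∸ 1 → isBadScale z i ≡ false → Good (z * 2 ^ i)
    not-bad⇒good z i le e rewrite Equivalence.to T-≡ (≤⇒≤ᵇ le) = good (isBad-false (z * 2 ^ i) (suffix (z * 2 ^ i + z * 2 ^ i) u) e)

    -- Take the dyadic scale k of the current size. If it or some larger scale is bad, its charge
    -- exceeds the size. If all of them are good, `good-scales` leaves h · N_h ≤ A′, which the
    -- choice of z excludes since N_h > 2z.
    levelSize-bad : ∀ {z h} → 1 ≤ z → A′ < h * (z + z) → levelSize u h ≤ suc (z + z) ⊎ levelSize u h ≤ badScales z
    levelSize-bad {z} {h} 1≤z big with levelSize u h ≤? suc (z + z)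
    ... | yes small = inj₁ small
    ... | no large with m≤n⇒∃[o]m+o≡n (≰⇒> large)
    ...   | e , eq with dyadic (z + z + e) {z + z + e} 1≤z (m≤m+n (z + z) e) (m≤m+n _ _)
    ...     | j , lo , hi with bool-cases (any (λ i → isBadScale z (j + i)) (upTo n))
    ...       | inj₁ found = inj₂ (bound (any⁻ (λ i → isBadScale z (j + i)) (upTo n) found))
      where
      k = z * 2 ^ j
      1≤k : 1 ≤ k
      1≤k = *-mono-≤ 1≤z (≤-trans (s≤s z≤n) (2^i>i j))
      bound : (∃ λ i → i ∈ upTo n × isBadScale z (j + i) ≡ true) → levelSize u h ≤ badScales z
      bound (i , _ , b) = begin
        levelSize u h              ≡⟨ eq ⟨
        suc (suc (z + z + e))      ≤⟨ s≤s hi ⟩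
        suc (2 * (k + k))          ≤⟨ arith k 1≤k ⟩
        6 * k                      ≤⟨ *-monoʳ-≤ 6 (*-monoʳ-≤ z (^-monoʳ-≤ 2 (m≤m+n j i))) ⟩
        6 * (z * 2 ^ (j + i))      ≤⟨ badScale-≥ z (j + i) b 1≤z ⟩
        badScales z                ∎
        where
        open ≤-Reasoning
        arith : ∀ k → 1 ≤ k → suc (2 * (k + k)) ≤ 6 * k
        arith (suc k) _ = ≤-via (ring k)
          where
          ring : ∀ k → 6 * suc k ≡ suc (2 * (suc k + suc k)) + (2 * k + 1)
          ring = solve-∀
    ...       | inj₂ none = ⊥-elim (contra (good-scales {k} 1≤k all-good h))
      where
      k = z * 2 ^ j
      1≤k : 1 ≤ k
      1≤k = *-mono-≤ 1≤z (≤-trans (s≤s z≤n) (2^i>i j))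
      shift : ∀ i → k * 2 ^ i ≡ z * 2 ^ (j + i)
      shift i = trans (*-assoc z (2 ^ j) (2 ^ i)) (cong (z *_) (sym (^-distribˡ-+-* 2 j i)))
      all-good : ∀ i → k * 2 ^ i + k * 2 ^ i ≤ n ∸ 1 → Good (k * 2 ^ i)
      all-good i le = subst Good (sym (shift i)) (not-bad⇒good z (j + i) (subst (λ x → x + x ≤ n ∸ 1) (shift i) le)
        (¬true⇒false λ b → true≢false (any⁺ (λ i → isBadScale z (j + i)) (∈-upTo⁺ (scale-index {k} {i} 1≤k le)) b) none))
      contra : levelSize u h ≤ suc (k + k) ⊎ h * levelSize u h ≤ A′ → ⊥
      contra (inj₁ small) = 1+n≰n (≤-trans (s≤s (≤-trans (s≤s lo) (≤-refl))) (≤-trans (≤-reflexive eq) small))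
      contra (inj₂ hN) = <⇒≱ big (≤-trans (*-monoʳ-≤ h (≤-trans (m≤m+n (z + z) (suc (suc e))) (≤-reflexive (trans (+-suc (z + z) (suc e)) (trans (cong suc (+-suc (z + z) e)) eq))))) hN)

-- Upper and lower bounds for the expected cover.

module Bounds where

  open Basics
  open Trees
  open Codes
  open Counting
  open Covers
  open Words
  open Estimates
  open import Data.Bool using (true; false)
  open import Data.Bool.Properties using (T-≡)
  open import Data.Fin using (Fin)
  open import Data.List using (List; map; length; upTo)
  open import Data.List.Properties using (map-upTo)
  open import Data.List.Membership.Propositional using (_∈_)
  open import Data.Nat as ℕ using (ℕ; zero; suc; _+_; _*_; _^_; _/_; _≤_; _<_; _∸_; z≤n; s≤s; _≤ᵇ_; NonZero)
  open import Data.Nat.DivMod using (m/n*n≤m; m≡m%n+[m/n]*n; m%n<n)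
  open import Data.Nat.Properties
  open import Data.Nat.Tactic.RingSolver using (solve-∀)
  open import Data.Product using (_,_)
  open import Data.Sum using ([_,_]′)
  open import Function using (_∘_; Equivalence)
  open import Relation.Nullary using (yes; no)
  open import Relation.Binary.PropositionalEquality

  -- The tail is bounded by applying the induction hypothesis to its doubled terms, which satisfy
  -- the same condition.
  geometric : ∀ K (Z : ℕ → ℕ) Q → (∀ i → 2 ^ i * Z i ≤ Q) → sumOver Z (upTo K) ≤ 2 * Q
  geometric zero Z Q h = z≤n
  geometric (suc K) Z Q h = begin
    sumOver Z (upTo (suc K))               ≡⟨ cong (λ l → Z 0 + sumOver Z l) (map-upTo suc K) ⟨
    Z 0 + sumOver Z (map suc (upTo K))     ≡⟨ cong (Z 0 +_) (sumOver-map Z suc (upTo K)) ⟩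
    Z 0 + sumOver (Z ∘ suc) (upTo K)       ≤⟨ +-mono-≤ (≤-trans (≤-reflexive (sym (*-identityˡ (Z 0)))) (h 0)) tail ⟩
    Q + Q                                  ≡⟨ cong (Q +_) (sym (+-identityʳ Q)) ⟩
    2 * Q                                  ∎
    where
    open ≤-Reasoning
    tail : sumOver (Z ∘ suc) (upTo K) ≤ Q
    tail = *-cancelˡ-≤ 2 (subst (_≤ 2 * Q) (sumOver-* 2 (Z ∘ suc) (upTo K))
      (geometric K (λ i → 2 * Z (suc i)) Q (λ i → ≤-trans (≤-reflexive (ring (2 ^ i) (Z (suc i)))) (h (suc i)))))
      where
      ring : ∀ p z → p * (2 * z) ≡ 2 * p * z
      ring = solve-∀

  n<[n/d+1]*d : ∀ n d .{{_ : NonZero d}} → n < suc (n / d) * d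
  n<[n/d+1]*d n d = subst (_< suc (n / d) * d) (sym (m≡m%n+[m/n]*n n d)) (+-monoˡ-< (n / d * d) (m%n<n n d))

  tall-scale : ∀ t z → 32 * t < z * z → threshold t < 4 * z * (z + z)
  tall-scale t z big = begin-strict
    threshold t       ≡⟨ threshold-≡ t ⟩
    256 * t           ≡⟨ *-assoc 8 32 t ⟩
    8 * (32 * t)      <⟨ *-monoʳ-< 8 big ⟩
    8 * (z * z)       ≡⟨ ring z ⟩
    4 * z * (z + z)   ∎
    where
    open ≤-Reasoning
    ring : ∀ z → 8 * (z * z) ≡ 4 * z * (z + z)
    ring = solve-∀

  tall-positive : ∀ {t} z → t < z * z → 1 ≤ z
  tall-positive (suc z) _ = s≤s z≤n

  tall-height : ∀ {h} z → 1 ≤ z → h ≤ 7 + z * 8 → h ≤ 15 * z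
  tall-height (suc y) _ hi = ≤-trans hi (≤-via {e = 7 * y} (ring y))
    where
    ring : ∀ y → 15 * suc y ≡ 7 + suc y * 8 + 7 * y
    ring = solve-∀

  tall-gap : ∀ z → 1 ≤ z → suc (z + z) ≤ 4 * z
  tall-gap (suc y) _ = ≤-via {e = 2 * y + 1} (ring y)
    where
    ring : ∀ y → 4 * suc y ≡ suc (suc y + suc y) + (2 * y + 1)
    ring = solve-∀

  double-4 : ∀ z → z * 8 ≡ 4 * z + 4 * z
  double-4 = solve-∀

  short-scale : ∀ t h y → 128 * t < h * y → threshold t < h * (y + y)
  short-scale t h y hy = begin-strict
    threshold t       ≡⟨ threshold-≡ t ⟩
    256 * t           ≡⟨ *-assoc 2 128 t ⟩
    2 * (128 * t)     <⟨ *-monoʳ-< 2 hy ⟩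
    2 * (h * y)       ≡⟨ ring h y ⟩
    h * (y + y)       ∎
    where
    open ≤-Reasoning
    ring : ∀ h y → 2 * (h * y) ≡ h * (y + y)
    ring = solve-∀

  short-base : ∀ t h y → 1 ≤ y → h * y ≤ 129 * t → h * suc (y + y) ≤ 387 * t
  short-base t h (suc w) _ hy = begin
    h * suc (suc w + suc w)    ≤⟨ *-monoʳ-≤ h (≤-via (ring w)) ⟩
    h * (3 * suc w)            ≡⟨ ring′ h (suc w) ⟩
    3 * (h * suc w)            ≤⟨ *-monoʳ-≤ 3 hy ⟩
    3 * (129 * t)              ≡⟨ *-assoc 3 129 t ⟨
    387 * t                    ∎
    where
    open ≤-Reasoning
    ring : ∀ w → 3 * suc w ≡ suc (suc w + suc w) + w
    ring = solve-∀
    ring′ : ∀ h y → h * (3 * y) ≡ 3 * (h * y)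
    ring′ = solve-∀

  short-square : ∀ t h z → 1 ≤ t → h ≤ 7 + z * 8 → z * z ≤ 32 * t → h * h ≤ 45 * (128 * t)
  short-square t h z 1≤t hi small = begin
    h * h                                           ≤⟨ *-mono-≤ hi hi ⟩
    (7 + z * 8) * (7 + z * 8)                       ≡⟨ ring z ⟩
    49 + (112 * z + 64 * (z * z))                   ≤⟨ +-mono-≤ (*-monoʳ-≤ 49 1≤t) (+-mono-≤ (*-monoʳ-≤ 112 (≤-trans (z≤z² z) small)) (*-monoʳ-≤ 64 small)) ⟩
    49 * t + (112 * (32 * t) + 64 * (32 * t))       ≡⟨ cong (49 * t +_) (cong₂ _+_ (sym (*-assoc 112 32 t)) (sym (*-assoc 64 32 t))) ⟩
    49 * t + (112 * 32 * t + 64 * 32 * t)           ≡⟨ cong (49 * t +_) (*-distribʳ-+ t (112 * 32) (64 * 32)) ⟨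
    49 * t + (112 * 32 + 64 * 32) * t               ≡⟨ *-distribʳ-+ t 49 (112 * 32 + 64 * 32) ⟨
    -- The left side is 5681, and 45 · 128 = 5760. This is where 45 comes from.
    (49 + (112 * 32 + 64 * 32)) * t                 ≤⟨ *-monoˡ-≤ t (m≤m+n 5681 79) ⟩
    45 * 128 * t                                    ≡⟨ *-assoc 45 128 t ⟩
    45 * (128 * t)                                  ∎
    where
    open ≤-Reasoning
    z≤z² : ∀ z → z ≤ z * z
    z≤z² zero = z≤n
    z≤z² (suc z) = m≤m*n (suc z) (suc z)
    ring : ∀ z → (7 + z * 8) * (7 + z * 8) ≡ 49 + (112 * z + 64 * (z * z))
    ring = solve-∀

  short-height : ∀ t h y .{{_ : NonZero h}} → h * h ≤ 45 * (128 * t) → 128 * t < h * y → h ≤ 45 * y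
  short-height t h y h² hy = *-cancelˡ-≤ h (≤-trans h² (≤-trans (*-monoʳ-≤ 45 (<⇒≤ hy)) (≤-reflexive (ring h y))))
    where
    ring : ∀ h y → 45 * (h * y) ≡ h * (45 * y)
    ring = solve-∀

  short-quotient : ∀ t h .{{_ : NonZero h}} → h ≤ t → h * suc (128 * t / h) ≤ 129 * t
  short-quotient t h h≤t = begin
    h * suc (128 * t / h)        ≡⟨ trans (*-suc h (128 * t / h)) (cong (h +_) (*-comm h (128 * t / h))) ⟩
    h + 128 * t / h * h          ≤⟨ +-mono-≤ h≤t (m/n*n≤m (128 * t) h) ⟩
    t + 128 * t                  ∎
    where open ≤-Reasoning

  module _ (n : ℕ) where

    private
      τ = suc n
      m = n ∸ 1
      Q = τ * τ ^ m

    -- For k = z · 2^i the expected charge is at most 6k · 8t/k² = 48t/k, which decays geometrically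
    -- in i.
    badScale-sum : ∀ {z} → 1 ≤ z → ∀ i → 2 ^ i * (z * wordSum τ m (λ u → badScale u z i)) ≤ 48 * Q
    badScale-sum {z} 1≤z i with z * 2 ^ i + z * 2 ^ i ≤ᵇ m in fits
    ... | false = ≤-trans (≤-reflexive (trans (cong (λ s → 2 ^ i * (z * s)) (trans (wordSum-const m 0) (*-zeroʳ (τ ^ m)))) (trans (cong (2 ^ i *_) (*-zeroʳ z)) (*-zeroʳ (2 ^ i))))) z≤n
    ... | true = begin
      2 ^ i * (z * wordSum τ m (λ u → 6 * k * F (suffix (k + k) u)))  ≡⟨ cong (λ s → 2 ^ i * (z * s)) (trans (wordSum-* m (6 * k) (F ∘ suffix (k + k))) (cong (6 * k *_) (wordSum-suffix le F))) ⟩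
      2 ^ i * (z * (6 * k * (p * W)))                                 ≡⟨ ring (2 ^ i) z p W ⟩
      6 * p * (k * k * W)                                             ≤⟨ *-monoʳ-≤ (6 * p) (bad-rare k (≤-trans (m≤m+n k k) (≤-trans le (≤-trans (m∸n≤m n 1) (n≤1+n n))))) ⟩
      6 * p * (8 * τ * τ ^ (k + k))                                   ≡⟨ ring′ p τ (τ ^ (k + k)) ⟩
      48 * (τ * (p * τ ^ (k + k)))                                    ≡⟨ cong (λ s → 48 * (τ * s)) (trans (sym (^-distribˡ-+-* τ (m ∸ (k + k)) (k + k))) (cong (τ ^_) (m∸n+n≡m le))) ⟩
      48 * Q                                                          ∎
      where
      open ≤-Reasoning
      k = z * 2 ^ i
      le : k + k ≤ m
      le = ≤ᵇ⇒≤ (k + k) m (Equivalence.from T-≡ fits)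
      F : List (Fin τ) → ℕ
      F = indicator ∘ isBad k
      p = τ ^ (m ∸ (k + k))
      W = wordSum τ (k + k) F
      ring : ∀ a z p w → a * (z * (6 * (z * a) * (p * w))) ≡ 6 * p * (z * a * (z * a) * w)
      ring = solve-∀
      ring′ : ∀ p t q → 6 * p * (8 * t * q) ≡ 48 * (t * (p * q))
      ring′ = solve-∀

    badScales-sum : ∀ {z} → 1 ≤ z → z * wordSum τ m (λ u → badScales u z) ≤ 2 * (48 * Q)
    badScales-sum {z} 1≤z = begin
      z * wordSum τ m (λ u → sumOver (badScale u z) (upTo n))        ≡⟨ cong (z *_) (wordSum-swap m (λ i u → badScale u z i) (upTo n)) ⟨
      z * sumOver (λ i → wordSum τ m (λ u → badScale u z i)) (upTo n) ≡⟨ sumOver-* z (λ i → wordSum τ m (λ u → badScale u z i)) (upTo n) ⟨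
      sumOver (λ i → z * wordSum τ m (λ u → badScale u z i)) (upTo n) ≤⟨ geometric n (λ i → z * wordSum τ m (λ u → badScale u z i)) (48 * Q) (badScale-sum 1≤z) ⟩
      2 * (48 * Q)                                                    ∎
      where open ≤-Reasoning

    private
      mean-from-scales : ∀ {h z b} → 1 ≤ z → h ≤ b * z → h * wordSum τ m (λ u → badScales u z) ≤ b * (2 * (48 * Q))
      mean-from-scales {h} {z} {b} 1≤z h≤ = ≤-trans (*-monoˡ-≤ _ h≤) (≤-trans (≤-reflexive (*-assoc b z _)) (*-monoʳ-≤ b (badScales-sum 1≤z)))

    -- At height 4z the scale z applies, as 256t < 4z · 2z. A size of at most 2z + 1 there is used
    -- up within another 4z levels, each of which loses a vertex while any is left, so only the
    -- charges of bad scales remain.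
    mean-tall : ∀ {h z} → h ≤ 7 + z * 8 → z * 8 ≤ h → 32 * τ < z * z → h * wordSum τ m (λ u → levelSize u h) ≤ 15 * (2 * (48 * Q))
    mean-tall {h} {z} hi lo big = ≤-trans (*-monoʳ-≤ h (wordSum-mono m (λ u _ → pointwise u)))
      (mean-from-scales {h} {z} {15} 1≤z (tall-height z 1≤z hi))
      where
      1≤z : 1 ≤ z
      1≤z = tall-positive z big
      8z≤h : 4 * z + 4 * z ≤ h
      8z≤h = ≤-trans (≤-reflexive (sym (double-4 z))) lo
      pointwise : ∀ u → levelSize u h ≤ badScales u z
      pointwise u = [ (λ small → ≤-trans (levelSize-antitone u 8z≤h)
          (≤-trans (levelSize-dec u (4 * z) (4 * z)) (≤-trans (≤-reflexive (m≤n⇒m∸n≡0 (≤-trans small (tall-gap z 1≤z)))) z≤n)))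
        , ≤-trans (levelSize-antitone u (≤-trans (m≤m+n (4 * z) (4 * z)) 8z≤h))
        ]′ (levelSize-bad u {z} {4 * z} 1≤z (tall-scale τ z big))

    -- `y` is the least scale to which `levelSize-bad` applies at height h, that is 128t < hy. The
    -- regular part 2y + 1 ≤ 3y contributes 3 · 129t, and h ≤ 45y holds because h has order at most
    -- √t here.
    mean-short : ∀ {h z} → 1 ≤ h → h ≤ τ → h ≤ 7 + z * 8 → z * z ≤ 32 * τ →
      h * wordSum τ m (λ u → levelSize u h) ≤ 387 * Q + 45 * (2 * (48 * Q))
    mean-short {h@(suc h₀)} {z} 1≤h h≤τ hi small = begin
      h * wordSum τ m (λ u → levelSize u h)                             ≤⟨ *-monoʳ-≤ h (wordSum-mono m (λ u _ → pointwise u)) ⟩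
      h * wordSum τ m (λ u → suc (y + y) + badScales u y)               ≡⟨ cong (h *_) (trans (wordSum-+ m (λ _ → suc (y + y)) (λ u → badScales u y)) (cong (_+ B) (wordSum-const m (suc (y + y))))) ⟩
      h * (τ ^ m * suc (y + y) + B)                                     ≡⟨ ring (τ ^ m) h (suc (y + y)) B ⟩
      h * suc (y + y) * τ ^ m + h * B                                   ≤⟨ +-mono-≤ (≤-trans (*-monoˡ-≤ (τ ^ m) main) (≤-reflexive (*-assoc 387 τ (τ ^ m)))) (mean-from-scales {h} {y} {45} (s≤s z≤n) h≤45y) ⟩
      387 * Q + 45 * (2 * (48 * Q))                                     ∎
      where
      open ≤-Reasoning
      y = suc (128 * τ / h)
      B = wordSum τ m (λ u → badScales u y)
      ring : ∀ p h s b → h * (p * s + b) ≡ h * s * p + h * b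
      ring = solve-∀
      hy : 128 * τ < h * y
      hy = subst (128 * τ <_) (*-comm y h) (n<[n/d+1]*d (128 * τ) h)
      pointwise : ∀ u → levelSize u h ≤ suc (y + y) + badScales u y
      pointwise u = [ (λ a → ≤-trans a (m≤m+n (suc (y + y)) (badScales u y))) , (λ b → ≤-trans b (m≤n+m (badScales u y) (suc (y + y)))) ]′
        (levelSize-bad u {y} {h} (s≤s z≤n) (short-scale τ h y hy))
      main : h * suc (y + y) ≤ 387 * τ
      main = short-base τ h y (s≤s z≤n) (short-quotient τ h h≤τ)
      h≤45y : h ≤ 45 * y
      h≤45y = short-height τ h y (short-square τ h z (s≤s z≤n) hi small) hy

    -- The two regimes meet at h of order √t. The quotient by 8 leaves 4z levels to come down to the
    -- scale z and 4z more to die out.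
    levelSize-mean : ∀ {h} → 1 ≤ h → h ≤ τ → h * wordSum τ m (λ u → levelSize u h) ≤ 387 * Q + 45 * (2 * (48 * Q))
    levelSize-mean {h} 1≤h h≤τ with (h / 8) * (h / 8) ≤? 32 * τ
    ... | yes small = mean-short {h} {h / 8} 1≤h h≤τ hi small
      where
      hi : h ≤ 7 + h / 8 * 8
      hi = ℕ.s≤s⁻¹ (n<[n/d+1]*d h 8)
    ... | no big = ≤-trans (mean-tall {h} {h / 8} (ℕ.s≤s⁻¹ (n<[n/d+1]*d h 8)) (m/n*n≤m h 8) (≰⇒> big))
        (≤-trans (*-monoˡ-≤ (2 * (48 * Q)) (m≤m+n 15 30)) (m≤n+m _ (387 * Q)))

    private
      ts = trees τ
      P : ∀ {G} → G ∈ ts → ParentOf G (parent G)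
      P = parent-ParentOf

    treeCount : ℕ
    treeCount = length (trees τ)

    totalCov : ℕ → ℕ
    totalCov ℓ = sumOver (cov ℓ) (trees τ)

    levelSize-trees : ∀ {h} → 1 ≤ n → 1 ≤ h → h ≤ τ → h * sumOver (λ G → levelSize (treeCode G) h) (trees τ)
      ≤ 387 * (τ * treeCount) + 45 * (2 * (48 * (τ * treeCount)))
    levelSize-trees {h} 1≤n 1≤h h≤τ = ≤-trans (*-monoʳ-≤ h (≤-trans (sum-treeCode {n} (λ u → levelSize u h)) (≤-reflexive (wordSum-list m (λ u → levelSize u h)))))
      (≤-trans (levelSize-mean 1≤h h≤τ) (+-mono-≤ (*-monoʳ-≤ 387 le) (*-monoʳ-≤ 45 (*-monoʳ-≤ 2 (*-monoʳ-≤ 48 le)))))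
      where
      le : Q ≤ τ * treeCount
      le = *-monoʳ-≤ τ (trees-lower 1≤n)

    upperBound : ℕ
    upperBound = 14 * (387 * (τ * treeCount) + 45 * (2 * (48 * (τ * treeCount))))

    -- Here the quotient of ℓ by 4 is zero and gives no height to compare with, but the trivial
    -- bound t on a cover is enough.
    totalCov-upper-short : ∀ {ℓ} → ℓ ≤ 3 → ℓ * totalCov ℓ ≤ upperBound
    totalCov-upper-short {ℓ} ℓ≤3 = begin
      ℓ * totalCov ℓ                      ≤⟨ *-mono-≤ ℓ≤3 (sumOver-mono (trees τ) (λ {G} _ → cov-≤ ℓ G)) ⟩
      3 * sumOver (λ _ → τ) (trees τ)     ≡⟨ cong (3 *_) (trans (sumOver-const τ (trees τ)) (*-comm treeCount τ)) ⟩
      3 * (τ * treeCount)                 ≤⟨ enlarge (τ * treeCount) ⟩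
      upperBound                          ∎
      where
      open ≤-Reasoning
      enlarge : ∀ x → 3 * x ≤ 14 * (387 * x + 45 * (2 * (48 * x)))
      enlarge x = *-mono-≤ (m≤m+n 3 11) (≤-trans (m≤n*m x 387) (m≤m+n (387 * x) (45 * (2 * (48 * x)))))

    -- With h the quotient of ℓ by 4 one has ℓ ≤ 7h, and `cov-size` contributes a factor 2; together
    -- they give the 14 in `upperBound`.
    totalCov-upper-long : ∀ {ℓ} h → 1 ≤ h → h * 4 ≤ ℓ → ℓ ≤ 3 + h * 4 → ℓ ≤ τ → ℓ * totalCov ℓ ≤ upperBound
    totalCov-upper-long {ℓ} h 1≤h lo hi ℓ≤τ = begin
      ℓ * totalCov ℓ                      ≤⟨ *-mono-≤ (ℓ≤7h h 1≤h hi) (sumOver-mono (trees τ) each) ⟩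
      7 * h * sumOver (λ G → 2 * levelSize (treeCode G) h) (trees τ) ≡⟨ cong (7 * h *_) (sumOver-* 2 (λ G → levelSize (treeCode G) h) (trees τ)) ⟩
      7 * h * (2 * S)                     ≡⟨ ring h S ⟩
      14 * (h * S)                        ≤⟨ *-monoʳ-≤ 14 (levelSize-trees 1≤n 1≤h (≤-trans (m≤m*n h 4) (≤-trans lo ℓ≤τ))) ⟩
      upperBound                          ∎
      where
      open ≤-Reasoning
      S = sumOver (λ G → levelSize (treeCode G) h) (trees τ)
      ring : ∀ h s → 7 * h * (2 * s) ≡ 14 * (h * s)
      ring = solve-∀
      ℓ≤7h : ∀ {ℓ} h → 1 ≤ h → ℓ ≤ 3 + h * 4 → ℓ ≤ 7 * h
      ℓ≤7h (suc h) _ hi = ≤-trans hi (≤-via {e = 3 * h} (lem h))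
        where
        lem : ∀ h → 7 * suc h ≡ 3 + suc h * 4 + 3 * h
        lem = solve-∀
      1≤n : 1 ≤ n
      1≤n = ℕ.s≤s⁻¹ (≤-trans (m≤m+n 2 2) (≤-trans (*-monoˡ-≤ 4 1≤h) (≤-trans lo ℓ≤τ)))
      each : ∀ {G} → G ∈ trees τ → cov ℓ G ≤ 2 * levelSize (treeCode G) h
      each {G} G∈ = subst (λ s → cov ℓ G ≤ 2 * s) (size-levelSize (ParentOf.noCycle (P G∈)) h) (cov-size (P G∈) {h} (≤-trans (≤-reflexive (*-comm 4 h)) lo))

    totalCov-upper : ∀ {ℓ} → ℓ ≤ τ → ℓ * totalCov ℓ ≤ upperBound
    totalCov-upper {ℓ} ℓ≤τ = by-quotient (ℓ / 4) (m/n*n≤m ℓ 4) (ℕ.s≤s⁻¹ (n<[n/d+1]*d ℓ 4))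
      where
      by-quotient : ∀ q → q * 4 ≤ ℓ → ℓ ≤ 3 + q * 4 → ℓ * totalCov ℓ ≤ upperBound
      by-quotient zero lo hi = totalCov-upper-short hi
      by-quotient (suc h) lo hi = totalCov-upper-long (suc h) (s≤s z≤n) lo hi ℓ≤τ

    -- M, about t/(4ℓ), balances the losses in `levelSize-lower`: ℓ ≤ M/8 since 32ℓ² ≤ t, and the
    -- expected repeats cost at most ℓM²/t ≤ M/4. So the mean cover is at least 5M/8, while t ≤ 8ℓM.
    totalCov-lower : ∀ {ℓ} → 1 ≤ ℓ → 32 * (ℓ * ℓ) ≤ τ → τ * treeCount ≤ 16 * (ℓ * totalCov ℓ)
    totalCov-lower {ℓ@(suc ℓ₀)} 1≤ℓ small = *-cancelˡ-≤ 5 (begin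
      5 * (τ * N)                         ≤⟨ *-monoʳ-≤ 5 (*-monoˡ-≤ N (≤-trans (<⇒≤ (n<[n/d+1]*d τ (4 * ℓ))) (≤-trans (*-monoˡ-≤ (4 * ℓ) (≤-trans (+-monoˡ-≤ M (≤-trans (s≤s z≤n) 8ℓ≤M)) (≤-reflexive (cong (M +_) (sym (+-identityʳ M)))))) ≤-refl))) ⟩
      5 * (2 * M * (4 * ℓ) * N)           ≡⟨ ring₁ M ℓ N ⟩
      8 * ℓ * (5 * (M * N))               ≤⟨ *-monoʳ-≤ (8 * ℓ) key ⟩
      8 * ℓ * (8 * C)                     ≤⟨ ≤-via (ring₂ ℓ C) ⟩
      5 * (16 * (ℓ * C))                  ∎)
      where
      open ≤-Reasoning
      N = treeCount
      C = totalCov ℓ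
      M = τ / (4 * ℓ)
      ring₁ : ∀ M ℓ N → 5 * (2 * M * (4 * ℓ) * N) ≡ 8 * ℓ * (5 * (M * N))
      ring₁ = solve-∀
      ring₂ : ∀ ℓ c → 5 * (16 * (ℓ * c)) ≡ 8 * ℓ * (8 * c) + 16 * (ℓ * c)
      ring₂ = solve-∀
      M4ℓ≤τ : M * (4 * ℓ) ≤ τ
      M4ℓ≤τ = m/n*n≤m τ (4 * ℓ)
      8ℓ≤M : 8 * ℓ ≤ M
      8ℓ≤M = ℕ.s≤s⁻¹ (*-cancelʳ-< (4 * ℓ) (8 * ℓ) (suc M) (≤-<-trans (≤-trans (≤-reflexive (lem ℓ)) small) (n<[n/d+1]*d τ (4 * ℓ))))
        where
        lem : ∀ ℓ → 8 * ℓ * (4 * ℓ) ≡ 32 * (ℓ * ℓ)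
        lem = solve-∀
      4M≤τ : M * 4 ≤ τ
      4M≤τ = ≤-trans (*-monoʳ-≤ M (m≤m*n 4 ℓ)) M4ℓ≤τ
      M+2≤τ : 2 + M ≤ τ
      M+2≤τ = ≤-trans (+-monoˡ-≤ M (≤-trans (m≤m+n 2 6) (≤-trans (m≤m*n 8 ℓ) 8ℓ≤M))) (≤-trans (≤-via (lem M)) 4M≤τ)
        where
        lem : ∀ M → M * 4 ≡ (M + M) + 2 * M
        lem = solve-∀
      M≤m : M ≤ m
      M≤m = ∸-monoˡ-≤ 2 M+2≤τ
      1≤n : 1 ≤ n
      1≤n = ℕ.s≤s⁻¹ (≤-trans (m≤m+n 2 M) M+2≤τ)
      Rsum : ℕ
      Rsum = sumOver (λ G → repeats (treeCode G) M) (trees τ)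
      each : ∀ {G} → G ∈ trees τ → M ≤ cov ℓ G + (ℓ + ℓ * repeats (treeCode G) M)
      each {G} G∈ = ≤-trans (levelSize-lower (treeCode G) (≤-trans (m≤n+m M 2) M+2≤τ) ℓ)
        (+-mono-≤ (subst (_≤ cov ℓ G) (size-levelSize (ParentOf.noCycle (P G∈)) ℓ) (size-cov (P G∈) ℓ)) (≤-reflexive (*-suc ℓ (repeats (treeCode G) M))))
      sum₁ : N * M ≤ C + (N * ℓ + ℓ * Rsum)
      sum₁ = begin
        N * M                                                                    ≡⟨ sumOver-const M (trees τ) ⟨
        sumOver (λ _ → M) (trees τ)                                              ≤⟨ sumOver-mono (trees τ) each ⟩
        sumOver (λ G → cov ℓ G + (ℓ + ℓ * repeats (treeCode G) M)) (trees τ)     ≡⟨ sumOver-+ (cov ℓ) (λ G → ℓ + ℓ * repeats (treeCode G) M) (trees τ) ⟩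
        C + sumOver (λ G → ℓ + ℓ * repeats (treeCode G) M) (trees τ)             ≡⟨ cong (C +_) (trans (sumOver-+ (λ _ → ℓ) (λ G → ℓ * repeats (treeCode G) M) (trees τ)) (cong₂ _+_ (sumOver-const ℓ (trees τ)) (sumOver-* ℓ (λ G → repeats (treeCode G) M) (trees τ)))) ⟩
        C + (N * ℓ + ℓ * Rsum)                                                   ∎
      sum₂ : τ * Rsum ≤ M * M * N
      sum₂ = begin
        τ * Rsum                                     ≤⟨ *-monoʳ-≤ τ (≤-trans (sum-treeCode {n} (λ u → repeats u M)) (≤-reflexive (wordSum-list m (λ u → repeats u M)))) ⟩
        τ * wordSum τ m (rep₀ ∘ suffix M)            ≡⟨ cong (τ *_) (wordSum-suffix M≤m rep₀) ⟩
        τ * (τ ^ (m ∸ M) * wordSum τ M rep₀)         ≡⟨ lem τ (τ ^ (m ∸ M)) (wordSum τ M rep₀) ⟩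
        τ ^ (m ∸ M) * (τ * wordSum τ M rep₀)         ≤⟨ *-monoʳ-≤ (τ ^ (m ∸ M)) (rep₀-mean M) ⟩
        τ ^ (m ∸ M) * (M * M * τ ^ M)                ≡⟨ lem (τ ^ (m ∸ M)) (M * M) (τ ^ M) ⟩
        M * M * (τ ^ (m ∸ M) * τ ^ M)                ≡⟨ cong (M * M *_) (trans (sym (^-distribˡ-+-* τ (m ∸ M) M)) (cong (τ ^_) (m∸n+n≡m M≤m))) ⟩
        M * M * τ ^ m                                ≤⟨ *-monoʳ-≤ (M * M) (trees-lower 1≤n) ⟩
        M * M * N                                    ∎
        where
        lem : ∀ a b c → a * (b * c) ≡ b * (a * c)
        lem = solve-∀
      key : 5 * (M * N) ≤ 8 * C
      key = *-cancelˡ-≤ τ (+-cancelʳ-≤ (3 * (τ * (M * N))) _ _ (begin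
        τ * (5 * (M * N)) + 3 * (τ * (M * N))                 ≡⟨ lem₁ τ M N ⟩
        8 * (τ * (N * M))                                     ≤⟨ *-monoʳ-≤ 8 (*-monoʳ-≤ τ sum₁) ⟩
        8 * (τ * (C + (N * ℓ + ℓ * Rsum)))                    ≡⟨ lem₂ τ C N ℓ Rsum ⟩
        τ * (8 * C) + (τ * N * (8 * ℓ) + 8 * ℓ * (τ * Rsum))  ≤⟨ +-monoʳ-≤ (τ * (8 * C)) (+-mono-≤ (*-monoʳ-≤ (τ * N) 8ℓ≤M) (*-monoʳ-≤ (8 * ℓ) sum₂)) ⟩
        τ * (8 * C) + (τ * N * M + 8 * ℓ * (M * M * N))       ≡⟨ cong (λ x → τ * (8 * C) + (τ * N * M + x)) (lem₃ ℓ M N) ⟩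
        τ * (8 * C) + (τ * N * M + 2 * (M * (4 * ℓ)) * (M * N)) ≤⟨ +-monoʳ-≤ (τ * (8 * C)) (+-monoʳ-≤ (τ * N * M) (*-monoˡ-≤ (M * N) (*-monoʳ-≤ 2 M4ℓ≤τ))) ⟩
        τ * (8 * C) + (τ * N * M + 2 * τ * (M * N))           ≡⟨ cong (τ * (8 * C) +_) (lem₄ τ M N) ⟩
        τ * (8 * C) + 3 * (τ * (M * N))                       ∎))
        where
        lem₁ : ∀ t M N → t * (5 * (M * N)) + 3 * (t * (M * N)) ≡ 8 * (t * (N * M))
        lem₁ = solve-∀
        lem₂ : ∀ t C N ℓ R → 8 * (t * (C + (N * ℓ + ℓ * R))) ≡ t * (8 * C) + (t * N * (8 * ℓ) + 8 * ℓ * (t * R))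
        lem₂ = solve-∀
        lem₃ : ∀ ℓ M N → 8 * ℓ * (M * M * N) ≡ 2 * (M * (4 * ℓ)) * (M * N)
        lem₃ = solve-∀
        lem₄ : ∀ t M N → t * N * M + 2 * t * (M * N) ≡ 3 * (t * (M * N))
        lem₄ = solve-∀

-- The product inequality for two families of trees, with weights that are powers of one number.

module Deviation where

  open Basics
  open Trees
  open Covers
  open Product
  open Rationals
  open Indicator using (indicatorℚ)
  open import Data.Bool using (Bool; true; false; _∧_; not)
  open import Data.Fin using (Fin)
  open import Data.Fin.Properties using () renaming (_≟_ to _≟F_)
  open import Data.List as List using (List; []; _∷_; map; concatMap; length; filterᵇ; allFin)
  open import Data.List.Properties using (length-map)
  open import Data.List.Membership.Propositional using (_∈_)
  open import Data.List.Membership.DecPropositional using (_∈?_)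
  open import Data.List.Membership.Propositional.Properties using (∈-map⁺; ∈-map⁻; ∈-allFin; ∈-concatMap⁺)
  open import Data.List.Relation.Unary.Any as Any using (here)
  open import Data.List.Relation.Unary.Unique.Propositional using (Unique)
  open import Data.Nat as ℕ using (ℕ; zero; suc; z≤n; s≤s)
  import Data.Nat.Properties as ℕₚ
  open import Data.Product using (_×_; _,_; proj₁; proj₂; ∃; Σ)
  open import Data.Rational using (ℚ; 0ℚ; 1ℚ; _+_; _*_; _-_; _≤_; _<_; 1/_; positive)
  open import Data.Rational.Properties
  open import Data.Vec as Vec using (Vec; []; _∷_; tabulate; replicate)
  open import Data.Vec.Properties using (lookup∘tabulate) renaming (≡-dec to Vec-≡-dec)
  open import Function using (_∘_)
  open import Relation.Nullary using (Dec; yes; no; does)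
  open import Relation.Nullary.Decidable using (dec-true)
  open import Relation.Binary.PropositionalEquality
  open import Tactic.RingSolver using (solve-∀)

  private variable
    A : Set
    n t k : ℕ

  indicatorℚ-nonneg : ∀ b → 0ℚ ≤ indicatorℚ b
  indicatorℚ-nonneg true = 0≤1
  indicatorℚ-nonneg false = ≤-refl

  sumℚ-indicator : ∀ (χ : A → Bool) xs → sumℚ (indicatorℚ ∘ χ) xs ≡ fromℕ (length (filterᵇ χ xs))
  sumℚ-indicator χ [] = refl
  sumℚ-indicator χ (x ∷ xs) with χ x
  ... | true = trans (cong (1ℚ +_) (sumℚ-indicator χ xs)) (sym (fromℕ-+ 1 (length (filterᵇ χ xs))))
  ... | false = trans (+-identityˡ _) (sumℚ-indicator χ xs)

  sumℚ-++ : ∀ (f : A → ℚ) xs ys → sumℚ f (xs List.++ ys) ≡ sumℚ f xs + sumℚ f ys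
  sumℚ-++ f [] ys = sym (+-identityˡ _)
  sumℚ-++ f (x ∷ xs) ys = trans (cong (f x +_) (sumℚ-++ f xs ys)) (sym (+-assoc (f x) _ _))

  vectors : ∀ t k → List (Vec (Fin t) k)
  vectors t zero = [] ∷ []
  vectors t (suc k) = concatMap (λ a → map (a ∷_) (vectors t k)) (allFin t)

  vectors⁺ : ∀ (v : Vec (Fin t) k) → v ∈ vectors t k
  vectors⁺ [] = here refl
  vectors⁺ {t} {suc k} (a ∷ v) = ∈-concatMap⁺ (λ a → map (a ∷_) (vectors t k)) (Any.map (λ { refl → ∈-map⁺ (a ∷_) (vectors⁺ v) }) (∈-allFin a))

  sumWords-vectors : ∀ k (F : Vec (Fin t) k → ℚ) → sumWords k F ≡ sumℚ F (vectors t k)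
  sumWords-vectors zero F = sym (+-identityʳ _)
  sumWords-vectors {t} (suc k) F = go (allFin t)
    where
    sumℚ-map : ∀ a vs → sumℚ F (map (a ∷_) vs) ≡ sumℚ (λ v → F (a ∷ v)) vs
    sumℚ-map a [] = refl
    sumℚ-map a (v ∷ vs) = cong (F (a ∷ v) +_) (sumℚ-map a vs)
    go : ∀ as → sumℚ (λ a → sumWords k (λ v → F (a ∷ v))) as ≡ sumℚ F (concatMap (λ a → map (a ∷_) (vectors t k)) as)
    go [] = refl
    go (a ∷ as) = trans (cong₂ _+_ (trans (sumWords-vectors k (λ v → F (a ∷ v))) (sym (sumℚ-map a (vectors t k)))) (go as))
      (sym (sumℚ-++ F (map (a ∷_) (vectors t k)) _))

  vec∈? : (v : Vec (Fin t) k) (ws : List (Vec (Fin t) k)) → Dec (v ∈ ws)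
  vec∈? = _∈?_ (Vec-≡-dec _≟F_)

  length≤sumWords : ∀ {ws : List (Vec (Fin t) k)} → Unique ws → fromℕ (length ws) ≤ sumWords k (λ v → indicatorℚ (does (vec∈? v ws)))
  length≤sumWords {t} {k} {ws} u = ≤-trans (fromℕ-mono {length ws} {length (filterᵇ χ (vectors t k))} (length-⊆ u (λ {v} v∈ → ∈-filterᵇ⁺ χ (vectors⁺ v) (dec-true (vec∈? v ws) v∈))))
    (≤-reflexive (sym (trans (sumWords-vectors k (indicatorℚ ∘ χ)) (sumℚ-indicator χ (vectors t k)))))
    where
    χ : Vec (Fin t) k → Bool
    χ v = does (vec∈? v ws)

  alphabet-≡ : ∀ t → alphabet {t} ≡ fromℕ t
  alphabet-≡ t = trans (go (allFin t)) (cong fromℕ (length-allFin t))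
    where
    go : ∀ (xs : List (Fin t)) → sumℚ (λ _ → 1ℚ) xs ≡ fromℕ (length xs)
    go [] = refl
    go (x ∷ xs) = trans (cong (1ℚ +_) (go xs)) (sym (fromℕ-+ 1 (length xs)))

  marked-tabulate : ∀ (χ : A → Bool) (f : Fin k → A) → marked (tabulate (χ ∘ f)) ≡ length (filterᵇ χ (List.tabulate f))
  marked-tabulate {k = zero} χ f = refl
  marked-tabulate {k = suc k} χ f with χ (f Fin.zero)
  ... | true = cong suc (marked-tabulate χ (f ∘ Fin.suc))
  ... | false = marked-tabulate χ (f ∘ Fin.suc)

  mismatch-tabulate : ∀ (χ : A → Bool) (p q : A → Fin t) (f : Fin k → A) →
    mismatch (tabulate (χ ∘ f)) (tabulate (p ∘ f)) (tabulate (q ∘ f)) ≡ length (filterᵇ (λ a → χ a ∧ not (p a == q a)) (List.tabulate f))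
  mismatch-tabulate {k = zero} χ p q f = refl
  mismatch-tabulate {k = suc k} χ p q f with χ (f Fin.zero) ∧ not (p (f Fin.zero) == q (f Fin.zero))
  ... | true = cong suc (mismatch-tabulate χ p q (f ∘ Fin.suc))
  ... | false = mismatch-tabulate χ p q (f ∘ Fin.suc)

  mesh : ℕ → ℚ
  mesh M = divℕ 1 M

  shrinkage : ℕ → ℚ
  shrinkage M = 1ℚ - mesh M * mesh M

  -- κ is the reciprocal of an integer M, so that 1 - κ can be compared with the M-th power of z = 1
  -- - κ². With S = 1/z the condition on `S` in `Concentration` is an equality.
  module Mesh {M : ℕ} (2≤M : 2 ℕ.≤ M) where

    κ z : ℚ
    κ = mesh M
    z = shrinkage M

    0≤κ : 0ℚ ≤ κ
    0≤κ = divℕ-nonneg 1 M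

    κM : κ * fromℕ M ≡ 1ℚ
    κM = divℕ-fromℕ 1 M (ℕₚ.≤-trans (s≤s z≤n) 2≤M)

    κ<1 : κ < 1ℚ
    κ<1 = ≰⇒> λ 1≤κ → ℕₚ.<⇒≱ 2≤M (fromℕ-reflect {M} {1} (subst₂ _≤_ (*-identityˡ (fromℕ M)) κM (*-monoʳ (fromℕ-nonneg M) 1≤κ)))

    κκ≤1 : κ * κ ≤ 1ℚ
    κκ≤1 = ≤-trans (*-mono 0≤κ 0≤1 (<⇒≤ κ<1) (<⇒≤ κ<1)) (≤-reflexive (*-identityˡ 1ℚ))

    0<z : 0ℚ < z
    0<z = subst (0ℚ <_) (lem κ) (positive⁻¹ _ {{pos*pos⇒pos (1ℚ - κ) {{positive a}} (1ℚ + κ) {{positive b}}}})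
      where
      lem : ∀ κ → (1ℚ - κ) * (1ℚ + κ) ≡ 1ℚ - κ * κ
      lem = solve-∀ ℚ-ring
      a : 0ℚ < 1ℚ - κ
      a = subst (_< 1ℚ - κ) (+-inverseʳ κ) (+-monoˡ-< (Data.Rational.- κ) κ<1)
      b : 0ℚ < 1ℚ + κ
      b = <-≤-trans 0<1 (≤-from 0≤κ refl)

    z≤1 : z ≤ 1ℚ
    z≤1 = ≤-from (*-nonneg 0≤κ 0≤κ) (lem κ)
      where
      lem : ∀ κ → 1ℚ - κ * κ + κ * κ ≡ 1ℚ
      lem = solve-∀ ℚ-ring

    S : ℚ
    S = (1/ z) {{pos⇒nonZero z {{positive 0<z}}}}

    Sz : S * z ≡ 1ℚ
    Sz = *-inverseˡ z {{pos⇒nonZero z {{positive 0<z}}}}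

    0≤S : 0ℚ ≤ S
    0≤S = <⇒≤ (positive⁻¹ S {{1/pos⇒pos z {{positive 0<z}}}})

    -- Bernoulli's inequality, as Mκ² = κ.
    r≤zM : 1ℚ - κ ≤ pow z M
    r≤zM = subst (_≤ pow z M) (trans (lem κ (fromℕ M)) (trans (cong (λ s → 1ℚ - κ * s) κM) (cong (λ s → 1ℚ - s) (*-identityʳ κ)))) (bernoulli (*-nonneg 0≤κ 0≤κ) κκ≤1 M)
      where
      lem : ∀ κ m → 1ℚ - m * (κ * κ) ≡ 1ℚ - κ * (κ * m)
      lem = solve-∀ ℚ-ring

    -- Since S is the inverse of z and 1 - κ ≤ z^M, the product is at most z^(dM - m): m marked
    -- coordinates are paid for by d mismatches worth M each.
    balance : ∀ {E m d} → E ℕ.+ m ℕ.≤ d ℕ.* M → pow S m * pow (1ℚ - κ) d ≤ pow z E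
    balance {E} {m} {d} le = begin
      pow S m * pow (1ℚ - κ) d                       ≤⟨ *-monoˡ (pow-nonneg 0≤S m) (pow-mono (≤⇒0≤- (<⇒≤ κ<1)) r≤zM d) ⟩
      pow S m * pow (pow z M) d                      ≡⟨ cong (pow S m *_) (trans (sym (pow-* z d M)) (trans (cong (pow z) (sym eq)) (trans (pow-+ z (E ℕ.+ m) e) (cong (_* pow z e) (pow-+ z E m))))) ⟩
      pow S m * (pow z E * pow z m * pow z e)        ≡⟨ lem (pow S m) (pow z E) (pow z m) (pow z e) ⟩
      pow S m * pow z m * (pow z E * pow z e)        ≡⟨ cong (_* (pow z E * pow z e)) (trans (sym (pow-distrib S z m)) (trans (cong (λ s → pow s m) Sz) (pow-1 m))) ⟩
      1ℚ * (pow z E * pow z e)                       ≡⟨ *-identityˡ _ ⟩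
      pow z E * pow z e                              ≤⟨ *-monoˡ (pow-nonneg (<⇒≤ 0<z) E) (pow-≤1 (<⇒≤ 0<z) z≤1 e) ⟩
      pow z E * 1ℚ                                   ≡⟨ *-identityʳ _ ⟩
      pow z E                                        ∎
      where
      open ≤-Reasoning
      e : ℕ
      e = d ℕ.* M ℕ.∸ (E ℕ.+ m)
      eq : E ℕ.+ m ℕ.+ e ≡ d ℕ.* M
      eq = ℕₚ.m+[n∸m]≡n le
      lem : ∀ a b c d → a * (b * c * d) ≡ a * c * (b * d)
      lem = solve-∀ ℚ-ring

  mark : List (Fin t) → Vec Bool t
  mark C = tabulate (λ v → memᵇ v C)

  marked-mark : ∀ {C : List (Fin t)} → Unique C → marked (mark C) ≡ length C
  marked-mark {t} {C} u = trans (marked-tabulate χ (λ i → i)) (length-≡ (count-Unique χ) u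
    (λ v∈ → memᵇ⁻ C (proj₂ (∈-filterᵇ⁻ χ {allFin t} v∈))) (λ v∈ → ∈-count χ (memᵇ⁺ v∈)))
    where
    χ : Fin t → Bool
    χ v = memᵇ v C

  mismatch-mark : ∀ {C : List (Fin t)} (p q : Fin t → Fin t) → Unique C →
    mismatch (mark C) (tabulate p) (tabulate q) ≡ length (filterᵇ (λ x → not (p x == q x)) C)
  mismatch-mark {t} {C} p q u = trans (mismatch-tabulate (λ v → memᵇ v C) p q (λ i → i))
    (length-≡ (count-Unique ψ) (filterᵇ-Unique (λ x → not (p x == q x)) u)
      (λ {v} v∈ → let (a , b) = ∧⁻ (memᵇ v C) (proj₂ (∈-filterᵇ⁻ ψ {allFin t} v∈)) in ∈-filterᵇ⁺ (λ x → not (p x == q x)) (memᵇ⁻ C a) b)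
      (λ v∈ → let (a , b) = ∈-filterᵇ⁻ (λ x → not (p x == q x)) {C} v∈ in ∈-count ψ (∧⁺ (memᵇ⁺ a) b)))
    where
    ψ : Fin t → Bool
    ψ a = memᵇ a C ∧ not (p a == q a)

  -- Objects x coded by functions p x, with a statistic f such that f x is certified by f x coordinates,
  -- each of which accounts for a change of at most L.
  module TwoSets {t : ℕ} {A : Set} {ts : List A} (ts-unique : Unique ts) (p : A → Fin t → Fin t) (f : A → ℕ) (L : ℕ)
    (determined : ∀ {x y} → x ∈ ts → y ∈ ts → (∀ v → p x v ≡ p y v) → x ≡ y)
    (certificate : ∀ {x} → x ∈ ts → Σ (List (Fin t)) λ C → Unique C × length C ≡ f x ×
      (∀ {y} → y ∈ ts → f x ℕ.≤ f y ℕ.+ L ℕ.* length (filterᵇ (λ v → not (p x v == p y v)) C))) where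

    codeVec : A → Vec (Fin t) t
    codeVec x = tabulate (p x)

    codes : (A → Bool) → List (Vec (Fin t) t)
    codes χ = map codeVec (filterᵇ χ ts)

    codes-Unique : ∀ χ → Unique (codes χ)
    codes-Unique χ = map-Unique codeVec
      (λ {x} {y} x∈ y∈ eq → determined (proj₁ (∈-filterᵇ⁻ χ {ts} x∈)) (proj₁ (∈-filterᵇ⁻ χ {ts} y∈))
        (λ v → trans (sym (lookup∘tabulate (p x) v)) (trans (cong (λ w → Vec.lookup w v) eq) (lookup∘tabulate (p y) v))))
      (filterᵇ-Unique χ ts-unique)

    codes⁻ : ∀ χ {w} → w ∈ codes χ → ∃ λ x → x ∈ ts × χ x ≡ true × w ≡ codeVec x
    codes⁻ χ w∈ with ∈-map⁻ codeVec w∈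
    ... | x , x∈ , eq = x , proj₁ (∈-filterᵇ⁻ χ {ts} x∈) , proj₂ (∈-filterᵇ⁻ χ {ts} x∈) , eq

    module _ (β α : A → Bool) {κ S : ℚ} (0≤κ : 0ℚ ≤ κ) (κ≤1 : κ ≤ 1ℚ) (1≤S : 1ℚ ≤ S * (1ℚ - κ * κ)) (0≤S : 0ℚ ≤ S) {c : ℚ} (0≤c : 0ℚ ≤ c)
      (far : ∀ {x y} d → x ∈ ts → y ∈ ts → β x ≡ true → α y ≡ true → f x ℕ.≤ f y ℕ.+ L ℕ.* d → pow S (f x) * pow (1ℚ - κ) d ≤ c) where

      private
        lem₀ : ∀ x w → 0ℚ * x * w ≡ 0ℚ
        lem₀ = solve-∀ ℚ-ring
        lem₁ : ∀ w → 1ℚ * 0ℚ * w ≡ 0ℚ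
        lem₁ = solve-∀ ℚ-ring
        lem₂ : ∀ w → 1ℚ * 1ℚ * w ≡ w
        lem₂ = solve-∀ ℚ-ring

      open Concentration {t = t} {κ} {S} 0≤κ κ≤1 1≤S 0≤S {c} 0≤c

      Ψ Φ : Vec (Fin t) t → ℚ
      Ψ v = indicatorℚ (does (vec∈? v (codes β)))
      Φ w = indicatorℚ (does (vec∈? w (codes α)))

      pair-bound : ∀ {x} → x ∈ ts → β x ≡ true → Σ (Vec Bool t) λ I → ∀ {y} → y ∈ ts → α y ≡ true → weight I (codeVec x) (codeVec y) ≤ c
      pair-bound {x} x∈ βx with certificate x∈
      ... | C , u , len , lipschitz = mark C , λ {y} y∈ αy →
        subst₂ (λ m d → pow S m * pow (1ℚ - κ) d ≤ c) (trans (sym len) (sym (marked-mark u))) (sym (mismatch-mark (p x) (p y) u))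
          (far (length (filterᵇ (λ v → not (p x v == p y v)) C)) x∈ y∈ βx αy (lipschitz y∈))

      all-bound : Bound t Ψ Φ
      all-bound v with vec∈? v (codes β)
      -- `Ψ` vanishes outside the coded set, so any marking will do.
      ... | no _ = replicate t false , λ w → ≤-trans (≤-reflexive (lem₀ (Φ w) (weight (replicate t false) v w))) 0≤c
      ... | yes v∈ with codes⁻ β v∈
      ...   | x , x∈ , βx , refl = proj₁ (pair-bound x∈ βx) , rest
        where
        I = proj₁ (pair-bound x∈ βx)
        rest : ∀ w → 1ℚ * Φ w * weight I (codeVec x) w ≤ c
        rest w with vec∈? w (codes α)
        ... | no _ = ≤-trans (≤-reflexive (lem₁ (weight I (codeVec x) w))) 0≤c
        ... | yes w∈ with codes⁻ α w∈
        ...   | y , y∈ , αy , refl = ≤-trans (≤-reflexive (lem₂ (weight I (codeVec x) (codeVec y)))) (proj₂ (pair-bound x∈ βx) y∈ αy)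

      two-sets : fromℕ (length (filterᵇ β ts)) * fromℕ (length (filterᵇ α ts)) ≤ c * pow (fromℕ t * fromℕ t) t
      two-sets = begin
        fromℕ (length (filterᵇ β ts)) * fromℕ (length (filterᵇ α ts))     ≡⟨ cong₂ (λ a b → fromℕ a * fromℕ b) (length-map codeVec (filterᵇ β ts)) (length-map codeVec (filterᵇ α ts)) ⟨
        fromℕ (length (codes β)) * fromℕ (length (codes α))               ≤⟨ *-mono (fromℕ-nonneg (length (codes α))) (sumWords-nonneg t (λ v → indicatorℚ-nonneg (does (vec∈? v (codes β)))))
                                                                              (length≤sumWords (codes-Unique β)) (length≤sumWords (codes-Unique α)) ⟩
        sumWords t Ψ * sumWords t Φ                                       ≤⟨ concentration t Ψ Φ (λ v → indicatorℚ-nonneg (does (vec∈? v (codes β)))) (λ v → indicatorℚ-nonneg (does (vec∈? v (codes α)))) all-bound ⟩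
        c * pow (alphabet {t} * alphabet {t}) t                     ≡⟨ cong (λ s → c * pow (s * s) t) (alphabet-≡ t) ⟩
        c * pow (fromℕ t * fromℕ t) t                               ∎
        where open ≤-Reasoning

-- From the two-set inequality to the deviation bound.

module Tail where

  open Basics
  open Product
  open Rationals
  open Indicator using (indicatorℚ)
  open Deviation using (shrinkage; mesh; sumℚ-indicator; module Mesh)
  open Bounds using (n<[n/d+1]*d)
  open import Data.Bool using (Bool; true; false; not; T)
  open import Data.Bool.Properties using (T-≡)
  open import Data.Empty using (⊥-elim)
  open import Data.List using (List; []; _∷_; length; filterᵇ)
  open import Data.List.Membership.Propositional using (_∈_)
  open import Data.List.Relation.Unary.Any using (here; there)
  open import Data.List.Properties using (length-filter)
  open import Data.Nat as ℕ using (ℕ; zero; suc; z≤n; s≤s)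
  open import Data.Nat.DivMod using (m/n*n≤m)
  import Data.Nat.Properties as ℕₚ
  open import Data.Nat.Tactic.RingSolver using () renaming (solve-∀ to solveℕ)
  open import Data.Product using (proj₁; proj₂)
  open import Data.Rational using (ℚ; 0ℚ; 1ℚ; _+_; _*_; _-_; -_; _≤_; _<_; _≤ᵇ_; ∣_∣; positive)
  open import Data.Rational.Properties
  open import Data.Sum using (_⊎_; inj₁; inj₂)
  open import Function using (_∘_; Equivalence)
  open import Relation.Binary.PropositionalEquality
  open import Tactic.RingSolver using (solve-∀)

  ≤ᵇ-true : ∀ {x y} → (x ≤ᵇ y) ≡ true → x ≤ y
  ≤ᵇ-true e = ≤ᵇ⇒≤ (Equivalence.from T-≡ e)

  ≤ᵇ-false : ∀ {x y} → (x ≤ᵇ y) ≡ false → y < x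
  ≤ᵇ-false {x} {y} e = ≰⇒> λ le → true≢false (Equivalence.to T-≡ (≤⇒≤ᵇ le)) e

  abs-≤ : ∀ {y Δ} → y ≤ Δ → - y ≤ Δ → ∣ y ∣ ≤ Δ
  abs-≤ {y} a b with ∣p∣≡p∨∣p∣≡-p y
  ... | inj₁ e = subst (_≤ _) (sym e) a
  ... | inj₂ e = subst (_≤ _) (sym e) b

  length-cover : ∀ {A : Set} (p q r : A → Bool) xs → (∀ x → p x ≡ true → q x ≡ true ⊎ r x ≡ true) →
    length (filterᵇ p xs) ℕ.≤ length (filterᵇ q xs) ℕ.+ length (filterᵇ r xs)
  length-cover p q r [] h = z≤n
  length-cover p q r (x ∷ xs) h with p x | q x | r x | h x | length-cover p q r xs h
  ... | false | false | false | _ | ih = ih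
  ... | false | true | false | _ | ih = ℕₚ.m≤n⇒m≤1+n ih
  ... | false | false | true | _ | ih = ℕₚ.≤-trans ih (ℕₚ.+-monoʳ-≤ (length (filterᵇ q xs)) (ℕₚ.n≤1+n _))
  ... | false | true | true | _ | ih = ℕₚ.m≤n⇒m≤1+n (ℕₚ.≤-trans ih (ℕₚ.+-monoʳ-≤ (length (filterᵇ q xs)) (ℕₚ.n≤1+n _)))
  ... | true | true | false | _ | ih = s≤s ih
  ... | true | false | true | _ | ih = ℕₚ.≤-trans (s≤s ih) (ℕₚ.≤-reflexive (sym (ℕₚ.+-suc (length (filterᵇ q xs)) _)))
  ... | true | true | true | _ | ih = s≤s (ℕₚ.≤-trans ih (ℕₚ.+-monoʳ-≤ (length (filterᵇ q xs)) (ℕₚ.n≤1+n _)))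
  ... | true | false | false | k | ih with k refl
  ...   | inj₁ ()
  ...   | inj₂ ()

  sumℚ-≤ : ∀ {A : Set} {f g : A → ℚ} xs → (∀ {x} → x ∈ xs → f x ≤ g x) → sumℚ f xs ≤ sumℚ g xs
  sumℚ-≤ [] h = ≤-refl
  sumℚ-≤ (x ∷ xs) h = +-mono-≤ (h (here refl)) (sumℚ-≤ xs (h ∘ there))

  sumℚ-const : ∀ {A : Set} c (xs : List A) → sumℚ (λ _ → c) xs ≡ fromℕ (length xs) * c
  sumℚ-const c [] = sym (*-zeroˡ c)
  sumℚ-const c (x ∷ xs) = trans (cong (c +_) (sumℚ-const c xs)) (trans (lem c (fromℕ (length xs))) (cong (_* c) (sym (fromℕ-+ 1 (length xs)))))
    where
    lem : ∀ c l → c + l * c ≡ (1ℚ + l) * c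
    lem = solve-∀ ℚ-ring

  indicator-cases : ∀ b (P : ℚ → Set) → (b ≡ true → P 1ℚ) → (b ≡ false → P 0ℚ) → P (indicatorℚ b)
  indicator-cases true P h _ = h refl
  indicator-cases false P _ h = h refl

  ½ : ℚ
  ½ = divℕ 1 2

  ½+½ : ∀ x → ½ * x + ½ * x ≡ x
  ½+½ x = trans (lem ½ x) (trans (cong (_* x) (divℕ-fromℕ 1 2 (s≤s z≤n))) (*-identityˡ x))
    where
    lem : ∀ h x → h * x + h * x ≡ h * (1ℚ + 1ℚ) * x
    lem = solve-∀ ℚ-ring

  *-pos : ∀ {a b} → 0ℚ < a → 0ℚ < b → 0ℚ < a * b
  *-pos {a} {b} ha hb = positive⁻¹ (a * b) {{pos*pos⇒pos a {{positive ha}} b {{positive hb}}}}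

  -- With c = 1/k, q = T/l³ and h = 1/m, the exponent c δ² q is at most f h² as soon as m ≤ g l/δ, T ≤ e l f and e g² ≤ k.
  exponent-scale : ∀ {c δ q k l³ h m e l f g T} → 0ℚ ≤ e → 0ℚ ≤ δ → 0ℚ ≤ m → 0ℚ ≤ g → 0ℚ ≤ l → 0ℚ ≤ f → 0ℚ < k → 0ℚ < l³ → 0ℚ < m →
    c * k ≡ 1ℚ → q * l³ ≡ T → h * m ≡ 1ℚ → l³ ≡ pow l 3 → δ * m ≤ g * l → T ≤ e * l * f → e * (g * g) ≤ k →
    c * δ * δ * q ≤ f * (h * h)
  exponent-scale {c} {δ} {q} {k} {l³} {h} {m} {e} {l} {f} {g} {T} 0≤e 0≤δ 0≤m 0≤g 0≤l 0≤f 0<k 0<l³ 0<m ck ql hm l³≡ δm Tlf eg = cancel-pos (*-pos (*-pos 0<k 0<l³) (*-pos 0<m 0<m)) (begin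
    c * δ * δ * q * (k * l³ * (m * m))               ≡⟨ lem₁ c δ q k l³ m ⟩
    c * k * (q * l³) * (δ * m * (δ * m))             ≡⟨ cong₂ (λ a b → a * b * (δ * m * (δ * m))) ck ql ⟩
    1ℚ * T * (δ * m * (δ * m))                       ≤⟨ *-monoʳ (square-nonneg (δ * m)) (*-monoˡ 0≤1 Tlf) ⟩
    1ℚ * (e * l * f) * (δ * m * (δ * m))             ≡⟨ lem₂ e l f (δ * m) ⟩
    e * (δ * m * (δ * m)) * (l * f)                  ≤⟨ *-monoʳ (*-nonneg 0≤l 0≤f) square ⟩
    k * (l * l) * (l * f)                            ≡⟨ lem₃ k l f ⟩
    k * f * (l * (l * (l * 1ℚ))) * (1ℚ * 1ℚ)         ≡⟨ cong₂ (λ a b → k * f * a * (b * b)) l³≡ hm ⟨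
    k * f * l³ * (h * m * (h * m))                   ≡⟨ lem₄ k f l³ h m ⟩
    f * (h * h) * (k * l³ * (m * m))                 ∎)
    where
    open ≤-Reasoning
    lem₁ : ∀ c d q k l m → c * d * d * q * (k * l * (m * m)) ≡ c * k * (q * l) * (d * m * (d * m))
    lem₁ = solve-∀ ℚ-ring
    lem₂ : ∀ e l f x → 1ℚ * (e * l * f) * (x * x) ≡ e * (x * x) * (l * f)
    lem₂ = solve-∀ ℚ-ring
    lem₃ : ∀ k l f → k * (l * l) * (l * f) ≡ k * f * (l * (l * (l * 1ℚ))) * (1ℚ * 1ℚ)
    lem₃ = solve-∀ ℚ-ring
    lem₄ : ∀ k f l h m → k * f * l * (h * m * (h * m)) ≡ f * (h * h) * (k * l * (m * m))
    lem₄ = solve-∀ ℚ-ring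
    lem₅ : ∀ e g l → e * (g * l * (g * l)) ≡ e * (g * g) * (l * l)
    lem₅ = solve-∀ ℚ-ring
    square : e * (δ * m * (δ * m)) ≤ k * (l * l)
    square = ≤-trans (*-monoˡ 0≤e (*-mono (*-nonneg 0≤δ 0≤m) (*-nonneg 0≤g 0≤l) δm δm))
      (≤-trans (≤-reflexive (lem₅ e g l)) (*-monoʳ (square-nonneg l) eg))

  -- `C` is the constant of the mean bound, and `count` says that the objects have density at least
  -- t^(-2) among all t^t codes. `H`, `G` and `K` are only bounded from below, so that the proof
  -- never computes with their large values.
  module _ {A : Set} {ts : List A} {f : A → ℕ} {t ℓ C H G K : ℕ} {L : ℕ} (L-≡ : L ≡ 3 ℕ.* ℓ)
    (1≤ℓ : 1 ℕ.≤ ℓ) (1≤N : 1 ℕ.≤ length ts) (f≤t : ∀ {x} → x ∈ ts → f x ℕ.≤ t)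
    (mean≤ : ℓ ℕ.* sumOver f ts ℕ.≤ C ℕ.* (t ℕ.* length ts))
    (count : t ℕ.^ t ℕ.≤ t ℕ.* t ℕ.* length ts)
    (H-≥ : 6 ℕ.* (C ℕ.+ 2) ℕ.≤ H) (G-≥ : H ℕ.+ H ℕ.+ 3 ℕ.≤ G) (K-≥ : 8 ℕ.* (G ℕ.* G) ℕ.≤ K) (t-≥ : K ℕ.* K ℕ.* (ℓ ℕ.* ℓ) ℕ.≤ t)
    (two-sets : ∀ (β α : A → Bool) {M E : ℕ} → 2 ℕ.≤ M →
      (∀ {x y} d → x ∈ ts → y ∈ ts → β x ≡ true → α y ≡ true → f x ℕ.≤ f y ℕ.+ L ℕ.* d → E ℕ.+ f x ℕ.≤ d ℕ.* M) →
      fromℕ (length (filterᵇ β ts)) * fromℕ (length (filterᵇ α ts)) ≤ pow (shrinkage M) E * pow (fromℕ t * fromℕ t) t)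
    {δ : ℚ} (0<δ : 0ℚ < δ) (δ<1 : δ < 1ℚ)
    {μ : ℚ} (μ-≡ : μ ≡ fromℕ (sumOver f ts) * divℕ 1 (length ts))
    {dev : A → Bool} (dev⇒ : ∀ x → dev x ≡ true → not (∣ fromℕ (f x) - μ ∣ ≤ᵇ δ * divℕ t ℓ) ≡ true) where

    private
      T′ ℓ′ N′ i D Δ η : ℚ
      T′ = fromℕ t
      ℓ′ = fromℕ ℓ
      N′ = fromℕ (length ts)
      i = divℕ 1 (length ts)
      D = divℕ t ℓ
      Δ = δ * D
      η = ½ * Δ

      0≤T : 0ℚ ≤ T′
      0≤T = fromℕ-nonneg t
      0≤ℓ : 0ℚ ≤ ℓ′
      0≤ℓ = fromℕ-nonneg ℓ
      0≤N : 0ℚ ≤ N′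
      0≤N = fromℕ-nonneg (length ts)
      0<N : 0ℚ < N′
      0<N = fromℕ-pos 1≤N
      0≤δ : 0ℚ ≤ δ
      0≤δ = <⇒≤ 0<δ
      0≤½ : 0ℚ ≤ ½
      0≤½ = divℕ-nonneg 1 2
      0≤D : 0ℚ ≤ D
      0≤D = divℕ-nonneg t ℓ
      0≤Δ : 0ℚ ≤ Δ
      0≤Δ = *-nonneg 0≤δ 0≤D
      0≤η : 0ℚ ≤ η
      0≤η = *-nonneg 0≤½ 0≤Δ

      Dℓ : D * ℓ′ ≡ T′
      Dℓ = divℕ-fromℕ t ℓ 1≤ℓ
      iN : i * N′ ≡ 1ℚ
      iN = divℕ-fromℕ 1 (length ts) 1≤N

      μN : μ * N′ ≡ fromℕ (sumOver f ts)
      μN = trans (cong (_* N′) μ-≡) (trans (*-assoc (fromℕ (sumOver f ts)) i N′) (trans (cong (fromℕ (sumOver f ts) *_) iN) (*-identityʳ (fromℕ (sumOver f ts)))))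

      μℓ : μ * ℓ′ ≤ fromℕ C * T′
      μℓ = cancel-pos 0<N (begin
        μ * ℓ′ * N′                                  ≡⟨ lem μ ℓ′ N′ ⟩
        ℓ′ * (μ * N′)                                ≡⟨ trans (cong (ℓ′ *_) μN) (sym (fromℕ-* ℓ (sumOver f ts))) ⟩
        fromℕ (ℓ ℕ.* sumOver f ts)                   ≤⟨ fromℕ-mono {ℓ ℕ.* sumOver f ts} {C ℕ.* (t ℕ.* length ts)} mean≤ ⟩
        fromℕ (C ℕ.* (t ℕ.* length ts))              ≡⟨ trans (fromℕ-* C (t ℕ.* length ts)) (trans (cong (fromℕ C *_) (fromℕ-* t (length ts))) (sym (*-assoc (fromℕ C) T′ N′))) ⟩
        fromℕ C * T′ * N′                            ∎)
        where
        open ≤-Reasoning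
        lem : ∀ a b c → a * b * c ≡ b * (a * c)
        lem = solve-∀ ℚ-ring

      ηℓ : η * ℓ′ ≡ ½ * (δ * T′)
      ηℓ = trans (lem ½ δ D ℓ′) (cong (λ s → ½ * (δ * s)) Dℓ)
        where
        lem : ∀ h d D l → h * (d * D) * l ≡ h * (d * (D * l))
        lem = solve-∀ ℚ-ring

      η≤Δ : η ≤ Δ
      η≤Δ = ≤-from 0≤η (½+½ Δ)

      Δ≤T : Δ ≤ T′
      Δ≤T = ≤-trans (*-monoʳ 0≤D (<⇒≤ δ<1)) (≤-trans (≤-reflexive (trans (*-identityˡ D) (sym (*-identityʳ D))))
        (≤-trans (*-monoˡ 0≤D (fromℕ-mono {1} {ℓ} 1≤ℓ)) (≤-reflexive Dℓ)))

      η≤T : η ≤ T′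
      η≤T = ≤-trans η≤Δ Δ≤T

      ηℓ≤T : η * ℓ′ ≤ T′
      ηℓ≤T = ≤-trans (*-monoʳ 0≤ℓ η≤Δ) (≤-trans (≤-reflexive (trans (*-assoc δ D ℓ′) (cong (δ *_) Dℓ))) (≤-trans (*-monoʳ 0≤T (<⇒≤ δ<1)) (≤-reflexive (*-identityˡ T′))))

      μ≤T : μ ≤ T′
      μ≤T = cancel-pos 0<N (≤-trans (≤-reflexive (trans μN (sym (fromℕ-sum f ts))))
        (≤-trans (sumℚ-≤ ts (λ {x} x∈ → fromℕ-mono {f x} {t} (f≤t x∈))) (≤-reflexive (trans (sumℚ-const T′ ts) (*-comm N′ T′)))))

      size : (A → Bool) → ℚ
      size χ = fromℕ (length (filterᵇ χ ts))

      size-nonneg : ∀ χ → 0ℚ ≤ size χ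
      size-nonneg χ = fromℕ-nonneg (length (filterᵇ χ ts))

      sum-affine : ∀ χ a b → sumℚ (λ x → a * indicatorℚ (χ x) + b * 1ℚ) ts ≡ a * size χ + b * N′
      sum-affine χ a b = trans (sumℚ-lin (indicatorℚ ∘ χ) (λ _ → 1ℚ) a b ts) (cong₂ (λ x y → a * x + b * y) (sumℚ-indicator χ ts) (trans (sumℚ-const 1ℚ ts) (*-identityʳ N′)))

      -- The margin Δ is split in two halves η: one separates each tail from the bulk opposite to
      -- it, the other lets Markov's inequality show that this bulk is not too small.
      α β₂ up dn : A → Bool
      α x = fromℕ (f x) ≤ᵇ μ + η
      β₂ x = μ - η ≤ᵇ fromℕ (f x)
      up x = not (fromℕ (f x) ≤ᵇ μ + Δ)
      dn x = not (μ - Δ ≤ᵇ fromℕ (f x))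

      cov-sum : sumℚ (λ x → fromℕ (f x)) ts ≡ μ * N′
      cov-sum = trans (fromℕ-sum f ts) (sym μN)

      -- Markov's inequality on either side of the mean.
      α-large : N′ * η ≤ size α * (2ℚ * T′)
      α-large = begin
        N′ * η                              ≡⟨ lem₁ N′ μ η ⟩
        (μ + η) * N′ - μ * N′               ≤⟨ +-monoˡ-≤ (- (μ * N′)) sums ⟩
        μ * N′ + (μ + η) * size α - μ * N′  ≡⟨ lem₂ (μ * N′) (μ + η) (size α) ⟩
        size α * (μ + η)                    ≤⟨ *-monoˡ (size-nonneg α) (≤-trans (+-mono-≤ μ≤T η≤T) (≤-reflexive (lem₃ T′))) ⟩
        size α * (2ℚ * T′)                  ∎
        where
        open ≤-Reasoning
        lem₁ : ∀ n m e → n * e ≡ (m + e) * n - m * n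
        lem₁ = solve-∀ ℚ-ring
        lem₂ : ∀ a b c → a + b * c - a ≡ c * b
        lem₂ = solve-∀ ℚ-ring
        lem₃ : ∀ a → a + a ≡ (1ℚ + 1ℚ) * a
        lem₃ = solve-∀ ℚ-ring
        lem₄ : ∀ a b → 1ℚ * a + 1ℚ * b ≡ a + b
        lem₄ = solve-∀ ℚ-ring
        pointwise : ∀ x → μ + η ≤ fromℕ (f x) + ((μ + η) * indicatorℚ (α x) + 0ℚ * 1ℚ)
        pointwise x = indicator-cases (α x) (λ s → μ + η ≤ fromℕ (f x) + ((μ + η) * s + 0ℚ * 1ℚ))
          (λ _ → ≤-from (fromℕ-nonneg (f x)) (lem₅ (μ + η) (fromℕ (f x))))
          (λ e → ≤-trans (<⇒≤ (≤ᵇ-false e)) (≤-reflexive (lem₆ (μ + η) (fromℕ (f x)))))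
          where
          lem₅ : ∀ a b → a + b ≡ b + (a * 1ℚ + 0ℚ * 1ℚ)
          lem₅ = solve-∀ ℚ-ring
          lem₆ : ∀ a b → b ≡ b + (a * 0ℚ + 0ℚ * 1ℚ)
          lem₆ = solve-∀ ℚ-ring
        g : A → ℚ
        g x = (μ + η) * indicatorℚ (α x) + 0ℚ * 1ℚ
        sums : (μ + η) * N′ ≤ μ * N′ + (μ + η) * size α
        sums = begin
          (μ + η) * N′                                         ≡⟨ trans (*-comm (μ + η) N′) (sym (sumℚ-const (μ + η) ts)) ⟩
          sumℚ (λ _ → μ + η) ts                                ≤⟨ sumℚ-≤ ts (λ {x} _ → ≤-trans (pointwise x) (≤-reflexive (sym (lem₄ (fromℕ (f x)) (g x))))) ⟩
          sumℚ (λ x → 1ℚ * fromℕ (f x) + 1ℚ * g x) ts          ≡⟨ trans (sumℚ-lin (λ x → fromℕ (f x)) g 1ℚ 1ℚ ts) (lem₄ (sumℚ (λ x → fromℕ (f x)) ts) (sumℚ g ts)) ⟩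
          sumℚ (λ x → fromℕ (f x)) ts + sumℚ g ts              ≡⟨ cong₂ _+_ cov-sum (trans (sum-affine α (μ + η) 0ℚ) (trans (cong ((μ + η) * size α +_) (*-zeroˡ N′)) (+-identityʳ _))) ⟩
          μ * N′ + (μ + η) * size α                            ∎

      β₂-large : N′ * η ≤ size β₂ * (2ℚ * T′)
      β₂-large = begin
        N′ * η                                              ≡⟨ lem₁ N′ μ η ⟩
        μ * N′ - (μ - η) * N′                               ≤⟨ +-monoˡ-≤ (- ((μ - η) * N′)) sums ⟩
        (T′ + η) * size β₂ + (μ - η) * N′ - (μ - η) * N′    ≡⟨ lem₂ (T′ + η) (size β₂) ((μ - η) * N′) ⟩
        size β₂ * (T′ + η)                                  ≤⟨ *-monoˡ (size-nonneg β₂) (≤-trans (+-monoʳ-≤ T′ η≤T) (≤-reflexive (lem₃ T′))) ⟩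
        size β₂ * (2ℚ * T′)                                 ∎
        where
        open ≤-Reasoning
        lem₁ : ∀ n m e → n * e ≡ m * n - (m - e) * n
        lem₁ = solve-∀ ℚ-ring
        lem₂ : ∀ a b c → a * b + c - c ≡ b * a
        lem₂ = solve-∀ ℚ-ring
        lem₃ : ∀ a → a + a ≡ (1ℚ + 1ℚ) * a
        lem₃ = solve-∀ ℚ-ring
        0≤μ : 0ℚ ≤ μ
        0≤μ = subst (0ℚ ≤_) (sym μ-≡) (*-nonneg (fromℕ-nonneg (sumOver f ts)) (divℕ-nonneg 1 (length ts)))
        pointwise : ∀ {x} → x ∈ ts → fromℕ (f x) ≤ (T′ + η) * indicatorℚ (β₂ x) + (μ - η) * 1ℚ
        pointwise {x} x∈ = indicator-cases (β₂ x) (λ s → fromℕ (f x) ≤ (T′ + η) * s + (μ - η) * 1ℚ)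
          (λ _ → ≤-trans (fromℕ-mono {f x} {t} (f≤t x∈)) (≤-from 0≤μ (lem₅ T′ η μ)))
          (λ e → ≤-trans (<⇒≤ (≤ᵇ-false e)) (≤-reflexive (lem₆ T′ η μ)))
          where
          lem₅ : ∀ T e m → T + m ≡ (T + e) * 1ℚ + (m - e) * 1ℚ
          lem₅ = solve-∀ ℚ-ring
          lem₆ : ∀ T e m → m - e ≡ (T + e) * 0ℚ + (m - e) * 1ℚ
          lem₆ = solve-∀ ℚ-ring
        sums : μ * N′ ≤ (T′ + η) * size β₂ + (μ - η) * N′
        sums = begin
          μ * N′                                                           ≡⟨ cov-sum ⟨
          sumℚ (λ x → fromℕ (f x)) ts                                      ≤⟨ sumℚ-≤ ts pointwise ⟩
          sumℚ (λ x → (T′ + η) * indicatorℚ (β₂ x) + (μ - η) * 1ℚ) ts      ≡⟨ sum-affine β₂ (T′ + η) (μ - η) ⟩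
          (T′ + η) * size β₂ + (μ - η) * N′                                ∎

      dev-cover : ∀ x → dev x ≡ true → up x ≡ true ⊎ dn x ≡ true
      dev-cover x e = go (bool-cases (fromℕ (f x) ≤ᵇ μ + Δ)) (bool-cases (μ - Δ ≤ᵇ fromℕ (f x)))
        where
        lem₁ : ∀ m d → m + d - m ≡ d
        lem₁ = solve-∀ ℚ-ring
        lem₂ : ∀ x m → - (x - m) ≡ m - x
        lem₂ = solve-∀ ℚ-ring
        lem₃ : ∀ x d → x + d - x ≡ d
        lem₃ = solve-∀ ℚ-ring
        lem₄ : ∀ m d → m - d + d ≡ m
        lem₄ = solve-∀ ℚ-ring
        above : fromℕ (f x) ≤ μ + Δ → fromℕ (f x) - μ ≤ Δ
        above a = ≤-trans (+-monoˡ-≤ (- μ) a) (≤-reflexive (lem₁ μ Δ))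
        below : μ - Δ ≤ fromℕ (f x) → - (fromℕ (f x) - μ) ≤ Δ
        below b = ≤-trans (≤-reflexive (trans (lem₂ (fromℕ (f x)) μ) (cong (_- fromℕ (f x)) (sym (lem₄ μ Δ)))))
          (≤-trans (+-monoˡ-≤ (- fromℕ (f x)) (+-monoˡ-≤ Δ b)) (≤-reflexive (lem₃ (fromℕ (f x)) Δ)))
        go : (fromℕ (f x) ≤ᵇ μ + Δ) ≡ true ⊎ (fromℕ (f x) ≤ᵇ μ + Δ) ≡ false → (μ - Δ ≤ᵇ fromℕ (f x)) ≡ true ⊎ (μ - Δ ≤ᵇ fromℕ (f x)) ≡ false → up x ≡ true ⊎ dn x ≡ true
        go (inj₂ a) _ = inj₁ (not⁺ a)
        go (inj₁ _) (inj₂ b) = inj₂ (not⁺ b)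
        go (inj₁ a) (inj₁ b) = ⊥-elim (true≢false (Equivalence.to T-≡ (≤⇒≤ᵇ (abs-≤ (above (≤ᵇ-true a)) (below (≤ᵇ-true b))))) (not⁻ (dev⇒ x e)))

      dev-size : size dev ≤ size up + size dn
      dev-size = ≤-trans (fromℕ-mono {length (filterᵇ dev ts)} {length (filterᵇ up ts) ℕ.+ length (filterᵇ dn ts)} (length-cover dev up dn ts dev-cover))
        (≤-reflexive (fromℕ-+ (length (filterᵇ up ts)) (length (filterᵇ dn ts))))

      -- `m₀` is ℓ/δ up to a factor 2, so κ = 1/M has order δ/ℓ; the summand 3ℓ of `M` pays for the
      -- Lipschitz term in `far`. `E` has the order t/ℓ of the mean, and is a multiple of 4 in view
      -- of the final fourth root.
      m₀ M₀ M F E : ℕ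
      m₀ = proj₁ (round-up ℓ 0<δ δ<1 1≤ℓ)
      M₀ = H ℕ.* m₀
      M = M₀ ℕ.+ 3 ℕ.* ℓ
      F = ℕ._/_ t (4 ℕ.* ℓ) {{ℕ.>-nonZero (ℕₚ.≤-trans 1≤ℓ (ℕₚ.m≤n*m ℓ 4))}}
      E = 4 ℕ.* F

      2≤M : 2 ℕ.≤ M
      2≤M = ℕₚ.≤-trans (s≤s (s≤s z≤n)) (ℕₚ.≤-trans (ℕₚ.*-monoʳ-≤ 3 1≤ℓ) (ℕₚ.m≤n+m (3 ℕ.* ℓ) M₀))

      F4ℓ : F ℕ.* (4 ℕ.* ℓ) ℕ.≤ t
      F4ℓ = m/n*n≤m t (4 ℕ.* ℓ) {{ℕ.>-nonZero (ℕₚ.≤-trans 1≤ℓ (ℕₚ.m≤n*m ℓ 4))}}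

      ℓE : ℓ′ * fromℕ E ≤ T′
      ℓE = ≤-trans (≤-reflexive (sym (fromℕ-* ℓ E))) (fromℕ-mono {ℓ ℕ.* E} {t} (ℕₚ.≤-trans (ℕₚ.≤-reflexive (lem ℓ F)) F4ℓ))
        where
        lem : ∀ ℓ F → ℓ ℕ.* (4 ℕ.* F) ≡ F ℕ.* (4 ℕ.* ℓ)
        lem = solveℕ

      δM₀ : fromℕ H * ℓ′ ≤ δ * fromℕ M₀
      δM₀ = ≤-trans (*-monoˡ (fromℕ-nonneg H) (proj₁ (proj₂ (round-up ℓ 0<δ δ<1 1≤ℓ))))
        (≤-reflexive (trans (lem (fromℕ H) δ (fromℕ m₀)) (cong (δ *_) (sym (fromℕ-* H m₀)))))
        where
        lem : ∀ h d m → h * (d * m) ≡ d * (h * m)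
        lem = solve-∀ ℚ-ring

      -- The gap η forces d ≥ δt/(6ℓ²), and M₀ ≥ Hℓ/δ, so d · M₀ ≥ Ht/(6ℓ). This exceeds E + b ≤ (C
      -- + 2)t/ℓ, whence H ≥ 6(C + 2). The difference between a and b is at most 3ℓd, so only the
      -- smaller value b needs an a priori bound.
      far : ∀ {a b} d → η + fromℕ b ≤ fromℕ a → fromℕ b ≤ μ + η → a ℕ.≤ b ℕ.+ L ℕ.* d → E ℕ.+ a ℕ.≤ d ℕ.* M
      far {a} {b} d gap low lip = begin
        E ℕ.+ a                          ≤⟨ ℕₚ.+-monoʳ-≤ E (subst (λ z → a ℕ.≤ b ℕ.+ z ℕ.* d) L-≡ lip) ⟩
        E ℕ.+ (b ℕ.+ 3 ℕ.* ℓ ℕ.* d)      ≡⟨ ℕₚ.+-assoc E b _ ⟨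
        E ℕ.+ b ℕ.+ 3 ℕ.* ℓ ℕ.* d        ≤⟨ ℕₚ.+-monoˡ-≤ (3 ℕ.* ℓ ℕ.* d) core ⟩
        d ℕ.* M₀ ℕ.+ 3 ℕ.* ℓ ℕ.* d       ≡⟨ trans (cong (d ℕ.* M₀ ℕ.+_) (ℕₚ.*-comm (3 ℕ.* ℓ) d)) (sym (ℕₚ.*-distribˡ-+ d M₀ (3 ℕ.* ℓ))) ⟩
        d ℕ.* M                          ∎
        where
        open ℕₚ.≤-Reasoning
        module R = ≤-Reasoning
        d′ b′ : ℚ
        d′ = fromℕ d
        b′ = fromℕ b
        3ℚ 6ℚ : ℚ
        3ℚ = fromℕ 3
        6ℚ = fromℕ 6
        η≤ : η ≤ 3ℚ * ℓ′ * d′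
        η≤ = R.begin
          η                         R.≡⟨ lem η b′ ⟩
          η + b′ - b′               R.≤⟨ +-monoˡ-≤ (- b′) gap ⟩
          fromℕ a - b′              R.≤⟨ +-monoˡ-≤ (- b′) (fromℕ-mono {a} {b ℕ.+ 3 ℕ.* ℓ ℕ.* d} (subst (λ z → a ℕ.≤ b ℕ.+ z ℕ.* d) L-≡ lip)) ⟩
          fromℕ (b ℕ.+ 3 ℕ.* ℓ ℕ.* d) - b′ R.≡⟨ cong (_- b′) (trans (fromℕ-+ b (3 ℕ.* ℓ ℕ.* d)) (cong (b′ +_) (trans (fromℕ-* (3 ℕ.* ℓ) d) (cong (_* d′) (fromℕ-* 3 ℓ))))) ⟩
          b′ + 3ℚ * ℓ′ * d′ - b′    R.≡⟨ lem′ b′ (3ℚ * ℓ′ * d′) ⟩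
          3ℚ * ℓ′ * d′              R.∎
          where
          lem : ∀ e b → e ≡ e + b - b
          lem = solve-∀ ℚ-ring
          lem′ : ∀ b x → b + x - b ≡ x
          lem′ = solve-∀ ℚ-ring
        δT : δ * T′ ≤ 6ℚ * (ℓ′ * ℓ′) * d′
        δT = R.begin
          δ * T′                                              R.≡⟨ ½+½ (δ * T′) ⟨
          ½ * (δ * T′) + ½ * (δ * T′)                         R.≡⟨ cong₂ _+_ ηℓ ηℓ ⟨
          η * ℓ′ + η * ℓ′                                     R.≤⟨ +-mono-≤ (*-monoʳ 0≤ℓ η≤) (*-monoʳ 0≤ℓ η≤) ⟩
          3ℚ * ℓ′ * d′ * ℓ′ + 3ℚ * ℓ′ * d′ * ℓ′               R.≡⟨ lem 3ℚ ℓ′ d′ ⟩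
          (3ℚ + 3ℚ) * (ℓ′ * ℓ′) * d′                          R.∎
          where
          lem : ∀ t l d → t * l * d * l + t * l * d * l ≡ (t + t) * (l * l) * d
          lem = solve-∀ ℚ-ring
        upper : ℓ′ * (fromℕ E + b′) ≤ (fromℕ C + fromℕ 2) * T′
        upper = R.begin
          ℓ′ * (fromℕ E + b′)                       R.≤⟨ *-monoˡ 0≤ℓ (+-monoʳ-≤ (fromℕ E) low) ⟩
          ℓ′ * (fromℕ E + (μ + η))                  R.≡⟨ lem ℓ′ (fromℕ E) μ η ⟩
          ℓ′ * fromℕ E + (μ * ℓ′ + η * ℓ′)          R.≤⟨ +-mono-≤ ℓE (+-mono-≤ μℓ ηℓ≤T) ⟩
          T′ + (fromℕ C * T′ + T′)                  R.≡⟨ lem′ T′ (fromℕ C) ⟩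
          (fromℕ C + (1ℚ + 1ℚ)) * T′                R.∎
          where
          lem : ∀ l e m h → l * (e + (m + h)) ≡ l * e + (m * l + h * l)
          lem = solve-∀ ℚ-ring
          lem′ : ∀ t c → t + (c * t + t) ≡ (c + (1ℚ + 1ℚ)) * t
          lem′ = solve-∀ ℚ-ring
        0<6ℓℓ : 0ℚ < 6ℚ * (ℓ′ * ℓ′)
        0<6ℓℓ = subst (0ℚ <_) (trans (fromℕ-* 6 (ℓ ℕ.* ℓ)) (cong (6ℚ *_) (fromℕ-* ℓ ℓ))) (fromℕ-pos {6 ℕ.* (ℓ ℕ.* ℓ)} (ℕₚ.*-mono-≤ {1} {6} (s≤s z≤n) (ℕₚ.*-mono-≤ 1≤ℓ 1≤ℓ)))
        core′ : fromℕ E + b′ ≤ d′ * fromℕ M₀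
        core′ = cancel-pos 0<6ℓℓ (R.begin
          (fromℕ E + b′) * (6ℚ * (ℓ′ * ℓ′))                        R.≡⟨ lem₁ (fromℕ E + b′) 6ℚ ℓ′ ⟩
          6ℚ * ℓ′ * (ℓ′ * (fromℕ E + b′))                          R.≤⟨ *-monoˡ (*-nonneg (fromℕ-nonneg 6) 0≤ℓ) upper ⟩
          6ℚ * ℓ′ * ((fromℕ C + fromℕ 2) * T′)                     R.≡⟨ lem₂ 6ℚ ℓ′ (fromℕ C + fromℕ 2) T′ ⟩
          6ℚ * (fromℕ C + fromℕ 2) * ℓ′ * T′                       R.≡⟨ cong (λ s → s * ℓ′ * T′) (trans (fromℕ-* 6 (C ℕ.+ 2)) (cong (6ℚ *_) (fromℕ-+ C 2))) ⟨
          fromℕ (6 ℕ.* (C ℕ.+ 2)) * ℓ′ * T′                        R.≤⟨ *-monoʳ 0≤T (*-monoʳ 0≤ℓ (fromℕ-mono {6 ℕ.* (C ℕ.+ 2)} {H} H-≥)) ⟩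
          fromℕ H * ℓ′ * T′                                        R.≤⟨ *-monoʳ 0≤T δM₀ ⟩
          δ * fromℕ M₀ * T′                                        R.≡⟨ lem₃ δ (fromℕ M₀) T′ ⟩
          δ * T′ * fromℕ M₀                                        R.≤⟨ *-monoʳ (fromℕ-nonneg M₀) δT ⟩
          6ℚ * (ℓ′ * ℓ′) * d′ * fromℕ M₀                           R.≡⟨ lem₄ (6ℚ * (ℓ′ * ℓ′)) d′ (fromℕ M₀) ⟩
          d′ * fromℕ M₀ * (6ℚ * (ℓ′ * ℓ′))                         R.∎)
          where
          lem₁ : ∀ x s l → x * (s * (l * l)) ≡ s * l * (l * x)
          lem₁ = solve-∀ ℚ-ring
          lem₂ : ∀ s l c t → s * l * (c * t) ≡ s * c * l * t
          lem₂ = solve-∀ ℚ-ring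
          lem₃ : ∀ a b c → a * b * c ≡ a * c * b
          lem₃ = solve-∀ ℚ-ring
          lem₄ : ∀ a b c → a * b * c ≡ b * c * a
          lem₄ = solve-∀ ℚ-ring
        core : E ℕ.+ b ℕ.≤ d ℕ.* M₀
        core = fromℕ-reflect {E ℕ.+ b} {d ℕ.* M₀} (subst₂ _≤_ (sym (fromℕ-+ E b)) (sym (fromℕ-* d M₀)) core′)

      z : ℚ
      z = shrinkage M

      W : ℚ
      W = pow z E * pow (T′ * T′) t

      Δ-split : η + η ≡ Δ
      Δ-split = ½+½ Δ

      up-α : size up * size α ≤ W
      up-α = two-sets up α {M} {E} 2≤M λ {x} {y} d _ _ ux αy → far d (gap x y (≤ᵇ-false (not⁻ ux)) (≤ᵇ-true αy)) (≤ᵇ-true αy)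
        where
        lem : ∀ m e → e + (m + e) ≡ m + (e + e)
        lem = solve-∀ ℚ-ring
        gap : ∀ x y → μ + Δ < fromℕ (f x) → fromℕ (f y) ≤ μ + η → η + fromℕ (f y) ≤ fromℕ (f x)
        gap x y a b = ≤-trans (+-monoʳ-≤ η b) (≤-trans (≤-reflexive (trans (lem μ η) (cong (μ +_) Δ-split))) (<⇒≤ a))

      -- In the lower tail the bulk plays the part of the certified set, because its members have
      -- the larger values.
      β-dn : size β₂ * size dn ≤ W
      β-dn = two-sets β₂ dn {M} {E} 2≤M λ {x} {y} d _ _ βx dy → far d (gap x y (≤ᵇ-true βx) (≤ᵇ-false (not⁻ dy))) (low y (≤ᵇ-false (not⁻ dy)))
        where
        lem : ∀ m e → e + (m - (e + e)) ≡ m - e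
        lem = solve-∀ ℚ-ring
        gap : ∀ x y → μ - η ≤ fromℕ (f x) → fromℕ (f y) < μ - Δ → η + fromℕ (f y) ≤ fromℕ (f x)
        gap x y a b = ≤-trans (+-monoʳ-≤ η (<⇒≤ b)) (≤-trans (≤-reflexive (trans (cong (λ s → η + (μ - s)) (sym Δ-split)) (lem μ η))) a)
        lem′ : ∀ m D e → m - D + (D + e) ≡ m + e
        lem′ = solve-∀ ℚ-ring
        low : ∀ y → fromℕ (f y) < μ - Δ → fromℕ (f y) ≤ μ + η
        low y b = ≤-trans (<⇒≤ b) (≤-from (+-nonneg 0≤Δ 0≤η) (lem′ μ Δ η))

      open Mesh {M} 2≤M using (κM; 0≤κ; κκ≤1; 0<z)

      0≤z : 0ℚ ≤ z
      0≤z = <⇒≤ 0<z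

      0≤W : 0ℚ ≤ W
      0≤W = *-nonneg (pow-nonneg 0≤z E) (pow-nonneg (*-nonneg 0≤T 0≤T) t)

      side : ∀ χ ψ → size χ * size ψ ≤ W → N′ * η ≤ size ψ * (2ℚ * T′) → size χ * (N′ * η) ≤ W * (2ℚ * T′)
      side χ ψ prod large = ≤-trans (*-monoˡ (size-nonneg χ) large) (≤-trans (≤-reflexive (sym (*-assoc (size χ) (size ψ) (2ℚ * T′)))) (*-monoʳ (*-nonneg (+-nonneg 0≤1 0≤1) 0≤T) prod))

      dev-bound : size dev * (N′ * η) ≤ W * (2ℚ * T′) + W * (2ℚ * T′)
      dev-bound = ≤-trans (*-monoʳ (*-nonneg 0≤N 0≤η) dev-size) (≤-trans (≤-reflexive (*-distribʳ-+ (N′ * η) (size up) (size dn)))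
        (+-mono-≤ (side up α up-α α-large) (side dn β₂ (subst (_≤ W) (*-comm (size β₂) (size dn)) β-dn) β₂-large)))

      1≤t : 1 ℕ.≤ t
      1≤t = ℕₚ.≤-trans (ℕₚ.*-mono-≤ (ℕₚ.*-mono-≤ 1≤K 1≤K) (ℕₚ.*-mono-≤ 1≤ℓ 1≤ℓ)) t-≥
        where
        1≤G : 1 ℕ.≤ G
        1≤G = ℕₚ.≤-trans (s≤s z≤n) (ℕₚ.≤-trans (ℕₚ.m≤n+m 3 (H ℕ.+ H)) G-≥)
        1≤K : 1 ℕ.≤ K
        1≤K = ℕₚ.≤-trans (ℕₚ.*-mono-≤ {1} {8} (s≤s z≤n) (ℕₚ.*-mono-≤ 1≤G 1≤G)) K-≥

      3≤G : 3 ℕ.≤ G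
      3≤G = ℕₚ.≤-trans (ℕₚ.m≤n+m 3 (H ℕ.+ H)) G-≥

      8≤K : 8 ℕ.≤ K
      8≤K = ℕₚ.≤-trans (ℕₚ.*-monoʳ-≤ 8 (ℕₚ.*-mono-≤ (ℕₚ.≤-trans (s≤s z≤n) 3≤G) (ℕₚ.≤-trans (s≤s z≤n) 3≤G))) K-≥

      0<T : 0ℚ < T′
      0<T = fromℕ-pos 1≤t

      8ℓ≤t : 8 ℕ.* ℓ ℕ.≤ t
      8ℓ≤t = ℕₚ.≤-trans (ℕₚ.*-mono-≤ (ℕₚ.≤-trans (ℕₚ.≤-reflexive (sym (ℕₚ.*-identityʳ 8))) (ℕₚ.*-mono-≤ 8≤K (ℕₚ.≤-trans (s≤s z≤n) 8≤K))) (ℕₚ.≤-trans (ℕₚ.≤-reflexive (sym (ℕₚ.*-identityʳ ℓ))) (ℕₚ.*-monoʳ-≤ ℓ 1≤ℓ))) t-≥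

      -- `P` is the deviation probability. It is carried along with the factor δ because Markov's
      -- inequality bounds the bulk from below only by a multiple of η.
      P Q : ℚ
      P = size dev * i
      Q = P * δ

      0≤P : 0ℚ ≤ P
      0≤P = *-nonneg (size-nonneg dev) (divℕ-nonneg 1 (length ts))

      0≤Q : 0ℚ ≤ Q
      0≤Q = *-nonneg 0≤P 0≤δ

      Q≤1 : Q ≤ 1ℚ
      Q≤1 = ≤-trans (*-mono 0≤δ 0≤1 P≤1 (<⇒≤ δ<1)) (≤-reflexive (*-identityˡ 1ℚ))
        where
        P≤1 : P ≤ 1ℚ
        P≤1 = ≤-trans (*-monoʳ (divℕ-nonneg 1 (length ts)) (fromℕ-mono {length (filterᵇ dev ts)} {length ts} (length-filter _ ts))) (≤-reflexive (trans (*-comm N′ i) iN))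

      devδ : size dev * N′ * δ ≤ fromℕ 8 * ℓ′ * W
      devδ = cancel-pos 0<T (begin
        size dev * N′ * δ * T′                                       ≡⟨ lem₁ (size dev) N′ (δ) T′ ⟩
        size dev * N′ * (δ * T′)                                     ≡⟨ cong (size dev * N′ *_) (trans (sym (½+½ (δ * T′))) (sym (cong₂ _+_ ηℓ ηℓ))) ⟩
        size dev * N′ * (η * ℓ′ + η * ℓ′)                            ≡⟨ lem₂ (size dev) N′ η ℓ′ ⟩
        2ℚ * ℓ′ * (size dev * (N′ * η))                              ≤⟨ *-monoˡ (*-nonneg (+-nonneg 0≤1 0≤1) 0≤ℓ) dev-bound ⟩
        2ℚ * ℓ′ * (W * (2ℚ * T′) + W * (2ℚ * T′))                    ≡⟨ lem₃ ℓ′ W T′ ⟩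
        fromℕ 8 * ℓ′ * W * T′                                        ∎)
        where
        open ≤-Reasoning
        lem₁ : ∀ a b c d → a * b * c * d ≡ a * b * (c * d)
        lem₁ = solve-∀ ℚ-ring
        lem₂ : ∀ a b c d → a * b * (c * d + c * d) ≡ (1ℚ + 1ℚ) * d * (a * (b * c))
        lem₂ = solve-∀ ℚ-ring
        lem₃ : ∀ l w t → (1ℚ + 1ℚ) * l * (w * ((1ℚ + 1ℚ) * t) + w * ((1ℚ + 1ℚ) * t)) ≡ fromℕ 8 * l * w * t
        lem₃ = solve-∀ ℚ-ring

      B : ℚ
      B = T′ * T′ * N′

      -- The price of working with all functions instead of trees: a factor t² for each of the two
      -- sets.
      pow-bound : pow (T′ * T′) t ≤ B * B
      pow-bound = ≤-trans (≤-reflexive (pow-distrib T′ T′ t)) (*-mono (pow-nonneg 0≤T t) 0≤B le le)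
        where
        0≤B : 0ℚ ≤ B
        0≤B = *-nonneg (*-nonneg 0≤T 0≤T) 0≤N
        le : pow T′ t ≤ B
        le = subst₂ _≤_ (fromℕ-^ t t) (trans (fromℕ-* (t ℕ.* t) (length ts)) (cong (_* N′) (fromℕ-* t t))) (fromℕ-mono {t ℕ.^ t} {t ℕ.* t ℕ.* length ts} count)

      T⁴ T⁶ : ℚ
      T⁴ = T′ * T′ * (T′ * T′)
      T⁶ = T⁴ * (T′ * T′)

      0≤T⁴ : 0ℚ ≤ T⁴
      0≤T⁴ = *-nonneg (*-nonneg 0≤T 0≤T) (*-nonneg 0≤T 0≤T)

      Q-bound : Q ≤ T⁶ * pow z E
      Q-bound = cancel-pos 0<N (cancel-pos 0<N (begin
        P * δ * N′ * N′                                  ≡⟨ lem₁ (size dev) i δ N′ ⟩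
        size dev * N′ * δ * (i * N′)                     ≡⟨ trans (cong (size dev * N′ * δ *_) iN) (*-identityʳ _) ⟩
        size dev * N′ * δ                                ≤⟨ devδ ⟩
        fromℕ 8 * ℓ′ * W                                 ≤⟨ *-mono 0≤W 0≤T 8ℓ (*-monoˡ (pow-nonneg 0≤z E) pow-bound) ⟩
        -- The exponent of t is raised from 5 to 6, which is what the comparison T⁶ · (c²T)² =
        -- (cT²)⁴ at the end expects.
        T′ * (pow z E * (B * B))                         ≤⟨ ≤-trans (≤-reflexive (sym (*-identityʳ _))) (*-monoˡ (*-nonneg 0≤T (*-nonneg (pow-nonneg 0≤z E) (square-nonneg B))) (fromℕ-mono {1} {t} 1≤t)) ⟩
        T′ * (pow z E * (B * B)) * T′                    ≡⟨ lem₂ T′ (pow z E) N′ ⟩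
        T⁶ * pow z E * N′ * N′                           ∎))
        where
        open ≤-Reasoning
        8ℓ : fromℕ 8 * ℓ′ ≤ T′
        8ℓ = ≤-trans (≤-reflexive (sym (fromℕ-* 8 ℓ))) (fromℕ-mono {8 ℕ.* ℓ} {t} 8ℓ≤t)
        lem₁ : ∀ s i d n → s * i * d * n * n ≡ s * n * d * (i * n)
        lem₁ = solve-∀ ℚ-ring
        lem₂ : ∀ t p n → t * (p * (t * t * n * (t * t * n))) * t ≡ t * t * (t * t) * (t * t) * p * n * n
        lem₂ = solve-∀ ℚ-ring

      c : ℚ
      c = divℕ 1 K

      1≤K : 1 ℕ.≤ K
      1≤K = ℕₚ.≤-trans (s≤s z≤n) 8≤K

      cK : c * fromℕ K ≡ 1ℚ
      cK = divℕ-fromℕ 1 K 1≤K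

      0≤c : 0ℚ ≤ c
      0≤c = divℕ-nonneg 1 K

      1≤ccT : 1ℚ ≤ c * c * T′
      1≤ccT = begin
        1ℚ                                    ≡⟨ *-identityˡ 1ℚ ⟨
        1ℚ * 1ℚ                               ≡⟨ cong₂ _*_ cK cK ⟨
        c * fromℕ K * (c * fromℕ K)           ≡⟨ lem c (fromℕ K) ⟩
        c * c * (fromℕ K * fromℕ K)           ≡⟨ cong (c * c *_) (fromℕ-* K K) ⟨
        c * c * fromℕ (K ℕ.* K)               ≤⟨ *-monoˡ (*-nonneg 0≤c 0≤c) (fromℕ-mono {K ℕ.* K} {t} (ℕₚ.≤-trans (ℕₚ.≤-trans (ℕₚ.≤-reflexive (sym (ℕₚ.*-identityʳ (K ℕ.* K)))) (ℕₚ.*-monoʳ-≤ (K ℕ.* K) (ℕₚ.*-mono-≤ 1≤ℓ 1≤ℓ))) t-≥)) ⟩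
        c * c * T′                            ∎
        where
        open ≤-Reasoning
        lem : ∀ c k → c * k * (c * k) ≡ c * c * (k * k)
        lem = solve-∀ ℚ-ring

      X : ℚ
      X = c * δ * δ * divℕ t (ℓ ℕ.^ 3)

      -- δM₀ ≤ 2Hℓ by the rounding and δ · 3ℓ ≤ 3ℓ, whence the choice G ≥ 2H + 3.
      δM : δ * fromℕ M ≤ fromℕ G * ℓ′
      δM = begin
        δ * fromℕ M                                          ≡⟨ trans (cong (δ *_) (trans (fromℕ-+ M₀ (3 ℕ.* ℓ)) (cong₂ _+_ (fromℕ-* H m₀) (fromℕ-* 3 ℓ)))) (lem₁ δ (fromℕ H) (fromℕ m₀) (fromℕ 3 * ℓ′)) ⟩
        fromℕ H * (δ * fromℕ m₀) + δ * (fromℕ 3 * ℓ′)        ≤⟨ +-mono-≤ (*-monoˡ (fromℕ-nonneg H) (proj₂ (proj₂ (round-up ℓ 0<δ δ<1 1≤ℓ)))) (*-monoʳ (*-nonneg (fromℕ-nonneg 3) 0≤ℓ) (<⇒≤ δ<1)) ⟩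
        fromℕ H * fromℕ (ℓ ℕ.+ ℓ) + 1ℚ * (fromℕ 3 * ℓ′)      ≡⟨ trans (cong (λ s → fromℕ H * s + 1ℚ * (fromℕ 3 * ℓ′)) (fromℕ-+ ℓ ℓ)) (lem₂ (fromℕ H) ℓ′ (fromℕ 3)) ⟩
        (fromℕ H + fromℕ H + fromℕ 3) * ℓ′                   ≡⟨ cong (_* ℓ′) (trans (fromℕ-+ (H ℕ.+ H) 3) (cong (_+ fromℕ 3) (fromℕ-+ H H))) ⟨
        fromℕ (H ℕ.+ H ℕ.+ 3) * ℓ′                           ≤⟨ *-monoʳ 0≤ℓ (fromℕ-mono {H ℕ.+ H ℕ.+ 3} {G} G-≥) ⟩
        fromℕ G * ℓ′                                         ∎
        where
        open ≤-Reasoning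
        lem₁ : ∀ d h m w → d * (h * m + w) ≡ h * (d * m) + d * w
        lem₁ = solve-∀ ℚ-ring
        lem₂ : ∀ h l r → h * (l + l) + 1ℚ * (r * l) ≡ (h + h + r) * l
        lem₂ = solve-∀ ℚ-ring

      t≤8ℓF : t ℕ.≤ 8 ℕ.* ℓ ℕ.* F
      t≤8ℓF = ℕₚ.≤-trans (ℕₚ.<⇒≤ below) (ℕₚ.≤-trans (ℕₚ.*-monoˡ-≤ (4 ℕ.* ℓ) (ℕₚ.+-monoˡ-≤ F 1≤F)) (ℕₚ.≤-reflexive (lem F ℓ)))
        where
        below : t ℕ.< suc F ℕ.* (4 ℕ.* ℓ)
        below = n<[n/d+1]*d t (4 ℕ.* ℓ) {{ℕ.>-nonZero (ℕₚ.≤-trans 1≤ℓ (ℕₚ.m≤n*m ℓ 4))}}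
        lem : ∀ F ℓ → (F ℕ.+ F) ℕ.* (4 ℕ.* ℓ) ≡ 8 ℕ.* ℓ ℕ.* F
        lem = solveℕ
        positive-quotient : ∀ F → t ℕ.< suc F ℕ.* (4 ℕ.* ℓ) → 1 ℕ.≤ F
        positive-quotient zero lt = ⊥-elim (ℕₚ.<⇒≱ lt (ℕₚ.≤-trans (ℕₚ.≤-reflexive (ℕₚ.*-identityˡ (4 ℕ.* ℓ))) (ℕₚ.≤-trans (ℕₚ.*-monoˡ-≤ ℓ {4} {8} (s≤s (s≤s (s≤s (s≤s z≤n))))) 8ℓ≤t)))
        positive-quotient (suc F) _ = s≤s z≤n
        1≤F : 1 ℕ.≤ F
        1≤F = positive-quotient F below

      1≤ℓ³ : 1 ℕ.≤ ℓ ℕ.^ 3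
      1≤ℓ³ = ℕₚ.m^n>0 ℓ {{ℕ.>-nonZero 1≤ℓ}} 3

      1≤M : 1 ℕ.≤ M
      1≤M = ℕₚ.≤-trans (s≤s z≤n) 2≤M

      T≤8ℓF : T′ ≤ fromℕ 8 * ℓ′ * fromℕ F
      T≤8ℓF = ≤-trans (fromℕ-mono {t} {8 ℕ.* ℓ ℕ.* F} t≤8ℓF) (≤-reflexive (trans (fromℕ-* (8 ℕ.* ℓ) F) (cong (_* fromℕ F) (fromℕ-* 8 ℓ))))

      8GG≤K : fromℕ 8 * (fromℕ G * fromℕ G) ≤ fromℕ K
      8GG≤K = ≤-trans (≤-reflexive (sym (trans (fromℕ-* 8 (G ℕ.* G)) (cong (fromℕ 8 *_) (fromℕ-* G G))))) (fromℕ-mono {8 ℕ.* (G ℕ.* G)} {K} K-≥)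

      -- F ≥ t/(8ℓ) and 1/M ≥ δ/(Gℓ) give F/M² ≥ δ²t/(8G²ℓ³), whence K ≥ 8G². The exponential of X
      -- can then be played off against (1 - κ²)^F.
      X-bound : X ≤ fromℕ F * (mesh M * mesh M)
      X-bound = exponent-scale {c = c} {δ = δ} {q = divℕ t (ℓ ℕ.^ 3)} {k = fromℕ K} {l³ = fromℕ (ℓ ℕ.^ 3)} {h = mesh M} {m = fromℕ M} {e = fromℕ 8} {l = ℓ′} {f = fromℕ F} {g = fromℕ G} {T = T′} (fromℕ-nonneg 8) 0≤δ (fromℕ-nonneg M) (fromℕ-nonneg G) 0≤ℓ (fromℕ-nonneg F) (fromℕ-pos {K} 1≤K) (fromℕ-pos {ℓ ℕ.^ 3} 1≤ℓ³) (fromℕ-pos {M} 1≤M)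
        cK (divℕ-fromℕ t (ℓ ℕ.^ 3) 1≤ℓ³) κM (fromℕ-^ ℓ 3) δM T≤8ℓF 8GG≤K

      0≤X : 0ℚ ≤ X
      0≤X = *-nonneg (*-nonneg (*-nonneg 0≤c 0≤δ) 0≤δ) (divℕ-nonneg t (ℓ ℕ.^ 3))

      exp-bound : ∀ k → expPartial X k * pow z F ≤ 1ℚ
      exp-bound k = ≤-trans (*-monoʳ (pow-nonneg 0≤z F) (expPartial-mono 0≤X X-bound k)) (expPartial-pow (*-nonneg 0≤κ 0≤κ) κκ≤1 F k)

      -- Since Q ≤ 1, the fourth power absorbs the polynomial factor.
      fourth-power : ∀ {Q e x y s r} → 0ℚ ≤ Q → Q ≤ 1ℚ → 0ℚ ≤ e → 0ℚ ≤ x → 0ℚ ≤ s → 0ℚ ≤ y → Q ≤ s * (x * x * (x * x)) → e * x ≤ 1ℚ → r ≡ y * y → s ≤ r * r → Q * e ≤ y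
      fourth-power {Q} {e} {x} {y} {s} {r} 0≤Q Q≤1 0≤e 0≤x 0≤s 0≤y Qs ex refl sr = square-cancel 0≤y (square-cancel (*-nonneg 0≤y 0≤y) (begin
        Q * e * (Q * e) * (Q * e * (Q * e))                   ≡⟨ lem₁ Q e ⟩
        Q * Q * Q * (Q * (e * e * (e * e)))                   ≤⟨ *-mono (*-nonneg 0≤Q e⁴) 0≤1 Q³ (*-monoʳ e⁴ Qs) ⟩
        1ℚ * (s * (x * x * (x * x)) * (e * e * (e * e)))      ≡⟨ lem₂ s x e ⟩
        s * (e * x * (e * x) * (e * x * (e * x)))             ≤⟨ *-monoˡ 0≤s ex⁴ ⟩
        s * (1ℚ * 1ℚ * (1ℚ * 1ℚ))                             ≡⟨ lem₃ s ⟩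
        s                                                     ≤⟨ sr ⟩
        y * y * (y * y)                                       ∎))
        where
        open ≤-Reasoning
        0≤ex : 0ℚ ≤ e * x
        0≤ex = *-nonneg 0≤e 0≤x
        e⁴ : 0ℚ ≤ e * e * (e * e)
        e⁴ = square-nonneg (e * e)
        ex² : e * x * (e * x) ≤ 1ℚ * 1ℚ
        ex² = *-mono 0≤ex 0≤1 ex ex
        ex⁴ : e * x * (e * x) * (e * x * (e * x)) ≤ 1ℚ * 1ℚ * (1ℚ * 1ℚ)
        ex⁴ = *-mono (*-nonneg 0≤ex 0≤ex) 0≤1 ex² ex²
        Q³ : Q * Q * Q ≤ 1ℚ
        Q³ = *-mono 0≤Q 0≤1 (*-mono 0≤Q 0≤1 Q≤1 Q≤1) Q≤1
        lem₁ : ∀ q e → q * e * (q * e) * (q * e * (q * e)) ≡ q * q * q * (q * (e * e * (e * e)))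
        lem₁ = solve-∀ ℚ-ring
        lem₂ : ∀ s x e → 1ℚ * (s * (x * x * (x * x)) * (e * e * (e * e))) ≡ s * (e * x * (e * x) * (e * x * (e * x)))
        lem₂ = solve-∀ ℚ-ring
        lem₃ : ∀ s → s * (1ℚ * 1ℚ * (1ℚ * 1ℚ)) ≡ s
        lem₃ = solve-∀ ℚ-ring

    -- The fourth power of the left side is at most T⁶: the factor z^E = (z^F)⁴ cancels four copies
    -- of the exponential sum. The hypothesis K²ℓ² ≤ t gives c²T ≥ 1, hence T⁶ ≤ (cT²)⁴.
    deviation-bound : ∀ k → fromℕ (length (filterᵇ dev ts)) * divℕ 1 (length ts)
      * δ * expPartial (divℕ 1 K * δ * δ * divℕ t (ℓ ℕ.^ 3)) k ≤ divℕ 1 K * fromℕ (t ℕ.^ 2)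
    deviation-bound k = fourth-power {r = c * fromℕ (t ℕ.^ 2) * (c * fromℕ (t ℕ.^ 2))} 0≤Q Q≤1 (expPartial-nonneg 0≤X k) (pow-nonneg 0≤z F) (*-nonneg 0≤T⁴ (*-nonneg 0≤T 0≤T)) (*-nonneg 0≤c (fromℕ-nonneg (t ℕ.^ 2)))
      (subst (λ s → Q ≤ T⁶ * s) pow-E Q-bound) (exp-bound k) refl last
      where
      pow-E : pow z E ≡ pow z F * pow z F * (pow z F * pow z F)
      pow-E = trans (pow-* z 4 F) (lem (pow z F))
        where
        lem : ∀ p → p * (p * (p * (p * 1ℚ))) ≡ p * p * (p * p)
        lem = solve-∀ ℚ-ring
      last : T⁶ ≤ c * fromℕ (t ℕ.^ 2) * (c * fromℕ (t ℕ.^ 2)) * (c * fromℕ (t ℕ.^ 2) * (c * fromℕ (t ℕ.^ 2)))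
      last = begin
        T⁶                                                         ≡⟨ lem₁ T⁶ ⟩
        T⁶ * (1ℚ * 1ℚ)                                             ≤⟨ *-monoˡ (*-nonneg 0≤T⁴ (*-nonneg 0≤T 0≤T)) (*-mono 0≤1 (*-nonneg (*-nonneg 0≤c 0≤c) 0≤T) 1≤ccT 1≤ccT) ⟩
        T⁶ * (c * c * T′ * (c * c * T′))                           ≡⟨ lem₂ T′ c ⟩
        c * pow T′ 2 * (c * pow T′ 2) * (c * pow T′ 2 * (c * pow T′ 2)) ≡⟨ cong (λ s → c * s * (c * s) * (c * s * (c * s))) (fromℕ-^ t 2) ⟨
        c * fromℕ (t ℕ.^ 2) * (c * fromℕ (t ℕ.^ 2)) * (c * fromℕ (t ℕ.^ 2) * (c * fromℕ (t ℕ.^ 2))) ∎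
        where
        open ≤-Reasoning
        lem₁ : ∀ x → x ≡ x * (1ℚ * 1ℚ)
        lem₁ = solve-∀ ℚ-ring
        lem₂ : ∀ t c → t * t * (t * t) * (t * t) * (c * c * t * (c * c * t))
          ≡ c * (t * (t * 1ℚ)) * (c * (t * (t * 1ℚ))) * (c * (t * (t * 1ℚ)) * (c * (t * (t * 1ℚ))))
        lem₂ = solve-∀ ℚ-ring

-- The constants, and the passage from sums to averages.

module Final where

  open Basics
  open Trees
  open Counting
  open Covers
  open Product
  open Rationals
  open Bounds
  open Deviation
  open Indicator
  open Tail
  open import Data.Bool using (Bool; true; not)
  open import Data.Empty using (⊥-elim)
  open import Data.Fin using (Fin; zero; suc)
  open import Data.Fin.Properties using ()
  open import Data.List using (List; []; _∷_; map; length; filterᵇ; concat)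
  open import Data.List.Properties using (length-map)
  open import Data.List.Membership.Propositional using (_∈_)
  open import Data.List.Relation.Unary.Any using (here; there)
  open import Data.List.Relation.Unary.Unique.Propositional using (Unique)
  open import Data.Nat as ℕ using (ℕ; zero; suc; z≤n; s≤s)
  import Data.Nat.Properties as ℕₚ
  open import Data.Nat.Tactic.RingSolver using () renaming (solve-∀ to solveℕ)
  open import Data.Product using (Σ; _×_; _,_; proj₁; proj₂)
  open import Data.Rational using (ℚ; 0ℚ; 1ℚ; _+_; _*_; _≤_; _<_)
  open import Data.Rational.Properties
  open import Function using (_∘_)
  open import Relation.Binary.PropositionalEquality
  open import Tactic.RingSolver using (solve-∀)

  abstract
    upperConst : ℕ
    upperConst = 14 ℕ.* (387 ℕ.+ 45 ℕ.* (2 ℕ.* 48))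

    upperConst-pos : 1 ℕ.≤ upperConst
    upperConst-pos = s≤s z≤n

    upperBound-≤ : ∀ n → upperBound n ℕ.≤ upperConst ℕ.* (suc n ℕ.* treeCount n)
    upperBound-≤ n = ℕₚ.≤-reflexive (ring 14 387 45 2 48 (suc n ℕ.* treeCount n))
      where
      ring : ∀ a b c d e x → a ℕ.* (b ℕ.* x ℕ.+ c ℕ.* (d ℕ.* (e ℕ.* x))) ≡ a ℕ.* (b ℕ.+ c ℕ.* (d ℕ.* e)) ℕ.* x
      ring = solveℕ

    H G rate : ℕ
    H = 6 ℕ.* (upperConst ℕ.+ 2)
    G = H ℕ.+ H ℕ.+ 3
    rate = 8 ℕ.* (G ℕ.* G)

    H-≥ : 6 ℕ.* (upperConst ℕ.+ 2) ℕ.≤ H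
    H-≥ = ℕₚ.≤-refl

    G-≥ : H ℕ.+ H ℕ.+ 3 ℕ.≤ G
    G-≥ = ℕₚ.≤-refl

    rate-≥ : 8 ℕ.* (G ℕ.* G) ℕ.≤ rate
    rate-≥ = ℕₚ.≤-refl

  8≤rate : 8 ℕ.≤ rate
  8≤rate = ℕₚ.≤-trans (ℕₚ.*-monoʳ-≤ 8 (ℕₚ.*-mono-≤ 1≤G 1≤G)) rate-≥
    where
    1≤G : 1 ℕ.≤ G
    1≤G = ℕₚ.≤-trans (s≤s z≤n) (ℕₚ.≤-trans (ℕₚ.m≤n+m 3 (H ℕ.+ H)) G-≥)

  -- The tree with one vertex is treated by itself, since `trees-lower` starts with two vertices.
  1≤treeCount : ∀ n → 1 ℕ.≤ treeCount n
  1≤treeCount zero = nonempty-length (parentGraph∈trees {0} (λ x → x) (1 , λ { zero → refl }))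
    where
    nonempty-length : ∀ {A : Set} {x : A} {xs} → x ∈ xs → 1 ℕ.≤ length xs
    nonempty-length (here _) = s≤s z≤n
    nonempty-length (there _) = s≤s z≤n
  1≤treeCount (suc n) = ℕₚ.≤-trans (ℕₚ.m^n>0 (suc (suc n)) n) (trees-lower {suc n} (s≤s z≤n))

  expCov-≡ : ∀ ℓ t → expCov ℓ t ≡ fromℕ (sumOver (cov ℓ) (trees t)) * divℕ 1 (length (trees t))
  expCov-≡ ℓ t = cong₂ (λ a b → a * divℕ 1 b) (fromℕ-sum (cov ℓ) (trees t)) (length-map (λ T → fromℕ (cov ℓ T)) (trees t))

  mean-indicator : ∀ {A : Set} {h : A → ℚ} {χ : A → Bool} ts → (∀ x → h x ≡ indicatorℚ (χ x)) →
    mean (map h ts) ≡ fromℕ (length (filterᵇ χ ts)) * divℕ 1 (length ts)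
  mean-indicator {h = h} {χ} ts eq = cong₂ (λ a b → a * divℕ 1 b) (trans (go ts) (sumℚ-indicator χ ts)) (length-map h ts)
    where
    go : ∀ xs → sumℚ h xs ≡ sumℚ (indicatorℚ ∘ χ) xs
    go [] = refl
    go (x ∷ xs) = cong₂ _+_ (eq x) (go xs)

  probDev-≡ : ∀ ℓ t δ → probDev ℓ t δ ≡ fromℕ (length (filterᵇ (deviates ℓ (expCov ℓ t) (δ * divℕ t ℓ)) (trees t))) * divℕ 1 (length (trees t))
  probDev-≡ ℓ t δ = trans (proj₂ (probDev-summand ℓ t δ))
    (mean-indicator {h = proj₁ (probDev-summand ℓ t δ)} {χ = deviates ℓ (expCov ℓ t) (δ * divℕ t ℓ)} (trees t) (probDev-indicator ℓ t δ))

  quotient-upper : ∀ {S i N D l T C} → 0ℚ < N → 0ℚ < l → i * N ≡ 1ℚ → D * l ≡ T → S * l ≤ C * (T * N) → S * i ≤ C * D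
  quotient-upper {S} {i} {N} {D} {l} {T} {C} 0<N 0<l iN Dl h = cancel-pos (*-pos 0<N 0<l) (begin
    S * i * (N * l)          ≡⟨ lem₁ S i N l ⟩
    S * l * (i * N)          ≡⟨ trans (cong (S * l *_) iN) (*-identityʳ (S * l)) ⟩
    S * l                    ≤⟨ h ⟩
    C * (T * N)              ≡⟨ cong (λ s → C * (s * N)) Dl ⟨
    C * (D * l * N)          ≡⟨ lem₂ C D l N ⟩
    C * D * (N * l)          ∎)
    where
    open ≤-Reasoning
    lem₁ : ∀ s i n l → s * i * (n * l) ≡ s * l * (i * n)
    lem₁ = solve-∀ ℚ-ring
    lem₂ : ∀ c d l n → c * (d * l * n) ≡ c * d * (n * l)
    lem₂ = solve-∀ ℚ-ring

  quotient-lower : ∀ {S i N D l T c k} → 0ℚ < N → 0ℚ < l → 0ℚ ≤ c → i * N ≡ 1ℚ → D * l ≡ T → c * k ≡ 1ℚ → T * N ≤ k * (l * S) → c * D ≤ S * i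
  quotient-lower {S} {i} {N} {D} {l} {T} {c} {k} 0<N 0<l 0≤c iN Dl ck h = cancel-pos (*-pos 0<N 0<l) (begin
    c * D * (N * l)          ≡⟨ lem₁ c D N l ⟩
    c * (D * l * N)          ≡⟨ cong (λ s → c * (s * N)) Dl ⟩
    c * (T * N)              ≤⟨ *-monoˡ 0≤c h ⟩
    c * (k * (l * S))        ≡⟨ lem₂ c k l S ⟩
    c * k * (S * l)          ≡⟨ trans (cong (_* (S * l)) ck) (trans (*-identityˡ (S * l)) (sym (trans (cong (S * l *_) iN) (*-identityʳ (S * l))))) ⟩
    S * l * (i * N)          ≡⟨ lem₃ S l i N ⟩
    S * i * (N * l)          ∎)
    where
    open ≤-Reasoning
    lem₁ : ∀ c d n l → c * d * (n * l) ≡ c * (d * l * n)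
    lem₁ = solve-∀ ℚ-ring
    lem₂ : ∀ c k l s → c * (k * (l * s)) ≡ c * k * (s * l)
    lem₂ = solve-∀ ℚ-ring
    lem₃ : ∀ s l i n → s * l * (i * n) ≡ s * i * (n * l)
    lem₃ = solve-∀ ℚ-ring

  -- Clears denominators in the squared form of ℓ ≤ c√t for c = 1/k.
  range : ∀ {k ℓ t} → 1 ℕ.≤ k → fromℕ (ℓ ℕ.^ 2) ≤ divℕ 1 k * divℕ 1 k * fromℕ t → k ℕ.* k ℕ.* (ℓ ℕ.* ℓ) ℕ.≤ t
  range {k} {ℓ} {t} 1≤k h = fromℕ-reflect {k ℕ.* k ℕ.* (ℓ ℕ.* ℓ)} {t} (begin
    fromℕ (k ℕ.* k ℕ.* (ℓ ℕ.* ℓ))                  ≡⟨ trans (fromℕ-* (k ℕ.* k) (ℓ ℕ.* ℓ)) (cong₂ _*_ (fromℕ-* k k) (cong fromℕ (cong (ℓ ℕ.*_) (sym (ℕₚ.*-identityʳ ℓ))))) ⟩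
    fromℕ k * fromℕ k * fromℕ (ℓ ℕ.^ 2)            ≤⟨ *-monoˡ (*-nonneg (fromℕ-nonneg k) (fromℕ-nonneg k)) h ⟩
    fromℕ k * fromℕ k * (c * c * fromℕ t)          ≡⟨ lem (fromℕ k) c (fromℕ t) ⟩
    c * fromℕ k * (c * fromℕ k) * fromℕ t          ≡⟨ cong (λ s → s * s * fromℕ t) (divℕ-fromℕ 1 k 1≤k) ⟩
    1ℚ * 1ℚ * fromℕ t                              ≡⟨ trans (cong (_* fromℕ t) (*-identityˡ 1ℚ)) (*-identityˡ (fromℕ t)) ⟩
    fromℕ t                                        ∎)
    where
    open ≤-Reasoning
    c : ℚ
    c = divℕ 1 k
    lem : ∀ k c t → k * k * (c * c * t) ≡ c * k * (c * k) * t
    lem = solve-∀ ℚ-ring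

  C₁ C₂ : ℚ
  C₁ = fromℕ upperConst
  C₂ = divℕ 1 16

  0<C₁ : 0ℚ < C₁
  0<C₁ = fromℕ-pos {upperConst} upperConst-pos

  divℕ-pos : ∀ {k} → 1 ℕ.≤ k → 0ℚ < divℕ 1 k
  divℕ-pos {k} 1≤k = ≰⇒> λ le → <-irrefl refl (<-≤-trans 0<1 (≤-trans (≤-reflexive (sym (divℕ-fromℕ 1 k 1≤k))) (≤-trans (*-monoʳ (fromℕ-nonneg k) le) (≤-reflexive (*-zeroˡ (fromℕ k))))))

  0<C₂ : 0ℚ < C₂
  0<C₂ = divℕ-pos {16} (s≤s z≤n)

  totalCov-≤ : ∀ n {ℓ} → ℓ ℕ.≤ suc n → ℓ ℕ.* totalCov n ℓ ℕ.≤ upperConst ℕ.* (suc n ℕ.* treeCount n)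
  totalCov-≤ n ℓ≤ = ℕₚ.≤-trans (totalCov-upper n ℓ≤) (upperBound-≤ n)

  expectation-upper : ∀ t ℓ → 1ℚ ≤ fromℕ ℓ → fromℕ ℓ ≤ fromℕ t → expCov ℓ t ≤ C₁ * divℕ t ℓ
  expectation-upper zero ℓ 1≤ ≤t = ⊥-elim (ℕₚ.1+n≰n {0} (ℕₚ.≤-trans (fromℕ-reflect {1} {ℓ} 1≤) (fromℕ-reflect {ℓ} {0} ≤t)))
  expectation-upper (suc n) ℓ 1≤ ≤t = subst (_≤ C₁ * divℕ (suc n) ℓ) (sym (expCov-≡ ℓ (suc n)))
    (quotient-upper {S = fromℕ (totalCov n ℓ)} {N = fromℕ (treeCount n)} {l = fromℕ ℓ} {T = fromℕ (suc n)} {C = C₁}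
      (fromℕ-pos (1≤treeCount n)) (fromℕ-pos 1≤ℓ) (divℕ-fromℕ 1 (treeCount n) (1≤treeCount n)) (divℕ-fromℕ (suc n) ℓ 1≤ℓ)
      (subst₂ _≤_ (trans (fromℕ-* ℓ (totalCov n ℓ)) (*-comm (fromℕ ℓ) (fromℕ (totalCov n ℓ))))
        (trans (fromℕ-* upperConst (suc n ℕ.* treeCount n)) (cong (C₁ *_) (fromℕ-* (suc n) (treeCount n))))
        (fromℕ-mono {ℓ ℕ.* totalCov n ℓ} {upperConst ℕ.* (suc n ℕ.* treeCount n)} (totalCov-≤ n (fromℕ-reflect {ℓ} {suc n} ≤t)))))
    where
    1≤ℓ : 1 ℕ.≤ ℓ
    1≤ℓ = fromℕ-reflect {1} {ℓ} 1≤

  -- The 16 is dictated by `totalCov-lower`; as a constant of the range it gives 256ℓ² ≤ t, more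
  -- than the 32ℓ² ≤ t which that bound asks for.
  expectation-lower : ∀ t ℓ → 1ℚ ≤ fromℕ ℓ → fromℕ (ℓ ℕ.^ 2) ≤ C₂ * C₂ * fromℕ t → C₂ * divℕ t ℓ ≤ expCov ℓ t
  expectation-lower t ℓ 1≤ h = by-cases t (range {16} {ℓ} {t} (s≤s z≤n) h)
    where
    1≤ℓ : 1 ℕ.≤ ℓ
    1≤ℓ = fromℕ-reflect {1} {ℓ} 1≤
    by-cases : ∀ t → 256 ℕ.* (ℓ ℕ.* ℓ) ℕ.≤ t → C₂ * divℕ t ℓ ≤ expCov ℓ t
    by-cases zero le = ⊥-elim (ℕₚ.1+n≰n {0} (ℕₚ.≤-trans (ℕₚ.*-mono-≤ {1} {256} (s≤s z≤n) (ℕₚ.*-mono-≤ 1≤ℓ 1≤ℓ)) le))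
    by-cases (suc n) le = subst (C₂ * divℕ (suc n) ℓ ≤_) (sym (expCov-≡ ℓ (suc n)))
      (quotient-lower {S = fromℕ (totalCov n ℓ)} {i = divℕ 1 (treeCount n)} {N = fromℕ (treeCount n)} {D = divℕ (suc n) ℓ} {l = fromℕ ℓ} {T = fromℕ (suc n)} {c = C₂} {k = fromℕ 16}
        (fromℕ-pos (1≤treeCount n)) (fromℕ-pos 1≤ℓ) (<⇒≤ 0<C₂) (divℕ-fromℕ 1 (treeCount n) (1≤treeCount n)) (divℕ-fromℕ (suc n) ℓ 1≤ℓ) (divℕ-fromℕ 1 16 (s≤s z≤n))
        (subst₂ _≤_ (fromℕ-* (suc n) (treeCount n)) (trans (fromℕ-* 16 (ℓ ℕ.* totalCov n ℓ)) (cong (fromℕ 16 *_) (fromℕ-* ℓ (totalCov n ℓ))))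
          (fromℕ-mono {suc n ℕ.* treeCount n} {16 ℕ.* (ℓ ℕ.* totalCov n ℓ)} (totalCov-lower n 1≤ℓ (ℕₚ.≤-trans (ℕₚ.*-monoˡ-≤ (ℓ ℕ.* ℓ) (ℕₚ.m≤m+n 32 224)) le)))))

  1≤rate : 1 ℕ.≤ rate
  1≤rate = ℕₚ.≤-trans (s≤s z≤n) 8≤rate

  0<rate : 0ℚ < divℕ 1 rate
  0<rate = divℕ-pos {rate} 1≤rate

  module _ (n ℓ : ℕ) (1≤ℓ : 1 ℕ.≤ ℓ) where

    private
      tree-determined : ∀ {G G′} → G ∈ trees (suc n) → G′ ∈ trees (suc n) → (∀ x → parent G x ≡ parent G′ x) → G ≡ G′
      tree-determined G∈ G′∈ eq = graph-determined (proj₁ (trees⁻ G∈)) (proj₁ (trees⁻ G′∈)) (parent-ParentOf G∈) (parent-ParentOf G′∈) (λ x _ → eq x)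

      cov-certificate : ∀ {G} → G ∈ trees (suc n) → Σ (List (Fin (suc n))) λ I → Unique I × length I ≡ cov ℓ G ×
        (∀ {G′} → G′ ∈ trees (suc n) → cov ℓ G ℕ.≤ cov ℓ G′ ℕ.+ 3 ℕ.* ℓ ℕ.* length (filterᵇ (λ v → not (parent G v == parent G′ v)) I))
      cov-certificate {G} G∈ = let (S , sys , eq) = cov-attained ℓ G in concat S , System.disjoint sys , sym eq ,
        λ {G′} G′∈ → subst (ℕ._≤ cov ℓ G′ ℕ.+ 3 ℕ.* ℓ ℕ.* length (filterᵇ (λ v → not (parent G v == parent G′ v)) (concat S))) (sym eq)
          (cov-lipschitz (parent-ParentOf G∈) (parent-ParentOf G′∈) 1≤ℓ sys)

      module Sets = TwoSets {suc n} {Graph (suc n)} {trees (suc n)} (trees-Unique (suc n)) parent (cov ℓ) (3 ℕ.* ℓ) tree-determined cov-certificate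

    -- `balance` turns the counting condition on the two families into the weight bound with the
    -- constant z^E.
    tree-two-sets : ∀ (β α : Graph (suc n) → Bool) {M E : ℕ} → 2 ℕ.≤ M →
      (∀ {x y} d → x ∈ trees (suc n) → y ∈ trees (suc n) → β x ≡ true → α y ≡ true → cov ℓ x ℕ.≤ cov ℓ y ℕ.+ 3 ℕ.* ℓ ℕ.* d → E ℕ.+ cov ℓ x ℕ.≤ d ℕ.* M) →
      fromℕ (length (filterᵇ β (trees (suc n)))) * fromℕ (length (filterᵇ α (trees (suc n)))) ≤ pow (shrinkage M) E * pow (fromℕ (suc n) * fromℕ (suc n)) (suc n)
    tree-two-sets β α {M} {E} 2≤M far = Sets.two-sets β α {κ = Me.κ} {S = Me.S} Me.0≤κ (<⇒≤ Me.κ<1) (≤-reflexive (sym Me.Sz)) Me.0≤S {c = pow Me.z E} (pow-nonneg (<⇒≤ Me.0<z) E)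
      (λ {x} {y} d x∈ y∈ βx αy le → Me.balance {E} {cov ℓ x} {d} (far d x∈ y∈ βx αy le))
      where
      module Me = Mesh {M} 2≤M

  -- The single constant `divℕ 1 rate` has three tasks: it limits the range of ℓ, scales the
  -- exponent, and is the prefactor of t².
  concentration-bound : ∀ t ℓ δ → 1ℚ ≤ fromℕ ℓ → fromℕ (ℓ ℕ.^ 2) ≤ divℕ 1 rate * divℕ 1 rate * fromℕ t → 0ℚ < δ → δ < 1ℚ → ∀ N →
    probDev ℓ t δ * δ * expPartial (divℕ 1 rate * δ * δ * divℕ t (ℓ ℕ.^ 3)) N ≤ divℕ 1 rate * fromℕ (t ℕ.^ 2)
  concentration-bound t ℓ δ 1≤ h 0<δ δ<1 N = by-cases t (range {rate} {ℓ} {t} 1≤rate h)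
    where
    1≤ℓ : 1 ℕ.≤ ℓ
    1≤ℓ = fromℕ-reflect {1} {ℓ} 1≤
    64≤ : 64 ℕ.≤ rate ℕ.* rate ℕ.* (ℓ ℕ.* ℓ)
    64≤ = ℕₚ.*-mono-≤ (ℕₚ.*-mono-≤ 8≤rate 8≤rate) (ℕₚ.*-mono-≤ 1≤ℓ 1≤ℓ)
    ℓ≤ : ℓ ℕ.≤ rate ℕ.* rate ℕ.* (ℓ ℕ.* ℓ)
    ℓ≤ = ℕₚ.≤-trans (ℕₚ.≤-reflexive (sym (trans (ℕₚ.*-identityˡ (ℓ ℕ.* 1)) (ℕₚ.*-identityʳ ℓ)))) (ℕₚ.*-mono-≤ (ℕₚ.*-mono-≤ 1≤rate 1≤rate) (ℕₚ.*-monoʳ-≤ ℓ 1≤ℓ))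
    by-cases : ∀ t → rate ℕ.* rate ℕ.* (ℓ ℕ.* ℓ) ℕ.≤ t → probDev ℓ t δ * δ * expPartial (divℕ 1 rate * δ * δ * divℕ t (ℓ ℕ.^ 3)) N ≤ divℕ 1 rate * fromℕ (t ℕ.^ 2)
    by-cases zero le = ⊥-elim (ℕₚ.1+n≰n {0} (ℕₚ.≤-trans (s≤s z≤n) (ℕₚ.≤-trans 64≤ le)))
    by-cases (suc n) le = subst (λ s → s * δ * expPartial (divℕ 1 rate * δ * δ * divℕ (suc n) (ℓ ℕ.^ 3)) N ≤ divℕ 1 rate * fromℕ (suc n ℕ.^ 2)) (sym (probDev-≡ ℓ (suc n) δ))
      (deviation-bound {ts = trees (suc n)} {f = cov ℓ} {t = suc n} {ℓ = ℓ} {C = upperConst} {H = H} {G = G} {K = rate} {L = 3 ℕ.* ℓ} refl 1≤ℓ (1≤treeCount n)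
        (λ {T} _ → cov-≤ ℓ T) (totalCov-≤ n (ℕₚ.≤-trans ℓ≤ le)) (tree-power n (ℕ.s≤s⁻¹ (ℕₚ.≤-trans (s≤s (s≤s z≤n)) (ℕₚ.≤-trans 64≤ le)))) H-≥ G-≥ rate-≥ le (tree-two-sets n ℓ 1≤ℓ) 0<δ δ<1
        {μ = expCov ℓ (suc n)} (expCov-≡ ℓ (suc n)) {dev = deviates ℓ (expCov ℓ (suc n)) (δ * divℕ (suc n) ℓ)} (λ _ e → e) N)
      where
      tree-power : ∀ n → 1 ℕ.≤ n → suc n ℕ.^ suc n ℕ.≤ suc n ℕ.* suc n ℕ.* length (trees (suc n))
      tree-power (suc m) _ = ℕₚ.≤-trans (ℕₚ.≤-reflexive (sym (ℕₚ.*-assoc (suc (suc m)) (suc (suc m)) (suc (suc m) ℕ.^ m)))) (ℕₚ.*-monoʳ-≤ (suc (suc m) ℕ.* suc (suc m)) (trees-lower {suc m} (s≤s z≤n)))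

open import Data.Nat using (ℕ; _^_)
open import Data.Product using (Σ; _×_; _,_)
open import Data.Rational using (ℚ; 0ℚ; 1ℚ; _≤_; _<_; _*_)
open Final using (C₁; C₂; 0<C₁; 0<C₂; expectation-upper; expectation-lower; rate; 0<rate; concentration-bound)

-- The conditions with √t are squared. Division by the exponential becomes multiplication by each
-- partial sum of its series; as the exponent is nonnegative, these increase to the exponential, so
-- nothing is lost.
theorem1p5 : (Σ ℚ λ C₁ → Σ ℚ λ C₂ → 0ℚ < C₁ × 0ℚ < C₂ ×
    ((t : ℕ) →
    ((ℓ : ℕ) → 1ℚ ≤ fromℕ ℓ → fromℕ ℓ ≤ fromℕ t →
    expCov ℓ t ≤ C₁ * divℕ t ℓ)
    × ((ℓ : ℕ) → 1ℚ ≤ fromℕ ℓ → fromℕ (ℓ ^ 2) ≤ C₂ * C₂ * fromℕ t →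
    C₂ * divℕ t ℓ ≤ expCov ℓ t)))
    × (Σ ℚ λ c → 0ℚ < c ×
    ((t ℓ : ℕ) (δ : ℚ) → 1ℚ ≤ fromℕ ℓ → fromℕ (ℓ ^ 2) ≤ c * c * fromℕ t →
    0ℚ < δ → δ < 1ℚ →
    (N : ℕ) →
    probDev ℓ t δ * δ * expPartial (c * δ * δ * divℕ t (ℓ ^ 3)) N
    ≤ c * fromℕ (t ^ 2)))
theorem1p5 =
  (C₁ , C₂ , 0<C₁ , 0<C₂ , λ t → expectation-upper t , expectation-lower t) ,
  (divℕ 1 rate , 0<rate , concentration-bound)
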